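{- Let $V$ be a model of set theory, $\kappa$ an infinite ordinal, $X\in V$ an infinite set and $\mathscr{L}\in V$ a relational language. There is a code $U\in[\mathbb{B}^\kappa_{\mathscr{L}:X}]^V$ with $\mathrm{rank}(U)=5$ such that: if $\mathcal{M}$ is Cohen generic on $X$ over $V$ for some strong Fraïssé class of $\mathscr{L}$-structures that is not highly homogeneous then $\mathcal{M}\notin\mathrm{Int}(U)$; and if $\mathcal{M}$ is $\nu$-random generic over $V$ for some invariant measure $\nu \in V$ on $\mathrm{Str}^\kappa_{\mathscr{L}}(X)$ then $\mathcal{M}\in\mathrm{Int}(U)$.
   Context: A model of set theory is a transitive model of ZFC. $\mathrm{Int}(U)$ in the claim is computed in the generic extension containing $\mathcal{M}$. Structures and measures: $\mathrm{Str}_{\mathscr{L}}(X)$ is the set of $\mathscr{L}$-structures with underlying set $X$. An $\mathscr{L}$-literal is an atomic formula or a (possibly iterated) negation of one. $\sigma_\kappa(\mathrm{Str}_{\mathscr{L}}(X))$ is the smallest family of subsets of $\mathrm{Str}_{\mathscr{L}}(X)$ closed under complements and under unions of size $\le\kappa$ and containing all sets $\{\mathcal{M}:\mathcal{M}\models\varphi(\bar a)\}$ for $\varphi$ a literal and $\bar a$ a tuple from $X$. $\mathrm{Str}^\kappa_{\mathscr{L}}(X)$ is $\mathrm{Str}_{\mathscr{L}}(X)$ with this family of measurable sets. A probability $\kappa$-measure on it is a probability measure $\mu$ with $\mu(\bigcup_{i\in\kappa}A_i)=\sum_{i\in\kappa}\mu(A_i)$ for pairwise disjoint measurable $A_i$.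 $\mathrm{Sym}(X)$ acts by $g\mathcal{M}\models R(g(a_0),\dots)$ iff $\mathcal{M}\models R(a_0,\dots)$; "invariant measure" means a probability $\kappa$-measure $\mu$ with $\mu(g[A])=\mu(A)$ for all $g\in\mathrm{Sym}(X)$ and measurable $A$. Codes: the set $\mathbb{B}^\kappa_{\mathscr{L}:X}$ of $\kappa$-Borel codes is the smallest set containing the basic codes $\langle 0,\varphi,\bar a\rangle$ ($\varphi$ a finite conjunction of $\mathscr{L}$-literals, $\bar a$ a tuple from $X$) and closed under formal negation $\neg\gamma$ and formal $\bigvee\Gamma$, $\bigwedge\Gamma$ for $\Gamma=\{\gamma_i\}_{i\in\kappa}$. Rank: basic codes have rank $0$, $\mathrm{rank}(\neg\zeta)=\mathrm{rank}(\zeta)+1$, $\mathrm{rank}(\bigvee\Gamma)=\mathrm{rank}(\bigwedge\Gamma)=\sup\{\mathrm{rank}(\zeta)+1:\zeta\in\Gamma\}$. The interpretation $\mathrm{Int}(\gamma)\subseteq\mathrm{Str}_{\mathscr{L}}(X)$ interprets basic codes as $\{\mathcal{M}:\mathcal{M}\models\varphi(\bar a)\}$ and $\neg,\bigvee,\bigwedge$ as complement, union, intersection. $\mu(\gamma)=\mu(\mathrm{Int}(\gamma))$. Random generics: $\gamma\preceq_\mu\zeta$ means $\mu(\gamma\wedge\neg\zeta)=0$, and $\mathcal{O}^+(\mu)=(\{\gamma\in\mathbb{B}^\kappa_{\mathscr{L}:X}:\mu(\gamma)>0\},\preceq_\mu)$ (smaller is stronger), computed in $V$. For a filter $G$ on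 $\mathcal{O}^+(\mu)$ generic over $V$, there is a unique structure $\mathcal{M}_G$ with $V[G]\models\bigcap_{g\in G}\mathrm{Int}(g)=\{\mathcal{M}_G\}$; structures of this form are called $\mu$-random generic (over $V$). Cohen generics: a strong Fraïssé class is a class $\mathbf{K}$ of finite $\mathscr{L}$-structures closed under isomorphism and substructures (HP), such that any two members embed in a common member (JEP), and with strong amalgamation: for embeddings $i_1:\mathcal{M}_0\to\mathcal{M}_1$, $i_2:\mathcal{M}_0\to\mathcal{M}_2$ in $\mathbf{K}$ there are $\mathcal{M}_3\in\mathbf{K}$ and embeddings $j_1:\mathcal{M}_1\to\mathcal{M}_3$, $j_2:\mathcal{M}_2\to\mathcal{M}_3$ with $j_1 i_1=j_2 i_2$ and $j_1[M_1]\cap j_2[M_2]=j_1i_1[M_0]$. It is highly homogeneous if any two members of the same size are isomorphic. $\mathfrak{C}_X(\mathbf{K})$ is the partial order of members of $\mathbf{K}$ with underlying set a subset of $X$, with $\mathcal{A}\le\mathcal{B}$ ($\mathcal{A}$ stronger) iff $\mathcal{B}$ is a substructure of $\mathcal{A}$. A structure is Cohen generic for $\mathbf{K}$ on $X$ over $V$ ($\mathbf{K}$ in $V$) if it equals $\bigcup G$ for some filter $G$ on $\mathfrak{C}_X(\mathbf{K})$ generic over $V$.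
   Formalization: The formal theorem adds the hypothesis that V satisfies |𝓛| ≤ |κ|; without it the claim fails, since a κ-Borel code mentions at most |κ| symbols and cannot separate structures differing only in an unmentioned relation. -}

module Defs where

open import Level using (Level; Lift; lift) renaming (suc to lsuc)
open import Data.Nat using (ℕ; zero; suc)
open import Data.Fin using (Fin; toℕ) renaming (zero to fzero; suc to fsuc)
open import Data.Vec using (Vec; []; _∷_; lookup; map)
open import Data.List as List using (List; []; _∷_; foldr)
open import Data.List.Relation.Unary.All using (All)
open import Data.List.Relation.Unary.AllPairs using (AllPairs)
import Data.Vec.Relation.Unary.All as VecAll
open import Data.Integer using (ℤ; +_; -[1+_])
open import Data.Rational using (ℚ; mkℚ; 0ℚ; 1ℚ) renaming (_+_ to _+ℚ_; _<_ to _<ℚ_)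
open import Data.Bool using (Bool; true; false; if_then_else_)
open import Data.Product using (Σ; Σ-syntax; _×_; _,_; proj₁; proj₂)
open import Data.Sum using (_⊎_)
open import Data.Empty using (⊥)
open import Data.Empty.Polymorphic renaming (⊥ to ⊥ₚ)
open import Relation.Nullary using (¬_)
open import Relation.Binary.PropositionalEquality using (_≡_)

private variable
  ℓ : Level

------------------------------------------------------------------------
-- The ambient universe of sets: Aczel's iterative sets, with extensional
-- equality.  Classical reasoning enters only through excluded middle, an
-- explicit hypothesis of the theorem.

data 𝕍 (ℓ : Level) : Set (lsuc ℓ) where
  sup : (A : Set ℓ) → (A → 𝕍 ℓ) → 𝕍 ℓ

idx : 𝕍 ℓ → Set ℓ
idx (sup A f) = A

infixl 30 _▹_
_▹_ : (x : 𝕍 ℓ) → idx x → 𝕍 ℓ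
sup A f ▹ a = f a

infix 15 _≈_ _∈_ _⊆_

_≈_ : 𝕍 ℓ → 𝕍 ℓ → Set ℓ
sup A f ≈ sup B g =
  (∀ a → Σ[ b ∈ B ] f a ≈ g b) × (∀ b → Σ[ a ∈ A ] f a ≈ g b)

_∈_ : 𝕍 ℓ → 𝕍 ℓ → Set ℓ
x ∈ y = Σ[ j ∈ idx y ] x ≈ y ▹ j

_⊆_ : 𝕍 ℓ → 𝕍 ℓ → Set ℓ
x ⊆ y = ∀ i → x ▹ i ∈ y

∅ : 𝕍 ℓ
∅ = sup ⊥ₚ λ ()

⟦_,_⟧ : 𝕍 ℓ → 𝕍 ℓ → 𝕍 ℓ
⟦ x , y ⟧ = sup (Lift _ Bool) λ (lift b) → if b then x else y

⟨_,_⟩ : 𝕍 ℓ → 𝕍 ℓ → 𝕍 ℓ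
⟨ x , y ⟩ = ⟦ ⟦ x , x ⟧ , ⟦ x , y ⟧ ⟧

⋃ : 𝕍 ℓ → 𝕍 ℓ
⋃ a = sup (Σ[ i ∈ idx a ] idx (a ▹ i)) λ (i , j) → (a ▹ i) ▹ j

sep : 𝕍 ℓ → (𝕍 ℓ → Set ℓ) → 𝕍 ℓ
sep a P = sup (Σ[ i ∈ idx a ] P (a ▹ i)) λ (i , _) → a ▹ i

infixl 25 _∩_ _∖_
_∩_ : 𝕍 ℓ → 𝕍 ℓ → 𝕍 ℓ
a ∩ b = sep a (_∈ b)

_∖_ : 𝕍 ℓ → 𝕍 ℓ → 𝕍 ℓ
a ∖ b = sep a (λ x → ¬ x ∈ b)

succ : 𝕍 ℓ → 𝕍 ℓ
succ a = ⋃ ⟦ a , ⟦ a , a ⟧ ⟧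

num : ℕ → 𝕍 ℓ
num zero    = ∅
num (suc n) = succ (num n)

tup : ∀ {n} → Vec (𝕍 ℓ) n → 𝕍 ℓ
tup []       = ∅
tup (x ∷ xs) = ⟨ x , tup xs ⟩

_at_ : (X : 𝕍 ℓ) → ∀ {n} → Vec (idx X) n → Vec (𝕍 ℓ) n
X at a = map (X ▹_) a

-- f · x is ⋃ { y : ⟨ x , y ⟩ ∈ f }, the value of f at x when f is a
-- function defined at x.
infixl 28 _·_
_·_ : 𝕍 ℓ → 𝕍 ℓ → 𝕍 ℓ
f · x = ⋃ (sep (⋃ (⋃ f)) λ y → ⟨ x , y ⟩ ∈ f)

IsFun : 𝕍 ℓ → 𝕍 ℓ → Set ℓ
IsFun f a = f ≈ sup (idx a) λ i → ⟨ a ▹ i , f · (a ▹ i) ⟩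

image : 𝕍 ℓ → 𝕍 ℓ → 𝕍 ℓ
image f a = sup (idx a) λ i → f · (a ▹ i)

record IsInjection (f a b : 𝕍 ℓ) : Set ℓ where
  field
    isFun     : IsFun f a
    into      : image f a ⊆ b
    injective : ∀ i j → f · (a ▹ i) ≈ f · (a ▹ j) → a ▹ i ≈ a ▹ j

record IsBijection (f a b : 𝕍 ℓ) : Set ℓ where
  field
    isInjection : IsInjection f a b
    onto        : b ⊆ image f a

HasSize : 𝕍 ℓ → ℕ → Set ℓ
HasSize a n = Σ[ e ∈ (Fin n → idx a) ]
  (∀ i j → a ▹ e i ≈ a ▹ e j → i ≡ j) × (∀ k → Σ[ i ∈ Fin n ] a ▹ k ≈ a ▹ e i)

Finite Infinite : 𝕍 ℓ → Set ℓ
Finite a   = Σ[ n ∈ ℕ ] HasSize a n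
Infinite a = ¬ Finite a

TransitiveSet : 𝕍 ℓ → Set ℓ
TransitiveSet a = ∀ i → a ▹ i ⊆ a

IsOrdinal : 𝕍 ℓ → Set ℓ
IsOrdinal a = TransitiveSet a × (∀ i → TransitiveSet (a ▹ i))

------------------------------------------------------------------------
-- Transitive models of ZFC.  Separation and replacement range over
-- first-order formulas with parameters, relativised to the model.

Class : (ℓ : Level) → Set (lsuc (lsuc ℓ))
Class ℓ = 𝕍 ℓ → Set (lsuc ℓ)

↑ : Set ℓ → Set (lsuc ℓ)
↑ = Lift _

infixr 4 _↔_
_↔_ : ∀ {a b} → Set a → Set b → Set _
P ↔ Q = (P → Q) × (Q → P)

-- Existential quantifiers over a model are the classical ¬ ∀ ¬, so that
-- the hypotheses below do not supply choice operators on the model.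
∃ᶜ : Class ℓ → (𝕍 ℓ → Set (lsuc ℓ)) → Set (lsuc ℓ)
∃ᶜ V P = ¬ (∀ x → V x → ¬ P x)

infix 2 ∃ᶜ
syntax ∃ᶜ V (λ x → P) = ∃[ x ∈ᶜ V ] P

-- De Bruijn indices; all' binds index zero.
data Formula : ℕ → Set where
  _∈'_ _≈'_ : ∀ {n} → Fin n → Fin n → Formula n
  ⊥'        : ∀ {n} → Formula n
  _⇒'_      : ∀ {n} → Formula n → Formula n → Formula n
  all'      : ∀ {n} → Formula (suc n) → Formula n

Holds : Class ℓ → ∀ {n} → Formula n → Vec (𝕍 ℓ) n → Set (lsuc ℓ)
Holds V (i ∈' j) ρ = ↑ (lookup ρ i ∈ lookup ρ j)
Holds V (i ≈' j) ρ = ↑ (lookup ρ i ≈ lookup ρ j)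
Holds V ⊥'       ρ = ⊥ₚ
Holds V (φ ⇒' ψ) ρ = Holds V φ ρ → Holds V ψ ρ
Holds V (all' φ) ρ = ∀ x → V x → Holds V φ (x ∷ ρ)

∃!ᶜ : Class ℓ → (𝕍 ℓ → Set (lsuc ℓ)) → Set (lsuc ℓ)
∃!ᶜ V P = ∃[ y ∈ᶜ V ] (P y × (∀ z → V z → P z → z ≈ y))

record TransitiveModelOfZFC (V : Class ℓ) : Set (lsuc ℓ) where
  field
    respects-≈ : ∀ x y → x ≈ y → V x → V y
    transitive : ∀ x y → V y → x ∈ y → V x
    extensionality : ∀ x y → V x → V y →
      (∀ z → V z → z ∈ x ↔ z ∈ y) → x ≈ y
    foundation : ∀ x → V x → (∃[ y ∈ᶜ V ] ↑ (y ∈ x)) →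
      ∃[ y ∈ᶜ V ] (↑ (y ∈ x) × (∀ z → V z → ¬ (z ∈ x × z ∈ y)))
    pairing : ∀ x y → V x → V y →
      ∃[ p ∈ᶜ V ] (∀ z → V z → z ∈ p ↔ (z ≈ x ⊎ z ≈ y))
    union : ∀ x → V x →
      ∃[ u ∈ᶜ V ] (∀ z → V z → z ∈ u ↔ (∃[ y ∈ᶜ V ] ↑ (y ∈ x × z ∈ y)))
    power : ∀ x → V x →
      ∃[ p ∈ᶜ V ] (∀ z → V z → z ∈ p ↔ (∀ w → V w → w ∈ z → w ∈ x))
    infinity :
      ∃[ w ∈ᶜ V ] (↑ (∅ ∈ w) × (∀ x → V x → x ∈ w → succ x ∈ w))
    separation : ∀ {n} (φ : Formula (suc n)) (ρ : Vec (𝕍 ℓ) n) →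
      VecAll.All V ρ → ∀ a → V a →
      ∃[ b ∈ᶜ V ] (∀ x → V x → x ∈ b ↔ (x ∈ a × Holds V φ (x ∷ ρ)))
    replacement : ∀ {n} (φ : Formula (suc (suc n))) (ρ : Vec (𝕍 ℓ) n) →
      VecAll.All V ρ → ∀ a → V a →
      (∀ x → V x → x ∈ a → ∃!ᶜ V λ y → Holds V φ (y ∷ x ∷ ρ)) →
      ∃[ b ∈ᶜ V ] (∀ y → V y →
        y ∈ b ↔ (∃[ x ∈ᶜ V ] (↑ (x ∈ a) × Holds V φ (y ∷ x ∷ ρ))))
    choice : ∀ a → V a →
      (∀ x → V x → x ∈ a → ∃[ y ∈ᶜ V ] ↑ (y ∈ x)) →
      (∀ x y → V x → V y → x ∈ a → y ∈ a →
        (∃[ z ∈ᶜ V ] ↑ (z ∈ x × z ∈ y)) → x ≈ y) →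
      ∃[ c ∈ᶜ V ] (∀ x → V x → x ∈ a →
        ∃!ᶜ V λ y → ↑ (y ∈ x × y ∈ c))

-- The cardinality relation ∣ a ∣ ≤ ∣ b ∣ computed in V.
Card≤ : Class ℓ → 𝕍 ℓ → 𝕍 ℓ → Set (lsuc ℓ)
Card≤ V a b = ∃[ f ∈ᶜ V ] ↑ (IsInjection f a b)

------------------------------------------------------------------------
-- Forcing.  A notion of forcing is a class of conditions with a relation
-- ≼, smaller being stronger.  Names are presented as trees together with
-- the sets they code; pairs ⟨ σ , p ⟩ with p not a condition never contribute
-- to val G when G consists of conditions.

record IsGenericFilter (V : Class ℓ) (Cond : Class ℓ)
    (_≼_ : 𝕍 ℓ → 𝕍 ℓ → Set (lsuc ℓ)) (G : 𝕍 ℓ) : Set (lsuc ℓ) where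
  field
    conditions : ∀ p → p ∈ G → Cond p
    nonempty   : Σ[ p ∈ 𝕍 ℓ ] p ∈ G
    upward     : ∀ p q → p ∈ G → Cond q → p ≼ q → q ∈ G
    directed   : ∀ p q → p ∈ G → q ∈ G →
      Σ[ r ∈ 𝕍 ℓ ] r ∈ G × r ≼ p × r ≼ q
    generic    : ∀ D → V D → (∀ d → d ∈ D → Cond d) →
      (∀ p → Cond p → Σ[ d ∈ 𝕍 ℓ ] d ∈ D × d ≼ p) →
      Σ[ d ∈ 𝕍 ℓ ] d ∈ D × d ∈ G

data Name (ℓ : Level) : Set (lsuc ℓ) where
  name : (A : Set ℓ) → (A → Name ℓ) → (A → 𝕍 ℓ) → Name ℓ

⌜_⌝ⁿ : Name ℓ → 𝕍 ℓ
⌜ name A σ p ⌝ⁿ = sup A λ a → ⟨ ⌜ σ a ⌝ⁿ , p a ⟩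

val : 𝕍 ℓ → Name ℓ → 𝕍 ℓ
val G (name A σ p) = sup (Σ[ a ∈ A ] p a ∈ G) λ (a , _) → val G (σ a)

infix 40 _[_]
_[_] : Class ℓ → 𝕍 ℓ → Class ℓ
(V [ G ]) x = Σ[ τ ∈ Name _ ] V ⌜ τ ⌝ⁿ × x ≈ val G τ

------------------------------------------------------------------------
-- Real numbers as sets: open lower Dedekind cuts of coded rationals.

⌜_⌝ᶻ : ℤ → 𝕍 ℓ
⌜ + n ⌝ᶻ      = ⟨ num 0 , num n ⟩
⌜ -[1+ n ] ⌝ᶻ = ⟨ num 1 , num n ⟩

⌜_⌝ᵠ : ℚ → 𝕍 ℓ
⌜ mkℚ n d-1 _ ⌝ᵠ = ⟨ ⌜ n ⌝ᶻ , num d-1 ⟩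

record IsReal (r : 𝕍 ℓ) : Set ℓ where
  field
    rational : ∀ i → Σ[ q ∈ ℚ ] r ▹ i ≈ ⌜ q ⌝ᵠ
    inhabited : Σ[ q ∈ ℚ ] ⌜ q ⌝ᵠ ∈ r
    bounded   : Σ[ q ∈ ℚ ] (¬ ⌜ q ⌝ᵠ ∈ r)
    lower     : ∀ p q → p <ℚ q → ⌜ q ⌝ᵠ ∈ r → ⌜ p ⌝ᵠ ∈ r
    open-cut  : ∀ p → ⌜ p ⌝ᵠ ∈ r → Σ[ q ∈ ℚ ] p <ℚ q × ⌜ q ⌝ᵠ ∈ r

cut : ℚ → 𝕍 ℓ
cut q = sup (Lift _ (Σ[ p ∈ ℚ ] p <ℚ q)) λ (lift (p , _)) → ⌜ p ⌝ᵠ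

0ᴿ 1ᴿ : 𝕍 ℓ
0ᴿ = cut 0ℚ
1ᴿ = cut 1ℚ

_≤ᴿ_ _<ᴿ_ : 𝕍 ℓ → 𝕍 ℓ → Set ℓ
r ≤ᴿ s = r ⊆ s
r <ᴿ s = ¬ s ≤ᴿ r

_+ᴿ_ : 𝕍 ℓ → 𝕍 ℓ → 𝕍 ℓ
r +ᴿ s = sup (Σ[ p ∈ ℚ ] Σ[ q ∈ ℚ ] ⌜ p ⌝ᵠ ∈ r × ⌜ q ⌝ᵠ ∈ s)
             λ (p , q , _) → ⌜ p +ℚ q ⌝ᵠ

-- The sum of a family of nonnegative reals over a set: the supremum of
-- its sums over finite sets of indices.
Σᴿ : (κ : 𝕍 ℓ) → (𝕍 ℓ → 𝕍 ℓ) → 𝕍 ℓ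
Σᴿ κ r = ⋃ (sup
  (Σ[ is ∈ List (idx κ) ] AllPairs (λ i j → ¬ κ ▹ i ≈ κ ▹ j) is)
  λ (is , _) → foldr (λ i s → r (κ ▹ i) +ᴿ s) 0ᴿ is)

------------------------------------------------------------------------
-- Relational languages and structures.  A language is a set of symbols
-- with arities, coded by the graph of the arity function.

record Language (ℓ : Level) : Set (lsuc ℓ) where
  field
    sym      : 𝕍 ℓ
    ar       : idx sym → ℕ
    ar-cong  : ∀ s t → sym ▹ s ≈ sym ▹ t → ar s ≡ ar t

  Sym : Set ℓ
  Sym = idx sym

open Language public

⌜_⌝ᴸ : Language ℓ → 𝕍 ℓ
⌜ L ⌝ᴸ = sup (Sym L) λ s → ⟨ sym L ▹ s , num (ar L s) ⟩

-- A structure is coded by a single set: ⟨ 0 , y ⟩ belongs to it when y is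
-- in the underlying set, and ⟨ 1 , ⟨ R , a ⟩ ⟩ when R holds of a.  The union
-- of a filter of structures is then its union as a set.
∣_∣ : 𝕍 ℓ → 𝕍 ℓ
∣ M ∣ = sep (⋃ (⋃ M)) λ y → ⟨ num 0 , y ⟩ ∈ M

module _ (L : Language ℓ) where

  fact : (s : Sym L) → Vec (𝕍 ℓ) (ar L s) → 𝕍 ℓ
  fact s a = ⟨ num 1 , ⟨ sym L ▹ s , tup a ⟩ ⟩

  IsStructure : 𝕍 ℓ → Set ℓ
  IsStructure M = ∀ k →
      (Σ[ i ∈ idx ∣ M ∣ ] M ▹ k ≈ ⟨ num 0 , ∣ M ∣ ▹ i ⟩)
    ⊎ (Σ[ s ∈ Sym L ] Σ[ a ∈ Vec (idx ∣ M ∣) (ar L s) ]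
         M ▹ k ≈ fact s (∣ M ∣ at a))

  Str : 𝕍 ℓ → 𝕍 ℓ → Set ℓ
  Str X M = IsStructure M × ∣ M ∣ ≈ X

  _isSubstructureOf_ : 𝕍 ℓ → 𝕍 ℓ → Set ℓ
  N isSubstructureOf M = IsStructure N × IsStructure M × ∣ N ∣ ⊆ ∣ M ∣ ×
    (∀ s (a : Vec (idx ∣ N ∣) (ar L s)) →
       fact s (∣ N ∣ at a) ∈ N ↔ fact s (∣ N ∣ at a) ∈ M)

  record IsEmbedding (f M N : 𝕍 ℓ) : Set ℓ where
    field
      isInjection : IsInjection f ∣ M ∣ ∣ N ∣
      relations   : ∀ s (a : Vec (idx ∣ M ∣) (ar L s)) →
        fact s (∣ M ∣ at a) ∈ M ↔ fact s (map (f ·_) (∣ M ∣ at a)) ∈ N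

  record IsIsomorphism (f M N : 𝕍 ℓ) : Set ℓ where
    field
      isEmbedding : IsEmbedding f M N
      onto        : ∣ N ∣ ⊆ image f ∣ M ∣

  -- The structure g M for a permutation g of X and M with underlying set X.
  act : (X g M : 𝕍 ℓ) → 𝕍 ℓ
  act X g M = sup
    (idx X ⊎ (Σ[ s ∈ Sym L ] Σ[ a ∈ Vec (idx X) (ar L s) ] fact s (X at a) ∈ M))
    λ { (_⊎_.inj₁ i)           → ⟨ num 0 , g · (X ▹ i) ⟩
      ; (_⊎_.inj₂ (s , a , _)) → fact s (map (g ·_) (X at a)) }

------------------------------------------------------------------------
-- Borel codes.

module _ (L : Language ℓ) where

  data Literal (m : ℕ) : Set ℓ where
    rel : (s : Sym L) → Vec (Fin m) (ar L s) → Literal m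
    eq  : Fin m → Fin m → Literal m
    neg : Literal m → Literal m

  ⌜_⌝ˡ : ∀ {m} → Literal m → 𝕍 ℓ
  ⌜ rel s v ⌝ˡ = ⟨ num 0 , ⟨ sym L ▹ s , tup (map (λ i → num (toℕ i)) v) ⟩ ⟩
  ⌜ eq i j ⌝ˡ  = ⟨ num 1 , ⟨ num (toℕ i) , num (toℕ j) ⟩ ⟩
  ⌜ neg φ ⌝ˡ   = ⟨ num 2 , ⌜ φ ⌝ˡ ⟩

  ⌜_⌝ᶜ : ∀ {m} → List (Literal m) → 𝕍 ℓ
  ⌜ [] ⌝ᶜ     = ∅
  ⌜ φ ∷ φs ⌝ᶜ = ⟨ ⌜ φ ⌝ˡ , ⌜ φs ⌝ᶜ ⟩

  SatLiteral : ∀ {m} → 𝕍 ℓ → Literal m → Vec (𝕍 ℓ) m → Set ℓ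
  SatLiteral M (rel s v) a = fact L s (map (lookup a) v) ∈ M
  SatLiteral M (eq i j)  a = lookup a i ≈ lookup a j
  SatLiteral M (neg φ)   a = ¬ SatLiteral M φ a

module _ (κ : 𝕍 ℓ) (L : Language ℓ) (X : 𝕍 ℓ) where

  -- Elements of κ may be indexed repeatedly by idx κ; the coherence
  -- argument of ⋁ and ⋀ makes ⌜ Γ ⌝ a function on the set κ.
  data Code : Set ℓ
  ⌜_⌝ : Code → 𝕍 ℓ

  data Code where
    basic : ∀ {m} → List (Literal L m) → Vec (idx X) m → Code
    ¬'_   : Code → Code
    ⋁ ⋀   : (Γ : idx κ → Code) →
            (∀ i j → κ ▹ i ≈ κ ▹ j → ⌜ Γ i ⌝ ≈ ⌜ Γ j ⌝) → Code

  ⌜ basic φ a ⌝ = ⟨ num 0 , ⟨ ⌜_⌝ᶜ L φ , tup (X at a) ⟩ ⟩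
  ⌜ ¬' γ ⌝      = ⟨ num 1 , ⌜ γ ⌝ ⟩
  ⌜ ⋁ Γ _ ⌝     = ⟨ num 2 , sup (idx κ) (λ i → ⟨ κ ▹ i , ⌜ Γ i ⌝ ⟩) ⟩
  ⌜ ⋀ Γ _ ⌝     = ⟨ num 3 , sup (idx κ) (λ i → ⟨ κ ▹ i , ⌜ Γ i ⌝ ⟩) ⟩

  -- A von Neumann ordinal.
  rank : Code → 𝕍 ℓ
  rank (basic _ _) = ∅
  rank (¬' γ)      = succ (rank γ)
  rank (⋁ Γ _)     = ⋃ (sup (idx κ) λ i → succ (rank (Γ i)))
  rank (⋀ Γ _)     = ⋃ (sup (idx κ) λ i → succ (rank (Γ i)))

  Sat : 𝕍 ℓ → Code → Set ℓ
  Sat M (basic φ a) = All (λ ψ → SatLiteral L M ψ (X at a)) φ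
  Sat M (¬' γ)      = ¬ Sat M γ
  Sat M (⋁ Γ _)     = Σ[ i ∈ idx κ ] Sat M (Γ i)
  Sat M (⋀ Γ _)     = ∀ i → Sat M (Γ i)

  -- Int(γ) computed in the model W.
  Int : Class ℓ → Code → Class ℓ
  Int W γ M = W M × Str L X M × Sat M γ

------------------------------------------------------------------------
-- Invariant measures in V and random generic structures.

module _ (V : Class ℓ) (κ : 𝕍 ℓ) (L : Language ℓ) (X : 𝕍 ℓ) where

  record IsKappaAlgebra (Ω 𝓑 : 𝕍 ℓ) : Set (lsuc ℓ) where
    field
      subsets     : ∀ A → A ∈ 𝓑 → A ⊆ Ω
      literals    : ∀ {m} (φ : Literal L m) (a : Vec (idx X) m) →
        sep Ω (λ M → SatLiteral L M φ (X at a)) ∈ 𝓑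
      complements : ∀ A → A ∈ 𝓑 → Ω ∖ A ∈ 𝓑
      unions      : ∀ F → V F → F ⊆ 𝓑 → Card≤ V F κ → ⋃ F ∈ 𝓑

  record InvariantMeasure : Set (lsuc ℓ) where
    field
      -- the set Str(X) of V, its measurable sets, and the measure
      Ω 𝓑 μ : 𝕍 ℓ
      Ω∈V : V Ω
      𝓑∈V : V 𝓑
      μ∈V : V μ

      Ω-spec  : ∀ M → M ∈ Ω ↔ (V M × Str L X M)
      algebra : IsKappaAlgebra Ω 𝓑
      least   : ∀ 𝓣 → V 𝓣 → IsKappaAlgebra Ω 𝓣 → 𝓑 ⊆ 𝓣

      isFun       : IsFun μ 𝓑
      real        : ∀ A → A ∈ 𝓑 → IsReal (μ · A)
      nonnegative : ∀ A → A ∈ 𝓑 → 0ᴿ ≤ᴿ (μ · A)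
      total       : μ · Ω ≈ 1ᴿ
      additive    : ∀ A → V A → IsFun A κ → image A κ ⊆ 𝓑 →
        (∀ i j → ¬ κ ▹ i ≈ κ ▹ j → A · (κ ▹ i) ∩ A · (κ ▹ j) ≈ ∅) →
        μ · ⋃ (image A κ) ≈ Σᴿ κ (λ i → μ · (A · i))

      invariant   : ∀ g → V g → IsBijection g X X → ∀ A → A ∈ 𝓑 →
        μ · sup (idx A) (λ i → act L X g (A ▹ i)) ≈ μ · A

    measure : (𝕍 ℓ → Set ℓ) → 𝕍 ℓ
    measure P = μ · sep Ω P

  module _ (ν : InvariantMeasure) where
    open InvariantMeasure ν

    _codes_ : 𝕍 ℓ → Code κ L X → Set (lsuc ℓ)
    c codes γ = V c × c ≈ ⌜_⌝ κ L X γ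

    O⁺ : Class ℓ
    O⁺ c = Σ[ γ ∈ Code κ L X ]
      c codes γ × 0ᴿ <ᴿ measure (λ M → Sat κ L X M γ)

    -- γ ∧ ¬ ζ is evaluated directly as an event.
    _≼O⁺_ : 𝕍 ℓ → 𝕍 ℓ → Set (lsuc ℓ)
    c ≼O⁺ d = Σ[ γ ∈ Code κ L X ] Σ[ ζ ∈ Code κ L X ] c codes γ × d codes ζ ×
      measure (λ M → Sat κ L X M γ × ¬ Sat κ L X M ζ) ≈ 0ᴿ

    InAll : 𝕍 ℓ → Class ℓ
    InAll G M = ∀ γ → ⌜_⌝ κ L X γ ∈ G → Int κ L X (V [ G ]) γ M

    record IsRandomGeneric (G M : 𝕍 ℓ) : Set (lsuc ℓ) where
      field
        isGenericFilter : IsGenericFilter V O⁺ _≼O⁺_ G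
        member          : InAll G M
        unique          : ∀ N → InAll G N → N ≈ M

------------------------------------------------------------------------
-- Strong Fraïssé classes of V and Cohen generic structures.

-- K is a class in the sense of V: definable over V with parameters.
IsClassOf : Class ℓ → Class ℓ → Set (lsuc ℓ)
IsClassOf {ℓ} V K = Σ[ n ∈ ℕ ] Σ[ φ ∈ Formula (suc n) ] Σ[ ρ ∈ Vec (𝕍 ℓ) n ]
  VecAll.All V ρ × (∀ x → K x ↔ (V x × Holds V φ (x ∷ ρ)))

module _ (V : Class ℓ) (L : Language ℓ) where

  _↪_ _≅_ : 𝕍 ℓ → 𝕍 ℓ → Set (lsuc ℓ)
  M ↪ N = ∃[ f ∈ᶜ V ] ↑ (IsEmbedding L f M N)
  M ≅ N = ∃[ f ∈ᶜ V ] ↑ (IsIsomorphism L f M N)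

  -- The underlying set of a structure may be empty.
  record IsStrongFraisse (K : Class ℓ) : Set (lsuc ℓ) where
    field
      isClass     : IsClassOf V K
      structures  : ∀ M → K M → IsStructure L M × Finite ∣ M ∣
      isomorphism : ∀ M N → K M → V N → IsStructure L N → M ≅ N → K N
      hereditary  : ∀ M N → K M → V N → _isSubstructureOf_ L N M → K N
      joint       : ∀ M₁ M₂ → K M₁ → K M₂ →
        ∃[ M₃ ∈ᶜ V ] (K M₃ × (M₁ ↪ M₃) × (M₂ ↪ M₃))
      strong-amalgamation : ∀ M₀ M₁ M₂ → K M₀ → K M₁ → K M₂ →
        ∀ i₁ i₂ → V i₁ → V i₂ → IsEmbedding L i₁ M₀ M₁ → IsEmbedding L i₂ M₀ M₂ →
        ∃[ M₃ ∈ᶜ V ] (K M₃ × (∃[ j₁ ∈ᶜ V ] ∃[ j₂ ∈ᶜ V ] ↑ (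
          IsEmbedding L j₁ M₁ M₃ × IsEmbedding L j₂ M₂ M₃ ×
          (∀ x → j₁ · (i₁ · (∣ M₀ ∣ ▹ x)) ≈ j₂ · (i₂ · (∣ M₀ ∣ ▹ x))) ×
          image j₁ ∣ M₁ ∣ ∩ image j₂ ∣ M₂ ∣ ≈ image j₁ (image i₁ ∣ M₀ ∣))))

  HighlyHomogeneous : Class ℓ → Set (lsuc ℓ)
  HighlyHomogeneous K = ∀ M N n → K M → K N →
    HasSize ∣ M ∣ n → HasSize ∣ N ∣ n → M ≅ N

  ℭ : 𝕍 ℓ → Class ℓ → Class ℓ
  ℭ X K M = K M × ∣ M ∣ ⊆ X

  record IsCohenGeneric (K : Class ℓ) (X G M : 𝕍 ℓ) : Set (lsuc ℓ) where
    field
      isGenericFilter :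
        IsGenericFilter V (ℭ X K) (λ A B → ↑ (_isSubstructureOf_ L B A)) G
      isUnion         : M ≈ ⋃ G

-- Fix in V an injective sequence x₀ , x₁ , … in X.  For a relation symbol R and
-- a pattern of arguments, let A c say that R holds of the tuple formed
-- according to the pattern from x_c and some fixed parameters x_k with k < i,
-- where c ≥ i.  The code U says, for all R and all patterns, that A fails
-- everywhere or that all but finitely many of the blocks
-- J_q = { q , … , q + 2 ^ q - 1 } contain some c with A c.
--
-- Under an invariant measure, the event that A c holds and A fails on all of J_q
-- has measure at most 2 ^ - q when c < q: exchanging x_c with the elements of J_q
-- gives 2 ^ q disjoint events of the same measure.  By Borel–Cantelli, U has
-- measure 1, so it lies in every generic filter of events.
--
-- If K is not highly homogeneous, take n least such that two injective
-- (n + 1)-tuples in members of K differ in some fact R(t).  All n-tuples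
-- look alike, so by strong amalgamation any condition extends to a new point x_c
-- with A c decided either way.  Hence generically some A c holds, while A fails
-- on infinitely many blocks.

module Submission where

open import Defs
open import Level using (Level; Lift; lift; lower) renaming (suc to lsuc)
open import Axiom.ExcludedMiddle using (ExcludedMiddle)
open import Data.Nat as ℕ using (ℕ; zero; suc; z≤n; s≤s)
import Data.Nat.Properties as ℕₚ
open import Data.Fin using (Fin; toℕ) renaming (zero to fzero; suc to fsuc)
import Data.Fin as Fin
import Data.Fin.Properties as Finₚ
open import Data.Vec as Vec using (Vec; []; _∷_; lookup; map; _++_)
import Data.Vec.Properties as Vecₚ
open import Data.List as List using (List; []; _∷_)
import Data.Vec.Relation.Unary.All as VecAll
open import Data.List.Relation.Unary.All as All using (All)
open import Data.Bool using (true; false)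
open import Data.Product using (Σ; Σ-syntax; _×_; _,_; proj₁; proj₂)
open import Data.Sum using (_⊎_; inj₁; inj₂)
open import Data.Empty using (⊥; ⊥-elim)
import Data.Empty.Polymorphic as E
open import Relation.Binary using (tri<; tri≈; tri>)
open import Data.Unit.Polymorphic using (tt) renaming (⊤ to ⊤ₚ)
open import Function using (_∘_; id; case_of_)
open import Relation.Nullary using (¬_; Dec; yes; no)
open import Relation.Binary.PropositionalEquality using (_≡_; _≢_; refl; cong; cong₂; subst; subst₂) renaming (sym to ≡-sym; trans to ≡-trans)
open import Data.Integer as ℤ using (ℤ; +_; -[1+_])
import Data.Integer.Properties as ℤₚ
import Data.Rational.Unnormalised as ℚᵘ
import Data.Rational.Unnormalised.Properties as ℚᵘₚ
open import Data.Nat.Coprimality using (1-coprimeTo)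
open import Data.Maybe using (Maybe; just; nothing; maybe′)
open import Data.Rational as ℚ using (ℚ)
import Data.Rational.Properties as ℚₚ
open import Data.List.Relation.Unary.AllPairs as AllPairs using (AllPairs)
import Data.List.Properties as Listₚ
import Data.List.Relation.Unary.All.Properties as Allₚ
import Data.List.Relation.Unary.AllPairs.Properties as AllPairsₚ

-- The obstacle is that `V` is an arbitrary transitive class known only through first-order axioms.
-- The code `U`, the families to which additivity applies, the transpositions and the dense sets all
-- have to be elements of `V`. Every construction is therefore made twice at once, as an operation
-- on ambient sets and as a formula over `V`. The rank 5 is met because the two alternatives in `U`
-- share one disjunction over a number `N`: `N = 0` is the alternative that A fails everywhere,
-- `N > 0` the place from which all blocks are hit. A separate binary disjunction would cost a
-- further level. The levels are symbol, pattern, `N`, block, position in the block, each indexed by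
-- all of `κ`, so elements of `κ` that are not numerals or name no symbol need default readings. The
-- injection of the symbols into `κ` lets a single conjunction range over all of them. Blocks start
-- at `q` so that `q > c` keeps `x_c` and the parameters out of `J_q`, and have length 2 ^ q so that
-- the bounds 2 ^ - q are summable. Overlapping blocks are harmless, since only a union bound is
-- used.

private variable
  ℓ : Level

-- Iterative sets: extensionality, pairs, numerals, functions, projections.

-- _≈_ and _∈_ compute by recursion on sets, which blocks the inference of
-- their arguments; the following records make it possible.
infix 15 _≋_ _∊_ _⊑_

record _≋_ (x y : 𝕍 ℓ) : Set ℓ where
  constructor eq
  field un≋ : x ≈ y
open _≋_ public

record _∊_ (x y : 𝕍 ℓ) : Set ℓ where
  constructor mem
  field un∊ : x ∈ y
open _∊_ public

_⊑_ : 𝕍 ℓ → 𝕍 ℓ → Set (lsuc ℓ)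
x ⊑ y = ∀ {z} → z ∊ x → z ∊ y

≈-refl : (x : 𝕍 ℓ) → x ≈ x
≈-refl (sup A f) = (λ a → a , ≈-refl (f a)) , (λ a → a , ≈-refl (f a))

≈-sym : (x y : 𝕍 ℓ) → x ≈ y → y ≈ x
≈-sym (sup A f) (sup B g) (p , q) =
  (λ b → proj₁ (q b) , ≈-sym _ _ (proj₂ (q b))) ,
  (λ a → proj₁ (p a) , ≈-sym _ _ (proj₂ (p a)))

≈-trans : (x y z : 𝕍 ℓ) → x ≈ y → y ≈ z → x ≈ z
≈-trans (sup A f) (sup B g) (sup C h) (p , q) (r , s) =
  (λ a → let (b , e) = p a ; (c , e′) = r b in c , ≈-trans (f a) (g b) (h c) e e′) ,
  (λ c → let (b , e′) = s c ; (a , e) = q b in a , ≈-trans (f a) (g b) (h c) e e′)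

≋-refl : {x : 𝕍 ℓ} → x ≋ x
≋-refl {x = x} = eq (≈-refl x)

≋-sym : {x y : 𝕍 ℓ} → x ≋ y → y ≋ x
≋-sym (eq p) = eq (≈-sym _ _ p)

infixr 5 _◂_
_◂_ : {x y z : 𝕍 ℓ} → x ≋ y → y ≋ z → x ≋ z
eq p ◂ eq q = eq (≈-trans _ _ _ p q)

≡⇒≋ : {x y : 𝕍 ℓ} → x ≡ y → x ≋ y
≡⇒≋ refl = ≋-refl

▹-∊ : (x : 𝕍 ℓ) (i : idx x) → x ▹ i ∊ x
▹-∊ x i = mem (i , ≈-refl (x ▹ i))

∊-▹ : {x : 𝕍 ℓ} (i : idx x) {z : 𝕍 ℓ} → z ≋ x ▹ i → z ∊ x
∊-▹ i (eq e) = mem (i , e)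

∊-idx : {z x : 𝕍 ℓ} → z ∊ x → Σ[ i ∈ idx x ] z ≋ x ▹ i
∊-idx (mem (i , e)) = i , eq e

∊-respˡ : {x y z : 𝕍 ℓ} → x ≋ y → x ∊ z → y ∊ z
∊-respˡ p (mem (j , q)) = ∊-▹ j (≋-sym p ◂ eq q)

∊-respʳ : {z x y : 𝕍 ℓ} → x ≋ y → z ∊ x → z ∊ y
∊-respʳ {x = sup A f} {sup B g} (eq (p , q)) (mem (a , r)) = ∊-▹ (proj₁ (p a)) (eq r ◂ eq (proj₂ (p a)))

ext : {x y : 𝕍 ℓ} → x ⊑ y → y ⊑ x → x ≋ y
ext {x = sup A f} {sup B g} p q = eq
  ((λ a → un∊ (p (▹-∊ (sup A f) a))) ,
   (λ b → let (a , e) = un∊ (q (▹-∊ (sup B g) b)) in a , ≈-sym _ _ e))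

⊆⇒⊑ : {x y : 𝕍 ℓ} → x ⊆ y → x ⊑ y
⊆⇒⊑ s (mem (i , e)) = ∊-respˡ (≋-sym (eq e)) (mem (s i))

⊑⇒⊆ : {x y : 𝕍 ℓ} → x ⊑ y → x ⊆ y
⊑⇒⊆ {x = x} s i = un∊ (s (▹-∊ x i))

-- An element of `x` is only equal to a subtree of `x`, so the structural recursion runs on a tree
-- while proving `P y` for every `y` equal to that tree.
∈-ind : ∀ {a} (P : 𝕍 ℓ → Set a) → (∀ x → (∀ y → y ∊ x → P y) → P x) → ∀ x → P x
∈-ind P step x = go x x ≋-refl
  where
  go : ∀ x y → y ≋ x → P y
  go (sup A f) y e = step y λ z z∊y → let (a , e′) = ∊-idx (∊-respʳ e z∊y) in go (f a) z e′

∊-irrefl : {x : 𝕍 ℓ} → ¬ x ∊ x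
∊-irrefl {x = x} = ∈-ind (λ x → ¬ x ∊ x) (λ x h m → h x m m) x

∊-asym : {x y : 𝕍 ℓ} → x ∊ y → ¬ y ∊ x
∊-asym {x = x} {y} = ∈-ind (λ x → ∀ y → x ∊ y → ¬ y ∊ x) (λ x h y m m′ → h y m′ x m′ m) x y

∉∅ : {x : 𝕍 ℓ} → ¬ x ∊ ∅
∉∅ (mem (() , _))

∊-sup : {A : Set ℓ} {f : A → 𝕍 ℓ} {z : 𝕍 ℓ} → z ∊ sup A f → Σ[ a ∈ A ] z ≋ f a
∊-sup = ∊-idx

sup-∊ : {A : Set ℓ} {f : A → 𝕍 ℓ} (a : A) {z : 𝕍 ℓ} → z ≋ f a → z ∊ sup A f
sup-∊ {A = A} {f} a e = ∊-▹ {x = sup A f} a e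

sup-cong : {A : Set ℓ} {f g : A → 𝕍 ℓ} → (∀ a → f a ≋ g a) → sup A f ≋ sup A g
sup-cong h = eq ((λ a → a , un≋ (h a)) , (λ a → a , un≋ (h a)))

sup-η : (x : 𝕍 ℓ) → sup (idx x) (x ▹_) ≋ x
sup-η (sup A f) = ≋-refl

∊-pair : {z a b : 𝕍 ℓ} → z ∊ ⟦ a , b ⟧ → z ≋ a ⊎ z ≋ b
∊-pair (mem (lift true , e))  = inj₁ (eq e)
∊-pair (mem (lift false , e)) = inj₂ (eq e)

pair-∊ˡ : {z a b : 𝕍 ℓ} → z ≋ a → z ∊ ⟦ a , b ⟧
pair-∊ˡ (eq e) = mem (lift true , e)

pair-∊ʳ : {z a b : 𝕍 ℓ} → z ≋ b → z ∊ ⟦ a , b ⟧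
pair-∊ʳ (eq e) = mem (lift false , e)

⟦⟧-cong : {a a′ b b′ : 𝕍 ℓ} → a ≋ a′ → b ≋ b′ → ⟦ a , b ⟧ ≋ ⟦ a′ , b′ ⟧
⟦⟧-cong p q = sup-cong λ { (lift true) → p ; (lift false) → q }

⟨⟩-cong : {a a′ b b′ : 𝕍 ℓ} → a ≋ a′ → b ≋ b′ → ⟨ a , b ⟩ ≋ ⟨ a′ , b′ ⟩
⟨⟩-cong p q = ⟦⟧-cong (⟦⟧-cong p p) (⟦⟧-cong p q)

⟦⟧-inj : {a b c : 𝕍 ℓ} → ⟦ a , b ⟧ ≋ ⟦ c , c ⟧ → a ≋ c × b ≋ c
⟦⟧-inj e = only (∊-pair (∊-respʳ e (pair-∊ˡ ≋-refl))) , only (∊-pair (∊-respʳ e (pair-∊ʳ ≋-refl)))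
  where
  only : ∀ {x c : 𝕍 ℓ} → x ≋ c ⊎ x ≋ c → x ≋ c
  only (inj₁ p) = p
  only (inj₂ p) = p

⟨⟩-injˡ : {a b c d : 𝕍 ℓ} → ⟨ a , b ⟩ ≋ ⟨ c , d ⟩ → a ≋ c
⟨⟩-injˡ e with ∊-pair (∊-respʳ e (pair-∊ˡ ≋-refl))
... | inj₁ p = proj₁ (⟦⟧-inj p)
... | inj₂ p = ≋-sym (proj₁ (⟦⟧-inj (≋-sym p)))

⟨⟩-injʳ : {a b c d : 𝕍 ℓ} → ⟨ a , b ⟩ ≋ ⟨ c , d ⟩ → b ≋ d
⟨⟩-injʳ {a = a} {b} {c} {d} e with ∊-pair (∊-respʳ e (pair-∊ʳ ≋-refl)) | ∊-pair (∊-respʳ (≋-sym e) (pair-∊ʳ ≋-refl))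
... | inj₁ p | inj₁ q = proj₂ (⟦⟧-inj p) ◂ ≋-sym (⟨⟩-injˡ e) ◂ ≋-sym (proj₂ (⟦⟧-inj q))
... | inj₁ p | inj₂ q = side (∊-pair (∊-respʳ q (pair-∊ʳ ≋-refl)))
  where
  side : d ≋ a ⊎ d ≋ b → b ≋ d
  side (inj₁ r) = proj₂ (⟦⟧-inj p) ◂ ≋-sym (⟨⟩-injˡ e) ◂ ≋-sym r
  side (inj₂ r) = ≋-sym r
... | inj₂ p | _ = side (∊-pair (∊-respʳ p (pair-∊ʳ ≋-refl))) (∊-pair (∊-respʳ (≋-sym p) (pair-∊ʳ ≋-refl)))
  where
  side : b ≋ c ⊎ b ≋ d → d ≋ a ⊎ d ≋ b → b ≋ d
  side (inj₂ r) _ = r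
  side (inj₁ r) (inj₂ r′) = ≋-sym r′
  side (inj₁ r) (inj₁ r′) = r ◂ ≋-sym (⟨⟩-injˡ e) ◂ ≋-sym r′

∊-⋃ : {z : 𝕍 ℓ} (a : 𝕍 ℓ) → z ∊ ⋃ a → Σ[ y ∈ 𝕍 ℓ ] y ∊ a × z ∊ y
∊-⋃ a (mem ((i , j) , e)) = a ▹ i , ▹-∊ a i , mem (j , e)

⋃-∊ : {z y a : 𝕍 ℓ} → y ∊ a → z ∊ y → z ∊ ⋃ a
⋃-∊ (mem (i , e)) m with ∊-respʳ (eq e) m
... | mem (j , e′) = mem ((i , j) , e′)

⋃-cong : {a b : 𝕍 ℓ} → a ≋ b → ⋃ a ≋ ⋃ b
⋃-cong {a = a} {b} e = ext (λ m → let (_ , p , q) = ∊-⋃ a m in ⋃-∊ (∊-respʳ e p) q)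
                       (λ m → let (_ , p , q) = ∊-⋃ b m in ⋃-∊ (∊-respʳ (≋-sym e) p) q)

Resp : (𝕍 ℓ → Set ℓ) → Set (lsuc ℓ)
Resp P = ∀ {x y} → x ≋ y → P x → P y

∊-sep : (a : 𝕍 ℓ) (P : 𝕍 ℓ → Set ℓ) → Resp P → ∀ {z} → z ∊ sep a P → z ∊ a × P z
∊-sep a P r (mem ((i , p) , e)) = mem (i , e) , r (≋-sym (eq e)) p

sep-∊ : {a : 𝕍 ℓ} (P : 𝕍 ℓ → Set ℓ) → Resp P → ∀ {z} → z ∊ a → P z → z ∊ sep a P
sep-∊ P r (mem (i , e)) p = mem ((i , r (eq e) p) , e)

sep-cong : {a b : 𝕍 ℓ} (P Q : 𝕍 ℓ → Set ℓ) → Resp P → Resp Q → a ≋ b →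
  (∀ z → P z → Q z) → (∀ z → Q z → P z) → sep a P ≋ sep b Q
sep-cong {a = a} {b} P Q rP rQ e f g = ext
  (λ m → let (p , q) = ∊-sep a P rP m in sep-∊ Q rQ (∊-respʳ e p) (f _ q))
  (λ m → let (p , q) = ∊-sep b Q rQ m in sep-∊ P rP (∊-respʳ (≋-sym e) p) (g _ q))

∖-resp : (b : 𝕍 ℓ) → Resp (λ x → ¬ x ∈ b)
∖-resp b e n m = n (un∊ (∊-respˡ (≋-sym e) (mem {y = b} m)))

∊-∖ : {z : 𝕍 ℓ} (a b : 𝕍 ℓ) → z ∊ a ∖ b → z ∊ a × ¬ z ∊ b
∊-∖ a b m = let (p , q) = ∊-sep a (λ x → ¬ x ∈ b) (∖-resp b) m in p , q ∘ un∊

∖-∊ : {z a b : 𝕍 ℓ} → z ∊ a → ¬ z ∊ b → z ∊ a ∖ b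
∖-∊ {b = b} p q = sep-∊ (λ x → ¬ x ∈ b) (∖-resp b) p (q ∘ mem)

∊-succ : {z : 𝕍 ℓ} (a : 𝕍 ℓ) → z ∊ succ a → z ∊ a ⊎ z ≋ a
∊-succ a m with ∊-⋃ ⟦ a , ⟦ a , a ⟧ ⟧ m
... | y , p , q with ∊-pair p
...   | inj₁ e = inj₁ (∊-respʳ e q)
...   | inj₂ e with ∊-pair (∊-respʳ e q)
...     | inj₁ r = inj₂ r
...     | inj₂ r = inj₂ r

succ-∊ˡ : {z a : 𝕍 ℓ} → z ∊ a → z ∊ succ a
succ-∊ˡ = ⋃-∊ (pair-∊ˡ ≋-refl)

succ-∊ʳ : {z a : 𝕍 ℓ} → z ≋ a → z ∊ succ a
succ-∊ʳ e = ⋃-∊ (pair-∊ʳ ≋-refl) (pair-∊ˡ e)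

succ-cong : {a b : 𝕍 ℓ} → a ≋ b → succ a ≋ succ b
succ-cong e = ⋃-cong (⟦⟧-cong e (⟦⟧-cong e e))

∊-num : ∀ {n} {z : 𝕍 ℓ} → z ∊ num n → Σ[ m ∈ ℕ ] m ℕ.< n × z ≋ num m
∊-num {n = zero} m = ⊥-elim (∉∅ m)
∊-num {n = suc n} m with ∊-succ (num n) m
... | inj₂ e = n , ℕₚ.n<1+n n , e
... | inj₁ m′ = let (k , lt , e) = ∊-num {n = n} m′ in k , ℕₚ.m<n⇒m<1+n lt , e

num-< : ∀ {m n} → m ℕ.< n → num {ℓ} m ∊ num n
num-< {n = suc n} (s≤s le) with ℕₚ.m≤n⇒m<n∨m≡n le
... | inj₁ lt = succ-∊ˡ (num-< lt)
... | inj₂ refl = succ-∊ʳ ≋-refl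

num-inj : ∀ {m n} → num {ℓ} m ≋ num n → m ≡ n
num-inj {ℓ} {m} {n} e with ℕₚ.<-cmp m n
... | tri< lt _ _ = ⊥-elim (∊-irrefl {ℓ} (∊-respˡ e (num-< lt)))
... | tri≈ _ p _ = p
... | tri> _ _ gt = ⊥-elim (∊-irrefl {ℓ} (∊-respˡ (≋-sym e) (num-< gt)))

num-∊⇒< : ∀ {m n} → num {ℓ} m ∊ num n → m ℕ.< n
num-∊⇒< {n = n} m = let (k , lt , e) = ∊-num {n = n} m in subst (ℕ._< _) (≡-sym (num-inj e)) lt

num-≋ : ∀ {m n} → m ≡ n → num {ℓ} m ≋ num n
num-≋ refl = ≋-refl

succ-inj : {x y : 𝕍 ℓ} → succ x ≋ succ y → x ≋ y
succ-inj {x = x} {y} e with ∊-succ y (∊-respʳ e (succ-∊ʳ ≋-refl)) | ∊-succ x (∊-respʳ (≋-sym e) (succ-∊ʳ ≋-refl))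
... | inj₂ p | _ = p
... | inj₁ _ | inj₂ q = ≋-sym q
... | inj₁ p | inj₁ q = ⊥-elim (∊-asym p q)

ω : 𝕍 ℓ
ω {ℓ} = sup (Lift ℓ ℕ) λ (lift n) → num n

num∊ω : ∀ {n} → num {ℓ} n ∊ ω
num∊ω {n = n} = sup-∊ (lift n) ≋-refl

∊-ω : {z : 𝕍 ℓ} → z ∊ ω → Σ[ n ∈ ℕ ] z ≋ num n
∊-ω m = let (lift n , e) = ∊-sup m in n , e

suc-≢∅ : {x : 𝕍 ℓ} → ¬ succ x ≋ ∅
suc-≢∅ e = ∉∅ (∊-respʳ e (succ-∊ʳ ≋-refl))

⟨⟩-≢∅ : {x y : 𝕍 ℓ} → ¬ ⟨ x , y ⟩ ≋ ∅
⟨⟩-≢∅ e = ∉∅ (∊-respʳ e (pair-∊ˡ ≋-refl))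

ins : 𝕍 ℓ → 𝕍 ℓ → 𝕍 ℓ
ins x a = ⋃ ⟦ a , ⟦ x , x ⟧ ⟧

∊-ins : {z : 𝕍 ℓ} (x a : 𝕍 ℓ) → z ∊ ins x a → z ≋ x ⊎ z ∊ a
∊-ins x a m with ∊-⋃ ⟦ a , ⟦ x , x ⟧ ⟧ m
... | y , p , q with ∊-pair p
...   | inj₁ e = inj₂ (∊-respʳ e q)
...   | inj₂ e with ∊-pair (∊-respʳ e q)
...     | inj₁ r = inj₁ r
...     | inj₂ r = inj₁ r

ins-∊ˡ : {z x a : 𝕍 ℓ} → z ≋ x → z ∊ ins x a
ins-∊ˡ e = ⋃-∊ (pair-∊ʳ ≋-refl) (pair-∊ˡ e)

ins-∊ʳ : {z x a : 𝕍 ℓ} → z ∊ a → z ∊ ins x a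
ins-∊ʳ = ⋃-∊ (pair-∊ˡ ≋-refl)

iter : ∀ {a} {A : Set a} → (A → A) → A → ℕ → A
iter f x zero = x
iter f x (suc n) = f (iter f x n)

ite : ∀ {a p} {A : Set a} {P : Set p} → Dec P → A → A → A
ite (yes _) x y = x
ite (no _) x y = y

ite-yes : ∀ {a p} {A : Set a} {P : Set p} (d : Dec P) {x y : A} → P → ite d x y ≡ x
ite-yes (yes _) _ = refl
ite-yes (no n) p = ⊥-elim (n p)

ite-no : ∀ {a p} {A : Set a} {P : Set p} (d : Dec P) {x y : A} → ¬ P → ite d x y ≡ y
ite-no (no _) _ = refl
ite-no (yes p) n = ⊥-elim (n p)

tup-cong : ∀ {n} {xs ys : Vec (𝕍 ℓ) n} → (∀ i → lookup xs i ≋ lookup ys i) → tup xs ≋ tup ys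
tup-cong {xs = []} {[]} h = ≋-refl
tup-cong {xs = x ∷ xs} {y ∷ ys} h = ⟨⟩-cong (h fzero) (tup-cong (h ∘ fsuc))

tup-len : ∀ {m n} {xs : Vec (𝕍 ℓ) m} {ys : Vec (𝕍 ℓ) n} → tup xs ≋ tup ys → m ≡ n
tup-len {xs = []} {[]} e = refl
tup-len {xs = []} {y ∷ ys} e = ⊥-elim (⟨⟩-≢∅ (≋-sym e))
tup-len {xs = x ∷ xs} {[]} e = ⊥-elim (⟨⟩-≢∅ e)
tup-len {xs = x ∷ xs} {y ∷ ys} e = cong suc (tup-len (⟨⟩-injʳ e))

⟨⟩-∊⋃⋃ : {x y f : 𝕍 ℓ} → ⟨ x , y ⟩ ∊ f → y ∊ ⋃ (⋃ f)
⟨⟩-∊⋃⋃ m = ⋃-∊ (⋃-∊ m (pair-∊ʳ ≋-refl)) (pair-∊ʳ ≋-refl)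

graph-resp : (x f : 𝕍 ℓ) → Resp (λ y → ⟨ x , y ⟩ ∈ f)
graph-resp x f e m = un∊ (∊-respˡ (⟨⟩-cong (≋-refl {x = x}) e) (mem {y = f} m))

·-≋ : {f x y : 𝕍 ℓ} → ⟨ x , y ⟩ ∊ f → (∀ {z} → ⟨ x , z ⟩ ∊ f → z ≋ y) → f · x ≋ y
·-≋ {f = f} {x} m u = ext
  (λ z → let (w , p , q) = ∊-⋃ (sep (⋃ (⋃ f)) P) z ; (_ , r) = ∊-sep (⋃ (⋃ f)) P (graph-resp x f) p
         in ∊-respʳ (u (mem r)) q)
  (⋃-∊ (sep-∊ P (graph-resp x f) (⟨⟩-∊⋃⋃ m) (un∊ m)))
  where
  P = λ y → ⟨ x , y ⟩ ∈ f

·-cong : {f g x y : 𝕍 ℓ} → f ≋ g → x ≋ y → f · x ≋ g · y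
·-cong {f = f} {g} {x} {y} e e′ = ⋃-cong (sep-cong _ _ (graph-resp x f) (graph-resp y g) (⋃-cong (⋃-cong e))
  (λ z m → un∊ (∊-respʳ e (∊-respˡ (⟨⟩-cong e′ ≋-refl) (mem m))))
  (λ z m → un∊ (∊-respʳ (≋-sym e) (∊-respˡ (⟨⟩-cong (≋-sym e′) ≋-refl) (mem m)))))

graphOf : (a : 𝕍 ℓ) → (idx a → 𝕍 ℓ) → 𝕍 ℓ
graphOf a F = sup (idx a) λ i → ⟨ a ▹ i , F i ⟩

Coherent : (a : 𝕍 ℓ) → (idx a → 𝕍 ℓ) → Set ℓ
Coherent a F = ∀ i j → a ▹ i ≋ a ▹ j → F i ≋ F j

module _ {a : 𝕍 ℓ} {F : idx a → 𝕍 ℓ} (coh : Coherent a F) where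

  graphOf-· : ∀ {x} i → x ≋ a ▹ i → graphOf a F · x ≋ F i
  graphOf-· {x} i e = ·-≋ (sup-∊ i (⟨⟩-cong e ≋-refl)) λ m →
    let (j , e′) = ∊-sup m in ⟨⟩-injʳ e′ ◂ coh j i (≋-sym (⟨⟩-injˡ e′) ◂ e)

  graphOf-isFun : ∀ {f} → f ≋ graphOf a F → IsFun f a
  graphOf-isFun e = un≋ (e ◂ sup-cong λ i → ⟨⟩-cong ≋-refl (≋-sym (·-cong e (≋-refl {x = a ▹ i}) ◂ graphOf-· i ≋-refl)))

∊-fun : {f a x y : 𝕍 ℓ} → IsFun f a → ⟨ x , y ⟩ ∊ f → x ∊ a × y ≋ f · x
∊-fun {f = f} {a} h m = let (i , e) = ∊-sup (∊-respʳ {y = graphOf a (λ i → f · (a ▹ i))} (eq h) m) in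
  ∊-▹ i (⟨⟩-injˡ e) , (⟨⟩-injʳ e ◂ ·-cong {f = f} ≋-refl (≋-sym (⟨⟩-injˡ e)))

∊-image : {y : 𝕍 ℓ} (f a : 𝕍 ℓ) → y ∊ image f a → Σ[ x ∈ 𝕍 ℓ ] x ∊ a × y ≋ f · x
∊-image f a m = let (i , e) = ∊-sup m in a ▹ i , ▹-∊ a i , e

image-∊ : {a x y : 𝕍 ℓ} (f : 𝕍 ℓ) → x ∊ a → y ≋ f · x → y ∊ image f a
image-∊ f m e = let (i , e′) = ∊-idx m in sup-∊ i (e ◂ ·-cong {f = f} ≋-refl e′)

opaque
  fst : 𝕍 ℓ → 𝕍 ℓ
  fst p = ⋃ (sep (⋃ p) λ x → ⟦ x , x ⟧ ∈ p)

  snd : 𝕍 ℓ → 𝕍 ℓ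
  snd p = ⋃ (sep (⋃ p) λ y → p ≈ ⟨ fst p , y ⟩)

  single-resp : (p : 𝕍 ℓ) → Resp (λ x → ⟦ x , x ⟧ ∈ p)
  single-resp p e m = un∊ (∊-respˡ (⟦⟧-cong e e) (mem {y = p} m))

  fst-⟨⟩ : {x y : 𝕍 ℓ} → fst ⟨ x , y ⟩ ≋ x
  fst-⟨⟩ {ℓ} {x} {y} = ext
    (λ m → let (w , p , q) = ∊-⋃ (sep (⋃ ⟨ x , y ⟩) P) m ; (_ , r) = ∊-sep (⋃ ⟨ x , y ⟩) P (single-resp _) p
           in ∊-respʳ (h (∊-pair (mem r))) q)
    (⋃-∊ (sep-∊ P (single-resp _) (⋃-∊ (pair-∊ˡ ≋-refl) (pair-∊ˡ ≋-refl)) (un∊ (pair-∊ˡ ≋-refl))))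
    where
    P : 𝕍 ℓ → Set ℓ
    P w = ⟦ w , w ⟧ ∈ ⟨ x , y ⟩
    h : ∀ {w} → ⟦ w , w ⟧ ≋ ⟦ x , x ⟧ ⊎ ⟦ w , w ⟧ ≋ ⟦ x , y ⟧ → w ≋ x
    h (inj₁ e) = proj₁ (⟦⟧-inj e)
    h (inj₂ e) = ≋-sym (proj₁ (⟦⟧-inj (≋-sym e)))

  snd-resp : (p : 𝕍 ℓ) → Resp (λ y → p ≈ ⟨ fst p , y ⟩)
  snd-resp p {x} {y} e m = un≋ {x = p} {⟨ fst p , y ⟩} (eq m ◂ ⟨⟩-cong (≋-refl {x = fst p}) e)

  snd-⟨⟩ : {x y : 𝕍 ℓ} → snd ⟨ x , y ⟩ ≋ y
  snd-⟨⟩ {ℓ} {x} {y} = ext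
    (λ m → let (w , p , q) = ∊-⋃ (sep (⋃ ⟨ x , y ⟩) P) m ; (_ , r) = ∊-sep (⋃ ⟨ x , y ⟩) P (snd-resp _) p
           in ∊-respʳ (≋-sym (⟨⟩-injʳ (eq {x = ⟨ x , y ⟩} {⟨ fst ⟨ x , y ⟩ , w ⟩} r))) q)
    (⋃-∊ (sep-∊ P (snd-resp _) (⋃-∊ (pair-∊ʳ ≋-refl) (pair-∊ʳ ≋-refl))
      (un≋ {x = ⟨ x , y ⟩} (⟨⟩-cong (≋-sym (fst-⟨⟩ {x = x} {y})) ≋-refl))))
    where
    P : 𝕍 ℓ → Set ℓ
    P w = ⟨ x , y ⟩ ≈ ⟨ fst ⟨ x , y ⟩ , w ⟩

  fst-cong : {x y : 𝕍 ℓ} → x ≋ y → fst x ≋ fst y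
  fst-cong {x = x} {y} e = ⋃-cong (sep-cong _ _ (single-resp x) (single-resp y) (⋃-cong e)
    (λ z m → un∊ (∊-respʳ e (mem m))) (λ z m → un∊ (∊-respʳ (≋-sym e) (mem m))))

  snd-cong : {x y : 𝕍 ℓ} → x ≋ y → snd x ≋ snd y
  snd-cong {x = x} {y} e = ⋃-cong (sep-cong _ _ (snd-resp x) (snd-resp y) (⋃-cong e)
    (λ z m → un≋ {x = y} {⟨ fst y , z ⟩} (≋-sym e ◂ eq m ◂ ⟨⟩-cong (fst-cong e) ≋-refl))
    (λ z m → un≋ {x = x} {⟨ fst x , z ⟩} (e ◂ eq m ◂ ⟨⟩-cong (≋-sym (fst-cong e)) ≋-refl)))

  -- With `∅` coding both the number 0 and the empty list, reading past the end of a coded list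
  -- yields 0 and the empty list again.
  fst-∅ : fst {ℓ} ∅ ≋ ∅
  fst-∅ = ext (λ { (mem ((((() , _) , _) , _) , _)) }) (λ m → ⊥-elim (∉∅ m))

  snd-∅ : snd {ℓ} ∅ ≋ ∅
  snd-∅ = ext (λ { (mem ((((() , _) , _) , _) , _)) }) (λ m → ⊥-elim (∉∅ m))

∊-∣∣ : {y : 𝕍 ℓ} (M : 𝕍 ℓ) → y ∊ ∣ M ∣ → ⟨ num 0 , y ⟩ ∊ M
∊-∣∣ M m = mem (proj₂ (∊-sep (⋃ (⋃ M)) (λ y → ⟨ num 0 , y ⟩ ∈ M) (graph-resp _ M) m))

∣∣-∊ : {M y : 𝕍 ℓ} → ⟨ num 0 , y ⟩ ∊ M → y ∊ ∣ M ∣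
∣∣-∊ {M = M} m = sep-∊ (λ y → ⟨ num 0 , y ⟩ ∈ M) (graph-resp _ M) (⟨⟩-∊⋃⋃ m) (un∊ m)

-- First-order definability over `V`.

module Definability {ℓ : Level} (em : ExcludedMiddle (lsuc ℓ)) (V : Class ℓ) (zfc : TransitiveModelOfZFC V) where

  open TransitiveModelOfZFC zfc

  private
    E : ℕ → Set (lsuc ℓ)
    E n = Vec (𝕍 ℓ) n

  abstract
    em₀ : (P : Set ℓ) → Dec P
    em₀ P with em {Lift (lsuc ℓ) P}
    ... | yes (lift p) = yes p
    ... | no h = no λ p → h (lift p)

    stable : {P : Set (lsuc ℓ)} → ¬ ¬ P → P
    stable {P} h with em {P}
    ... | yes p = p
    ... | no q = ⊥-elim (h q)

    stable₀ : {P : Set ℓ} → ¬ ¬ P → P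
    stable₀ {P} h with em₀ P
    ... | yes p = p
    ... | no q = ⊥-elim (h q)

    ¬∀⇒∃ : {A : Set ℓ} {P : A → Set ℓ} → ¬ (∀ a → P a) → Σ[ a ∈ A ] ¬ P a
    ¬∀⇒∃ h = stable₀ λ k → h λ a → stable₀ λ n → k (a , n)

    -- By excluded middle every proposition has a copy in the lower universe.
    Squash : Set (lsuc ℓ) → Set ℓ
    Squash P with em {P}
    ... | yes _ = ⊤ₚ
    ... | no _ = E.⊥

    squash : ∀ {P} → P → Squash P
    squash {P} p with em {P}
    ... | yes _ = tt
    ... | no h = ⊥-elim (h p)

    unsquash : ∀ {P} → Squash P → P
    unsquash {P} s with em {P}
    ... | yes p = p
    unsquash {P} () | no _

  V-≋ : ∀ {x y} → x ≋ y → V x → V y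
  V-≋ (eq e) = respects-≈ _ _ e

  V-∊ : ∀ {x y} → V y → x ∊ y → V x
  V-∊ v (mem m) = transitive _ _ v m

  V-▹ : ∀ {x} → V x → ∀ i → V (x ▹ i)
  V-▹ {x} v i = V-∊ v (▹-∊ x i)

  V-ext : ∀ {x y} → V x → V y → (∀ z → V z → z ∊ x → z ∊ y) → (∀ z → V z → z ∊ y → z ∊ x) → x ≋ y
  V-ext vx vy f g = ext (λ m → f _ (V-∊ vx m) m) (λ m → g _ (V-∊ vy m) m)

  abstract
    ∃V : {P : 𝕍 ℓ → Set (lsuc ℓ)} → ∃ᶜ V P → Σ[ x ∈ 𝕍 ℓ ] V x × P x
    ∃V h = stable λ k → h λ x v p → k (x , v , p)

  ∃ᶜ-intro : {P : 𝕍 ℓ → Set (lsuc ℓ)} → ∀ x → V x → P x → ∃ᶜ V P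
  ∃ᶜ-intro x v p h = h x v p

  AllV : ∀ {n} → E n → Set (lsuc ℓ)
  AllV ρ = ∀ i → V (lookup ρ i)

  []ᵛ : AllV []
  []ᵛ ()

  infixr 5 _∷ᵛ_
  _∷ᵛ_ : ∀ {n x} {ρ : E n} → V x → AllV ρ → AllV (x ∷ ρ)
  (v ∷ᵛ vs) fzero = v
  (v ∷ᵛ vs) (fsuc i) = vs i

  AllV-tail : ∀ {n} (ρ : E (suc n)) → AllV ρ → AllV (Vec.tail ρ)
  AllV-tail (x ∷ ρ) vs i = vs (fsuc i)

  AllV⇒All : ∀ {n} {ρ : E n} → AllV ρ → VecAll.All V ρ
  AllV⇒All {ρ = []} vs = VecAll.[]
  AllV⇒All {ρ = x ∷ ρ} vs = vs fzero VecAll.∷ AllV⇒All (vs ∘ fsuc)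

  All⇒AllV : ∀ {n} {ρ : E n} → VecAll.All V ρ → AllV ρ
  All⇒AllV (p VecAll.∷ ps) fzero = p
  All⇒AllV (p VecAll.∷ ps) (fsuc i) = All⇒AllV ps i

  AllV-++ : ∀ {n m} (ρ : E n) {τ : E m} → AllV ρ → AllV τ → AllV (ρ ++ τ)
  AllV-++ [] vs ws = ws
  AllV-++ (x ∷ ρ) vs ws = vs fzero ∷ᵛ AllV-++ ρ (vs ∘ fsuc) ws

  liftR : ∀ {n m} → (Fin n → Fin m) → Fin (suc n) → Fin (suc m)
  liftR σ fzero = fzero
  liftR σ (fsuc i) = fsuc (σ i)

  ren : ∀ {n m} → (Fin n → Fin m) → Formula n → Formula m
  ren σ (i ∈' j) = σ i ∈' σ j
  ren σ (i ≈' j) = σ i ≈' σ j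
  ren σ ⊥' = ⊥'
  ren σ (φ ⇒' ψ) = ren σ φ ⇒' ren σ ψ
  ren σ (all' φ) = all' (ren (liftR σ) φ)

  Match : ∀ {n m} → (Fin n → Fin m) → E n → E m → Set ℓ
  Match σ ρ τ = ∀ i → lookup ρ i ≋ lookup τ (σ i)

  match-∷ : ∀ {n m} {σ : Fin n → Fin m} {ρ τ} → Match σ ρ τ → ∀ x → Match (liftR σ) (x ∷ ρ) (x ∷ τ)
  match-∷ h x fzero = ≋-refl
  match-∷ h x (fsuc i) = h i

  -- With the identity renaming this is invariance under _≋_.
  holds-ren : ∀ {n m} {σ : Fin n → Fin m} (φ : Formula n) {ρ τ} → Match σ ρ τ → Holds V φ ρ ↔ Holds V (ren σ φ) τ
  holds-ren (i ∈' j) h =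
    (λ (lift p) → lift (un∊ (∊-respʳ (h j) (∊-respˡ (h i) (mem p))))) ,
    (λ (lift p) → lift (un∊ (∊-respʳ (≋-sym (h j)) (∊-respˡ (≋-sym (h i)) (mem p)))))
  holds-ren (i ≈' j) h =
    (λ (lift p) → lift (un≋ (≋-sym (h i) ◂ eq p ◂ h j))) ,
    (λ (lift p) → lift (un≋ (h i ◂ eq p ◂ ≋-sym (h j))))
  holds-ren ⊥' h = id , id
  holds-ren (φ ⇒' ψ) h =
    (λ f p → proj₁ (holds-ren ψ h) (f (proj₂ (holds-ren φ h) p))) ,
    (λ f p → proj₂ (holds-ren ψ h) (f (proj₁ (holds-ren φ h) p)))
  holds-ren (all' φ) h =
    (λ f x v → proj₁ (holds-ren φ (match-∷ h x)) (f x v)) ,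
    (λ f x v → proj₂ (holds-ren φ (match-∷ h x)) (f x v))

  -- The parameters come after the free variables, so that binding variable 0 leaves them in place.
  -- The equivalence concerns only arguments from `V`.
  record Def {n : ℕ} (P : E n → Set (lsuc ℓ)) : Set (lsuc ℓ) where
    constructor mkDef
    field
      {arity} : ℕ
      params : E arity
      paramsV : AllV params
      formula : Formula (n ℕ.+ arity)
      defines : ∀ ρ → AllV ρ → P ρ ↔ Holds V formula (ρ ++ params)

  Def-ext : ∀ {n} {P Q : E n → Set (lsuc ℓ)} → Def P → (∀ ρ → AllV ρ → P ρ ↔ Q ρ) → Def Q
  Def-ext (mkDef ps vs φ h) k = mkDef ps vs φ λ ρ v →
    (λ q → proj₁ (h ρ v) (proj₂ (k ρ v) q)) , (λ q → proj₁ (k ρ v) (proj₂ (h ρ v) q))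

  split-match : ∀ {n m k} {σ : Fin (n ℕ.+ m) → Fin k} (ρ : E n) (τ : E m) {υ : E k} →
    (∀ i → lookup ρ i ≋ lookup υ (σ (i Fin.↑ˡ m))) → (∀ i → lookup τ i ≋ lookup υ (σ (n Fin.↑ʳ i))) →
    Match σ (ρ ++ τ) υ
  split-match [] τ f g i = g i
  split-match (x ∷ ρ) τ f g fzero = f fzero
  split-match {σ = σ} (x ∷ ρ) τ {υ} f g (fsuc i) = split-match {σ = σ ∘ fsuc} ρ τ {υ} (f ∘ fsuc) g i

  splitR : ∀ {n m k} → (Fin n → Fin k) → (Fin m → Fin k) → Fin (n ℕ.+ m) → Fin k
  splitR {n} f g i with Fin.splitAt n i
  ... | inj₁ j = f j
  ... | inj₂ j = g j

  splitR-ˡ : ∀ {n m k} (f : Fin n → Fin k) (g : Fin m → Fin k) i → splitR f g (i Fin.↑ˡ m) ≡ f i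
  splitR-ˡ {n} {m} f g i rewrite Finₚ.splitAt-↑ˡ n i m = refl

  splitR-ʳ : ∀ {n m k} (f : Fin n → Fin k) (g : Fin m → Fin k) i → splitR f g (n Fin.↑ʳ i) ≡ g i
  splitR-ʳ {n} {m} f g i rewrite Finₚ.splitAt-↑ʳ n m i = refl

  ++-match : ∀ {n m k} (f : Fin n → Fin k) (g : Fin m → Fin k) (ρ : E n) (τ : E m) (υ : E k) →
    Match f ρ υ → Match g τ υ → Match (splitR f g) (ρ ++ τ) υ
  ++-match f g ρ τ υ p q = split-match {σ = splitR f g} ρ τ {υ}
    (λ i → p i ◂ ≡⇒≋ (cong (lookup υ) (≡-sym (splitR-ˡ f g i))))
    (λ i → q i ◂ ≡⇒≋ (cong (lookup υ) (≡-sym (splitR-ʳ f g i))))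

  Def-ren : ∀ {n m} {P : E n → Set (lsuc ℓ)} (f : E m → E n) (σ : Fin n → Fin m) →
    (∀ ρ i → lookup (f ρ) i ≡ lookup ρ (σ i)) → Def P → Def (λ ρ → P (f ρ))
  Def-ren {m = m} f σ h (mkDef {k} ps vs φ d) = mkDef ps vs (ren τ φ) λ ρ v →
    let vf = λ i → subst V (≡-sym (h ρ i)) (v (σ i))
        r = holds-ren φ (++-match τ₁ τ₂ (f ρ) ps (ρ ++ ps)
              (λ i → ≡⇒≋ (≡-trans (h ρ i) (≡-sym (Vecₚ.lookup-++ˡ ρ ps (σ i)))))
              (λ i → ≡⇒≋ (≡-sym (Vecₚ.lookup-++ʳ ρ ps i))))
    in (λ p → proj₁ r (proj₁ (d (f ρ) vf) p)) , (λ p → proj₂ (d (f ρ) vf) (proj₂ r p))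
    where
    τ₁ : Fin _ → Fin (m ℕ.+ k)
    τ₁ i = σ i Fin.↑ˡ k
    τ₂ : Fin k → Fin (m ℕ.+ k)
    τ₂ i = m Fin.↑ʳ i
    τ : Fin (_ ℕ.+ k) → Fin (m ℕ.+ k)
    τ = splitR τ₁ τ₂

  -- Formulas see sets only through `_∈_` and `_≈_`, so every definable predicate is invariant under
  -- equality of sets in `V`.
  Def-resp : ∀ {n} {P : E n → Set (lsuc ℓ)} → Def P → ∀ {ρ τ} → AllV ρ → AllV τ →
    (∀ i → lookup ρ i ≋ lookup τ i) → P ρ → P τ
  Def-resp (mkDef {k} ps vs φ d) {ρ} {τ} v w e p = proj₂ (d τ w) (proj₂ back (proj₁ forth (proj₁ (d ρ v) p)))
    where
    σ : Fin _ → Fin _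
    σ i = i
    forth = holds-ren φ {ρ ++ ps} {τ ++ ps} (split-match {σ = σ} ρ ps {τ ++ ps}
      (λ i → e i ◂ ≡⇒≋ (≡-sym (Vecₚ.lookup-++ˡ τ ps i))) (λ i → ≡⇒≋ (≡-sym (Vecₚ.lookup-++ʳ τ ps i))))
    -- `forth` ends in a copy of `φ` renamed along the identity; this second use removes the
    -- renaming.
    back = holds-ren φ {τ ++ ps} {τ ++ ps} (λ i → ≋-refl)

  -- The fixed first argument becomes one more parameter.
  Def-cst : ∀ {n} {P : E (suc n) → Set (lsuc ℓ)} → Def P → ∀ {c} → V c → Def (λ ρ → P (c ∷ ρ))
  Def-cst {n} (mkDef {k} ps vs φ d) {c} vc = mkDef (c ∷ ps) (vc ∷ᵛ vs) (ren τ φ) λ ρ v →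
    let r = holds-ren φ {(c ∷ ρ) ++ ps} {ρ ++ (c ∷ ps)} (++-match τ₁ τ₂ (c ∷ ρ) ps (ρ ++ (c ∷ ps))
              (λ { fzero → ≡⇒≋ (≡-sym (Vecₚ.lookup-++ʳ ρ (c ∷ ps) fzero))
                 ; (fsuc i) → ≡⇒≋ (≡-sym (Vecₚ.lookup-++ˡ ρ (c ∷ ps) i)) })
              (λ i → ≡⇒≋ (≡-sym (Vecₚ.lookup-++ʳ ρ (c ∷ ps) (fsuc i)))))
    in (λ p → proj₁ r (proj₁ (d (c ∷ ρ) (vc ∷ᵛ v)) p)) , (λ p → proj₂ (d (c ∷ ρ) (vc ∷ᵛ v)) (proj₂ r p))
    where
    τ₁ : Fin (suc n) → Fin (n ℕ.+ suc k)
    τ₁ fzero = n Fin.↑ʳ fzero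
    τ₁ (fsuc i) = i Fin.↑ˡ suc k
    τ₂ : Fin k → Fin (n ℕ.+ suc k)
    τ₂ i = n Fin.↑ʳ fsuc i
    τ = splitR τ₁ τ₂

  Def-∈ : ∀ {n} (i j : Fin n) → Def (λ ρ → ↑ (lookup ρ i ∈ lookup ρ j))
  Def-∈ i j = mkDef [] []ᵛ ((i Fin.↑ˡ 0) ∈' (j Fin.↑ˡ 0)) λ ρ _ →
    subst id (cong₂ (λ a b → ↑ (lookup ρ i ∈ lookup ρ j) ↔ ↑ (a ∈ b))
      (≡-sym (Vecₚ.lookup-++ˡ ρ [] i)) (≡-sym (Vecₚ.lookup-++ˡ ρ [] j))) (id , id)

  Def-≈ : ∀ {n} (i j : Fin n) → Def (λ ρ → ↑ (lookup ρ i ≈ lookup ρ j))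
  Def-≈ i j = mkDef [] []ᵛ ((i Fin.↑ˡ 0) ≈' (j Fin.↑ˡ 0)) λ ρ _ →
    subst id (cong₂ (λ a b → ↑ (lookup ρ i ≈ lookup ρ j) ↔ ↑ (a ≈ b))
      (≡-sym (Vecₚ.lookup-++ˡ ρ [] i)) (≡-sym (Vecₚ.lookup-++ˡ ρ [] j))) (id , id)

  Def-⊥ : ∀ {n} → Def {n} (λ _ → E.⊥)
  Def-⊥ = mkDef [] []ᵛ ⊥' λ _ _ → id , id

  Def-⇒ : ∀ {n} {P Q : E n → Set (lsuc ℓ)} → Def P → Def Q → Def (λ ρ → P ρ → Q ρ)
  Def-⇒ {n} (mkDef {k} ps vs φ d) (mkDef {l} qs ws ψ e) =
    mkDef (ps ++ qs) (AllV-++ ps vs ws) (ren σ φ ⇒' ren τ ψ) λ ρ v →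
      let a = holds-ren φ {ρ ++ ps} {ρ ++ (ps ++ qs)} (++-match σ₁ σ₂ ρ ps (ρ ++ (ps ++ qs))
                (λ i → ≡⇒≋ (≡-sym (Vecₚ.lookup-++ˡ ρ (ps ++ qs) i)))
                (λ i → ≡⇒≋ (≡-sym (≡-trans (Vecₚ.lookup-++ʳ ρ (ps ++ qs) (i Fin.↑ˡ l)) (Vecₚ.lookup-++ˡ ps qs i)))))
          b = holds-ren ψ {ρ ++ qs} {ρ ++ (ps ++ qs)} (++-match σ₁ τ₂ ρ qs (ρ ++ (ps ++ qs))
                (λ i → ≡⇒≋ (≡-sym (Vecₚ.lookup-++ˡ ρ (ps ++ qs) i)))
                (λ i → ≡⇒≋ (≡-sym (≡-trans (Vecₚ.lookup-++ʳ ρ (ps ++ qs) (k Fin.↑ʳ i)) (Vecₚ.lookup-++ʳ ps qs i)))))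
      in (λ f p → proj₁ b (proj₁ (e ρ v) (f (proj₂ (d ρ v) (proj₂ a p))))) ,
         (λ f p → proj₂ (e ρ v) (proj₂ b (f (proj₁ a (proj₁ (d ρ v) p)))))
    where
    σ₁ : Fin n → Fin (n ℕ.+ (k ℕ.+ l))
    σ₁ i = i Fin.↑ˡ (k ℕ.+ l)
    σ₂ : Fin k → Fin (n ℕ.+ (k ℕ.+ l))
    σ₂ i = n Fin.↑ʳ (i Fin.↑ˡ l)
    τ₂ : Fin l → Fin (n ℕ.+ (k ℕ.+ l))
    τ₂ i = n Fin.↑ʳ (k Fin.↑ʳ i)
    σ : Fin (n ℕ.+ k) → Fin (n ℕ.+ (k ℕ.+ l))
    σ = splitR σ₁ σ₂
    τ : Fin (n ℕ.+ l) → Fin (n ℕ.+ (k ℕ.+ l))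
    τ = splitR σ₁ τ₂

  Def-∀ : ∀ {n} {P : E (suc n) → Set (lsuc ℓ)} → Def P → Def (λ ρ → ∀ x → V x → P (x ∷ ρ))
  Def-∀ (mkDef ps vs φ d) = mkDef ps vs (all' φ) λ ρ v →
    (λ f x vx → proj₁ (d (x ∷ ρ) (vx ∷ᵛ v)) (f x vx)) , (λ f x vx → proj₂ (d (x ∷ ρ) (vx ∷ᵛ v)) (f x vx))

  Def-¬ : ∀ {n} {P : E n → Set (lsuc ℓ)} → Def P → Def (λ ρ → ¬ P ρ)
  Def-¬ d = Def-ext (Def-⇒ d Def-⊥) λ _ _ → (λ f p → E.⊥-elim (f p)) , (λ f p → ⊥-elim (f p))

  Def-∧ : ∀ {n} {P Q : E n → Set (lsuc ℓ)} → Def P → Def Q → Def (λ ρ → P ρ × Q ρ)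
  Def-∧ d e = Def-ext (Def-¬ (Def-⇒ d (Def-¬ e))) λ _ _ →
    (λ f → stable λ k → f λ p q → k (p , q)) , (λ (p , q) f → f p q)

  Def-∨ : ∀ {n} {P Q : E n → Set (lsuc ℓ)} → Def P → Def Q → Def (λ ρ → P ρ ⊎ Q ρ)
  Def-∨ d e = Def-ext (Def-⇒ (Def-¬ d) e) λ _ _ →
    (λ f → stable λ k → k (inj₂ (f λ p → k (inj₁ p)))) , λ { (inj₁ p) n → ⊥-elim (n p) ; (inj₂ q) _ → q }

  Def-∃ : ∀ {n} {P : E (suc n) → Set (lsuc ℓ)} → Def P → Def (λ ρ → Σ[ x ∈ 𝕍 ℓ ] V x × P (x ∷ ρ))
  Def-∃ d = Def-ext (Def-¬ (Def-∀ (Def-¬ d))) λ _ _ → ∃V , (λ (x , v , p) f → f x v p)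

  -- Definable operations and the closure of `V` under them.

  ↑-map : {P Q : Set ℓ} → (P → Q) → ↑ P → ↑ Q
  ↑-map f (lift p) = lift (f p)

  -- Formulas and terms are predicates and operations on sets together with a
  -- proof that they are first-order definable over V (a term through its
  -- graph).  V is closed under the set-theoretic operations below because
  -- separation and replacement apply to these formulas.
  record Fm (n : ℕ) : Set (lsuc ℓ) where
    constructor mkFm
    field
      holds : E n → Set ℓ
      isDef : Def (λ ρ → ↑ (holds ρ))
  open Fm public

  record Tm (n : ℕ) : Set (lsuc ℓ) where
    constructor mkTm
    field
      ev     : E n → 𝕍 ℓ
      closed : ∀ ρ → AllV ρ → V (ev ρ)
      graph  : Def (λ ρ → ↑ (Vec.head ρ ≈ ev (Vec.tail ρ)))
  open Tm public

  holds-resp : ∀ {n} (φ : Fm n) {ρ τ} → AllV ρ → AllV τ → (∀ i → lookup ρ i ≋ lookup τ i) → holds φ ρ → holds φ τ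
  holds-resp φ v w e p = lower (Def-resp (isDef φ) v w e (lift p))

  ev-cong : ∀ {n} (t : Tm n) {ρ τ} → AllV ρ → AllV τ → (∀ i → lookup ρ i ≋ lookup τ i) → ev t ρ ≋ ev t τ
  ev-cong t {ρ} {τ} v w e = eq (lower (Def-resp (graph t) {ev t ρ ∷ ρ} {ev t ρ ∷ τ} (closed t ρ v ∷ᵛ v) (closed t ρ v ∷ᵛ w)
    (λ { fzero → ≋-refl ; (fsuc i) → e i }) (lift (≈-refl (ev t ρ)))))

  ∷-≋ : ∀ {n x y} {ρ : E n} → x ≋ y → ∀ i → lookup (x ∷ ρ) i ≋ lookup (y ∷ ρ) i
  ∷-≋ e fzero = e
  ∷-≋ e (fsuc i) = ≋-refl

  abstract
    -- Formulas have no function symbols; substituting `t` means asserting `P` of some `y` that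
    -- satisfies the graph of `t`.
    Def-let : ∀ {n} {P : E (suc n) → Set (lsuc ℓ)} → Def P → (t : Tm n) → Def (λ ρ → P (ev t ρ ∷ ρ))
    Def-let d t = Def-ext (Def-∃ (Def-∧ (graph t) d)) λ ρ v →
      (λ (y , vy , (lift e) , p) → Def-resp d (vy ∷ᵛ v) (closed t ρ v ∷ᵛ v) (∷-≋ (eq e)) p) ,
      (λ p → ev t ρ , closed t ρ v , lift (≈-refl (ev t ρ)) , p)

    Def-wk : ∀ {n} {P : E n → Set (lsuc ℓ)} → Def P → Def (λ ρ → P (Vec.tail ρ))
    Def-wk = Def-ren Vec.tail fsuc λ { (x ∷ ρ) i → refl }

    Def-wk₁ : ∀ {n} {P : E (suc n) → Set (lsuc ℓ)} → Def P → Def (λ ρ → P (Vec.head ρ ∷ Vec.tail (Vec.tail ρ)))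
    Def-wk₁ = Def-ren (λ ρ → Vec.head ρ ∷ Vec.tail (Vec.tail ρ)) (liftR fsuc)
      λ { (x ∷ y ∷ ρ) fzero → refl ; (x ∷ y ∷ ρ) (fsuc i) → refl }

    Def-wk₂ : ∀ {n} {P : E (suc (suc n)) → Set (lsuc ℓ)} → Def P →
      Def (λ ρ → P (Vec.head ρ ∷ Vec.head (Vec.tail ρ) ∷ Vec.tail (Vec.tail (Vec.tail ρ))))
    Def-wk₂ = Def-ren (λ ρ → Vec.head ρ ∷ Vec.head (Vec.tail ρ) ∷ Vec.tail (Vec.tail (Vec.tail ρ))) (liftR (liftR fsuc))
      λ { (x ∷ y ∷ z ∷ ρ) fzero → refl ; (x ∷ y ∷ z ∷ ρ) (fsuc fzero) → refl ; (x ∷ y ∷ z ∷ ρ) (fsuc (fsuc i)) → refl }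

    Def-swap : ∀ {n} {P : E (suc (suc n)) → Set (lsuc ℓ)} → Def P →
      Def (λ ρ → P (Vec.head (Vec.tail ρ) ∷ Vec.head ρ ∷ Vec.tail (Vec.tail ρ)))
    Def-swap {n} = Def-ren (λ ρ → Vec.head (Vec.tail ρ) ∷ Vec.head ρ ∷ Vec.tail (Vec.tail ρ)) σ
      λ { (x ∷ y ∷ ρ) fzero → refl ; (x ∷ y ∷ ρ) (fsuc fzero) → refl ; (x ∷ y ∷ ρ) (fsuc (fsuc i)) → refl }
      where
      σ : Fin (suc (suc n)) → Fin (suc (suc n))
      σ fzero = fsuc fzero
      σ (fsuc fzero) = fzero
      σ (fsuc (fsuc i)) = fsuc (fsuc i)

  wkT : ∀ {n} → Tm n → Tm (suc n)
  wkT t = mkTm (λ ρ → ev t (Vec.tail ρ)) (λ ρ v → closed t _ (AllV-tail ρ v)) (Def-wk₁ (graph t))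

  wk₁T : ∀ {n} → Tm (suc n) → Tm (suc (suc n))
  wk₁T t = mkTm (λ ρ → ev t (Vec.head ρ ∷ Vec.tail (Vec.tail ρ)))
    (λ { (x ∷ y ∷ ρ) v → closed t _ (v fzero ∷ᵛ (λ i → v (fsuc (fsuc i)))) }) (Def-wk₂ (graph t))

  wkF : ∀ {n} → Fm n → Fm (suc n)
  wkF φ = mkFm (λ ρ → holds φ (Vec.tail ρ)) (Def-wk (isDef φ))

  var : ∀ {n} → Fin n → Tm n
  var i = mkTm (λ ρ → lookup ρ i) (λ ρ v → v i) (Def-ext (Def-≈ fzero (fsuc i)) λ { (x ∷ ρ) _ → id , id })

  #0 : ∀ {n} → Tm (suc n)
  #0 = var fzero
  #1 : ∀ {n} → Tm (suc (suc n))
  #1 = var (fsuc fzero)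
  #2 : ∀ {n} → Tm (suc (suc (suc n)))
  #2 = var (fsuc (fsuc fzero))
  #3 : ∀ {n} → Tm (suc (suc (suc (suc n))))
  #3 = var (fsuc (fsuc (fsuc fzero)))
  #4 : ∀ {n} → Tm (suc (suc (suc (suc (suc n)))))
  #4 = var (fsuc (fsuc (fsuc (fsuc fzero))))

  infix 15 _∈ᵗ_ _≈ᵗ_
  _∈ᵗ_ _≈ᵗ_ : ∀ {n} → Tm n → Tm n → Fm n
  t ∈ᵗ u = mkFm (λ ρ → ev t ρ ∈ ev u ρ) def
    where abstract
    def : Def (λ ρ → ↑ (ev t ρ ∈ ev u ρ))
    def = Def-let (Def-let (Def-∈ fzero (fsuc fzero)) (wkT t)) u
  t ≈ᵗ u = mkFm (λ ρ → ev t ρ ≈ ev u ρ) def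
    where abstract
    def : Def (λ ρ → ↑ (ev t ρ ≈ ev u ρ))
    def = Def-let (Def-let (Def-≈ fzero (fsuc fzero)) (wkT t)) u

  infixr 6 _⇒ᵗ_
  infixr 8 _∧ᵗ_
  infixr 7 _∨ᵗ_
  _⇒ᵗ_ _∧ᵗ_ _∨ᵗ_ : ∀ {n} → Fm n → Fm n → Fm n
  φ ⇒ᵗ ψ = mkFm (λ ρ → holds φ ρ → holds ψ ρ) (Def-ext (Def-⇒ (isDef φ) (isDef ψ)) λ ρ v →
    (λ f → lift λ p → lower (f (lift p))) , λ { (lift f) (lift p) → lift (f p) })
  φ ∧ᵗ ψ = mkFm (λ ρ → holds φ ρ × holds ψ ρ) (Def-ext (Def-∧ (isDef φ) (isDef ψ)) λ ρ v →
    (λ (lift p , lift q) → lift (p , q)) , λ (lift (p , q)) → lift p , lift q)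
  φ ∨ᵗ ψ = mkFm (λ ρ → holds φ ρ ⊎ holds ψ ρ) (Def-ext (Def-∨ (isDef φ) (isDef ψ)) λ ρ v →
    (λ { (inj₁ (lift p)) → lift (inj₁ p) ; (inj₂ (lift p)) → lift (inj₂ p) }) ,
    (λ { (lift (inj₁ p)) → inj₁ (lift p) ; (lift (inj₂ p)) → inj₂ (lift p) }))

  ¬ᵗ_ : ∀ {n} → Fm n → Fm n
  ¬ᵗ φ = mkFm (λ ρ → ¬ holds φ ρ) (Def-ext (Def-¬ (isDef φ)) λ ρ v →
    (λ f → lift λ p → f (lift p)) , λ { (lift f) (lift p) → f p })

  ∀ᵗ ∃ᵗ : ∀ {n} → Tm n → Fm (suc n) → Fm n
  ∀ᵗ t φ = mkFm (λ ρ → ∀ i → holds φ (ev t ρ ▹ i ∷ ρ)) def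
    where abstract
    def : Def (λ ρ → ↑ (∀ i → holds φ (ev t ρ ▹ i ∷ ρ)))
    def = Def-ext (Def-∀ (Def-⇒ (isDef (#0 ∈ᵗ wkT t)) (isDef φ))) λ ρ v →
      (λ f → lift λ i → lower (f _ (V-▹ (closed t ρ v) i) (lift (un∊ (▹-∊ (ev t ρ) i))))) ,
      λ { (lift f) x vx (lift (i , e)) → lift (holds-resp φ (V-▹ (closed t ρ v) i ∷ᵛ v) (vx ∷ᵛ v) (∷-≋ (≋-sym (eq e))) (f i)) }
  ∃ᵗ t φ = mkFm (λ ρ → Σ[ i ∈ idx (ev t ρ) ] holds φ (ev t ρ ▹ i ∷ ρ)) def
    where abstract
    def : Def (λ ρ → ↑ (Σ[ i ∈ idx (ev t ρ) ] holds φ (ev t ρ ▹ i ∷ ρ)))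
    def = Def-ext (Def-∃ (Def-∧ (isDef (#0 ∈ᵗ wkT t)) (isDef φ))) λ ρ v →
      (λ { (x , vx , lift (i , e) , lift p) → lift (i , holds-resp φ (vx ∷ᵛ v) (V-▹ (closed t ρ v) i ∷ᵛ v) (∷-≋ (eq e)) p) }) ,
      λ { (lift (i , p)) → ev t ρ ▹ i , V-▹ (closed t ρ v) i , lift (un∊ (▹-∊ (ev t ρ) i)) , lift p }

  abstract
    -- By extensionality and transitivity of `V`, a formula for the elements of `f ρ` gives one for
    -- its graph: `y` is the value if both have the same elements in `V`.
    member-graph : ∀ {n} (f : E n → 𝕍 ℓ) → (∀ ρ → AllV ρ → V (f ρ)) →
      Def (λ ρ → ↑ (Vec.head ρ ∈ f (Vec.tail ρ))) → Def (λ ρ → ↑ (Vec.head ρ ≈ f (Vec.tail ρ)))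
    member-graph f c d = Def-ext
      (Def-∀ (Def-∧ (Def-⇒ (Def-∈ fzero (fsuc fzero)) (Def-wk₁ d)) (Def-⇒ (Def-wk₁ d) (Def-∈ fzero (fsuc fzero)))))
      λ { (y ∷ ρ) v →
        (λ h → lift (un≋ (V-ext (v fzero) (c ρ (v ∘ fsuc))
          (λ z vz (mem m) → mem (lower (proj₁ (h z vz) (lift m)))) (λ z vz (mem m) → mem (lower (proj₂ (h z vz) (lift m))))))) ,
        (λ (lift e) z vz → ↑-map (λ m → un∊ (∊-respʳ (eq e) (mem m))) , ↑-map (λ m → un∊ (∊-respʳ (≋-sym (eq e)) (mem m)))) }

  memTm : ∀ {n} (f : E n → 𝕍 ℓ) → (∀ ρ → AllV ρ → V (f ρ)) → Def (λ ρ → ↑ (Vec.head ρ ∈ f (Vec.tail ρ))) → Tm n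
  memTm f c d = mkTm f c (member-graph f c d)

  cst : ∀ {n} x → V x → Tm n
  cst x vx = mkTm (λ _ → x) (λ _ _ → vx) (Def-ext (Def-cst (Def-≈ (fsuc fzero) fzero) vx) λ { (y ∷ ρ) _ → id , id })

  V-⟦⟧ : ∀ {x y} → V x → V y → V ⟦ x , y ⟧
  V-⟦⟧ {x} {y} vx vy with ∃V (pairing x y vx vy)
  ... | p , vp , h = V-≋ (ext
    (λ m → case proj₁ (h _ (V-∊ vp m)) (un∊ m) of λ { (inj₁ e) → pair-∊ˡ (eq e) ; (inj₂ e) → pair-∊ʳ (eq e) })
    (λ m → case ∊-pair m of λ { (inj₁ e) → mem (proj₂ (h _ (V-≋ (≋-sym e) vx)) (inj₁ (un≋ e)))
                              ; (inj₂ e) → mem (proj₂ (h _ (V-≋ (≋-sym e) vy)) (inj₂ (un≋ e))) })) vp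

  V-⟨⟩ : ∀ {x y} → V x → V y → V ⟨ x , y ⟩
  V-⟨⟩ vx vy = V-⟦⟧ (V-⟦⟧ vx vx) (V-⟦⟧ vx vy)

  V-⋃ : ∀ {x} → V x → V (⋃ x)
  V-⋃ {x} vx with ∃V (union x vx)
  ... | u , vu , h = V-≋ (ext
    (λ m → let (y , _ , lift (p , q)) = ∃V (proj₁ (h _ (V-∊ vu m)) (un∊ m)) in ⋃-∊ (mem {y = x} p) (mem q))
    (λ m → let (y , p , q) = ∊-⋃ x m ; vy = V-∊ vx p in
      mem (proj₂ (h _ (V-∊ vy q)) (∃ᶜ-intro y vy (lift (un∊ p , un∊ q)))))) vu

  V-⟨⟩ʳ : ∀ {x y} → V ⟨ x , y ⟩ → V y
  V-⟨⟩ʳ v = V-∊ (V-∊ v (pair-∊ʳ ≋-refl)) (pair-∊ʳ ≋-refl)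

  ⟦_,_⟧ᵗ ⟨_,_⟩ᵗ : ∀ {n} → Tm n → Tm n → Tm n
  ⟦ t , u ⟧ᵗ = memTm (λ ρ → ⟦ ev t ρ , ev u ρ ⟧) (λ ρ v → V-⟦⟧ (closed t ρ v) (closed u ρ v)) def
    where abstract
    def : Def (λ ρ → ↑ (Vec.head ρ ∈ ⟦ ev t (Vec.tail ρ) , ev u (Vec.tail ρ) ⟧))
    def = Def-ext (isDef ((#0 ≈ᵗ wkT t) ∨ᵗ (#0 ≈ᵗ wkT u))) λ { (z ∷ ρ) v →
      ↑-map (λ { (inj₁ e) → lift true , e ; (inj₂ e) → lift false , e }) ,
      ↑-map (λ { (lift true , e) → inj₁ e ; (lift false , e) → inj₂ e }) }
  ⟨ t , u ⟩ᵗ = ⟦ ⟦ t , t ⟧ᵗ , ⟦ t , u ⟧ᵗ ⟧ᵗ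

  ⋃ᵗ : ∀ {n} → Tm n → Tm n
  ⋃ᵗ t = memTm (λ ρ → ⋃ (ev t ρ)) (λ ρ v → V-⋃ (closed t ρ v)) def
    where abstract
    def : Def (λ ρ → ↑ (Vec.head ρ ∈ ⋃ (ev t (Vec.tail ρ))))
    def = Def-ext (isDef (∃ᵗ (wkT t) (#1 ∈ᵗ #0))) λ { (z ∷ ρ) v →
      ↑-map (λ (i , m) → un∊ (⋃-∊ (▹-∊ (ev t ρ) i) (mem m))) ,
      ↑-map (λ { ((i , j) , e) → i , j , e }) }

  -- The set that separation provides inside `V` equals the ambient `sep`, because `V` is transitive
  -- and `φ` is invariant under `_≋_`.
  sepᵗ : ∀ {n} → Tm n → Fm (suc n) → Tm n
  sepᵗ {n} t φ = memTm (λ ρ → sep (ev t ρ) (λ x → holds φ (x ∷ ρ))) cl def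
    where abstract
    to : ∀ {ρ z} → AllV ρ → V z → z ∊ ev t ρ → holds φ (z ∷ ρ) → z ∊ sep (ev t ρ) (λ x → holds φ (x ∷ ρ))
    to {ρ} v vz (mem (i , e)) p = mem ((i , holds-resp φ (vz ∷ᵛ v) (V-▹ (closed t ρ v) i ∷ᵛ v) (∷-≋ (eq e)) p) , e)
    from : ∀ {ρ z} → AllV ρ → V z → z ∊ sep (ev t ρ) (λ x → holds φ (x ∷ ρ)) → z ∊ ev t ρ × holds φ (z ∷ ρ)
    from {ρ} v vz (mem ((i , p) , e)) = mem (i , e) , holds-resp φ (V-▹ (closed t ρ v) i ∷ᵛ v) (vz ∷ᵛ v) (∷-≋ (≋-sym (eq e))) p
    cl : ∀ ρ → AllV ρ → V (sep (ev t ρ) (λ x → holds φ (x ∷ ρ)))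
    cl ρ v with isDef φ
    ... | mkDef ps vs ψ d with ∃V (separation ψ (ρ ++ ps) (AllV⇒All (AllV-++ ρ v vs)) (ev t ρ) (closed t ρ v))
    ...   | b , vb , h = V-≋ (ext
      (λ m → let vz = V-∊ vb m ; (p , q) = proj₁ (h _ vz) (un∊ m) in to v vz (mem p) (lower (proj₂ (d (_ ∷ ρ) (vz ∷ᵛ v)) q)))
      (λ { m@(mem ((i , _) , e)) → let vz = V-≋ (≋-sym (eq e)) (V-▹ (closed t ρ v) i) ; (p , q) = from v vz m in
         mem (proj₂ (h _ vz) (un∊ p , proj₁ (d (_ ∷ ρ) (vz ∷ᵛ v)) (lift q))) })) vb
    def : Def (λ ρ → ↑ (Vec.head ρ ∈ sep (ev t (Vec.tail ρ)) (λ x → holds φ (x ∷ Vec.tail ρ))))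
    def = Def-ext (isDef ((#0 ∈ᵗ wkT t) ∧ᵗ φ)) λ { (z ∷ ρ) v →
      ↑-map (λ (p , q) → un∊ (to (v ∘ fsuc) (v fzero) (mem p) q)) ,
      ↑-map (λ m → let (p , q) = from (v ∘ fsuc) (v fzero) (mem m) in un∊ p , q) }

  -- Replacement applies to the formula for the graph of `u`, which is functional because `u` is an
  -- operation whose values lie in `V`.
  imgᵗ : ∀ {n} → Tm n → Tm (suc n) → Tm n
  imgᵗ {n} t u = memTm (λ ρ → sup (idx (ev t ρ)) λ i → ev u (ev t ρ ▹ i ∷ ρ)) cl def
    where abstract
    cl : ∀ ρ → AllV ρ → V (sup (idx (ev t ρ)) λ i → ev u (ev t ρ ▹ i ∷ ρ))
    cl ρ v with graph u
    ... | mkDef ps vs ψ d with ∃V (replacement ψ (ρ ++ ps) (AllV⇒All (AllV-++ ρ v vs)) (ev t ρ) (closed t ρ v)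
                (λ x vx _ → let vux = closed u (x ∷ ρ) (vx ∷ᵛ v) in
                  ∃ᶜ-intro (ev u (x ∷ ρ)) vux (proj₁ (d (_ ∷ x ∷ ρ) (vux ∷ᵛ vx ∷ᵛ v)) (lift (≈-refl (ev u (x ∷ ρ)))) ,
                    λ z vz p → lower (proj₂ (d (z ∷ x ∷ ρ) (vz ∷ᵛ vx ∷ᵛ v)) p))))
    ...   | b , vb , h = V-≋ (ext
      (λ {y} m → let vy = V-∊ vb m ; (x , vx , lift (i , e) , p) = ∃V (proj₁ (h _ vy) (un∊ m)) in
        sup-∊ i (eq (lower (proj₂ (d (y ∷ x ∷ ρ) (vy ∷ᵛ vx ∷ᵛ v)) p)) ◂ ev-cong u (vx ∷ᵛ v) (V-▹ (closed t ρ v) i ∷ᵛ v) (∷-≋ (eq e))))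
      (λ {y} m → let (i , e) = ∊-sup m ; vx = V-▹ (closed t ρ v) i ; vy = V-≋ (≋-sym e) (closed u _ (vx ∷ᵛ v)) in
        mem (proj₂ (h y vy) (∃ᶜ-intro (ev t ρ ▹ i) vx (lift (un∊ (▹-∊ (ev t ρ) i)) ,
          proj₁ (d (y ∷ ev t ρ ▹ i ∷ ρ) (vy ∷ᵛ vx ∷ᵛ v)) (lift (un≋ e))))))) vb
    def : Def (λ ρ → ↑ (Vec.head ρ ∈ sup (idx (ev t (Vec.tail ρ))) λ i → ev u (ev t (Vec.tail ρ) ▹ i ∷ Vec.tail ρ)))
    def = Def-ext (isDef (∃ᵗ (wkT t) (#1 ≈ᵗ wk₁T u))) λ { (z ∷ ρ) v → ↑-map id , ↑-map id }

  -- Numerals and recursion on ω inside `V`.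

  V-inductive : Σ[ w ∈ 𝕍 ℓ ] V w × ∅ ∊ w × (∀ {x} → x ∊ w → succ x ∊ w)
  V-inductive with ∃V infinity
  ... | w , vw , lift z , s = w , vw , mem z , λ m → mem (s _ (V-∊ vw m) (un∊ m))

  V-∅ : V ∅
  V-∅ = let (w , vw , z , _) = V-inductive in V-∊ vw z

  ∅ᵗ : ∀ {n} → Tm n
  ∅ᵗ = cst ∅ V-∅

  insᵗ : ∀ {n} → Tm n → Tm n → Tm n
  insᵗ t u = ⋃ᵗ ⟦ u , ⟦ t , t ⟧ᵗ ⟧ᵗ

  succᵗ : ∀ {n} → Tm n → Tm n
  succᵗ t = ⋃ᵗ ⟦ t , ⟦ t , t ⟧ᵗ ⟧ᵗ

  numᵗ : ∀ {n} → ℕ → Tm n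
  numᵗ zero = ∅ᵗ
  numᵗ (suc k) = succᵗ (numᵗ k)

  V-num : ∀ n → V (num n)
  V-num zero = V-∅
  V-num (suc n) = V-⋃ (V-⟦⟧ (V-num n) (V-⟦⟧ (V-num n) (V-num n)))

  private
    Pre : 𝕍 ℓ → 𝕍 ℓ → Set ℓ
    Pre x y = y ≋ ∅ ⊎ (Σ[ i ∈ idx x ] y ≋ succ (x ▹ i))

    -- By induction on membership. If `x` is the successor of `x ▹ i`, the condition passes to
    -- `x ▹ i`: a predecessor found in `x` already lies in `x ▹ i`, unless it is `x ▹ i` itself, and
    -- then `z` would equal `x` and be an element of `x`.
    numeral : ∀ x → (∀ y → y ∊ succ x → Pre x y) → Σ[ n ∈ ℕ ] x ≋ num n
    numeral = ∈-ind _ step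
      where
      step : ∀ x → (∀ y → y ∊ x → (∀ z → z ∊ succ y → Pre y z) → Σ[ n ∈ ℕ ] y ≋ num n) →
             (∀ y → y ∊ succ x → Pre x y) → Σ[ n ∈ ℕ ] x ≋ num n
      step x ih h with h x (succ-∊ʳ ≋-refl)
      ... | inj₁ e = 0 , e
      ... | inj₂ (i , e) = let (n , e′) = ih (x ▹ i) (▹-∊ x i) sub in suc n , (e ◂ succ-cong e′)
        where
        sub : ∀ z → z ∊ succ (x ▹ i) → Pre (x ▹ i) z
        sub z m with h z (succ-∊ˡ (∊-respʳ (≋-sym e) m))
        ... | inj₁ p = inj₁ p
        ... | inj₂ (j , p) with ∊-succ (x ▹ i) (∊-respʳ e (▹-∊ x j))
        ...   | inj₁ q = let (k , r) = ∊-idx q in inj₂ (k , (p ◂ succ-cong r))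
        ...   | inj₂ q = ⊥-elim (∊-irrefl (∊-respˡ (p ◂ succ-cong q ◂ ≋-sym e) (∊-respʳ (≋-sym e) m)))

  -- Infinity gives only some inductive set of `V`. The formula `φ` cuts out of it the sets accepted
  -- by `numeral`, so the ω of `V` is the one of the ambient universe.
  V-ω : V ω
  V-ω with V-inductive
  ... | w , vw , z , s = V-≋ (ext to from) (closed t [] []ᵛ)
    where
    φ : Fm 1
    φ = ∀ᵗ (succᵗ #0) ((#0 ≈ᵗ ∅ᵗ) ∨ᵗ ∃ᵗ #1 (#1 ≈ᵗ succᵗ #0))
    t : Tm 0
    t = sepᵗ (cst w vw) φ
    rφ : ∀ {x y} → V x → V y → x ≋ y → holds φ (x ∷ []) → holds φ (y ∷ [])
    rφ {x} {y} vx vy e = holds-resp φ {x ∷ []} {y ∷ []} (vx ∷ᵛ []ᵛ) (vy ∷ᵛ []ᵛ) (∷-≋ e)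
    to : ev t [] ⊑ ω
    to m@(mem ((i , p) , e)) = let (n , e′) = numeral _ λ y q → f (∊-idx q) in sup-∊ (lift n) (eq e ◂ e′)
      where
      f : ∀ {y} → Σ[ j ∈ idx (succ (w ▹ i)) ] y ≋ succ (w ▹ i) ▹ j → Pre (w ▹ i) y
      f (j , r) with p j
      ... | inj₁ q = inj₁ (r ◂ eq q)
      ... | inj₂ (k , q) = inj₂ (k , (r ◂ eq q))
    num∊w : ∀ n → num n ∊ w
    num∊w zero = z
    num∊w (suc n) = s (num∊w n)
    holdsNum : ∀ n → holds φ (num n ∷ [])
    holdsNum n i with ∊-num {n = suc n} (▹-∊ (succ (num n)) i)
    ... | zero , _ , e = inj₁ (un≋ e)
    ... | suc k , s≤s lt , e = let (j , q) = ∊-idx (num-< {ℓ} lt) in inj₂ (j , un≋ (e ◂ succ-cong q))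
    from : ω ⊑ ev t []
    from m = let (n , e) = ∊-ω m ; (i , q) = ∊-idx (num∊w n) in
      mem ((i , rφ (V-num n) (V-▹ vw i) q (holdsNum n)) , un≋ (e ◂ q))

  ωᵗ : ∀ {n} → Tm n
  ωᵗ = cst ω V-ω

  abstract
    -- 0 when the argument is not a numeral.
    natOf : 𝕍 ℓ → ℕ
    natOf x with em₀ (Σ[ n ∈ ℕ ] x ≋ num n)
    ... | yes (n , _) = n
    ... | no _ = 0

    natOf-num : ∀ {x n} → x ≋ num n → natOf x ≡ n
    natOf-num {x} {n} e with em₀ (Σ[ n ∈ ℕ ] x ≋ num n)
    ... | yes (m , e′) = num-inj (≋-sym e′ ◂ e)
    ... | no h = ⊥-elim (h (n , e))

    natOf-no : ∀ {x} → ¬ x ∊ ω → natOf x ≡ 0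
    natOf-no {x} h with em₀ (Σ[ n ∈ ℕ ] x ≋ num n)
    ... | yes (m , e) = ⊥-elim (h (sup-∊ (lift m) e))
    ... | no _ = refl

    natOf-cong : ∀ {x y} → x ≋ y → natOf x ≡ natOf y
    natOf-cong {x} {y} e with em₀ (y ∊ ω)
    ... | yes m = let (n , p) = ∊-ω m in ≡-trans (natOf-num (e ◂ p)) (≡-sym (natOf-num p))
    ... | no h = ≡-trans (natOf-no (λ m → h (∊-respˡ e m))) (≡-sym (natOf-no h))

  -- The value of a term may be replaced by an equal expression, in practice
  -- an opaque one.
  sealᵗ : ∀ {n} (t : Tm n) (f : Vec (𝕍 ℓ) n → 𝕍 ℓ) → (∀ ρ → ev t ρ ≡ f ρ) → Tm n
  sealᵗ t f h = mkTm f (λ ρ v → subst V (h ρ) (closed t ρ v))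
    (Def-ext (graph t) λ { (y ∷ ρ) _ → subst (λ z → ↑ (y ≈ ev t ρ) ↔ ↑ (y ≈ z)) (h ρ) (id , id) })

  sealᶠ : ∀ {n} (φ : Fm n) (P : Vec (𝕍 ℓ) n → Set ℓ) → (∀ ρ → AllV ρ → holds φ ρ ↔ P ρ) → Fm n
  sealᶠ φ P h = mkFm P (Def-ext (isDef φ) λ ρ v → ↑-map (proj₁ (h ρ v)) , ↑-map (proj₂ (h ρ v)))

  letᵗ : ∀ {n} → Tm n → Tm (suc n) → Tm n
  letᵗ t u = mkTm (λ ρ → ev u (ev t ρ ∷ ρ)) (λ ρ v → closed u _ (closed t ρ v ∷ᵛ v)) def
    where abstract
    def : Def (λ ρ → ↑ (Vec.head ρ ≈ ev u (ev t (Vec.tail ρ) ∷ Vec.tail ρ)))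
    def = Def-let (Def-swap (graph u)) (wkT t)

  iteᵗ : ∀ {n} → Fm n → Tm n → Tm n → Tm n
  iteᵗ φ t u = mkTm (λ ρ → ite (em₀ (holds φ ρ)) (ev t ρ) (ev u ρ)) cl def
    where abstract
    cl : ∀ ρ → AllV ρ → V (ite (em₀ (holds φ ρ)) (ev t ρ) (ev u ρ))
    cl ρ v with em₀ (holds φ ρ)
    ... | yes _ = closed t ρ v
    ... | no _ = closed u ρ v
    def : Def (λ ρ → ↑ (Vec.head ρ ≈ ite (em₀ (holds φ (Vec.tail ρ))) (ev t (Vec.tail ρ)) (ev u (Vec.tail ρ))))
    def = Def-ext (isDef ((wkF φ ∧ᵗ (#0 ≈ᵗ wkT t)) ∨ᵗ ((¬ᵗ wkF φ) ∧ᵗ (#0 ≈ᵗ wkT u)))) λ { (y ∷ ρ) v → f y ρ }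
      where
      f : ∀ y ρ → ↑ ((holds φ ρ × y ≈ ev t ρ) ⊎ (¬ holds φ ρ × y ≈ ev u ρ)) ↔
                  ↑ (y ≈ ite (em₀ (holds φ ρ)) (ev t ρ) (ev u ρ))
      f y ρ with em₀ (holds φ ρ)
      ... | yes p = ↑-map (λ { (inj₁ (_ , e)) → e ; (inj₂ (n , _)) → ⊥-elim (n p) }) , ↑-map (λ e → inj₁ (p , e))
      ... | no n = ↑-map (λ { (inj₁ (p , _)) → ⊥-elim (n p) ; (inj₂ (_ , e)) → e }) , ↑-map (λ e → inj₂ (n , e))

  opaque
    unfolding fst

    ev-fstᵗ : ∀ {n} (t : Tm n) ρ → ev (⋃ᵗ (sepᵗ (⋃ᵗ t) (⟦ #0 , #0 ⟧ᵗ ∈ᵗ wkT t))) ρ ≡ fst (ev t ρ)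
    ev-fstᵗ t ρ = refl

  fstᵗ : ∀ {n} → Tm n → Tm n
  fstᵗ t = sealᵗ (⋃ᵗ (sepᵗ (⋃ᵗ t) (⟦ #0 , #0 ⟧ᵗ ∈ᵗ wkT t))) (λ ρ → fst (ev t ρ)) (ev-fstᵗ t)

  opaque
    unfolding snd

    ev-sndᵗ : ∀ {n} (t : Tm n) ρ → ev (⋃ᵗ (sepᵗ (⋃ᵗ t) (wkT t ≈ᵗ ⟨ wkT (fstᵗ t) , #0 ⟩ᵗ))) ρ ≡ snd (ev t ρ)
    ev-sndᵗ t ρ = refl

  sndᵗ : ∀ {n} → Tm n → Tm n
  sndᵗ t = sealᵗ (⋃ᵗ (sepᵗ (⋃ᵗ t) (wkT t ≈ᵗ ⟨ wkT (fstᵗ t) , #0 ⟩ᵗ))) (λ ρ → snd (ev t ρ)) (ev-sndᵗ t)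

  infixl 28 _·ᵗ_
  _·ᵗ_ : ∀ {n} → Tm n → Tm n → Tm n
  t ·ᵗ u = ⋃ᵗ (sepᵗ (⋃ᵗ (⋃ᵗ t)) (⟨ wkT u , #0 ⟩ᵗ ∈ᵗ wkT t))

  ∣_∣ᵗ : ∀ {n} → Tm n → Tm n
  ∣ t ∣ᵗ = sepᵗ (⋃ᵗ (⋃ᵗ t)) (⟨ ∅ᵗ , #0 ⟩ᵗ ∈ᵗ wkT t)

  infixl 25 _∖ᵗ_
  _∖ᵗ_ : ∀ {n} → Tm n → Tm n → Tm n
  t ∖ᵗ u = sepᵗ t (¬ᵗ (#0 ∈ᵗ wkT u))

  -- All later recursions in `V` (the sequence in `X`, the patterns, sets of tuples, arithmetic) are
  -- instances of this one. A count that is not a numeral means 0 steps.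
  iterᵗ : ∀ {n} → Tm n → Tm (suc n) → Tm n → Tm n
  iterᵗ {n} a g k = mkTm value cl def
    where
    seq : E n → ℕ → 𝕍 ℓ
    seq ρ = iter (λ w → ev g (w ∷ ρ)) (ev a ρ)
    value : E n → 𝕍 ℓ
    value ρ = seq ρ (natOf (ev k ρ))
    abstract
      V-seq : ∀ ρ → AllV ρ → ∀ m → V (seq ρ m)
      V-seq ρ v zero = closed a ρ v
      V-seq ρ v (suc m) = closed g _ (V-seq ρ v m ∷ᵛ v)
      cl : ∀ ρ → AllV ρ → V (value ρ)
      cl ρ v = V-seq ρ v (natOf (ev k ρ))
      -- The n-th iterate is y iff ⟨ n , y ⟩ lies in some set h of pairs each
      -- of which is either the initial one or obtained from another one in h;
      -- h need not be a function.
      trace : Fm (suc (suc n))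
      trace = ∀ᵗ #0 ((#0 ≈ᵗ ⟨ ∅ᵗ , wkT (wkT (wkT a)) ⟩ᵗ) ∨ᵗ
        ∃ᵗ #1 (#1 ≈ᵗ ⟨ succᵗ (fstᵗ #0) , letᵗ (sndᵗ #0) (wk₁T (wk₁T (wk₁T (wk₁T g)))) ⟩ᵗ))
      Justified : 𝕍 ℓ → E n → 𝕍 ℓ → Set ℓ
      Justified h ρ p = p ≋ ⟨ ∅ , ev a ρ ⟩ ⊎
        (Σ[ j ∈ idx h ] p ≋ ⟨ succ (fst (h ▹ j)) , ev g (snd (h ▹ j) ∷ ρ) ⟩)
      unfold : ∀ {h y ρ} → holds trace (h ∷ y ∷ ρ) → ∀ i → Justified h ρ (h ▹ i)
      unfold tr i with tr i
      ... | inj₁ e = inj₁ (eq e)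
      ... | inj₂ (j , e) = inj₂ (j , eq e)
      fold : ∀ {h y ρ} → (∀ i → Justified h ρ (h ▹ i)) → holds trace (h ∷ y ∷ ρ)
      fold tr i with tr i
      ... | inj₁ (eq e) = inj₁ e
      ... | inj₂ (j , eq e) = inj₂ (j , e)
      isPair : ∀ {h ρ p} → Justified h ρ p → p ≋ ⟨ fst p , snd p ⟩
      isPair (inj₁ r) = r ◂ ⟨⟩-cong (≋-sym fst-⟨⟩ ◂ fst-cong (≋-sym r)) (≋-sym snd-⟨⟩ ◂ snd-cong (≋-sym r))
      isPair (inj₂ (_ , r)) = r ◂ ⟨⟩-cong (≋-sym fst-⟨⟩ ◂ fst-cong (≋-sym r)) (≋-sym snd-⟨⟩ ◂ snd-cong (≋-sym r))
      -- Uniqueness: by induction on `m`, every justified `h` agrees with the true iterates.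
      -- Existence is witnessed by `hist`, the record of the iterates up to `m`.
      sound : ∀ {h ρ} → V h → AllV ρ → (∀ i → Justified h ρ (h ▹ i)) → ∀ m {w} i → ⟨ num m , w ⟩ ≋ h ▹ i → w ≋ seq ρ m
      sound′ : ∀ {h ρ} → V h → AllV ρ → (∀ i → Justified h ρ (h ▹ i)) → ∀ m {w} {p} → ⟨ num m , w ⟩ ≋ p → Justified h ρ p → w ≋ seq ρ m
      sound vh v tr m i e = sound′ vh v tr m e (tr i)
      sound′ vh v tr zero e (inj₁ q) = ⟨⟩-injʳ (e ◂ q)
      sound′ vh v tr (suc m) e (inj₁ q) = ⊥-elim (suc-≢∅ (⟨⟩-injˡ (e ◂ q)))
      sound′ vh v tr zero e (inj₂ (j , q)) = ⊥-elim (suc-≢∅ (≋-sym (⟨⟩-injˡ (e ◂ q))))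
      sound′ {h} {ρ} vh v tr (suc m) e (inj₂ (j , q)) =
        ⟨⟩-injʳ (e ◂ q) ◂ ev-cong g (V-≋ (≋-sym ih) (V-seq ρ v m) ∷ᵛ v) (V-seq ρ v m ∷ᵛ v) (∷-≋ ih)
        where
        ih : snd (h ▹ j) ≋ seq ρ m
        ih = sound vh v tr m j (≋-sym (isPair {h} {ρ} (tr j) ◂ ⟨⟩-cong (succ-inj (≋-sym (⟨⟩-injˡ (e ◂ q)))) ≋-refl))
      hist : E n → ℕ → 𝕍 ℓ
      hist ρ zero = ins ⟨ ∅ , ev a ρ ⟩ ∅
      hist ρ (suc m) = ins ⟨ num (suc m) , seq ρ (suc m) ⟩ (hist ρ m)
      V-hist : ∀ ρ → AllV ρ → ∀ m → V (hist ρ m)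
      V-hist ρ v zero = let p = V-⟨⟩ V-∅ (closed a ρ v) in V-⋃ (V-⟦⟧ V-∅ (V-⟦⟧ p p))
      V-hist ρ v (suc m) = let p = V-⟨⟩ (V-num (suc m)) (V-seq ρ v (suc m)) in V-⋃ (V-⟦⟧ (V-hist ρ v m) (V-⟦⟧ p p))
      top : ∀ ρ m → ⟨ num m , seq ρ m ⟩ ∊ hist ρ m
      top ρ zero = ins-∊ˡ ≋-refl
      top ρ (suc m) = ins-∊ˡ ≋-refl
      Just : E n → 𝕍 ℓ → 𝕍 ℓ → Set ℓ
      Just ρ h p = p ≋ ⟨ ∅ , ev a ρ ⟩ ⊎ (Σ[ m ∈ ℕ ] ⟨ num m , seq ρ m ⟩ ∊ h × p ≋ ⟨ num (suc m) , seq ρ (suc m) ⟩)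
      justified : ∀ ρ m {p} → p ∊ hist ρ m → Just ρ (hist ρ m) p
      justified ρ zero {p} m with ∊-ins ⟨ ∅ , ev a ρ ⟩ ∅ m
      ... | inj₁ e = inj₁ e
      ... | inj₂ q = ⊥-elim (∉∅ q)
      justified ρ (suc k) m with ∊-ins ⟨ num (suc k) , seq ρ (suc k) ⟩ (hist ρ k) m
      ... | inj₁ e = inj₂ (k , ins-∊ʳ (top ρ k) , e)
      ... | inj₂ q with justified ρ k q
      ...   | inj₁ e = inj₁ e
      ...   | inj₂ (j , r , e) = inj₂ (j , ins-∊ʳ r , e)
      complete : ∀ ρ → AllV ρ → ∀ m {p} → Just ρ (hist ρ m) p → Justified (hist ρ m) ρ p
      complete ρ v m (inj₁ e) = inj₁ e
      complete ρ v m (inj₂ (k , r , e)) = let (j , q) = ∊-idx r ; e′ = ≋-sym snd-⟨⟩ ◂ snd-cong q in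
        inj₂ (j , (e ◂ ⟨⟩-cong (succ-cong (≋-sym fst-⟨⟩ ◂ fst-cong q))
          (ev-cong g (V-seq ρ v k ∷ᵛ v) (V-≋ e′ (V-seq ρ v k) ∷ᵛ v) (∷-≋ e′))))
      Recorded : 𝕍 ℓ → E n → Set (lsuc ℓ)
      Recorded y ρ = Σ[ h ∈ 𝕍 ℓ ] V h × ↑ (holds (trace ∧ᵗ (⟨ wkT (wkT k) , #1 ⟩ᵗ ∈ᵗ #0)) (h ∷ y ∷ ρ))
      Value : 𝕍 ℓ → E n → Set (lsuc ℓ)
      Value y ρ = (↑ (ev k ρ ∈ ω) × Recorded y ρ) ⊎ ↑ ((¬ ev k ρ ∈ ω) × y ≈ ev a ρ)
      to : ∀ y ρ → AllV ρ → Value y ρ → ↑ (y ≈ value ρ)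
      to y ρ v (inj₁ (lift p , h , vh , lift (tr , q))) =
        let (m , e) = ∊-ω {z = ev k ρ} (mem p) ; (i , r) = ∊-idx {z = ⟨ ev k ρ , y ⟩} {h} (mem q) in
        lift (un≋ (sound {h} {ρ} vh v (unfold {h} {y} {ρ} tr) m i (⟨⟩-cong (≋-sym e) ≋-refl ◂ r) ◂
          ≡⇒≋ (cong (seq ρ) (≡-sym (natOf-num e)))))
      to y ρ v (inj₂ (lift (p , e))) = lift (un≋ (eq {x = y} {ev a ρ} e ◂ ≡⇒≋ (cong (seq ρ) (≡-sym (natOf-no (p ∘ un∊))))))
      from : ∀ y ρ → AllV ρ → Dec (ev k ρ ∈ ω) → y ≋ value ρ → Value y ρ
      from y ρ v (no p) e = inj₂ (lift (p , un≋ (e ◂ ≡⇒≋ (cong (seq ρ) (natOf-no (p ∘ un∊))))))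
      from y ρ v (yes p) e = let (m , q) = ∊-ω {z = ev k ρ} (mem p) in
        inj₁ (lift p , hist ρ m , V-hist ρ v m ,
          lift (fold {hist ρ m} {y} {ρ} (λ i → complete ρ v m (justified ρ m (▹-∊ (hist ρ m) i))) ,
            un∊ {x = ⟨ ev k ρ , y ⟩} {hist ρ m}
              (∊-respˡ (⟨⟩-cong (≋-sym q) (≋-sym (e ◂ ≡⇒≋ (cong (seq ρ) (natOf-num q))))) (top ρ m))))
      def : Def (λ ρ → ↑ (Vec.head ρ ≈ value (Vec.tail ρ)))
      def = Def-ext (Def-∨ (Def-∧ (isDef (wkT k ∈ᵗ ωᵗ)) (Def-∃ (isDef (trace ∧ᵗ (⟨ wkT (wkT k) , #1 ⟩ᵗ ∈ᵗ #0)))))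
                           (isDef ((¬ᵗ (wkT k ∈ᵗ ωᵗ)) ∧ᵗ (#0 ≈ᵗ wkT a))))
        λ { (y ∷ ρ) v → to y ρ (v ∘ fsuc) , λ (lift e) → from y ρ (v ∘ fsuc) (em₀ _) (eq e) }

  ∊-sepᵗ : ∀ {n} (t : Tm n) (φ : Fm (suc n)) {ρ z} → AllV ρ → z ∊ ev (sepᵗ t φ) ρ → z ∊ ev t ρ × holds φ (z ∷ ρ)
  ∊-sepᵗ t φ {ρ} {z} v (mem ((i , p) , e)) = let e′ = eq {x = z} {ev t ρ ▹ i} e ; vi = V-▹ (closed t ρ v) i in
    ∊-▹ i e′ , holds-resp φ {ev t ρ ▹ i ∷ ρ} {z ∷ ρ} (vi ∷ᵛ v) (V-≋ (≋-sym e′) vi ∷ᵛ v) (∷-≋ (≋-sym e′)) p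

  sepᵗ-∊ : ∀ {n} (t : Tm n) (φ : Fm (suc n)) {ρ z} → AllV ρ → z ∊ ev t ρ → holds φ (z ∷ ρ) → z ∊ ev (sepᵗ t φ) ρ
  sepᵗ-∊ t φ {ρ} {z} v m p = let (i , e) = ∊-idx m ; vi = V-▹ (closed t ρ v) i in
    ∊-▹ {x = ev (sepᵗ t φ) ρ} (i , holds-resp φ {z ∷ ρ} {ev t ρ ▹ i ∷ ρ} (V-≋ (≋-sym e) vi ∷ᵛ v) (vi ∷ᵛ v) (∷-≋ e) p) e

  ∊-imgᵗ : ∀ {n} (t : Tm n) (u : Tm (suc n)) {ρ z} → z ∊ ev (imgᵗ t u) ρ → Σ[ y ∈ 𝕍 ℓ ] y ∊ ev t ρ × z ≋ ev u (y ∷ ρ)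
  ∊-imgᵗ t u {ρ} m = let (i , e) = ∊-sup m in ev t ρ ▹ i , ▹-∊ (ev t ρ) i , e

  imgᵗ-∊ : ∀ {n} (t : Tm n) (u : Tm (suc n)) {ρ y z} → AllV ρ → y ∊ ev t ρ → z ≋ ev u (y ∷ ρ) → z ∊ ev (imgᵗ t u) ρ
  imgᵗ-∊ t u {ρ} {y} v m e = let (i , p) = ∊-idx m ; vi = V-▹ (closed t ρ v) i in
    sup-∊ {f = λ i → ev u (ev t ρ ▹ i ∷ ρ)} i (e ◂ ev-cong u {y ∷ ρ} {ev t ρ ▹ i ∷ ρ} (V-≋ (≋-sym p) vi ∷ᵛ v) (vi ∷ᵛ v) (∷-≋ p))

  graphᵗ : ∀ {n} → Tm n → Tm (suc n) → Tm n
  graphᵗ t u = imgᵗ t ⟨ #0 , u ⟩ᵗ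

  abstract
    V-power : ∀ x → V x → Σ[ p ∈ 𝕍 ℓ ] V p × (∀ z → z ∊ p → z ⊑ x) × (∀ z → V z → z ⊑ x → z ∊ p)
    V-power x vx with ∃V (power x vx)
    ... | p , vp , h = p , vp ,
      (λ z m y → mem (proj₁ (h z (V-∊ vp m)) (un∊ m) _ (V-∊ (V-∊ vp m) y) (un∊ y))) ,
      (λ z vz s → mem (proj₂ (h z vz) λ w vw m → un∊ (s (mem m))))

  classFm : ∀ {n} {K : Class ℓ} → IsClassOf V K → Tm n → Fm n
  classFm {n} {K} (m , φ , ps , vs , h) t = mkFm (λ ρ → Squash (K (ev t ρ))) def
    where abstract
    def : Def (λ ρ → ↑ (Squash (K (ev t ρ))))
    def = Def-let {P = λ ρ → ↑ (Squash (K (Vec.head ρ)))}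
      (Def-wkn (Def-ext (mkDef {1} {λ ρ → K (Vec.head ρ)} ps (All⇒AllV vs) φ λ { (x ∷ []) v →
          (λ k → proj₂ (proj₁ (h x) k)) , λ p → proj₂ (h x) (v fzero , p) })
        λ _ _ → (λ k → lift (squash k)) , λ (lift s) → unsquash s)) t
      where
      Def-wkn : ∀ {m} {P : E 1 → Set (lsuc ℓ)} → Def P → Def {suc m} (λ ρ → P (Vec.head ρ ∷ []))
      Def-wkn = Def-ren (λ ρ → Vec.head ρ ∷ []) (λ _ → fzero) λ { (x ∷ ρ) fzero → refl }

-- An injective sequence in `X`, chosen inside `V`.

module Sequence {ℓ : Level} (em : ExcludedMiddle (lsuc ℓ)) (V : Class ℓ) (zfc : TransitiveModelOfZFC V)
    (X : 𝕍 ℓ) (VX : V X) (infinite : Infinite X) where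

  open Definability em V zfc public
  open TransitiveModelOfZFC zfc

  choose : 𝕍 ℓ → 𝕍 ℓ → 𝕍 ℓ
  choose c A = ⋃ (sep A λ x → ⟨ A , x ⟩ ∈ c)

  chooseᵗ : ∀ {n} {c} → V c → Tm n → Tm n
  chooseᵗ {c = c} vc t = ⋃ᵗ (sepᵗ t (⟨ wkT t , #0 ⟩ᵗ ∈ᵗ cst c vc))

  -- The axiom of choice selects from pairwise disjoint sets only; a subset `A` of `X` is therefore
  -- replaced by `tagged A`, the product of the singleton of `A` with `A`.
  choice-function : Σ[ c ∈ 𝕍 ℓ ] V c × (∀ A → V A → A ⊑ X → ∀ x → x ∊ A → choose c A ∊ A)
  choice-function = proj₁ spec , proj₁ (proj₂ spec) , chosen
    where
    P = proj₁ (V-power X VX)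
    vP = proj₁ (proj₂ (V-power X VX))
    -- The inner formula says that some element equals itself, which discards the empty subset.
    fam : Tm 0
    fam = imgᵗ (sepᵗ (cst P vP) (∃ᵗ #0 (#0 ≈ᵗ #0))) (imgᵗ #0 ⟨ #1 , #0 ⟩ᵗ)
    tagged : 𝕍 ℓ → 𝕍 ℓ
    tagged A = sup (idx A) λ j → ⟨ A , A ▹ j ⟩
    F = ev fam []
    tagged-cong : ∀ {A B} → A ≋ B → tagged A ⊑ tagged B
    tagged-cong {A} {B} e m = let (j , p) = ∊-sup m ; (k , q) = ∊-idx {x = B} (∊-respʳ e (▹-∊ A j)) in
      sup-∊ k (p ◂ ⟨⟩-cong e q)
    F-elim : ∀ {a} → a ∊ F → Σ[ A ∈ 𝕍 ℓ ] Σ[ j ∈ idx A ] a ≋ tagged A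
    F-elim m = let ((i , (j , _)) , e) = ∊-sup m in P ▹ i , j , e
    inhabited : ∀ x → V x → x ∈ F → ∃[ y ∈ᶜ V ] ↑ (y ∈ x)
    inhabited x vx m = let (A , j , e) = F-elim {x} (mem m) ; p = ∊-respʳ (≋-sym e) (sup-∊ j ≋-refl) in
      ∃ᶜ-intro ⟨ A , A ▹ j ⟩ (V-∊ vx p) (lift (un∊ p))
    disjoint : ∀ x y → V x → V y → x ∈ F → y ∈ F → (∃[ z ∈ᶜ V ] ↑ (z ∈ x × z ∈ y)) → x ≈ y
    disjoint x y vx vy mx my h with ∃V h
    ... | z , vz , lift (p , q) = un≋ (go (F-elim (mem mx)) (F-elim (mem my)) (mem p) (mem q))
      where
      go : (Σ[ A ∈ 𝕍 ℓ ] Σ[ j ∈ idx A ] x ≋ tagged A) → (Σ[ B ∈ 𝕍 ℓ ] Σ[ j ∈ idx B ] y ≋ tagged B) →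
           z ∊ x → z ∊ y → x ≋ y
      go (A , _ , e) (B , _ , e′) p q =
        let (_ , r) = ∊-sup (∊-respʳ e p) ; (_ , r′) = ∊-sup (∊-respʳ e′ q) ; A≋B = ⟨⟩-injˡ (≋-sym r ◂ r′) in
        e ◂ ext (tagged-cong A≋B) (tagged-cong (≋-sym A≋B)) ◂ ≋-sym e′
    spec = ∃V (choice F (closed fam [] []ᵛ) inhabited disjoint)
    c = proj₁ spec
    vc = proj₁ (proj₂ spec)
    h = proj₂ (proj₂ spec)
    chosen : ∀ A → V A → A ⊑ X → ∀ x → x ∊ A → choose c A ∊ A
    chosen A vA sub x xA = ∊-respˡ (≋-sym unique) y∊A
      where
      A∊P = ∊-idx (proj₂ (proj₂ (proj₂ (V-power X VX))) A vA sub)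
      i = proj₁ A∊P
      A≋ = proj₂ A∊P
      a₀ = tagged (P ▹ i)
      a₀∊F : a₀ ∊ F
      a₀∊F = let (k , _) = ∊-idx (∊-respʳ A≋ xA) in sup-∊ (i , (k , ≈-refl _)) ≋-refl
      pt = ∃V (h a₀ (V-∊ (closed fam [] []ᵛ) a₀∊F) (un∊ a₀∊F))
      p₀ = proj₁ pt
      p₀∊ : p₀ ∊ a₀
      p₀∊ = mem (proj₁ (lower (proj₁ (proj₂ (proj₂ pt)))))
      p₀∊c : p₀ ∊ c
      p₀∊c = mem (proj₂ (lower (proj₁ (proj₂ (proj₂ pt)))))
      k₀ = proj₁ (∊-sup p₀∊)
      y = (P ▹ i) ▹ k₀
      p₀≋ : p₀ ≋ ⟨ P ▹ i , y ⟩
      p₀≋ = proj₂ (∊-sup p₀∊)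
      y∊A : y ∊ A
      y∊A = ∊-respʳ (≋-sym A≋) (▹-∊ (P ▹ i) k₀)
      S : 𝕍 ℓ → Set ℓ
      S w = ⟨ A , w ⟩ ∈ c
      yS : ⟨ A , y ⟩ ∊ c
      yS = ∊-respˡ (p₀≋ ◂ ⟨⟩-cong (≋-sym A≋) ≋-refl) p₀∊c
      only : ∀ {w} → w ∊ A → ⟨ A , w ⟩ ∊ c → w ≋ y
      only {w} wA wc = let (l , q) = ∊-idx (∊-respʳ A≋ wA) ; m = sup-∊ l (⟨⟩-cong A≋ q) in
        ⟨⟩-injʳ (eq {x = ⟨ A , w ⟩} {p₀} (proj₂ (proj₂ (proj₂ pt)) ⟨ A , w ⟩ (V-∊ vc wc) (lift (un∊ m , un∊ wc))) ◂ p₀≋)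
      unique : ⋃ (sep A S) ≋ y
      unique = ext
        (λ m → let (w , p , q) = ∊-⋃ (sep A S) m ; (r , s) = ∊-sep A S (graph-resp A c) p in ∊-respʳ (only r (mem s)) q)
        (⋃-∊ (sep-∊ S (graph-resp A c) y∊A (un∊ yS)))

  private
    cX = proj₁ choice-function
    vcX = proj₁ (proj₂ choice-function)

  opaque
    next : 𝕍 ℓ → 𝕍 ℓ
    next A = choose cX (X ∖ A)

    ev-nextᵗ : ∀ {n} (t : Tm n) ρ → ev (chooseᵗ vcX (cst X VX ∖ᵗ t)) ρ ≡ next (ev t ρ)
    ev-nextᵗ t ρ = refl

    next-spec : ∀ A → V A → ∀ x → x ∊ X → ¬ x ∊ A → next A ∊ X × ¬ next A ∊ A
    next-spec A vA x xX xA = let m = proj₂ (proj₂ choice-function) (X ∖ A) (closed (#0 ∖ᵗ #1) (X ∷ A ∷ []) (VX ∷ᵛ vA ∷ᵛ []ᵛ))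
                                     (λ q → proj₁ (∊-sep X N r q)) x (sep-∊ N r xX (xA ∘ mem))
                                 (p , q) = ∊-sep X N r m in p , λ s → q (un∊ s)
      where
      N : 𝕍 ℓ → Set ℓ
      N z = ¬ z ∈ A
      r : Resp N
      r e n m = n (un∊ (∊-respˡ (≋-sym e) (mem {y = A} m)))

  nextᵗ : ∀ {n} → Tm n → Tm n
  nextᵗ t = sealᵗ (chooseᵗ vcX (cst X VX ∖ᵗ t)) (λ ρ → next (ev t ρ)) (ev-nextᵗ t)

  -- Stage m is the pair of { xs 0 , … , xs (m - 1) } and the tuple
  -- ( xs (m - 1) , … , xs 0 ).
  stageStepᵗ : ∀ {n} → Tm (suc n)
  stageStepᵗ = ⟨ insᵗ (nextᵗ (fstᵗ #0)) (fstᵗ #0) , ⟨ nextᵗ (fstᵗ #0) , sndᵗ #0 ⟩ᵗ ⟩ᵗ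

  opaque
    stage : ℕ → 𝕍 ℓ
    stage = iter (λ w → ⟨ ins (next (fst w)) (fst w) , ⟨ next (fst w) , snd w ⟩ ⟩) ⟨ ∅ , ∅ ⟩

    ev-stageᵗ : ∀ {n} (t : Tm n) ρ → ev (iterᵗ ⟨ ∅ᵗ , ∅ᵗ ⟩ᵗ stageStepᵗ t) ρ ≡ stage (natOf (ev t ρ))
    ev-stageᵗ t ρ = refl

    stage-suc : ∀ m → stage (suc m) ≡ ⟨ ins (next (fst (stage m))) (fst (stage m)) , ⟨ next (fst (stage m)) , snd (stage m) ⟩ ⟩
    stage-suc m = refl

    stage-zero : stage 0 ≡ ⟨ ∅ , ∅ ⟩
    stage-zero = refl

  stageᵗ : ∀ {n} → Tm n → Tm n
  stageᵗ t = sealᵗ (iterᵗ ⟨ ∅ᵗ , ∅ᵗ ⟩ᵗ stageStepᵗ t) (λ ρ → stage (natOf (ev t ρ))) (ev-stageᵗ t)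

  xs : ℕ → 𝕍 ℓ
  xs m = next (fst (stage m))

  xsᵗ : ∀ {n} → Tm n → Tm n
  xsᵗ t = nextᵗ (fstᵗ (stageᵗ t))

  prevs : (m : ℕ) → Vec (𝕍 ℓ) m
  prevs zero = []
  prevs (suc m) = xs m ∷ prevs m

  prevsᵗ : ∀ {n} → Tm n → Tm n
  prevsᵗ t = sndᵗ (stageᵗ t)

  prevs-tup : ∀ m → snd (stage m) ≋ tup (prevs m)
  prevs-tup zero = snd-cong (≡⇒≋ stage-zero) ◂ snd-⟨⟩
  prevs-tup (suc m) = snd-cong (≡⇒≋ (stage-suc m)) ◂ snd-⟨⟩ ◂ ⟨⟩-cong ≋-refl (prevs-tup m)

  fst-stage-suc : ∀ m → fst (stage (suc m)) ≋ ins (xs m) (fst (stage m))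
  fst-stage-suc m = fst-cong (≡⇒≋ (stage-suc m)) ◂ fst-⟨⟩

  ∊-stage : ∀ m {z} → z ∊ fst (stage m) → Σ[ k ∈ ℕ ] k ℕ.< m × z ≋ xs k
  ∊-stage zero p = ⊥-elim (∉∅ (∊-respʳ (fst-cong (≡⇒≋ stage-zero) ◂ fst-⟨⟩) p))
  ∊-stage (suc m) p with ∊-ins (xs m) (fst (stage m)) (∊-respʳ (fst-stage-suc m) p)
  ... | inj₁ e = m , ℕₚ.n<1+n m , e
  ... | inj₂ q = let (k , lt , e) = ∊-stage m q in k , ℕₚ.m<n⇒m<1+n lt , e

  stage-∊ : ∀ {m k} → k ℕ.< m → xs k ∊ fst (stage m)
  stage-∊ {suc m} (s≤s le) with ℕₚ.m≤n⇒m<n∨m≡n le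
  ... | inj₁ lt = ∊-respʳ (≋-sym (fst-stage-suc m)) (ins-∊ʳ (stage-∊ lt))
  ... | inj₂ refl = ∊-respʳ (≋-sym (fst-stage-suc m)) (ins-∊ˡ ≋-refl)

  V-stage : ∀ m → V (stage m)
  V-stage m = subst (V ∘ stage) (natOf-num ≋-refl) (closed (stageᵗ (cst (num m) (V-num m))) [] []ᵛ)

  fresh : ∀ m → (∀ k → k ℕ.< m → xs k ∊ X) → (∀ k l → k ℕ.< l → l ℕ.< m → ¬ xs k ≋ xs l) → Σ[ x ∈ 𝕍 ℓ ] x ∊ X × ¬ x ∊ fst (stage m)
  fresh m inX distinct = stable λ h → infinite (m , e , e-inj , λ k → e-onto k (stable₀ λ n → h (X ▹ k , ▹-∊ X k , n)))
    where
    e : Fin m → idx X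
    e k = proj₁ (∊-idx (inX (toℕ k) (Finₚ.toℕ<n k)))
    e≋ : ∀ k → xs (toℕ k) ≋ X ▹ e k
    e≋ k = proj₂ (∊-idx (inX (toℕ k) (Finₚ.toℕ<n k)))
    e-inj : ∀ i j → X ▹ e i ≈ X ▹ e j → i ≡ j
    e-inj i j q with ℕₚ.<-cmp (toℕ i) (toℕ j)
    ... | tri< lt _ _ = ⊥-elim (distinct _ _ lt (Finₚ.toℕ<n j) (e≋ i ◂ eq q ◂ ≋-sym (e≋ j)))
    ... | tri≈ _ p _ = Finₚ.toℕ-injective p
    ... | tri> _ _ gt = ⊥-elim (distinct _ _ gt (Finₚ.toℕ<n i) (e≋ j ◂ ≋-sym (eq q) ◂ ≋-sym (e≋ i)))
    e-onto : ∀ k → X ▹ k ∊ fst (stage m) → Σ[ i ∈ Fin m ] X ▹ k ≈ X ▹ e i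
    e-onto k p = let (j , lt , q) = ∊-stage m p in Fin.fromℕ< lt ,
      un≋ (q ◂ ≡⇒≋ (cong xs (≡-sym (Finₚ.toℕ-fromℕ< lt))) ◂ e≋ (Fin.fromℕ< lt))

  xs-upto : ∀ m → (∀ k → k ℕ.< m → xs k ∊ X) × (∀ k l → k ℕ.< l → l ℕ.< m → ¬ xs k ≋ xs l)
  xs-upto zero = (λ _ ()) , λ _ _ _ ()
  xs-upto (suc m) =
    let (inX , distinct) = xs-upto m
        (x , xX , x∉) = fresh m inX distinct
        (p , q) = next-spec (fst (stage m)) (closed (fstᵗ #0) (stage m ∷ []) (V-stage m ∷ᵛ []ᵛ)) x xX x∉
    in (λ k lt → case ℕₚ.m≤n⇒m<n∨m≡n (ℕₚ.≤-pred lt) of λ { (inj₁ l) → inX k l ; (inj₂ refl) → p }) ,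
       (λ k l kl lm e → case ℕₚ.m≤n⇒m<n∨m≡n (ℕₚ.≤-pred lm) of λ
         { (inj₁ l′) → distinct k l kl l′ e ; (inj₂ refl) → q (∊-respˡ e (stage-∊ kl)) })

  xs-∊ : ∀ m → xs m ∊ X
  xs-∊ m = proj₁ (xs-upto (suc m)) m (ℕₚ.n<1+n m)

  xs-inj : ∀ k l → xs k ≋ xs l → k ≡ l
  xs-inj k l e with ℕₚ.<-cmp k l
  ... | tri< lt _ _ = ⊥-elim (proj₂ (xs-upto (suc l)) k l lt (ℕₚ.n<1+n l) e)
  ... | tri≈ _ p _ = p
  ... | tri> _ _ gt = ⊥-elim (proj₂ (xs-upto (suc k)) l k gt (ℕₚ.n<1+n k) (≋-sym e))

  xi : ℕ → idx X
  xi m = proj₁ (∊-idx (xs-∊ m))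

  xi-≋ : ∀ m → X ▹ xi m ≋ xs m
  xi-≋ m = ≋-sym (proj₂ (∊-idx (xs-∊ m)))

  prevs-lookup : ∀ m (l : Fin m) → lookup (prevs m) l ≡ xs (m ℕ.∸ suc (toℕ l))
  prevs-lookup (suc m) fzero = refl
  prevs-lookup (suc m) (fsuc l) = prevs-lookup m l

-- Enumeration of the patterns.

-- A machine that runs through all lists of naturals: reading a ∷ t as the
-- number 2 ^ a * (1 + 2 * t), it computes successors, the first component
-- being the length of the carry.

step : ℕ × List ℕ → ℕ × List ℕ
step (c , [])        = 0 , c ∷ []
step (c , zero ∷ t)  = suc c , t
step (c , suc a ∷ t) = 0 , c ∷ a ∷ t

machine : ℕ → ℕ × List ℕ
machine = iter step (0 , [])

Bounded : ℕ → ℕ × List ℕ → Set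
Bounded n (c , t) = c ℕ.≤ n × All (ℕ._≤ n) t

step-bounded : ∀ {n} s → Bounded n s → Bounded (suc n) (step s)
step-bounded (c , []) (p , _) = z≤n , ℕₚ.m≤n⇒m≤1+n p All.∷ All.[]
step-bounded (c , zero ∷ t) (p , _ All.∷ q) = s≤s p , All.map ℕₚ.m≤n⇒m≤1+n q
step-bounded (c , suc a ∷ t) (p , r All.∷ q) =
  z≤n , ℕₚ.m≤n⇒m≤1+n p All.∷ ℕₚ.≤-trans (ℕₚ.n≤1+n a) (ℕₚ.m≤n⇒m≤1+n r) All.∷ All.map ℕₚ.m≤n⇒m≤1+n q

-- This keeps the entries of the `i`-th pattern at most `i`, so that they select among `x_c` and the
-- `i` parameters.
machine-bounded : ∀ n → Bounded n (machine n)
machine-bounded zero = z≤n , All.[]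
machine-bounded (suc n) = step-bounded (machine n) (machine-bounded n)

Reached : ℕ × List ℕ → Set
Reached s = Σ[ n ∈ ℕ ] machine n ≡ s

reached-step : ∀ {s} → Reached s → Reached (step s)
reached-step (n , refl) = suc n , refl

zeros : ℕ → List ℕ → List ℕ
zeros zero w = w
zeros (suc c) w = zero ∷ zeros c w

reached-zeros : ∀ b c w → Reached (b , zeros c w) → Reached (b ℕ.+ c , w)
reached-zeros b zero w r = subst (λ d → Reached (d , w)) (≡-sym (ℕₚ.+-identityʳ b)) r
reached-zeros b (suc c) w r = subst (λ d → Reached (d , w)) (≡-sym (ℕₚ.+-suc b c)) (reached-zeros (suc b) c w (reached-step r))

double : ℕ → ℕ
double m = m ℕ.+ m

listVal : List ℕ → ℕ
listVal [] = 0
listVal (a ∷ t) = iter double (suc (double (listVal t))) a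

borrow : List ℕ → List ℕ
borrow [] = []
borrow (a ∷ t) = suc a ∷ t

listVal-∷ : ∀ c t → listVal (c ∷ t) ≡ suc (listVal (zeros c (borrow t)))
listVal-∷ zero [] = refl
listVal-∷ zero (a ∷ t) = refl
listVal-∷ (suc c) t = ≡-trans (cong double (listVal-∷ c t)) (cong suc (ℕₚ.+-suc _ _))

-- Induction on the number coded by the list. The predecessor of `c ∷ t` is `zeros c (borrow t)`;
-- from there the machine absorbs the `c` zeros as carry and then writes `c` in front.
reached : ∀ t → Reached (0 , t)
reached t = go (listVal t) t refl
  where
  go : ∀ n t → listVal t ≡ n → Reached (0 , t)
  go n [] e = 0 , refl
  go zero (c ∷ t) e = case ≡-trans (≡-sym (listVal-∷ c t)) e of λ ()
  go (suc n) (c ∷ t) e = last t (reached-zeros 0 c (borrow t)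
    (go n (zeros c (borrow t)) (ℕₚ.suc-injective (≡-trans (≡-sym (listVal-∷ c t)) e))))
    where
    last : ∀ t → Reached (c , borrow t) → Reached (0 , c ∷ t)
    last [] r = reached-step r
    last (a ∷ t) r = reached-step r

hd : List ℕ → ℕ
hd [] = 0
hd (a ∷ t) = a

tl : List ℕ → List ℕ
tl [] = []
tl (a ∷ t) = t

hd-≤ : ∀ {n} t → All (ℕ._≤ n) t → hd t ℕ.≤ n
hd-≤ [] _ = z≤n
hd-≤ (a ∷ t) (p All.∷ _) = p

tl-≤ : ∀ {n} t → All (ℕ._≤ n) t → All (ℕ._≤ n) (tl t)
tl-≤ [] q = q
tl-≤ (a ∷ t) (_ All.∷ q) = q

-- The first entry of the list is discarded, so that every pattern occurs
-- for arbitrarily large i.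
patternList : ℕ → List ℕ
patternList i = tl (proj₂ (machine i))

entry : ℕ → ℕ → ℕ
entry i r = hd (iter tl (patternList i) r)

entry-≤ : ∀ i r → entry i r ℕ.≤ i
entry-≤ i r = hd-≤ (iter tl (patternList i) r) (go r)
  where
  go : ∀ r → All (ℕ._≤ i) (iter tl (patternList i) r)
  go zero = tl-≤ (proj₂ (machine i)) (proj₂ (machine-bounded i))
  go (suc r) = tl-≤ (iter tl (patternList i) r) (go r)

pat : (i r : ℕ) → Vec (Fin (suc i)) r
pat i zero = []
pat i (suc r) = Fin.fromℕ< (s≤s (entry-≤ i r)) ∷ pat i r

revList : ∀ {r} → Vec ℕ r → List ℕ → List ℕ
revList [] t = t
revList (a ∷ v) t = revList v (a ∷ t)

revEntry : ∀ {r} (v : Vec ℕ r) u k → hd (iter tl (revList v u) (r ℕ.+ k)) ≡ hd (iter tl u k)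
revEntry [] u k = refl
revEntry {suc r} (a ∷ v) u k = ≡-trans (cong (λ m → hd (iter tl (revList v (a ∷ u)) m)) (≡-sym (ℕₚ.+-suc r k)))
  (≡-trans (revEntry v (a ∷ u) (suc k)) (cong hd (iter-tl k)))
  where
  iter-tl : ∀ k → iter tl (a ∷ u) (suc k) ≡ iter tl u k
  iter-tl zero = refl
  iter-tl (suc k) = cong tl (iter-tl k)

-- The entry `n` placed in front forces `n ≤ i` through `machine-bounded`. The rest is reversed
-- because `pat` puts the entry with the largest index first.
pat-onto : ∀ n {r} (v : Vec ℕ r) → Σ[ i ∈ ℕ ] n ℕ.≤ i × map toℕ (pat i r) ≡ v
pat-onto n {r} v with reached (n ∷ revList v [])
... | i , e = i , subst (λ s → hd (proj₂ s) ℕ.≤ i) e (hd-≤ _ (proj₂ (machine-bounded i))) ,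
  go v [] (λ k → cong (λ s → hd (iter tl (tl (proj₂ s)) k)) e)
  where
  go : ∀ {r} (v : Vec ℕ r) u → (∀ k → entry i k ≡ hd (iter tl (revList v u) k)) → map toℕ (pat i r) ≡ v
  go [] u h = refl
  go {suc r} (a ∷ v) u h = cong₂ _∷_
    (≡-trans (Finₚ.toℕ-fromℕ< (s≤s (entry-≤ i r))) (≡-trans (h r)
      (≡-trans (cong (λ m → hd (iter tl (revList v (a ∷ u)) m)) (≡-sym (ℕₚ.+-identityʳ r))) (revEntry v (a ∷ u) 0))))
    (go v (a ∷ u) h)

-- Blocks of indices.

pow2 : ℕ → ℕ
pow2 = iter double 1

-- Values `j` beyond the block go to its first position, so that letting `j` run over all of `κ`
-- hits exactly the block.
blk : ℕ → ℕ → ℕ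
blk q j = ite (j ℕ.<? pow2 q) j 0

-- With q = k + (N + i), the indices index i N k j for N ≠ 0 run through
-- the block { q , … , q + 2 ^ q - 1 }.
index : (i N k j : ℕ) → ℕ
index i zero    k j = k ℕ.+ i
index i (suc N) k j = (k ℕ.+ (suc N ℕ.+ i)) ℕ.+ blk (k ℕ.+ (suc N ℕ.+ i)) j

-- Rational estimates for cuts and sums of powers of 1/2.

module _ {ℓ : Level} where

  ℤ-inj : ∀ {m n : ℤ} → ⌜_⌝ᶻ {ℓ} m ≋ ⌜ n ⌝ᶻ → m ≡ n
  ℤ-inj {+ m} {+ n} e = cong +_ (num-inj (⟨⟩-injʳ e))
  ℤ-inj { -[1+ m ]} { -[1+ n ]} e = cong -[1+_] (num-inj (⟨⟩-injʳ e))
  ℤ-inj {+ m} { -[1+ n ]} e = ⊥-elim (suc-≢∅ (≋-sym (⟨⟩-injˡ e)))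
  ℤ-inj { -[1+ m ]} {+ n} e = ⊥-elim (suc-≢∅ (⟨⟩-injˡ e))

  ℚ-inj : ∀ {p q : ℚ} → ⌜_⌝ᵠ {ℓ} p ≋ ⌜ q ⌝ᵠ → p ≡ q
  ℚ-inj {ℚ.mkℚ m d _} {ℚ.mkℚ n e _} h with ℤ-inj {m} {n} (⟨⟩-injˡ h) | num-inj {m = d} {e} (⟨⟩-injʳ h)
  ... | refl | refl = refl

  infix 15 _∊ᴿ_
  _∊ᴿ_ : ℚ → 𝕍 ℓ → Set ℓ
  p ∊ᴿ r = ⌜ p ⌝ᵠ ∊ r

  ∊-cut : ∀ {p q} → p ∊ᴿ cut q → p ℚ.< q
  ∊-cut {p} {q} m with ∊-sup m
  ... | lift (p′ , lt) , e = subst (ℚ._< q) (≡-sym (ℚ-inj e)) lt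

  cut-∊ : ∀ {p q} → p ℚ.< q → p ∊ᴿ cut q
  cut-∊ {p} lt = sup-∊ (lift (p , lt)) ≋-refl

  ∊-+ : ∀ {p} r s → p ∊ᴿ (r +ᴿ s) → Σ[ a ∈ ℚ ] Σ[ b ∈ ℚ ] a ∊ᴿ r × b ∊ᴿ s × p ≡ a ℚ.+ b
  ∊-+ r s m = let ((a , b , p , q) , e) = ∊-sup m in a , b , mem p , mem q , ℚ-inj e

  +-∊ : ∀ {a b r s} → a ∊ᴿ r → b ∊ᴿ s → (a ℚ.+ b) ∊ᴿ (r +ᴿ s)
  +-∊ {a} {b} p q = sup-∊ (a , b , un∊ p , un∊ q) ≋-refl

sumOver : ∀ {a} {A : Set a} → (A → ℚ) → List A → ℚ
sumOver w = List.foldr (λ i s → w i ℚ.+ s) ℚ.0ℚ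

foldr-≤ : ∀ {ℓ a} {A : Set a} (R : A → 𝕍 ℓ) (w : A → ℚ) → (∀ i p → p ∊ᴿ R i → p ℚ.≤ w i) →
  ∀ is {p} → p ∊ᴿ List.foldr (λ i s → R i +ᴿ s) 0ᴿ is → p ℚ.≤ sumOver w is
foldr-≤ R w h [] m = ℚₚ.<⇒≤ (∊-cut m)
foldr-≤ R w h (i ∷ is) m with ∊-+ (R i) _ m
... | a , b , p , q , refl = ℚₚ.+-mono-≤ (h i a p) (foldr-≤ R w h is q)

halfPow : ℕ → ℚ
halfPow zero = ℚ.1ℚ
halfPow (suc n) = ℚ.½ ℚ.* halfPow n

halve : ∀ p → ℚ.½ ℚ.* p ℚ.+ ℚ.½ ℚ.* p ≡ p
halve p = ≡-trans (≡-sym (ℚₚ.*-distribʳ-+ p ℚ.½ ℚ.½)) (ℚₚ.*-identityˡ p)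

mult : ℕ → ℚ → ℚ
mult zero p = ℚ.0ℚ
mult (suc n) p = p ℚ.+ mult n p

mult-+ : ∀ m n p → mult (m ℕ.+ n) p ≡ mult m p ℚ.+ mult n p
mult-+ zero n p = ≡-sym (ℚₚ.+-identityˡ _)
mult-+ (suc m) n p = ≡-trans (cong (p ℚ.+_) (mult-+ m n p)) (≡-sym (ℚₚ.+-assoc p _ _))

half-mono : ∀ {p q} → p ℚ.+ p ℚ.≤ q → p ℚ.≤ ℚ.½ ℚ.* q
half-mono {p} {q} h = subst (ℚ._≤ ℚ.½ ℚ.* q)
  (≡-trans (ℚₚ.*-distribˡ-+ ℚ.½ p p) (halve p)) (ℚₚ.*-monoˡ-≤-nonNeg ℚ.½ h)

-- Induction on `q`: a factor 2 of the multiplicity is moved into `p`, which becomes `p + p`.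
mult-bound : ∀ q {p} → mult (pow2 q) p ℚ.≤ ℚ.1ℚ → p ℚ.≤ halfPow q
mult-bound zero {p} h = subst (ℚ._≤ ℚ.1ℚ) (ℚₚ.+-identityʳ p) h
mult-bound (suc q) {p} h = half-mono (mult-bound q
  (subst (ℚ._≤ ℚ.1ℚ) (≡-trans (mult-+ (pow2 q) (pow2 q) p) (mult-both (pow2 q))) h))
  where
  mult-both : ∀ m → mult m p ℚ.+ mult m p ≡ mult m (p ℚ.+ p)
  mult-both zero = refl
  mult-both (suc m) = ≡-trans (+-interchange p (mult m p) p (mult m p)) (cong (p ℚ.+ p ℚ.+_) (mult-both m))
    where
    +-interchange : ∀ a b c d → (a ℚ.+ b) ℚ.+ (c ℚ.+ d) ≡ (a ℚ.+ c) ℚ.+ (b ℚ.+ d)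
    +-interchange a b c d = ≡-trans (ℚₚ.+-assoc a b _) (≡-trans (cong (a ℚ.+_)
      (≡-trans (≡-sym (ℚₚ.+-assoc b c d)) (≡-trans (cong (ℚ._+ d) (ℚₚ.+-comm b c)) (ℚₚ.+-assoc c b d))))
      (≡-sym (ℚₚ.+-assoc a c _)))

recip : ℕ → ℚ
recip q = ℚ.mkℚ (+ 1) q (1-coprimeTo (suc q))

halfPow-≤ : ∀ q → halfPow q ℚ.≤ recip q
halfPow-≤ zero = ℚₚ.≤-refl
halfPow-≤ (suc q) = ℚₚ.≤-trans (ℚₚ.*-monoˡ-≤-nonNeg ℚ.½ (halfPow-≤ q))
  (ℚₚ.toℚᵘ-cancel-≤ (ℚᵘₚ.≤-respˡ-≃ (ℚᵘₚ.≃-sym (ℚₚ.toℚᵘ-homo-* ℚ.½ (recip q)))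
    (ℚᵘ.*≤* (ℤ.+≤+ (s≤s (ℕₚ.≤-trans (ℕₚ.≤-reflexive (ℕₚ.+-identityʳ (suc q)))
      (ℕₚ.≤-trans (ℕₚ.m≤n+m (suc q) q) (ℕₚ.≤-reflexive (≡-sym (≡-trans (ℕₚ.+-identityʳ _) (cong (q ℕ.+_) (ℕₚ.+-identityʳ (suc q)))))))))))))

archimedean : ∀ {p} → (∀ q → p ℚ.≤ halfPow q) → p ℚ.≤ ℚ.0ℚ
archimedean {ℚ.mkℚ (+ zero) d c} h = ℚ.*≤* ℤₚ.≤-refl
archimedean {ℚ.mkℚ -[1+ n ] d c} h = ℚ.*≤* ℤ.-≤+
-- A positive `p` with denominator `d + 1` is at least 1 / (d + 1), while the bound for `q = d + 1`
-- is at most 1 / (d + 2).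
archimedean {p@(ℚ.mkℚ (+ suc n) d c)} h with ℚₚ.≤-trans (h (suc d)) (halfPow-≤ (suc d))
... | ℚ.*≤* (ℤ.+≤+ le) = ⊥-elim (ℕₚ.<-irrefl refl (ℕₚ.≤-trans (ℕₚ.≤-trans (ℕₚ.≤-reflexive (≡-sym (ℕₚ.+-identityʳ _))) (ℕₚ.*-monoˡ-≤ (suc (suc d)) (s≤s (z≤n {n})))) (ℕₚ.≤-trans le (ℕₚ.≤-reflexive (ℕₚ.+-identityʳ (suc d))))))

decr : List ℕ → List ℕ
decr [] = []
decr (zero ∷ l) = decr l
decr (suc n ∷ l) = n ∷ decr l

All-decr : ∀ {P Q : ℕ → Set} → (∀ n → P (suc n) → Q n) → ∀ {l} → All P l → All Q (decr l)
All-decr f {[]} All.[] = All.[]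
All-decr f {zero ∷ l} (_ All.∷ ps) = All-decr f ps
All-decr f {suc n ∷ l} (p All.∷ ps) = f n p All.∷ All-decr f ps

Distinct : List ℕ → Set
Distinct = AllPairs _≢_

Distinct-decr : ∀ {l} → Distinct l → Distinct (decr l)
Distinct-decr {[]} AllPairs.[] = AllPairs.[]
Distinct-decr {zero ∷ l} (_ AllPairs.∷ ps) = Distinct-decr ps
Distinct-decr {suc n ∷ l} (p AllPairs.∷ ps) = All-decr (λ m ne e → ne (cong suc e)) p AllPairs.∷ Distinct-decr ps

sum-nonzero : ∀ {l} → All (0 ≢_) l → sumOver halfPow l ≡ ℚ.½ ℚ.* sumOver halfPow (decr l)
sum-nonzero {[]} All.[] = ≡-sym (ℚₚ.*-zeroʳ ℚ.½)
sum-nonzero {zero ∷ l} (p All.∷ ps) = ⊥-elim (p refl)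
sum-nonzero {suc n ∷ l} (p All.∷ ps) = ≡-trans (cong (ℚ.½ ℚ.* halfPow n ℚ.+_) (sum-nonzero ps))
  (≡-sym (ℚₚ.*-distribˡ-+ ℚ.½ (halfPow n) (sumOver halfPow (decr l))))

-- Distinct exponents contain 0 at most once, which contributes 1; lowering the others by one
-- doubles their terms.
sum-decr : ∀ {l} → Distinct l → sumOver halfPow l ℚ.≤ ℚ.1ℚ ℚ.+ ℚ.½ ℚ.* sumOver halfPow (decr l)
sum-decr {[]} AllPairs.[] = ℚ.*≤* (ℤ.+≤+ z≤n)
sum-decr {zero ∷ l} (p AllPairs.∷ ps) = ℚₚ.≤-reflexive (cong (ℚ.1ℚ ℚ.+_) (sum-nonzero p))
sum-decr {suc n ∷ l} (p AllPairs.∷ ps) = ℚₚ.≤-trans (ℚₚ.+-monoʳ-≤ (ℚ.½ ℚ.* halfPow n) (sum-decr ps)) (ℚₚ.≤-reflexive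
  (≡-trans (≡-sym (ℚₚ.+-assoc (ℚ.½ ℚ.* halfPow n) ℚ.1ℚ _)) (≡-trans (cong (ℚ._+ ℚ.½ ℚ.* sumOver halfPow (decr l)) (ℚₚ.+-comm (ℚ.½ ℚ.* halfPow n) ℚ.1ℚ))
    (≡-trans (ℚₚ.+-assoc ℚ.1ℚ (ℚ.½ ℚ.* halfPow n) (ℚ.½ ℚ.* sumOver halfPow (decr l))) (cong (ℚ.1ℚ ℚ.+_) (≡-sym (ℚₚ.*-distribˡ-+ ℚ.½ (halfPow n) _)))))))

2ℚ : ℚ
2ℚ = ℚ.1ℚ ℚ.+ ℚ.1ℚ

-- Induction on a bound for the exponents: s ≤ 1 + s' / 2, where s' ≤ 2 is the sum for the lowered
-- exponents.
sum-≤ : ∀ B {l} → All (ℕ._< B) l → Distinct l → sumOver halfPow l ℚ.≤ 2ℚ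
sum-≤ zero {[]} _ _ = ℚ.*≤* (ℤ.+≤+ z≤n)
sum-≤ zero {x ∷ l} (() All.∷ _) _
sum-≤ (suc B) {l} b d = ℚₚ.≤-trans (sum-decr d) (ℚₚ.+-monoʳ-≤ ℚ.1ℚ
  (ℚₚ.*-monoˡ-≤-nonNeg ℚ.½ (sum-≤ B (All-decr (λ n lt → ℕₚ.≤-pred lt) b) (Distinct-decr d))))

sum-distinct : ∀ {l} → Distinct l → sumOver halfPow l ℚ.≤ 2ℚ
sum-distinct {l} d = sum-≤ (suc (max l)) (below l) d
  where
  max : List ℕ → ℕ
  max = List.foldr ℕ._⊔_ 0
  below : ∀ l → All (ℕ._< suc (max l)) l
  below [] = All.[]
  below (n ∷ l) = s≤s (ℕₚ.m≤m⊔n n (max l)) All.∷ All.map (λ p → ℕₚ.≤-trans p (s≤s (ℕₚ.m≤n⊔m n (max l)))) (below l)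

module _ {a} {A : Set a} (number : A → Maybe ℕ) where

  -- Sums over `κ` are reduced to sums over numbers: an index without a number, such as an element
  -- of `κ` beyond ω, weighs 0.
  weight : A → ℚ
  weight i = maybe′ halfPow ℚ.0ℚ (number i)

  numbers : List A → List ℕ
  numbers [] = []
  numbers (i ∷ is) = maybe′ _∷_ id (number i) (numbers is)

  sum-numbers : ∀ is → sumOver weight is ≡ sumOver halfPow (numbers is)
  sum-numbers [] = refl
  sum-numbers (i ∷ is) with number i
  ... | just n = cong (halfPow n ℚ.+_) (sum-numbers is)
  ... | nothing = ≡-trans (ℚₚ.+-identityˡ _) (sum-numbers is)

  All-numbers : ∀ {P : ℕ → Set} is → All (λ i → ∀ n → number i ≡ just n → P n) is → All P (numbers is)
  All-numbers [] All.[] = All.[]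
  All-numbers (i ∷ is) (p All.∷ ps) with number i
  ... | just n = p n refl All.∷ All-numbers is ps
  ... | nothing = All-numbers is ps

  Distinct-numbers : ∀ is → AllPairs (λ i j → ∀ m n → number i ≡ just m → number j ≡ just n → m ≢ n) is → Distinct (numbers is)
  Distinct-numbers [] AllPairs.[] = AllPairs.[]
  Distinct-numbers (i ∷ is) (p AllPairs.∷ ps) with number i
  ... | just m = All-numbers is (All.map (λ q n e → q m n refl e) p) AllPairs.∷ Distinct-numbers is ps
  ... | nothing = Distinct-numbers is ps

  sum-weight : ∀ is → AllPairs (λ i j → ∀ m n → number i ≡ just m → number j ≡ just n → m ≢ n) is → sumOver weight is ℚ.≤ 2ℚ
  sum-weight is d = ℚₚ.≤-trans (ℚₚ.≤-reflexive (sum-numbers is)) (sum-distinct (Distinct-numbers is d))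

sumOver-* : ∀ {a} {A : Set a} c (w : A → ℚ) is → sumOver (λ i → c ℚ.* w i) is ≡ c ℚ.* sumOver w is
sumOver-* c w [] = ≡-sym (ℚₚ.*-zeroʳ c)
sumOver-* c w (i ∷ is) = ≡-trans (cong (c ℚ.* w i ℚ.+_) (sumOver-* c w is)) (≡-sym (ℚₚ.*-distribˡ-+ c (w i) (sumOver w is)))

sumOver-0 : ∀ {a} {A : Set a} (is : List A) → sumOver (λ _ → ℚ.0ℚ) is ≡ ℚ.0ℚ
sumOver-0 [] = refl
sumOver-0 (i ∷ is) = ≡-trans (ℚₚ.+-identityˡ _) (sumOver-0 is)

halfPow-≥0 : ∀ q → ℚ.0ℚ ℚ.≤ halfPow q
halfPow-≥0 zero = ℚ.*≤* (ℤ.+≤+ z≤n)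
halfPow-≥0 (suc q) = ℚₚ.*-monoˡ-≤-nonNeg ℚ.½ (halfPow-≥0 q)

halfPow-+ : ∀ m n → halfPow (m ℕ.+ n) ≡ halfPow m ℚ.* halfPow n
halfPow-+ zero n = ≡-sym (ℚₚ.*-identityˡ _)
halfPow-+ (suc m) n = ≡-trans (cong (ℚ.½ ℚ.*_) (halfPow-+ m n)) (≡-sym (ℚₚ.*-assoc ℚ.½ (halfPow m) (halfPow n)))

double-half : ∀ q → halfPow (suc q) ℚ.* 2ℚ ≡ halfPow q
double-half q = ≡-trans (ℚₚ.*-comm (ℚ.½ ℚ.* halfPow q) 2ℚ) (≡-trans (≡-sym (ℚₚ.*-assoc 2ℚ ℚ.½ (halfPow q))) (ℚₚ.*-identityˡ (halfPow q)))

halfPow-mono : ∀ m n → halfPow (n ℕ.+ m) ℚ.≤ halfPow m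
halfPow-mono m zero = ℚₚ.≤-refl
halfPow-mono m (suc n) = ℚₚ.≤-trans (halfPow-mono-suc (n ℕ.+ m)) (halfPow-mono m n)
  where
  halfPow-mono-suc : ∀ k → halfPow (suc k) ℚ.≤ halfPow k
  halfPow-mono-suc zero = ℚ.*≤* (ℤ.+≤+ (s≤s z≤n))
  halfPow-mono-suc (suc k) = ℚₚ.*-monoˡ-≤-nonNeg ℚ.½ (halfPow-mono-suc k)

-- Patterns and facts as definable operations.

module Facts {ℓ : Level} (em : ExcludedMiddle (lsuc ℓ)) (V : Class ℓ) (zfc : TransitiveModelOfZFC V)
    (X : 𝕍 ℓ) (VX : V X) (infinite : Infinite X) (L : Language ℓ) (VL : V ⌜ L ⌝ᴸ) where

  open Sequence em V zfc X VX infinite public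

  codeList : List ℕ → 𝕍 ℓ
  codeList [] = ∅
  codeList (a ∷ t) = ⟨ num a , codeList t ⟩

  codeState : ℕ × List ℕ → 𝕍 ℓ
  codeState (c , t) = ⟨ num c , codeList t ⟩

  snd-codeList : ∀ t → snd (codeList t) ≋ codeList (tl t)
  snd-codeList [] = snd-∅
  snd-codeList (a ∷ t) = snd-⟨⟩

  fst-codeList : ∀ t → fst (codeList t) ≋ num (hd t)
  fst-codeList [] = fst-∅
  fst-codeList (a ∷ t) = fst-⟨⟩

  ⋃-num : ∀ a → ⋃ (num (suc a)) ≋ num {ℓ} a
  ⋃-num a = ext
    (λ m → let (y , p , q) = ∊-⋃ (num (suc a)) m ; (k , lt , e) = ∊-num {n = suc a} p ; (j , lt′ , e′) = ∊-num {n = k} (∊-respʳ e q) in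
      ∊-respˡ (≋-sym e′) (num-< (ℕₚ.<-≤-trans lt′ (ℕₚ.≤-pred lt))))
    (⋃-∊ (num-< (ℕₚ.n<1+n a)))

  opaque
    -- The three clauses of `step` on coded states. The union of a nonzero numeral is its
    -- predecessor, by `⋃-num`.
    codeStep : 𝕍 ℓ → 𝕍 ℓ
    codeStep w = ite (em₀ (snd w ≈ ∅)) ⟨ ∅ , ⟨ fst w , ∅ ⟩ ⟩
      (ite (em₀ (fst (snd w) ≈ ∅)) ⟨ succ (fst w) , snd (snd w) ⟩
        ⟨ ∅ , ⟨ fst w , ⟨ ⋃ (fst (snd w)) , snd (snd w) ⟩ ⟩ ⟩)

    codeStep-spec : ∀ w s → w ≋ codeState s → codeStep w ≋ codeState (step s)
    codeStep-spec w (c , []) e = ≡⇒≋ (ite-yes (em₀ (snd w ≈ ∅)) (un≋ (snd-cong e ◂ snd-⟨⟩))) ◂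
      ⟨⟩-cong ≋-refl (⟨⟩-cong (fst-cong e ◂ fst-⟨⟩) ≋-refl)
    codeStep-spec w (c , zero ∷ t) e =
      ≡⇒≋ (ite-no (em₀ (snd w ≈ ∅)) (λ h → ⟨⟩-≢∅ (≋-sym p ◂ eq h))) ◂
      ≡⇒≋ (ite-yes (em₀ (fst (snd w) ≈ ∅)) (un≋ (fst-cong p ◂ fst-⟨⟩))) ◂
      ⟨⟩-cong (succ-cong (fst-cong e ◂ fst-⟨⟩)) (snd-cong p ◂ snd-⟨⟩)
      where
      p : snd w ≋ codeList (zero ∷ t)
      p = snd-cong e ◂ snd-⟨⟩
    codeStep-spec w (c , suc a ∷ t) e =
      ≡⇒≋ (ite-no (em₀ (snd w ≈ ∅)) (λ h → ⟨⟩-≢∅ (≋-sym p ◂ eq h))) ◂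
      ≡⇒≋ (ite-no (em₀ (fst (snd w) ≈ ∅)) (λ h → suc-≢∅ (≋-sym q ◂ eq h))) ◂
      ⟨⟩-cong ≋-refl (⟨⟩-cong (fst-cong e ◂ fst-⟨⟩) (⟨⟩-cong (⋃-cong q ◂ ⋃-num a) (snd-cong p ◂ snd-⟨⟩)))
      where
      p : snd w ≋ codeList (suc a ∷ t)
      p = snd-cong e ◂ snd-⟨⟩
      q : fst (snd w) ≋ num (suc a)
      q = fst-cong p ◂ fst-⟨⟩

    codeStepᵗ : ∀ {n} → Tm n → Tm n
    codeStepᵗ w = iteᵗ (sndᵗ w ≈ᵗ ∅ᵗ) ⟨ ∅ᵗ , ⟨ fstᵗ w , ∅ᵗ ⟩ᵗ ⟩ᵗ
      (iteᵗ (fstᵗ (sndᵗ w) ≈ᵗ ∅ᵗ) ⟨ succᵗ (fstᵗ w) , sndᵗ (sndᵗ w) ⟩ᵗ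
        ⟨ ∅ᵗ , ⟨ fstᵗ w , ⟨ ⋃ᵗ (fstᵗ (sndᵗ w)) , sndᵗ (sndᵗ w) ⟩ᵗ ⟩ᵗ ⟩ᵗ)

  opaque
    codeMachine : ℕ → 𝕍 ℓ
    codeMachine = iter codeStep ⟨ ∅ , ∅ ⟩

    codeMachine-≋ : ∀ n → codeMachine n ≋ codeState (machine n)
    codeMachine-≋ zero = ≋-refl
    codeMachine-≋ (suc n) = codeStep-spec (codeMachine n) (machine n) (codeMachine-≋ n)

  opaque
    unfolding codeMachine codeStepᵗ

    codeMachineᵗ′ : ∀ {n} → Tm n → Tm n
    codeMachineᵗ′ t = iterᵗ ⟨ ∅ᵗ , ∅ᵗ ⟩ᵗ (codeStepᵗ #0) t

    ev-codeMachineᵗ′ : ∀ {n} (t : Tm n) ρ → ev (codeMachineᵗ′ t) ρ ≡ codeMachine (natOf (ev t ρ))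
    ev-codeMachineᵗ′ t ρ = refl

  listᵗ : ∀ {n} → Tm n → Tm n
  listᵗ t = sndᵗ (sndᵗ (sealᵗ (codeMachineᵗ′ t) _ (ev-codeMachineᵗ′ t)))

  codePatternList : ℕ → 𝕍 ℓ
  codePatternList i = snd (snd (codeMachine i))

  codePatternList-≋ : ∀ i → codePatternList i ≋ codeList (patternList i)
  codePatternList-≋ i = snd-cong (snd-cong (codeMachine-≋ i) ◂ snd-⟨⟩) ◂ snd-codeList _

  opaque
    look : 𝕍 ℓ → 𝕍 ℓ → 𝕍 ℓ
    look a p = fst (iter snd a (natOf p))

    lookᵗ : ∀ {n} → Tm n → Tm n → Tm n
    lookᵗ a p = fstᵗ (iterᵗ a (sndᵗ #0) p)

    look-tup : ∀ {m} (a : Vec (𝕍 ℓ) m) {b p} (l : Fin m) → b ≋ tup a → p ≋ num (toℕ l) → look b p ≋ lookup a l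
    look-tup a {b} l e e′ = fst-cong (≡⇒≋ (cong (iter snd b) (natOf-num e′))) ◂ go a l e
      where
      iter-snd : ∀ (b : 𝕍 ℓ) k → iter snd b (suc k) ≡ iter snd (snd b) k
      iter-snd b zero = refl
      iter-snd b (suc k) = cong snd (iter-snd b k)
      go : ∀ {m} (a : Vec (𝕍 ℓ) m) {b} (l : Fin m) → b ≋ tup a → fst (iter snd b (toℕ l)) ≋ lookup a l
      go (x ∷ a) fzero e = fst-cong e ◂ fst-⟨⟩
      go (x ∷ a) {b} (fsuc l) e = ≡⇒≋ (cong fst (iter-snd b (toℕ l))) ◂ go a l (snd-cong e ◂ snd-⟨⟩)

  opaque
    -- The state pairs the unread part of the list with the tuple built so far. Each new entry is
    -- pushed in front, whence the order of the entries in `pat`.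
    patIter : 𝕍 ℓ → ℕ → 𝕍 ℓ
    patIter l = iter (λ w → ⟨ snd (fst w) , ⟨ fst (fst w) , snd w ⟩ ⟩) ⟨ l , ∅ ⟩

    patIter-≋ : ∀ i r → patIter (codePatternList i) r ≋
      ⟨ codeList (iter tl (patternList i) r) , tup (map (λ l → num (toℕ l)) (pat i r)) ⟩
    patIter-≋ i zero = ⟨⟩-cong (codePatternList-≋ i) ≋-refl
    patIter-≋ i (suc r) = let e = patIter-≋ i r ; p = fst-cong e ◂ fst-⟨⟩ in
      ⟨⟩-cong (snd-cong p ◂ snd-codeList _)
        (⟨⟩-cong (fst-cong p ◂ fst-codeList _ ◂ num-≋ (≡-sym (Finₚ.toℕ-fromℕ< (s≤s (entry-≤ i r))))) (snd-cong e ◂ snd-⟨⟩))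

    patIterᵗ : ∀ {n} → Tm n → Tm n → Tm n
    patIterᵗ l = iterᵗ ⟨ l , ∅ᵗ ⟩ᵗ ⟨ sndᵗ (fstᵗ #0) , ⟨ fstᵗ (fstᵗ #0) , sndᵗ #0 ⟩ᵗ ⟩ᵗ

    ev-patIterᵗ : ∀ {n} (l r : Tm n) ρ → ev (patIterᵗ l r) ρ ≡ patIter (ev l ρ) (natOf (ev r ρ))
    ev-patIterᵗ l r ρ = refl

    compIter : 𝕍 ℓ → 𝕍 ℓ → ℕ → 𝕍 ℓ
    compIter a l = iter (λ w → ⟨ snd (fst w) , ⟨ look a (fst (fst w)) , snd w ⟩ ⟩) ⟨ l , ∅ ⟩

    compIter-≋ : ∀ i {a} (v : Vec (𝕍 ℓ) (suc i)) r → a ≋ tup v → compIter a (codePatternList i) r ≋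
      ⟨ codeList (iter tl (patternList i) r) , tup (map (lookup v) (pat i r)) ⟩
    compIter-≋ i v zero _ = ⟨⟩-cong (codePatternList-≋ i) ≋-refl
    compIter-≋ i v (suc r) q = let e = compIter-≋ i v r q ; p = fst-cong e ◂ fst-⟨⟩ in
      ⟨⟩-cong (snd-cong p ◂ snd-codeList _)
        (⟨⟩-cong (look-tup v (Fin.fromℕ< (s≤s (entry-≤ i r))) q
          (fst-cong p ◂ fst-codeList _ ◂ num-≋ (≡-sym (Finₚ.toℕ-fromℕ< (s≤s (entry-≤ i r)))))) (snd-cong e ◂ snd-⟨⟩))

  opaque
    unfolding compIter lookᵗ

    compIterᵗ : ∀ {n} → Tm n → Tm n → Tm n → Tm n
    compIterᵗ a l = iterᵗ ⟨ l , ∅ᵗ ⟩ᵗ ⟨ sndᵗ (fstᵗ #0) , ⟨ lookᵗ (wkT a) (fstᵗ (fstᵗ #0)) , sndᵗ #0 ⟩ᵗ ⟩ᵗ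

    ev-compIterᵗ : ∀ {n} (a l r : Tm n) ρ → ev (compIterᵗ a l r) ρ ≡ compIter (ev a ρ) (ev l ρ) (natOf (ev r ρ))
    ev-compIterᵗ a l r ρ = refl

  V-sym : V (sym L)
  V-sym = V-≋ (sup-cong {g = sym L ▹_} (λ s → fst-⟨⟩) ◂ sup-η (sym L)) (closed (imgᵗ (cst ⌜ L ⌝ᴸ VL) (fstᵗ #0)) [] []ᵛ)

  S : Sym L → 𝕍 ℓ
  S s = sym L ▹ s

  opaque
    arity : 𝕍 ℓ → 𝕍 ℓ
    arity s = ⌜ L ⌝ᴸ · s

    arity-≋ : ∀ {x} s → x ≋ S s → arity x ≋ num (ar L s)
    arity-≋ s e = graphOf-· {a = sym L} (λ i j e → num-≋ (ar-cong L i j (un≋ e))) s e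

    ev-arityᵗ : ∀ {n} (t : Tm n) ρ → ev (cst ⌜ L ⌝ᴸ VL ·ᵗ t) ρ ≡ arity (ev t ρ)
    ev-arityᵗ t ρ = refl

  arityᵗ : ∀ {n} → Tm n → Tm n
  arityᵗ t = sealᵗ (cst ⌜ L ⌝ᴸ VL ·ᵗ t) _ (ev-arityᵗ t)

  -- R(t) for the r-tuple t with entries among xs c and xs (i - 1), …, xs 0
  -- that is selected by the i-th pattern: 0 stands for xs c, and l + 1 for
  -- xs (i - 1 - l).
  factAt : Sym L → (i c : ℕ) → 𝕍 ℓ
  factAt s i c = fact L s (map (lookup (xs c ∷ prevs i)) (pat i (ar L s)))

  codeFact : 𝕍 ℓ → ℕ → ℕ → 𝕍 ℓ
  codeFact x i c = ⟨ num 1 , ⟨ x , snd (compIter ⟨ xs c , snd (stage i) ⟩ (codePatternList i) (natOf (arity x))) ⟩ ⟩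

  codeFact-≋ : ∀ {x} s i c → x ≋ S s → codeFact x i c ≋ factAt s i c
  codeFact-≋ {x} s i c e = ⟨⟩-cong ≋-refl (⟨⟩-cong e
    (≡⇒≋ (cong (λ r → snd (compIter ⟨ xs c , snd (stage i) ⟩ (codePatternList i) r)) (natOf-num (arity-≋ s e))) ◂
     snd-cong (compIter-≋ i (xs c ∷ prevs i) (ar L s) (⟨⟩-cong ≋-refl (prevs-tup i))) ◂ snd-⟨⟩))

  factᵗ : ∀ {n} → Tm n → Tm n → Tm n → Tm n
  factᵗ x i c = sealᵗ ⟨ numᵗ 1 , ⟨ x , sndᵗ (compIterᵗ ⟨ xsᵗ c , prevsᵗ i ⟩ᵗ (listᵗ i) (arityᵗ x)) ⟩ᵗ ⟩ᵗ
    (λ ρ → codeFact (ev x ρ) (natOf (ev i ρ)) (natOf (ev c ρ)))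
    λ ρ → cong (λ z → ⟨ num 1 , ⟨ ev x ρ , snd z ⟩ ⟩) (ev-compIterᵗ ⟨ xsᵗ c , prevsᵗ i ⟩ᵗ (listᵗ i) (arityᵗ x) ρ)

  patternCode : 𝕍 ℓ → ℕ → 𝕍 ℓ
  patternCode x i = snd (patIter (codePatternList i) (natOf (arity x)))

  patternCode-≋ : ∀ {x} s i → x ≋ S s → patternCode x i ≋ tup (map (λ l → num (toℕ l)) (pat i (ar L s)))
  patternCode-≋ s i e = ≡⇒≋ (cong (λ r → snd (patIter (codePatternList i) r)) (natOf-num (arity-≋ s e))) ◂
    snd-cong (patIter-≋ i (ar L s)) ◂ snd-⟨⟩

  patternᵗ : ∀ {n} → Tm n → Tm n → Tm n
  patternᵗ x i = sealᵗ (sndᵗ (patIterᵗ (listᵗ i) (arityᵗ x))) (λ ρ → patternCode (ev x ρ) (natOf (ev i ρ)))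
    λ ρ → cong snd (ev-patIterᵗ (listᵗ i) (arityᵗ x) ρ)

  V-xs : ∀ m → V (xs m)
  V-xs m = V-∊ VX (xs-∊ m)

  module _ (s : Sym L) (i : ℕ) where

    atomᵗ : ∀ {n} → Tm n → Tm n
    atomᵗ t = factᵗ (cst (S s) (V-▹ V-sym s)) (cst (num i) (V-num i)) t

    ev-atomᵗ : ∀ {n} (t : Tm n) ρ {c} → natOf (ev t ρ) ≡ c → ev (atomᵗ t) ρ ≋ factAt s i c
    ev-atomᵗ t ρ refl = ≡⇒≋ (cong (λ i → codeFact (S s) i (natOf (ev t ρ))) (natOf-num ≋-refl)) ◂
      codeFact-≋ s i (natOf (ev t ρ)) (≋-refl {x = S s})

  indices : ∀ {n} (A : 𝕍 ℓ) (v : Vec (𝕍 ℓ) n) → (∀ l → lookup v l ∊ A) → Σ[ a ∈ Vec (idx A) n ] tup v ≋ tup (A at a)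
  indices A [] h = [] , ≋-refl
  indices A (x ∷ v) h = let (i , e) = ∊-idx (h fzero) ; (a , e′) = indices A v (h ∘ fsuc) in i ∷ a , ⟨⟩-cong e e′

  at-∊ : ∀ {n} (A : 𝕍 ℓ) (a : Vec (idx A) n) l → lookup (A at a) l ∊ A
  at-∊ A (i ∷ a) fzero = ▹-∊ A i
  at-∊ A (i ∷ a) (fsuc l) = at-∊ A a l

  Element : 𝕍 ℓ → 𝕍 ℓ → Set ℓ
  Element M z = (Σ[ y ∈ idx ∣ M ∣ ] z ≋ ⟨ num 0 , ∣ M ∣ ▹ y ⟩) ⊎
    (Σ[ s ∈ Sym L ] Σ[ a ∈ Vec (idx ∣ M ∣) (ar L s) ] z ≋ fact L s (∣ M ∣ at a))

  element : ∀ {M z} → IsStructure L M → z ∊ M → Element M z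
  element {M} {z} st m = let (k , e) = ∊-idx m in side e (st k)
    where
    side : ∀ {x} → z ≋ x → (Σ[ i ∈ idx ∣ M ∣ ] x ≈ ⟨ num 0 , ∣ M ∣ ▹ i ⟩) ⊎
      (Σ[ s ∈ Sym L ] Σ[ a ∈ Vec (idx ∣ M ∣) (ar L s) ] x ≈ fact L s (∣ M ∣ at a)) → Element M z
    side e (inj₁ (y , p)) = inj₁ (y , (e ◂ eq p))
    side e (inj₂ (s , a , p)) = inj₂ (s , a , (e ◂ eq p))

  structure : ∀ {M} → (∀ z → z ∊ M → Element M z) → IsStructure L M
  structure {M} h k = side (h (M ▹ k) (▹-∊ M k))
    where
    side : ∀ {x} → Element M x → (Σ[ i ∈ idx ∣ M ∣ ] x ≈ ⟨ num 0 , ∣ M ∣ ▹ i ⟩) ⊎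
      (Σ[ s ∈ Sym L ] Σ[ a ∈ Vec (idx ∣ M ∣) (ar L s) ] x ≈ fact L s (∣ M ∣ at a))
    side (inj₁ (y , p)) = inj₁ (y , un≋ p)
    side (inj₂ (s , a , p)) = inj₂ (s , a , un≋ p)

  fact-element : ∀ {M x t} → IsStructure L M → ⟨ num 1 , ⟨ x , t ⟩ ⟩ ∊ M →
    Σ[ s ∈ Sym L ] Σ[ a ∈ Vec (idx ∣ M ∣) (ar L s) ] x ≋ S s × t ≋ tup (∣ M ∣ at a)
  fact-element {M} {x} {t} st m = side (element st m)
    where
    side : Element M ⟨ num 1 , ⟨ x , t ⟩ ⟩ → Σ[ s ∈ Sym L ] Σ[ a ∈ Vec (idx ∣ M ∣) (ar L s) ] x ≋ S s × t ≋ tup (∣ M ∣ at a)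
    side (inj₁ (y , e)) = ⊥-elim (suc-≢∅ (⟨⟩-injˡ e))
    side (inj₂ (s , a , e)) = s , a , ⟨⟩-injˡ (⟨⟩-injʳ e) , ⟨⟩-injʳ (⟨⟩-injʳ e)

  fact-≋ : ∀ s {v w : Vec (𝕍 ℓ) (ar L s)} → tup v ≋ tup w → fact L s v ≋ fact L s w
  fact-≋ s e = ⟨⟩-cong ≋-refl (⟨⟩-cong ≋-refl e)

  map-≋ : ∀ {I : Set ℓ} {n} (a b : I → 𝕍 ℓ) (w : Vec I n) → (∀ i → a i ≋ b i) → tup (map a w) ≋ tup (map b w)
  map-≋ a b [] h = ≋-refl
  map-≋ a b (i ∷ w) h = ⟨⟩-cong (h i) (map-≋ a b w h)

  map-inj : ∀ {I : Set ℓ} {m n} (a b : I → 𝕍 ℓ) → (∀ i j → b i ≋ b j → a i ≋ a j) → (v : Vec I m) (w : Vec I n) →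
    tup (map b v) ≋ tup (map b w) → tup (map a v) ≋ tup (map a w)
  map-inj a b h [] [] e = ≋-refl
  map-inj a b h [] (j ∷ w) e = ⊥-elim (⟨⟩-≢∅ (≋-sym e))
  map-inj a b h (i ∷ v) [] e = ⊥-elim (⟨⟩-≢∅ e)
  map-inj a b h (i ∷ v) (j ∷ w) e = ⟨⟩-cong (h i j (⟨⟩-injˡ e)) (map-inj a b h v w (⟨⟩-injʳ e))

  -- Transport of structures along maps of points.

  pairs : (I : Set ℓ) (a b : I → 𝕍 ℓ) → 𝕍 ℓ
  pairs I a b = sup I λ i → ⟨ a i , b i ⟩

  module Tuples (I : Set ℓ) (a b : I → 𝕍 ℓ) (v : V (pairs I a b)) where

    -- The induced map from tuples over `a` to tuples over `b`, for all lengths at once. The index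
    -- type `I` is not an object of `V`; only the pairs of values are.
    TuplePair : 𝕍 ℓ → Set ℓ
    TuplePair z = Σ[ r ∈ ℕ ] Σ[ w ∈ Vec I r ] z ≋ ⟨ tup (map a w) , tup (map b w) ⟩

    extendᵗ : ∀ {n} → Tm (suc n)
    extendᵗ = ⋃ᵗ (imgᵗ (cst (pairs I a b) v) (imgᵗ #1 ⟨ ⟨ fstᵗ #1 , fstᵗ #0 ⟩ᵗ , ⟨ sndᵗ #1 , sndᵗ #0 ⟩ᵗ ⟩ᵗ))

    opaque
      level : ℕ → 𝕍 ℓ
      level = iter (λ w → ⋃ (sup I λ i → sup (idx w) λ k →
        ⟨ ⟨ fst ⟨ a i , b i ⟩ , fst (w ▹ k) ⟩ , ⟨ snd ⟨ a i , b i ⟩ , snd (w ▹ k) ⟩ ⟩)) ⟦ ⟨ ∅ , ∅ ⟩ , ⟨ ∅ , ∅ ⟩ ⟧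

      ev-levelᵗ : ∀ {n} (t : Tm n) ρ → ev (iterᵗ ⟦ ⟨ ∅ᵗ , ∅ᵗ ⟩ᵗ , ⟨ ∅ᵗ , ∅ᵗ ⟩ᵗ ⟧ᵗ extendᵗ t) ρ ≡ level (natOf (ev t ρ))
      ev-levelᵗ t ρ = refl

      level-∊ : ∀ r {z} → z ∊ level r → Σ[ w ∈ Vec I r ] z ≋ ⟨ tup (map a w) , tup (map b w) ⟩
      level-∊ zero m with ∊-pair m
      ... | inj₁ e = [] , e
      ... | inj₂ e = [] , e
      level-∊ (suc r) m =
        let (y , p , q) = ∊-⋃ (sup I λ i → sup (idx (level r)) λ k →
              ⟨ ⟨ fst ⟨ a i , b i ⟩ , fst (level r ▹ k) ⟩ , ⟨ snd ⟨ a i , b i ⟩ , snd (level r ▹ k) ⟩ ⟩) m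
            (i , e) = ∊-sup p
            (k , e′) = ∊-sup (∊-respʳ e q)
            (w , h) = level-∊ r (▹-∊ (level r) k)
        in i ∷ w , (e′ ◂ ⟨⟩-cong (⟨⟩-cong fst-⟨⟩ (fst-cong h ◂ fst-⟨⟩)) (⟨⟩-cong snd-⟨⟩ (snd-cong h ◂ snd-⟨⟩)))

      ∊-level : ∀ {r} (w : Vec I r) → ⟨ tup (map a w) , tup (map b w) ⟩ ∊ level r
      ∊-level [] = pair-∊ˡ ≋-refl
      ∊-level {suc r} (i ∷ w) = let (k , e) = ∊-idx (∊-level w) in
        ⋃-∊ (sup-∊ {f = λ i → sup (idx (level r)) λ k →
              ⟨ ⟨ fst ⟨ a i , b i ⟩ , fst (level r ▹ k) ⟩ , ⟨ snd ⟨ a i , b i ⟩ , snd (level r ▹ k) ⟩ ⟩} i ≋-refl)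
          (sup-∊ k (≋-sym (⟨⟩-cong (⟨⟩-cong fst-⟨⟩ (fst-cong (≋-sym e) ◂ fst-⟨⟩)) (⟨⟩-cong snd-⟨⟩ (snd-cong (≋-sym e) ◂ snd-⟨⟩)))))

    levelᵗ : ∀ {n} → Tm n → Tm n
    levelᵗ t = sealᵗ (iterᵗ ⟦ ⟨ ∅ᵗ , ∅ᵗ ⟩ᵗ , ⟨ ∅ᵗ , ∅ᵗ ⟩ᵗ ⟧ᵗ extendᵗ t) (λ ρ → level (natOf (ev t ρ))) (ev-levelᵗ t)

    abstract
      tuplesᵗ : ∀ {n} → Tm n
      tuplesᵗ = ⋃ᵗ (imgᵗ ωᵗ (levelᵗ #0))

      tuples-∊ : ∀ {n} (ρ : Vec (𝕍 ℓ) n) {z} → z ∊ ev tuplesᵗ ρ → TuplePair z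
      tuples-∊ ρ m = let (y , p , q) = ∊-⋃ (ev (imgᵗ ωᵗ (levelᵗ #0)) ρ) m ; (lift k , e) = ∊-sup p in
        k , level-∊ k (∊-respʳ (e ◂ ≡⇒≋ (cong level (natOf-num ≋-refl))) q)

      ∊-tuples : ∀ {n} (ρ : Vec (𝕍 ℓ) n) {r} (w : Vec I r) → ⟨ tup (map a w) , tup (map b w) ⟩ ∊ ev tuplesᵗ ρ
      ∊-tuples ρ {r} w = ⋃-∊ (sup-∊ {f = λ (lift k) → level (natOf (num k))} (lift r) (≡⇒≋ (cong level (≡-sym (natOf-num ≋-refl)))))
        (∊-level w)

  module Push (M : 𝕍 ℓ) (vM : V M) (stM : IsStructure L M) (I : Set ℓ) (a b : I → 𝕍 ℓ) (v : V (pairs I a b)) where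

    open Tuples I a b v

    -- The image, under `a i ↦ b i`, of the structure that `M` induces on the points `a i`. For
    -- `a = b` this is a restriction, for injective `b` a renaming.
    Source : 𝕍 ℓ → Set ℓ
    Source z = (Σ[ i ∈ I ] z ≋ ⟨ num 0 , b i ⟩) ⊎
      (Σ[ s ∈ Sym L ] Σ[ w ∈ Vec I (ar L s) ] fact L s (map a w) ∊ M × z ≋ fact L s (map b w))

    private
      tag : ∀ {n} → Tm n → Tm n → Tm n
      tag x t = ⟨ numᵗ 1 , ⟨ x , t ⟩ᵗ ⟩ᵗ
      tag-cong : ∀ {x x′ t t′ : 𝕍 ℓ} → x ≋ x′ → t ≋ t′ → ⟨ num 1 , ⟨ x , t ⟩ ⟩ ≋ ⟨ num 1 , ⟨ x′ , t′ ⟩ ⟩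
      tag-cong e e′ = ⟨⟩-cong ≋-refl (⟨⟩-cong e e′)
      pointsᵗ : Tm 0
      pointsᵗ = imgᵗ (cst (pairs I a b) v) ⟨ ∅ᵗ , sndᵗ #0 ⟩ᵗ
      hit : Fm 2
      hit = tag #1 (fstᵗ #0) ∈ᵗ cst M vM
      hitsᵗ : Tm 1
      hitsᵗ = imgᵗ (sepᵗ tuplesᵗ hit) (tag #1 (sndᵗ #0))
      factsᵗ : Tm 0
      factsᵗ = ⋃ᵗ (imgᵗ (cst (sym L) V-sym) hitsᵗ)

      Hit : 𝕍 ℓ → 𝕍 ℓ → Set (lsuc ℓ)
      Hit x z = Σ[ e ∈ 𝕍 ℓ ] TuplePair e × ⟨ num 1 , ⟨ x , fst e ⟩ ⟩ ∊ M × z ≋ ⟨ num 1 , ⟨ x , snd e ⟩ ⟩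

      hits-∊ : ∀ {x z} → V x → z ∊ ev hitsᵗ (x ∷ []) → Hit x z
      hits-∊ {x} vx m =
        let (e , p , q) = ∊-imgᵗ (sepᵗ tuplesᵗ hit) (tag #1 (sndᵗ #0)) {x ∷ []} m
            (r , h) = ∊-sepᵗ tuplesᵗ hit {x ∷ []} {e} (vx ∷ᵛ []ᵛ) p
        in e , tuples-∊ (x ∷ []) r , mem h , q

      ∊-hits : ∀ {x r} (w : Vec I r) → V x → ⟨ num 1 , ⟨ x , tup (map a w) ⟩ ⟩ ∊ M → ⟨ num 1 , ⟨ x , tup (map b w) ⟩ ⟩ ∊ ev hitsᵗ (x ∷ [])
      ∊-hits {x} w vx h = imgᵗ-∊ (sepᵗ tuplesᵗ hit) (tag #1 (sndᵗ #0)) {x ∷ []} {z} (vx ∷ᵛ []ᵛ)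
        (sepᵗ-∊ tuplesᵗ hit {x ∷ []} {z} (vx ∷ᵛ []ᵛ) (∊-tuples (x ∷ []) w)
          (un∊ (∊-respˡ (tag-cong (≋-refl {x = x}) (≋-sym (fst-⟨⟩ {x = tup (map a w)} {tup (map b w)}))) h)))
        (tag-cong (≋-refl {x = x}) (≋-sym (snd-⟨⟩ {x = tup (map a w)} {tup (map b w)})))
        where
        z : 𝕍 ℓ
        z = ⟨ tup (map a w) , tup (map b w) ⟩

      hit-source : ∀ {x z} s → x ≋ S s → Hit x z → Source z
      hit-source {x} {z} s e (c , (r , w , w≋) , h , z≋) = fix r w len
        (∊-respˡ (tag-cong e (fst-cong w≋ ◂ fst-⟨⟩)) h) (z≋ ◂ tag-cong e (snd-cong w≋ ◂ snd-⟨⟩))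
        where
        h′ : ⟨ num 1 , ⟨ S s , tup (map a w) ⟩ ⟩ ∊ M
        h′ = ∊-respˡ (tag-cong e (fst-cong w≋ ◂ fst-⟨⟩)) h
        -- `tuplesᵗ` contains tuples of every length; the correct one is enforced by `M` being a
        -- structure.
        len : r ≡ ar L s
        len = let (s′ , u , S≋ , u≋) = fact-element stM h′ in
          ≡-trans (tup-len {xs = map a w} {∣ M ∣ at u} u≋) (ar-cong L s′ s (un≋ (≋-sym S≋)))
        fix : ∀ r (w : Vec I r) → r ≡ ar L s → ⟨ num 1 , ⟨ S s , tup (map a w) ⟩ ⟩ ∊ M → z ≋ ⟨ num 1 , ⟨ S s , tup (map b w) ⟩ ⟩ → Source z
        fix r w refl h e = inj₂ (s , w , h , e)

    abstract
      push : 𝕍 ℓ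
      push = ev (⋃ᵗ ⟦ pointsᵗ , factsᵗ ⟧ᵗ) []

      V-push : V push
      V-push = closed (⋃ᵗ ⟦ pointsᵗ , factsᵗ ⟧ᵗ) [] []ᵛ

      push-∊ : ∀ {z} → z ∊ push → Source z
      push-∊ {z} m = let (y , p , q) = ∊-⋃ ⟦ ev pointsᵗ [] , ev factsᵗ [] ⟧ m in side q (∊-pair p)
        where
        side : ∀ {y} → z ∊ y → y ≋ ev pointsᵗ [] ⊎ y ≋ ev factsᵗ [] → Source z
        side q (inj₁ e) = let (i , e′) = ∊-sup (∊-respʳ e q) in inj₁ (i , (e′ ◂ ⟨⟩-cong ≋-refl (snd-⟨⟩ {x = a i} {b i})))
        side q (inj₂ e) =
          let (y , p , q′) = ∊-⋃ (ev (imgᵗ (cst (sym L) V-sym) hitsᵗ) []) (∊-respʳ e q)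
              (x , xL , y≋) = ∊-imgᵗ (cst (sym L) V-sym) hitsᵗ {[]} p
              (s , x≋) = ∊-idx xL
          in hit-source s x≋ (hits-∊ (V-∊ V-sym xL) (∊-respʳ y≋ q′))

      point-push : ∀ i → ⟨ num 0 , b i ⟩ ∊ push
      point-push i = ⋃-∊ (pair-∊ˡ ≋-refl) (sup-∊ {f = λ i → ⟨ ∅ , snd ⟨ a i , b i ⟩ ⟩} i (⟨⟩-cong ≋-refl (≋-sym (snd-⟨⟩ {x = a i} {b i}))))

      fact-push : ∀ s (w : Vec I (ar L s)) → fact L s (map a w) ∊ M → fact L s (map b w) ∊ push
      fact-push s w h = ⋃-∊ (pair-∊ʳ ≋-refl) (⋃-∊
        (imgᵗ-∊ (cst (sym L) V-sym) hitsᵗ {[]} {S s} {ev hitsᵗ (S s ∷ [])} []ᵛ (▹-∊ (sym L) s) ≋-refl)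
        (∊-hits w (V-▹ V-sym s) h))

    carrier-∊ : ∀ {y} → y ∊ ∣ push ∣ → Σ[ i ∈ I ] y ≋ b i
    carrier-∊ {y} m = side (push-∊ (∊-∣∣ push m))
      where
      side : Source ⟨ num 0 , y ⟩ → Σ[ i ∈ I ] y ≋ b i
      side (inj₁ (i , e)) = i , ⟨⟩-injʳ e
      side (inj₂ (s , w , _ , e)) = ⊥-elim (suc-≢∅ (≋-sym (⟨⟩-injˡ e)))

    ∊-carrier : ∀ i {y} → y ≋ b i → y ∊ ∣ push ∣
    ∊-carrier i e = ∣∣-∊ (∊-respˡ (⟨⟩-cong ≋-refl (≋-sym e)) (point-push i))

    push-structure : IsStructure L push
    push-structure = structure λ z m → side (push-∊ m)
      where
      side : ∀ {z} → Source z → Element push z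
      side (inj₁ (i , e)) = let (k , e′) = ∊-idx (∊-carrier i ≋-refl) in inj₁ (k , (e ◂ ⟨⟩-cong ≋-refl e′))
      side (inj₂ (s , w , _ , e)) =
        let (u , e′) = indices ∣ push ∣ (map b w) (λ l → ∊-carrier (lookup w l) (≡⇒≋ (Vecₚ.lookup-map l b w)))
        in inj₂ (s , u , (e ◂ ⟨⟩-cong ≋-refl (⟨⟩-cong ≋-refl e′)))

    push-fact : (∀ i j → b i ≋ b j → a i ≋ a j) → ∀ s (w : Vec I (ar L s)) → fact L s (map b w) ∊ push → fact L s (map a w) ∊ M
    push-fact inj s w m = side (push-∊ m)
      where
      side : Source (fact L s (map b w)) → fact L s (map a w) ∊ M
      side (inj₁ (i , e)) = ⊥-elim (suc-≢∅ (⟨⟩-injˡ e))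
      side (inj₂ (s′ , w′ , h , e)) = ∊-respˡ (⟨⟩-cong ≋-refl (⟨⟩-cong (≋-sym (⟨⟩-injˡ (⟨⟩-injʳ e)))
        (≋-sym (map-inj a b inj w w′ (⟨⟩-injʳ (⟨⟩-injʳ e)))))) h

-- The code `U`.

module Construction {ℓ : Level} (em : ExcludedMiddle (lsuc ℓ)) (V : Class ℓ) (zfc : TransitiveModelOfZFC V)
    (κ : 𝕍 ℓ) (Vκ : V κ) (ordinal : IsOrdinal κ) (infinite-κ : Infinite κ)
    (X : 𝕍 ℓ) (VX : V X) (infinite : Infinite X) (L : Language ℓ) (VL : V ⌜ L ⌝ᴸ)
    (f : 𝕍 ℓ) (Vf : V f) (f-inj : IsInjection f (sym L) κ) where

  open Facts em V zfc X VX infinite L VL public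

  transitive-κ : ∀ {x y} → x ∊ κ → y ∊ x → y ∊ κ
  transitive-κ p q = let (i , e) = ∊-idx p in ⊆⇒⊑ (proj₁ ordinal i) (∊-respʳ e q)

  transitive-∊κ : ∀ {x y z} → x ∊ κ → y ∊ x → z ∊ y → z ∊ x
  transitive-∊κ p q r = let (i , e) = ∊-idx p ; (j , e′) = ∊-idx (∊-respʳ e q) in
    ∊-respʳ (≋-sym e) (⊆⇒⊑ (proj₂ ordinal i j) (∊-respʳ e′ r))

  transitive-subset : ∀ n {y : 𝕍 ℓ} → y ⊑ num n → (∀ {z w} → z ∊ y → w ∊ z → w ∊ y) → Σ[ m ∈ ℕ ] m ℕ.≤ n × y ≋ num m
  transitive-subset zero s t = 0 , z≤n , ext s (λ m → ⊥-elim (∉∅ m))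
  transitive-subset (suc n) {y} s t with em₀ (num n ∊ y)
  ... | yes p = suc n , ℕₚ.≤-refl , ext s λ m → case ∊-succ (num n) m of λ { (inj₁ q) → t p q ; (inj₂ q) → ∊-respˡ (≋-sym q) p }
  ... | no p = let (m , le , e) = transitive-subset n (λ q → case ∊-succ (num n) (s q) of λ
                     { (inj₁ r) → r ; (inj₂ r) → ⊥-elim (p (∊-respˡ r q)) }) t in m , ℕₚ.m≤n⇒m≤1+n le , e

  private
    -- If `num n` is not in `κ` then, by induction on membership, every element of `κ` is a
    -- transitive subset of `num n`, hence a smaller numeral. So `κ` would consist of exactly `n`
    -- elements.
    below : ∀ n k → k ℕ.< n → num k ∊ κ
    below (suc n) k (s≤s le) with ℕₚ.m≤n⇒m<n∨m≡n le
    ... | inj₁ lt = below n k lt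
    ... | inj₂ refl = stable₀ λ n∉κ →
      let all-in : ∀ y → y ∊ κ → y ∊ num n
          all-in = ∈-ind _ λ y ih yκ →
            let (m , le , e) = transitive-subset n (λ z → ih _ z (transitive-κ yκ z)) (transitive-∊κ yκ) in
            case ℕₚ.m≤n⇒m<n∨m≡n le of λ
              { (inj₁ lt) → ∊-respˡ (≋-sym e) (num-< lt) ; (inj₂ p) → ⊥-elim (n∉κ (∊-respˡ (e ◂ num-≋ p) yκ)) }
          at : Fin n → idx κ
          at k = proj₁ (∊-idx (below n (toℕ k) (Finₚ.toℕ<n k)))
          at-≋ : ∀ k → num (toℕ k) ≋ κ ▹ at k
          at-≋ k = proj₂ (∊-idx (below n (toℕ k) (Finₚ.toℕ<n k)))
      in infinite-κ (n , at ,
        (λ i j e → Finₚ.toℕ-injective (num-inj (at-≋ i ◂ eq e ◂ ≋-sym (at-≋ j)))) ,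
        (λ k → let (m , lt , e) = ∊-num {n = n} (all-in _ (▹-∊ κ k)) in
          Fin.fromℕ< lt , un≋ (e ◂ num-≋ (≡-sym (Finₚ.toℕ-fromℕ< lt)) ◂ at-≋ (Fin.fromℕ< lt))))

  num∊κ : ∀ n → num n ∊ κ
  num∊κ n = below (suc n) n (ℕₚ.n<1+n n)

  nat→κ : ℕ → idx κ
  nat→κ n = proj₁ (∊-idx (num∊κ n))

  nat→κ-≋ : ∀ n → κ ▹ nat→κ n ≋ num n
  nat→κ-≋ n = ≋-sym (proj₂ (∊-idx (num∊κ n)))

  κ→nat : idx κ → ℕ
  κ→nat i = natOf (κ ▹ i)

  κ→nat→κ : ∀ n → κ→nat (nat→κ n) ≡ n
  κ→nat→κ n = natOf-num (nat→κ-≋ n)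

  opaque
    symOf : 𝕍 ℓ → 𝕍 ℓ
    symOf u = ⋃ (sep (sym L) λ s → f · s ≈ u)

    ev-symOfᵗ : ∀ {n} (u : Tm n) ρ → ev (⋃ᵗ (sepᵗ (cst (sym L) V-sym) (cst f Vf ·ᵗ #0 ≈ᵗ wkT u))) ρ ≡ symOf (ev u ρ)
    ev-symOfᵗ u ρ = refl

    symOf-≋ : ∀ {u} s → f · S s ≋ u → symOf u ≋ S s
    symOf-≋ {u} s e = ext
      (λ m → let (w , p , q) = ∊-⋃ (sep (sym L) P) m ; (a , b) = ∊-sep (sym L) P r p ; (i , e′) = ∊-idx a in
        ∊-respʳ (e′ ◂ eq (IsInjection.injective f-inj i s (un≋ (·-cong {f = f} ≋-refl (≋-sym e′) ◂ eq {x = f · w} b ◂ ≋-sym e)))) q)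
      (⋃-∊ (sep-∊ P r (▹-∊ (sym L) s) (un≋ e)))
      where
      P : 𝕍 ℓ → Set ℓ
      P s = f · s ≈ u
      r : Resp P
      r {x} {y} e p = un≋ (·-cong {f = f} (≋-refl {x = f}) (≋-sym e) ◂ eq {x = f · x} {u} p)

  symOfᵗ : ∀ {n} → Tm n → Tm n
  symOfᵗ u = sealᵗ (⋃ᵗ (sepᵗ (cst (sym L) V-sym) (cst f Vf ·ᵗ #0 ≈ᵗ wkT u))) (λ ρ → symOf (ev u ρ)) (ev-symOfᵗ u)

  Valid : 𝕍 ℓ → Set ℓ
  Valid u = Σ[ s ∈ Sym L ] f · S s ≈ u

  validᵗ : ∀ {n} → Tm n → Fm n
  validᵗ u = ∃ᵗ (cst (sym L) V-sym) (cst f Vf ·ᵗ #0 ≈ᵗ wkT u)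

  iter-succ : ∀ a b → iter succ (num {ℓ} a) b ≡ num (b ℕ.+ a)
  iter-succ a zero = refl
  iter-succ a (suc b) = cong succ (iter-succ a b)

  normᵗ : ∀ {n} → Tm n → Tm n
  normᵗ t = sealᵗ (iterᵗ ∅ᵗ (succᵗ #0) t) (λ ρ → num (natOf (ev t ρ)))
    λ ρ → ≡-trans (iter-succ 0 (natOf (ev t ρ))) (cong num (ℕₚ.+-identityʳ _))

  addᵗ : ∀ {n} → Tm n → Tm n → Tm n
  addᵗ a b = sealᵗ (iterᵗ (normᵗ b) (succᵗ #0) a) (λ ρ → num (natOf (ev a ρ) ℕ.+ natOf (ev b ρ)))
    λ ρ → iter-succ (natOf (ev b ρ)) (natOf (ev a ρ))

  powᵗ : ∀ {n} → Tm n → Tm n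
  powᵗ a = sealᵗ (iterᵗ (numᵗ 1) (addᵗ #0 #0) a) (λ ρ → num (pow2 (natOf (ev a ρ)))) λ ρ → go (natOf (ev a ρ))
    where
    go : ∀ m → iter (λ w → num {ℓ} (natOf w ℕ.+ natOf w)) (num 1) m ≡ num (pow2 m)
    go zero = refl
    go (suc m) = cong num (cong double (≡-trans (cong natOf (go m)) (natOf-num ≋-refl)))

  blkᵗ : ∀ {n} → Tm n → Tm n → Tm n
  blkᵗ q j = sealᵗ (iteᵗ (normᵗ j ∈ᵗ powᵗ q) (normᵗ j) ∅ᵗ) (λ ρ → num (blk (natOf (ev q ρ)) (natOf (ev j ρ))))
    λ ρ → go (natOf (ev q ρ)) (natOf (ev j ρ))
    where
    go : ∀ q j → ite (em₀ (num {ℓ} j ∈ num (pow2 q))) (num {ℓ} j) ∅ ≡ num (blk q j)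
    go q j with j ℕ.<? pow2 q
    ... | yes p = ite-yes (em₀ _) (un∊ (num-< p))
    ... | no n = ite-no (em₀ _) (λ m → n (num-∊⇒< {ℓ} {n = pow2 q} (mem m)))

  indexᵗ : ∀ {n} → Tm n → Tm n → Tm n → Tm n → Tm n
  indexᵗ i N k j = sealᵗ (iteᵗ (normᵗ N ≈ᵗ ∅ᵗ) (addᵗ k i) (addᵗ (addᵗ k (addᵗ N i)) (blkᵗ (addᵗ k (addᵗ N i)) j)))
    (λ ρ → num (index (natOf (ev i ρ)) (natOf (ev N ρ)) (natOf (ev k ρ)) (natOf (ev j ρ))))
    λ ρ → go (natOf (ev i ρ)) (natOf (ev N ρ)) (natOf (ev k ρ)) (natOf (ev j ρ))
    where
    nn : ∀ n → natOf (num n) ≡ n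
    nn n = natOf-num ≋-refl
    go : ∀ i N k j → ite (em₀ (num {ℓ} N ≈ ∅)) (num {ℓ} (k ℕ.+ i))
           (num (natOf (num (k ℕ.+ natOf (num (N ℕ.+ i)))) ℕ.+
                 natOf (num (blk (natOf (num (k ℕ.+ natOf (num (N ℕ.+ i))))) j)))) ≡ num (index i N k j)
    go i zero k j = ite-yes (em₀ _) (≈-refl ∅)
    go i (suc N) k j = ≡-trans (ite-no (em₀ _) (λ e → suc-≢∅ (eq {x = num (suc N)} e)))
      (cong num (cong₂ ℕ._+_ q (≡-trans (nn _) (cong (λ m → blk m j) q))))
      where
      q : natOf (num (k ℕ.+ natOf (num (suc N ℕ.+ i)))) ≡ k ℕ.+ (suc N ℕ.+ i)
      q = ≡-trans (nn _) (cong (k ℕ.+_) (nn _))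

  prevIdx : (i : ℕ) → Vec (idx X) i
  prevIdx zero = []
  prevIdx (suc i) = xi i ∷ prevIdx i

  args : (i c : ℕ) → Vec (idx X) (suc i)
  args i c = xi c ∷ prevIdx i

  args-≋ : ∀ i c l → lookup (X at args i c) l ≋ lookup (xs c ∷ prevs i) l
  args-≋ i c fzero = xi-≋ c
  args-≋ (suc i) c (fsuc l) = args-≋ i i l

  map-lookup-≋ : ∀ {m n} (a b : Vec (𝕍 ℓ) m) (v : Vec (Fin m) n) → (∀ l → lookup a l ≋ lookup b l) →
    tup (map (lookup a) v) ≋ tup (map (lookup b) v)
  map-lookup-≋ a b [] h = ≋-refl
  map-lookup-≋ a b (l ∷ v) h = ⟨⟩-cong (h l) (map-lookup-≋ a b v h)

  fact-args : ∀ s i c → fact L s (map (lookup (X at args i c)) (pat i (ar L s))) ≋ factAt s i c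
  fact-args s i c = ⟨⟩-cong ≋-refl (⟨⟩-cong ≋-refl (map-lookup-≋ (X at args i c) (xs c ∷ prevs i) (pat i (ar L s)) (args-≋ i c)))

  -- Below, u ∈ κ names a symbol R through the injection f, i a pattern, and
  -- A c the event factAt R i c.  The disjuncts over N of U are: A c fails for
  -- all c ≥ i (N = 0), and every block from the one numbered N + i on contains
  -- some c with A c (N ≠ 0).
  literal : (N : ℕ) (s : Sym L) (i : ℕ) → Literal L (suc i)
  literal zero s i = neg (rel s (pat i (ar L s)))
  literal (suc N) s i = rel s (pat i (ar L s))

  -- An element `u` of `κ` that names no symbol gets the empty conjunction, which is true, so its
  -- conjunct in `U` says nothing.
  leaf′ : ∀ {u} → Dec (Valid u) → (i N k j : ℕ) → Code κ L X
  leaf′ (no _) i N k j = basic [] []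
  leaf′ (yes (s , _)) i N k j = basic (literal N s i ∷ []) (args i (index i N k j))

  leaf : (u i N k j : idx κ) → Code κ L X
  leaf u i N k j = leaf′ (em₀ (Valid (κ ▹ u))) (κ→nat i) (κ→nat N) (κ→nat k) (κ→nat j)

  leafᵗ : Tm 5
  leafᵗ = iteᵗ (validᵗ u)
    ⟨ ∅ᵗ , ⟨ ⟨ iteᵗ (normᵗ N ≈ᵗ ∅ᵗ) ⟨ numᵗ 2 , lit ⟩ᵗ lit , ∅ᵗ ⟩ᵗ , ⟨ xsᵗ (indexᵗ i N k j) , prevsᵗ i ⟩ᵗ ⟩ᵗ ⟩ᵗ
    ⟨ ∅ᵗ , ⟨ ∅ᵗ , ∅ᵗ ⟩ᵗ ⟩ᵗ
    where
    j k N i u : Tm 5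
    j = #0
    k = #1
    N = #2
    i = #3
    u = #4
    lit = ⟨ ∅ᵗ , ⟨ symOfᵗ u , patternᵗ (symOfᵗ u) i ⟩ᵗ ⟩ᵗ

  leaf-ok : ∀ u i N k j → ⌜_⌝ κ L X (leaf u i N k j) ≋ ev leafᵗ (κ at (j ∷ k ∷ N ∷ i ∷ u ∷ []))
  leaf-ok u i N k j = go (em₀ (Valid (κ ▹ u)))
    where
    ρ = κ at (j ∷ k ∷ N ∷ i ∷ u ∷ [])
    U = symOf (κ ▹ u)
    n = κ→nat N
    body : 𝕍 ℓ
    body = ⟨ num 0 , ⟨ U , patternCode U (κ→nat i) ⟩ ⟩
    c = index (κ→nat i) n (κ→nat k) (κ→nat j)
    c′ = natOf (num c)
    pic : ∀ s → f · S s ≈ κ ▹ u → ⌜_⌝ˡ L (rel s (pat (κ→nat i) (ar L s))) ≋ body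
    pic s p = ⟨⟩-cong ≋-refl (⟨⟩-cong (≋-sym e) (≋-sym (patternCode-≋ s (κ→nat i) e)))
      where
      e : U ≋ S s
      e = symOf-≋ s (eq p)
    lits : ∀ s n → f · S s ≈ κ ▹ u → ⌜_⌝ˡ L (literal n s (κ→nat i)) ≋ ite (em₀ (num n ≈ ∅)) ⟨ num 2 , body ⟩ body
    lits s zero p = ⟨⟩-cong ≋-refl (pic s p) ◂ ≡⇒≋ (≡-sym (ite-yes (em₀ _) (≈-refl ∅)))
    lits s (suc n) p = pic s p ◂ ≡⇒≋ (≡-sym (ite-no (em₀ _) (λ e → suc-≢∅ (eq {x = num (suc n)} e))))
    arg : ∀ i c → tup (X at args i c) ≋ ⟨ xs c , snd (stage i) ⟩
    arg i c = tup-cong {xs = X at args i c} {xs c ∷ prevs i} (args-≋ i c) ◂ ⟨⟩-cong ≋-refl (≋-sym (prevs-tup i))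
    valid : 𝕍 ℓ
    valid = ⟨ num 0 , ⟨ ⟨ ite (em₀ (num n ≈ ∅)) ⟨ num 2 , body ⟩ body , ∅ ⟩ , ⟨ xs c , snd (stage (κ→nat i)) ⟩ ⟩ ⟩
    ev-leaf : ev leafᵗ ρ ≋ ite (em₀ (Valid (κ ▹ u))) valid ⟨ ∅ , ⟨ ∅ , ∅ ⟩ ⟩
    ev-leaf = ≡⇒≋ (cong (λ c → ite (em₀ (Valid (κ ▹ u)))
      ⟨ num 0 , ⟨ ⟨ ite (em₀ (num n ≈ ∅)) ⟨ num 2 , body ⟩ body , ∅ ⟩ , ⟨ xs c , snd (stage (κ→nat i)) ⟩ ⟩ ⟩
      ⟨ ∅ , ⟨ ∅ , ∅ ⟩ ⟩) (natOf-num {num c} ≋-refl))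
    go : (d : Dec (Valid (κ ▹ u))) → ⌜_⌝ κ L X (leaf′ d (κ→nat i) n (κ→nat k) (κ→nat j)) ≋ ev leafᵗ ρ
    go (yes (s , p)) = ⟨⟩-cong ≋-refl (⟨⟩-cong (⟨⟩-cong (lits s n p) ≋-refl) (arg (κ→nat i) c)) ◂
      ≡⇒≋ (≡-sym (ite-yes (em₀ (Valid (κ ▹ u))) {valid} {⟨ ∅ , ⟨ ∅ , ∅ ⟩ ⟩} (s , p))) ◂ ≋-sym ev-leaf
    go (no h) = ≡⇒≋ (≡-sym (ite-no (em₀ (Valid (κ ▹ u))) {valid} {⟨ ∅ , ⟨ ∅ , ∅ ⟩ ⟩} h)) ◂ ≋-sym ev-leaf

  AllV-κ : ∀ {n} (is : Vec (idx κ) n) → AllV (κ at is)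
  AllV-κ (i ∷ is) fzero = V-▹ Vκ i
  AllV-κ (i ∷ is) (fsuc l) = AllV-κ is l

  -- The term makes the codes of a family, and hence its ⋁ and ⋀, sets of V.
  record Family (r n : ℕ) : Set (lsuc ℓ) where
    field
      code     : Vec (idx κ) n → Code κ L X
      term     : Tm n
      code-≋   : ∀ is → ⌜_⌝ κ L X (code is) ≋ ev term (κ at is)
      rank-≋   : ∀ is → rank κ L X (code is) ≋ num r
  open Family public

  coherent : ∀ {r n} (Γ : Family r (suc n)) is i j → κ ▹ i ≈ κ ▹ j → ⌜_⌝ κ L X (code Γ (i ∷ is)) ≈ ⌜_⌝ κ L X (code Γ (j ∷ is))
  coherent Γ is i j e = un≋ (code-≋ Γ (i ∷ is) ◂
    ev-cong (term Γ) (AllV-κ (i ∷ is)) (AllV-κ (j ∷ is)) (∷-≋ (eq e)) ◂ ≋-sym (code-≋ Γ (j ∷ is)))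

  ⋃-succ : ∀ r (R : idx κ → 𝕍 ℓ) → (∀ i → R i ≋ num r) → ⋃ (sup (idx κ) λ i → succ (R i)) ≋ num (suc r)
  ⋃-succ r R h = ext
    (λ m → let (y , p , q) = ∊-⋃ (sup (idx κ) λ i → succ (R i)) m ; (i , e) = ∊-sup p in ∊-respʳ (e ◂ succ-cong (h i)) q)
    -- All successors are equal, and `κ` has an element 0, so the supremum is attained.
    (λ m → ⋃-∊ (sup-∊ {f = λ i → succ (R i)} (nat→κ 0) (≋-sym (succ-cong (h (nat→κ 0))))) m)

  ⋀ᶠ ⋁ᶠ : ∀ {r n} → Family r (suc n) → Family (suc r) n
  ⋀ᶠ {r} Γ = record
    { code   = λ is → ⋀ (λ i → code Γ (i ∷ is)) (coherent Γ is)
    ; term   = ⟨ numᵗ 3 , imgᵗ (cst κ Vκ) ⟨ #0 , term Γ ⟩ᵗ ⟩ᵗ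
    ; code-≋ = λ is → ⟨⟩-cong ≋-refl (sup-cong λ i → ⟨⟩-cong ≋-refl (code-≋ Γ (i ∷ is)))
    ; rank-≋ = λ is → ⋃-succ r _ λ i → rank-≋ Γ (i ∷ is) }
  ⋁ᶠ {r} Γ = record
    { code   = λ is → ⋁ (λ i → code Γ (i ∷ is)) (coherent Γ is)
    ; term   = ⟨ numᵗ 2 , imgᵗ (cst κ Vκ) ⟨ #0 , term Γ ⟩ᵗ ⟩ᵗ
    ; code-≋ = λ is → ⟨⟩-cong ≋-refl (sup-cong λ i → ⟨⟩-cong ≋-refl (code-≋ Γ (i ∷ is)))
    ; rank-≋ = λ is → ⋃-succ r _ λ i → rank-≋ Γ (i ∷ is) }

  leafᶠ : Family 0 5
  leafᶠ = record
    { code   = λ { (j ∷ k ∷ N ∷ i ∷ u ∷ []) → leaf u i N k j }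
    ; term   = leafᵗ
    ; code-≋ = λ { (j ∷ k ∷ N ∷ i ∷ u ∷ []) → leaf-ok u i N k j }
    ; rank-≋ = λ { (j ∷ k ∷ N ∷ i ∷ u ∷ []) → rank-leaf (em₀ (Valid (κ ▹ u))) (κ→nat i) (κ→nat N) (κ→nat k) (κ→nat j) } }
    where
    rank-leaf : ∀ {u} (d : Dec (Valid u)) i N k j → rank κ L X (leaf′ d i N k j) ≋ num 0
    rank-leaf (yes _) _ _ _ _ = ≋-refl
    rank-leaf (no _) _ _ _ _ = ≋-refl

  -- From the outside the levels bind the symbol `u`, the pattern `i`, the number `N`, the block `k`
  -- and the position `j`.
  Uᶠ : Family 5 0
  Uᶠ = ⋀ᶠ (⋀ᶠ (⋁ᶠ (⋀ᶠ (⋁ᶠ leafᶠ))))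

  U : Code κ L X
  U = code Uᶠ []

  V-U : V (⌜_⌝ κ L X U)
  V-U = V-≋ (≋-sym (code-≋ Uᶠ [])) (closed (term Uᶠ) [] []ᵛ)

  rank-U : rank κ L X U ≈ num 5
  rank-U = un≋ (rank-≋ Uᶠ [])

  -- Equal symbols may carry different indices `s` and `s′`. The two facts are compared through
  -- `codeFact`, which takes the symbol as a set.
  factAt-cong : ∀ s s′ i c → S s ≋ S s′ → factAt s i c ≋ factAt s′ i c
  factAt-cong s s′ i c e = ≋-sym (codeFact-≋ s i c (≋-refl {x = S s})) ◂ codeFact-≋ s′ i c e

  f-injective : ∀ s s′ {u} → f · S s ≋ u → f · S s′ ≋ u → S s ≋ S s′
  f-injective s s′ e e′ = eq (IsInjection.injective f-inj s s′ (un≋ (e ◂ ≋-sym e′)))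

  Signed : ℕ → 𝕍 ℓ → 𝕍 ℓ → Set ℓ
  Signed zero x M = ¬ x ∊ M
  Signed (suc _) x M = x ∊ M

  Signed-resp : ∀ N {x y M} → x ≋ y → Signed N x M → Signed N y M
  Signed-resp zero e n m = n (∊-respˡ (≋-sym e) m)
  Signed-resp (suc N) e m = ∊-respˡ e m

  indexOf : (i N k j : idx κ) → ℕ
  indexOf i N k j = index (κ→nat i) (κ→nat N) (κ→nat k) (κ→nat j)

  sat-literal : ∀ N s i c M → SatLiteral L M (literal N s i) (X at args i c) ↔ Signed N (factAt s i c) M
  sat-literal zero s i c M =
    (λ n m → n (un∊ (∊-respˡ (≋-sym (fact-args s i c)) m))) , (λ n m → n (∊-respˡ (fact-args s i c) (mem m)))
  sat-literal (suc N) s i c M =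
    (λ m → ∊-respˡ (fact-args s i c) (mem m)) , (λ m → un∊ (∊-respˡ (≋-sym (fact-args s i c)) m))

  sat-leaf⇒ : ∀ u i N k j s M → f · S s ≋ κ ▹ u → Sat κ L X M (leaf u i N k j) →
    Signed (κ→nat N) (factAt s (κ→nat i) (indexOf i N k j)) M
  sat-leaf⇒ u i N k j s M e h = go (em₀ (Valid (κ ▹ u))) h
    where
    go : (d : Dec (Valid (κ ▹ u))) → Sat κ L X M (leaf′ d (κ→nat i) (κ→nat N) (κ→nat k) (κ→nat j)) →
         Signed (κ→nat N) (factAt s (κ→nat i) (indexOf i N k j)) M
    go (yes (s′ , e′)) (p All.∷ _) = Signed-resp (κ→nat N) (factAt-cong s′ s _ _ (f-injective s′ s (eq e′) e))
      (proj₁ (sat-literal (κ→nat N) s′ _ _ M) p)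
    go (no n) _ = ⊥-elim (n (s , un≋ e))

  sat-leaf⇐ : ∀ u i N k j M → (∀ s → f · S s ≋ κ ▹ u → Signed (κ→nat N) (factAt s (κ→nat i) (indexOf i N k j)) M) →
    Sat κ L X M (leaf u i N k j)
  sat-leaf⇐ u i N k j M h = go (em₀ (Valid (κ ▹ u)))
    where
    go : (d : Dec (Valid (κ ▹ u))) → Sat κ L X M (leaf′ d (κ→nat i) (κ→nat N) (κ→nat k) (κ→nat j))
    go (yes (s , e)) = proj₂ (sat-literal (κ→nat N) s _ _ M) (h s (eq e)) All.∷ All.[]
    go (no n) = All.[]

-- Measurable sets and unions along `κ`.

module RandomSide {ℓ : Level} (em : ExcludedMiddle (lsuc ℓ)) (V : Class ℓ) (zfc : TransitiveModelOfZFC V)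
    (κ : 𝕍 ℓ) (Vκ : V κ) (ordinal : IsOrdinal κ) (infinite-κ : Infinite κ)
    (X : 𝕍 ℓ) (VX : V X) (infinite : Infinite X) (L : Language ℓ) (VL : V ⌜ L ⌝ᴸ)
    (f : 𝕍 ℓ) (Vf : V f) (f-inj : IsInjection f (sym L) κ) (ν : InvariantMeasure V κ L X) where

  open Construction em V zfc κ Vκ ordinal infinite-κ X VX infinite L VL f Vf f-inj public
  open InvariantMeasure ν public
  open IsKappaAlgebra algebra public

  fam : Tm 1 → 𝕍 ℓ → 𝕍 ℓ
  fam F x = ev F (x ∷ [])

  fam-cong : ∀ F {x y} → V x → x ≋ y → fam F x ≋ fam F y
  fam-cong F vx e = ev-cong F (vx ∷ᵛ []ᵛ) (V-≋ e vx ∷ᵛ []ᵛ) (∷-≋ e)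

  V-∊κ : ∀ {x} → x ∊ κ → V x
  V-∊κ = V-∊ Vκ

  trichotomy : ∀ x → x ∊ κ → ∀ y → y ∊ κ → x ∊ y ⊎ x ≋ y ⊎ y ∊ x
  trichotomy = ∈-ind _ λ x ihx xκ → ∈-ind _ λ y ihy yκ → case em₀ (x ∊ y) of λ
    { (yes p) → inj₁ p
    ; (no x∉y) → case em₀ (y ∊ x) of λ
      { (yes q) → inj₂ (inj₂ q)
      ; (no y∉x) → inj₂ (inj₁ (ext
          (λ {z} m → case ihx z m (transitive-κ xκ m) y yκ of λ
            { (inj₁ p) → p
            ; (inj₂ (inj₁ e)) → ⊥-elim (y∉x (∊-respˡ e m))
            ; (inj₂ (inj₂ q)) → ⊥-elim (y∉x (transitive-∊κ xκ m q)) })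
          (λ {z} m → case ihy z m (transitive-κ yκ m) of λ
            { (inj₁ p) → ⊥-elim (x∉y (transitive-∊κ yκ m p))
            ; (inj₂ (inj₁ e)) → ⊥-elim (x∉y (∊-respˡ (≋-sym e) m))
            ; (inj₂ (inj₂ q)) → q }))) } }

  least-element : (P : 𝕍 ℓ → Set ℓ) → ∀ x → x ∊ κ → P x → Σ[ y ∈ 𝕍 ℓ ] y ∊ κ × P y × (∀ z → z ∊ y → ¬ P z)
  least-element P = ∈-ind _ λ x ih xκ p → case em {Σ[ z ∈ 𝕍 ℓ ] z ∊ x × P z} of λ
    { (yes (z , m , q)) → ih z m (transitive-κ xκ m) q ; (no n) → x , xκ , p , λ z m q → n (z , m , q) }

  -- The injection sends `B` to its least preimage in the well-order of `κ`, which is definable over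
  -- `V`.
  Card≤-image : (F : Tm 1) (T : 𝕍 ℓ) → V T → (∀ B → B ∊ T → Σ[ x ∈ 𝕍 ℓ ] x ∊ κ × fam F x ≋ B) → Card≤ V T κ
  Card≤-image F T vT onto = ∃ᶜ-intro h (closed hᵗ [] []ᵛ) (lift record
    { isFun = graphOf-isFun {a = T} (λ i j e → fam-cong minᵗ (V-▹ vT i) e) ≋-refl
    ; into = ⊑⇒⊆ {x = image h T} λ m → let (i , e) = ∊-sup m in ∊-respˡ (≋-sym (e ◂ value i ◂ minOf i)) (proj₁ (proj₂ (lst i)))
    ; injective = λ i j e → un≋ (
        ≋-sym (eq (proj₁ (proj₂ (proj₂ (lst i))))) ◂
        fam-cong F (V-∊κ (proj₁ (proj₂ (lst i)))) (≋-sym (minOf i) ◂ ≋-sym (value i) ◂ eq e ◂ value j ◂ minOf j) ◂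
        eq (proj₁ (proj₂ (proj₂ (lst j))))) })
    where
    φ : Fm 2
    φ = (wk₁T F ≈ᵗ #1) ∧ᵗ ∀ᵗ #0 (¬ᵗ (wk₁T (wk₁T F) ≈ᵗ #2))
    minᵗ : Tm 1
    minᵗ = ⋃ᵗ (sepᵗ (cst κ Vκ) φ)
    hᵗ : Tm 0
    hᵗ = graphᵗ (cst T vT) minᵗ
    h = ev hᵗ []
    value : ∀ i → h · (T ▹ i) ≋ fam minᵗ (T ▹ i)
    value i = graphOf-· {a = T} (λ i j e → fam-cong minᵗ (V-▹ vT i) e) i ≋-refl
    Least : 𝕍 ℓ → Set (lsuc ℓ)
    Least B = Σ[ y ∈ 𝕍 ℓ ] y ∊ κ × fam F y ≈ B × (∀ z → z ∊ y → ¬ fam F z ≈ B)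
    lst : ∀ i → Least (T ▹ i)
    lst i = let (x , m , e) = onto (T ▹ i) (▹-∊ T i) in least-element (λ y → fam F y ≈ T ▹ i) x m (un≋ e)
    minOf : ∀ i → fam minᵗ (T ▹ i) ≋ proj₁ (lst i)
    minOf i = ext
      (λ m → let (w , p , q) = ∊-⋃ (ev (sepᵗ (cst κ Vκ) φ) (B ∷ [])) m
                 (wκ , e , l) = ∊-sepᵗ (cst κ Vκ) φ {B ∷ []} (vB ∷ᵛ []ᵛ) p
             in ∊-respʳ (same wκ e λ z zw e′ → let (j , r) = ∊-idx zw in
                  l j (un≋ (fam-cong F (V-▹ (V-∊κ wκ) j) (≋-sym r) ◂ eq {x = fam F z} {B} e′))) q)
      (⋃-∊ (sepᵗ-∊ (cst κ Vκ) φ {B ∷ []} (vB ∷ᵛ []ᵛ) yκ (yB , λ j → isLeast (y ▹ j) (▹-∊ y j))))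
      where
      B = T ▹ i
      vB = V-▹ vT i
      y = proj₁ (lst i)
      yκ = proj₁ (proj₂ (lst i))
      yB = proj₁ (proj₂ (proj₂ (lst i)))
      isLeast = proj₂ (proj₂ (proj₂ (lst i)))
      same : ∀ {w} → w ∊ κ → fam F w ≈ B → (∀ z → z ∊ w → ¬ fam F z ≈ B) → w ≋ y
      same {w} wκ e l with trichotomy w wκ y yκ
      ... | inj₁ p = ⊥-elim (isLeast w p e)
      ... | inj₂ (inj₁ p) = p
      ... | inj₂ (inj₂ p) = ⊥-elim (l y p yB)

  Meas : 𝕍 ℓ → Set ℓ
  Meas A = A ∊ 𝓑

  Meas-⊑ : ∀ {A} → Meas A → A ⊑ Ω
  Meas-⊑ {A} m = ⊆⇒⊑ (subsets A (un∊ m))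

  V-Meas : ∀ {A} → Meas A → V A
  V-Meas = V-∊ 𝓑∈V

  opaque
    Over : Tm 1 → 𝕍 ℓ → 𝕍 ℓ
    Over F x = ⋃ (sup (idx x) λ j → fam F (x ▹ j))

    ∊-Over : ∀ F x {z} → z ∊ Over F x → Σ[ y ∈ 𝕍 ℓ ] y ∊ x × z ∊ fam F y
    ∊-Over F x m = let (y , p , q) = ∊-⋃ (sup (idx x) λ j → fam F (x ▹ j)) m ; (j , e) = ∊-sup p in
      x ▹ j , ▹-∊ x j , ∊-respʳ e q

    Over-∊ : ∀ F {x y z} → V x → y ∊ x → z ∊ fam F y → z ∊ Over F x
    Over-∊ F {x} vx m q = let (j , e) = ∊-idx m in
      ⋃-∊ (sup-∊ {f = λ j → fam F (x ▹ j)} j ≋-refl) (∊-respʳ (fam-cong F (V-∊ vx m) e) q)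

    Meas-Over : ∀ F x → V x → x ⊑ κ → (∀ y → y ∊ x → Meas (fam F y)) → Meas (Over F x)
    Meas-Over F x vx sub h = mem (unions T vT
      (⊑⇒⊆ {x = T} λ m → let (j , e) = ∊-sup m in ∊-respˡ (≋-sym e) (h (x ▹ j) (▹-∊ x j)))
      (Card≤-image F T vT λ B m → let (j , e) = ∊-sup m in x ▹ j , sub (▹-∊ x j) , ≋-sym e))
      where
      T : 𝕍 ℓ
      T = ev (imgᵗ (cst x vx) F) []
      vT : V T
      vT = closed (imgᵗ (cst x vx) F) [] []ᵛ

    Over-≡ : ∀ F x → Over F x ≡ ⋃ (sup (idx x) λ j → fam F (x ▹ j))
    Over-≡ F x = refl

  Meas-Ω∖ : ∀ {A} → Meas A → Meas (Ω ∖ A)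
  Meas-Ω∖ {A} m = mem (complements A (un∊ m))

  abstract
    -- Additivity is stated for families over `κ`; two sets become such a family by padding with
    -- `∅`.
    cases : ∀ {A B} → V A → V B → Tm 1
    cases {A} {B} vA vB = iteᵗ (#0 ≈ᵗ ∅ᵗ) (cst A vA) (iteᵗ (#0 ≈ᵗ numᵗ 1) (cst B vB) ∅ᵗ)

    cases-0 : ∀ {A B x} (vA : V A) (vB : V B) → x ≋ num 0 → fam (cases vA vB) x ≋ A
    cases-0 vA vB e = ≡⇒≋ (ite-yes (em₀ _) (un≋ e))

    cases-1 : ∀ {A B x} (vA : V A) (vB : V B) → x ≋ num 1 → fam (cases vA vB) x ≋ B
    cases-1 vA vB e = ≡⇒≋ (ite-no (em₀ _) (λ e′ → suc-≢∅ (≋-sym e ◂ eq e′))) ◂ ≡⇒≋ (ite-yes (em₀ _) (un≋ e))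

    cases-else : ∀ {A B x} (vA : V A) (vB : V B) → ¬ x ≋ num 0 → ¬ x ≋ num 1 → fam (cases vA vB) x ≋ ∅
    cases-else vA vB n n′ = ≡⇒≋ (ite-no (em₀ _) (n ∘ eq)) ◂ ≡⇒≋ (ite-no (em₀ _) (n′ ∘ eq))

  Split : 𝕍 ℓ → 𝕍 ℓ → 𝕍 ℓ → 𝕍 ℓ → Set ℓ
  Split A B x D = (x ≋ num 0 × D ≋ A) ⊎ (x ≋ num 1 × D ≋ B) ⊎ D ≋ ∅

  cases-split : ∀ {A B} (vA : V A) (vB : V B) x → Split A B x (fam (cases vA vB) x)
  cases-split vA vB x with em₀ (x ≋ num 0) | em₀ (x ≋ num 1)
  ... | yes e | _ = inj₁ (e , cases-0 vA vB e)
  ... | no n | yes e = inj₂ (inj₁ (e , cases-1 vA vB e))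
  ... | no n | no n′ = inj₂ (inj₂ (cases-else vA vB n n′))

  ∪-≋ : ∀ {A B} (vA : V A) (vB : V B) → Over (cases vA vB) κ ≋ ⋃ ⟦ A , B ⟧
  ∪-≋ {A} {B} vA vB = ext
    (λ m → let (y , p , q) = ∊-Over F κ m in to q (cases-split vA vB y))
    (λ m → let (y , p , q) = ∊-⋃ ⟦ A , B ⟧ m in case ∊-pair p of λ
      { (inj₁ e) → Over-∊ F Vκ (num∊κ 0) (∊-respʳ (e ◂ ≋-sym (cases-0 vA vB ≋-refl)) q)
      ; (inj₂ e) → Over-∊ F Vκ (num∊κ 1) (∊-respʳ (e ◂ ≋-sym (cases-1 vA vB ≋-refl)) q) })
    where
    F = cases vA vB
    to : ∀ {z y D} → z ∊ D → Split A B y D → z ∊ ⋃ ⟦ A , B ⟧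
    to q (inj₁ (_ , e)) = ⋃-∊ (pair-∊ˡ ≋-refl) (∊-respʳ e q)
    to q (inj₂ (inj₁ (_ , e))) = ⋃-∊ (pair-∊ʳ ≋-refl) (∊-respʳ e q)
    to q (inj₂ (inj₂ e)) = ⊥-elim (∉∅ (∊-respʳ e q))

  Meas-Ω : Meas Ω
  Meas-Ω = ∊-respˡ (ext (λ m → proj₁ (∊-sep Ω P (λ _ → id) m)) (λ m → sep-∊ P (λ _ → id) m (≈-refl (X ▹ xi 0))))
    (mem {x = sep Ω P} (literals {1} (Literal.eq fzero fzero) (xi 0 ∷ [])))
    where
    P : 𝕍 ℓ → Set ℓ
    P _ = X ▹ xi 0 ≈ X ▹ xi 0

  Meas-∅ : Meas ∅
  Meas-∅ = ∊-respˡ (ext (λ m → let (p , q) = ∊-∖ Ω Ω m in ⊥-elim (q p)) (λ m → ⊥-elim (∉∅ m))) (Meas-Ω∖ Meas-Ω)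

  Meas-cases : ∀ {A B} → Meas A → Meas B → ∀ {x D} → Split A B x D → Meas D
  Meas-cases mA mB (inj₁ (_ , e)) = ∊-respˡ (≋-sym e) mA
  Meas-cases mA mB (inj₂ (inj₁ (_ , e))) = ∊-respˡ (≋-sym e) mB
  Meas-cases mA mB (inj₂ (inj₂ e)) = ∊-respˡ (≋-sym e) Meas-∅

  Meas-∪ : ∀ {A B} → Meas A → Meas B → Meas (⋃ ⟦ A , B ⟧)
  Meas-∪ mA mB = ∊-respˡ (∪-≋ (V-Meas mA) (V-Meas mB)) (Meas-Over (cases (V-Meas mA) (V-Meas mB)) κ Vκ id
    λ y _ → Meas-cases mA mB (cases-split (V-Meas mA) (V-Meas mB) y))

  Meas-∖ : ∀ {A B} → Meas A → Meas B → Meas (A ∖ B)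
  Meas-∖ {A} {B} mA mB = ∊-respˡ (ext
    (λ m → let (p , q) = ∊-∖ Ω C m in ∖-∊ {a = A} {B} (stable₀ λ n → q (⋃-∊ (pair-∊ˡ ≋-refl) (∖-∊ {a = Ω} {A} p n))) λ b → q (⋃-∊ (pair-∊ʳ ≋-refl) b))
    (λ m → let (p , q) = ∊-∖ A B m in ∖-∊ {a = Ω} {C} (Meas-⊑ mA p) λ c → let (y , r , s) = ∊-⋃ ⟦ Ω ∖ A , B ⟧ c in case ∊-pair r of λ
      { (inj₁ e) → proj₂ (∊-∖ Ω A (∊-respʳ e s)) p ; (inj₂ e) → q (∊-respʳ e s) }))
    (Meas-Ω∖ (Meas-∪ (Meas-Ω∖ mA) mB))
    where
    C = ⋃ ⟦ Ω ∖ A , B ⟧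

  -- Estimates for the measure.

  opaque
    ms : 𝕍 ℓ → 𝕍 ℓ
    ms A = μ · A

    ms-≡ : ∀ A → ms A ≡ μ · A
    ms-≡ A = refl

    ms-cong : ∀ {A B} → A ≋ B → ms A ≋ ms B
    ms-cong e = ·-cong {f = μ} ≋-refl e

    ms-additive : ∀ A → V A → IsFun A κ → image A κ ⊆ 𝓑 →
      (∀ i j → ¬ κ ▹ i ≈ κ ▹ j → A · (κ ▹ i) ∩ A · (κ ▹ j) ≈ ∅) →
      ms (⋃ (image A κ)) ≋ Σᴿ κ (λ x → ms (A · x))
    ms-additive A v h s d = eq (additive A v h s d)

  Disjoint : Tm 1 → Set (lsuc ℓ)
  Disjoint D = ∀ i j → ¬ κ ▹ i ≈ κ ▹ j → ∀ z → z ∊ fam D (κ ▹ i) → ¬ z ∊ fam D (κ ▹ j)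

  module Additive (D : Tm 1) (meas : ∀ i → Meas (fam D (κ ▹ i))) (disjoint : Disjoint D) where

    private
      A = ev (graphᵗ (cst κ Vκ) D) []
      coh : Coherent κ (λ i → fam D (κ ▹ i))
      coh i j e = fam-cong D (V-▹ Vκ i) e
      value : ∀ i → A · (κ ▹ i) ≋ fam D (κ ▹ i)
      value i = graphOf-· {a = κ} coh i ≋-refl
      union-≋ : ⋃ (image A κ) ≋ Over D κ
      union-≋ = ⋃-cong (sup-cong value) ◂ ≡⇒≋ (≡-sym (Over-≡ D κ))

    measure-≋ : ms (Over D κ) ≋ Σᴿ κ (λ x → ms (A · x))
    measure-≋ = ms-cong (≋-sym union-≋) ◂ ms-additive A (closed (graphᵗ (cst κ Vκ) D) [] []ᵛ)
      (graphOf-isFun {a = κ} coh ≋-refl)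
      (⊑⇒⊆ {x = image A κ} λ m → let (i , e) = ∊-sup m in ∊-respˡ (≋-sym (e ◂ value i)) (meas i))
      λ i j n → un≋ (ext {x = A · (κ ▹ i) ∩ A · (κ ▹ j)}
        (λ m → let (p , q) = ∊-sep (A · (κ ▹ i)) (_∈ A · (κ ▹ j)) (r (A · (κ ▹ j))) m in
          ⊥-elim (disjoint i j n _ (∊-respʳ (value i) p) (∊-respʳ (value j) (mem q))))
        (λ m → ⊥-elim (∉∅ m)))
      where
      r : ∀ b → Resp (_∈ b)
      r b e m = un∊ (∊-respˡ e (mem {y = b} m))

    Separated : List (idx κ) → Set ℓ
    Separated = AllPairs (λ i j → ¬ κ ▹ i ≈ κ ▹ j)

    -- The measure of the union is the supremum of its finite sums, and each of these is estimated
    -- term by term.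
    upper : (w : idx κ → ℚ) → (∀ i p → p ∊ᴿ ms (fam D (κ ▹ i)) → p ℚ.≤ w i) → ∀ b →
      (∀ is → Separated is → sumOver w is ℚ.≤ b) → ∀ p → p ∊ᴿ ms (Over D κ) → p ℚ.≤ b
    upper w h b sums p m =
      let (y , q , r) = ∊-⋃ (sup (Σ[ is ∈ List (idx κ) ] Separated is) λ (is , _) → List.foldr (λ i s → R i +ᴿ s) 0ᴿ is)
                            (∊-respʳ measure-≋ m)
          ((is , sep) , e) = ∊-sup q
      in ℚₚ.≤-trans (foldr-≤ R w (λ i p m → h i p (∊-respʳ (ms-cong (value i)) m)) is (∊-respʳ e r)) (sums is sep)
      where
      R : idx κ → 𝕍 ℓ
      R i = ms (A · (κ ▹ i))

    -- The negative summand `c` comes from the cut `0ᴿ` with which every finite sum starts.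
    lower₂ : ∀ i j → ¬ κ ▹ i ≈ κ ▹ j → ∀ {a b c} → a ∊ᴿ ms (fam D (κ ▹ i)) → b ∊ᴿ ms (fam D (κ ▹ j)) → c ℚ.< ℚ.0ℚ →
      (a ℚ.+ (b ℚ.+ c)) ∊ᴿ ms (Over D κ)
    lower₂ i j n {a} {b} {c} p q lt = ∊-respʳ (≋-sym measure-≋)
      (⋃-∊ (sup-∊ {f = λ (is , _) → List.foldr (λ i s → R i +ᴿ s) 0ᴿ is}
             (i ∷ j ∷ [] , (n All.∷ All.[]) AllPairs.∷ All.[] AllPairs.∷ AllPairs.[]) ≋-refl)
        (+-∊ {r = R i} {R j +ᴿ 0ᴿ} (∊-respʳ (ms-cong (≋-sym (value i))) p)
          (+-∊ {r = R j} {0ᴿ} (∊-respʳ (ms-cong (≋-sym (value j))) q) (cut-∊ lt))))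
      where
      R : idx κ → 𝕍 ℓ
      R i = ms (A · (κ ▹ i))

  open-∊ : ∀ {A p} → Meas A → p ∊ᴿ ms A → Σ[ q ∈ ℚ ] p ℚ.< q × q ∊ᴿ ms A
  open-∊ {A} {p} m h = let (q , lt , k) = IsReal.open-cut (subst IsReal (≡-sym (ms-≡ A)) (real A (un∊ m))) p (un∊ h) in q , lt , mem k

  negative-∊ : ∀ {A p} → Meas A → p ℚ.< ℚ.0ℚ → p ∊ᴿ ms A
  negative-∊ {A} m lt = ∊-respʳ (≡⇒≋ (≡-sym (ms-≡ A))) (⊆⇒⊑ {x = 0ᴿ} {μ · A} (nonnegative A (un∊ m)) (cut-∊ lt))

  num0≢num1 : ¬ κ ▹ nat→κ 0 ≈ κ ▹ nat→κ 1
  num0≢num1 e = case num-inj {ℓ} {0} {1} (≋-sym (nat→κ-≋ 0) ◂ eq e ◂ nat→κ-≋ 1) of λ ()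

  -- The remainder left by `lower₂` is absorbed by openness of the cut: `q` is replaced by some
  -- `q′ > q`, and the remainder is `q - q′`.
  superadditive : ∀ {B C} → Meas B → Meas C → B ⊑ C → ∀ {p q} → p ∊ᴿ ms B → q ∊ᴿ ms (C ∖ B) → (p ℚ.+ q) ∊ᴿ ms C
  superadditive {B} {C} mB mC sub {p} {q} hp hq with open-∊ {p = q} (Meas-∖ mC mB) hq
  ... | q′ , lt , hq′ = subst (_∊ᴿ ms C) (cong (p ℚ.+_) q′+) (∊-respʳ (ms-cong D-≋)
      (Additive.lower₂ D (λ i → Meas-cases mB mC∖B (split (κ ▹ i))) (λ i j n z a b → disjoint n z a b (split (κ ▹ i)) (split (κ ▹ j))) (nat→κ 0) (nat→κ 1) num0≢num1
        (∊-respʳ (ms-cong (≋-sym D0)) hp) (∊-respʳ (ms-cong (≋-sym D1)) hq′) q<0))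
    where
    q′+ : q′ ℚ.+ (q ℚ.- q′) ≡ q
    q′+ = ≡-trans (cong (q′ ℚ.+_) (ℚₚ.+-comm q (ℚ.- q′))) (≡-trans (≡-sym (ℚₚ.+-assoc q′ (ℚ.- q′) q))
      (≡-trans (cong (ℚ._+ q) (ℚₚ.+-inverseʳ q′)) (ℚₚ.+-identityˡ q)))
    q<0 : q ℚ.- q′ ℚ.< ℚ.0ℚ
    q<0 = subst (q ℚ.- q′ ℚ.<_) (ℚₚ.+-inverseʳ q′) (ℚₚ.+-monoˡ-< (ℚ.- q′) lt)
    mC∖B : Meas (C ∖ B)
    mC∖B = Meas-∖ mC mB
    D : Tm 1
    D = cases (V-Meas mB) (V-Meas mC∖B)
    split : ∀ x → Split B (C ∖ B) x (fam D x)
    split = cases-split (V-Meas mB) (V-Meas mC∖B)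
    D0 : fam D (κ ▹ nat→κ 0) ≋ B
    D0 = cases-0 (V-Meas mB) (V-Meas mC∖B) (nat→κ-≋ 0)
    D1 : fam D (κ ▹ nat→κ 1) ≋ C ∖ B
    D1 = cases-1 (V-Meas mB) (V-Meas mC∖B) (nat→κ-≋ 1)
    disjoint : ∀ {x y E F} → ¬ x ≈ y → ∀ z → z ∊ E → z ∊ F → Split B (C ∖ B) x E → Split B (C ∖ B) y F → ⊥
    disjoint n z a b (inj₁ (e , _)) (inj₁ (e′ , _)) = n (un≋ (e ◂ ≋-sym e′))
    disjoint n z a b (inj₁ (_ , e)) (inj₂ (inj₁ (_ , e′))) = proj₂ (∊-∖ C B (∊-respʳ e′ b)) (∊-respʳ e a)
    disjoint n z a b (inj₂ (inj₁ (_ , e))) (inj₁ (_ , e′)) = proj₂ (∊-∖ C B (∊-respʳ e a)) (∊-respʳ e′ b)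
    disjoint n z a b (inj₂ (inj₁ (e , _))) (inj₂ (inj₁ (e′ , _))) = n (un≋ (e ◂ ≋-sym e′))
    disjoint n z a b (inj₂ (inj₂ e)) _ = ∉∅ (∊-respʳ e a)
    disjoint n z a b (inj₁ _) (inj₂ (inj₂ e)) = ∉∅ (∊-respʳ e b)
    disjoint n z a b (inj₂ (inj₁ _)) (inj₂ (inj₂ e)) = ∉∅ (∊-respʳ e b)
    inC : ∀ {z x E} → z ∊ E → Split B (C ∖ B) x E → z ∊ C
    inC q (inj₁ (_ , e)) = sub (∊-respʳ e q)
    inC q (inj₂ (inj₁ (_ , e))) = proj₁ (∊-∖ C B (∊-respʳ e q))
    inC q (inj₂ (inj₂ e)) = ⊥-elim (∉∅ (∊-respʳ e q))
    D-≋ : Over D κ ≋ C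
    D-≋ = ext
      (λ m → let (y , p , q) = ∊-Over D κ m in inC q (split y))
      (λ {z} m → case em₀ (z ∊ B) of λ
        { (yes p) → Over-∊ D Vκ (▹-∊ κ (nat→κ 0)) (∊-respʳ (≋-sym D0) p)
        ; (no p) → Over-∊ D Vκ (▹-∊ κ (nat→κ 1)) (∊-respʳ (≋-sym D1) (∖-∊ {a = C} {B} m p)) })

  -- With `q > p` still in the smaller cut, `p` is `q` plus a negative number, and negative numbers
  -- lie in the cut of `C ∖ B`.
  monotone : ∀ {B C} → Meas B → Meas C → B ⊑ C → ∀ {p} → p ∊ᴿ ms B → p ∊ᴿ ms C
  monotone {B} {C} mB mC sub {p} h with open-∊ {p = p} mB h
  ... | q , lt , hq = subst (_∊ᴿ ms C) e (superadditive mB mC sub hq (negative-∊ (Meas-∖ mC mB) q<0))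
    where
    q<0 : p ℚ.- q ℚ.< ℚ.0ℚ
    q<0 = subst (p ℚ.- q ℚ.<_) (ℚₚ.+-inverseʳ q) (ℚₚ.+-monoˡ-< (ℚ.- q) lt)
    e : q ℚ.+ (p ℚ.- q) ≡ p
    e = ≡-trans (cong (q ℚ.+_) (ℚₚ.+-comm p (ℚ.- q))) (≡-trans (≡-sym (ℚₚ.+-assoc q (ℚ.- q) p))
      (≡-trans (cong (ℚ._+ p) (ℚₚ.+-inverseʳ q)) (ℚₚ.+-identityˡ p)))

  Bound : 𝕍 ℓ → ℚ → Set ℓ
  Bound A b = ∀ p → p ∊ᴿ ms A → p ℚ.≤ b

  Bound-⊑ : ∀ {A B b} → Meas A → Meas B → A ⊑ B → Bound B b → Bound A b
  Bound-⊑ mA mB s h p m = h p (monotone mA mB s m)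

  -- The family is made disjoint by removing from each member all earlier ones; a point of the union
  -- survives in the member with the least index. This handles every `κ`, not only ω.
  subadditive : ∀ F → (∀ i → Meas (fam F (κ ▹ i))) → (w : idx κ → ℚ) → (∀ i → Bound (fam F (κ ▹ i)) (w i)) → ∀ {b} →
    (∀ is → AllPairs (λ i j → ¬ κ ▹ i ≈ κ ▹ j) is → sumOver w is ℚ.≤ b) → Bound (Over F κ) b
  subadditive F meas w bound {b} sums p m = Additive.upper D measD disj w
    (λ i → Bound-⊑ (measD i) (meas i) (λ q → proj₁ (∊-∖ _ (Over F (κ ▹ i)) q)) (bound i)) b sums p
    (∊-respʳ (ms-cong Over-≋) m)
    where
    D : Tm 1
    D = F ∖ᵗ sealᵗ (⋃ᵗ (imgᵗ #0 (wk₁T F))) (λ ρ → Over F (Vec.head ρ)) λ { (x ∷ []) → ≡-sym (Over-≡ F x) }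
    measAt : ∀ {x} → x ∊ κ → Meas (fam F x)
    measAt m = let (i , e) = ∊-idx m in ∊-respˡ (fam-cong F (V-▹ Vκ i) (≋-sym e)) (meas i)
    measD : ∀ i → Meas (fam D (κ ▹ i))
    measD i = Meas-∖ (meas i) (Meas-Over F (κ ▹ i) (V-▹ Vκ i) (transitive-κ (▹-∊ κ i))
      λ y m → measAt (transitive-κ (▹-∊ κ i) m))
    disj : Disjoint D
    disj i j n z a b with trichotomy (κ ▹ i) (▹-∊ κ i) (κ ▹ j) (▹-∊ κ j)
    ... | inj₁ p = proj₂ (∊-∖ (fam F (κ ▹ j)) (Over F (κ ▹ j)) b) (Over-∊ F (V-▹ Vκ j) p (proj₁ (∊-∖ (fam F (κ ▹ i)) (Over F (κ ▹ i)) a)))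
    ... | inj₂ (inj₁ e) = n (un≋ e)
    ... | inj₂ (inj₂ p) = proj₂ (∊-∖ (fam F (κ ▹ i)) (Over F (κ ▹ i)) a) (Over-∊ F (V-▹ Vκ i) p (proj₁ (∊-∖ (fam F (κ ▹ j)) (Over F (κ ▹ j)) b)))
    Over-≋ : Over F κ ≋ Over D κ
    Over-≋ = ext
      (λ {z} m → let (x , xκ , q) = ∊-Over F κ m
                     (y , yκ , r , l) = least-element (λ y → z ∊ fam F y) x xκ q
                 in Over-∊ D Vκ yκ (∖-∊ r λ s → let (u , uy , t) = ∊-Over F y s in l u uy t))
      (λ m → let (x , xκ , q) = ∊-Over D κ m in Over-∊ F Vκ xκ (proj₁ (∊-∖ (fam F x) (Over F x) q)))

  null-union : ∀ F → (∀ i → Meas (fam F (κ ▹ i))) → (∀ i → Bound (fam F (κ ▹ i)) ℚ.0ℚ) → Bound (Over F κ) ℚ.0ℚ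
  null-union F meas null = subadditive F meas (λ _ → ℚ.0ℚ) null λ is _ → ℚₚ.≤-reflexive (sumOver-0 is)

  -- Peels off one set at a time; the others stay inside what remains of `C`.
  copies : ∀ {r p} → p ∊ᴿ r → (Bs : List (𝕍 ℓ)) → ∀ {C} → Meas C → All (λ B → Meas B × B ⊑ C × r ≋ ms B) Bs →
    AllPairs (λ A B → ∀ z → z ∊ A → ¬ z ∊ B) Bs → ∀ {c} → c ℚ.< ℚ.0ℚ → (mult (List.length Bs) p ℚ.+ c) ∊ᴿ ms C
  copies {p = p} h [] {C} mC _ _ {c} lt = negative-∊ mC (subst (ℚ._< ℚ.0ℚ) (≡-sym (ℚₚ.+-identityˡ c)) lt)
  copies {p = p} h (B ∷ Bs) {C} mC ((mB , sub , e) All.∷ hs) (d AllPairs.∷ ds) {c} lt =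
    subst (_∊ᴿ ms C) (≡-sym (ℚₚ.+-assoc p (mult (List.length Bs) p) c))
      (superadditive mB mC sub (∊-respʳ e h) (copies h Bs (Meas-∖ mC mB) (rest d hs) ds lt))
    where
    rest : ∀ {Bs} → All (λ A → ∀ z → z ∊ B → ¬ z ∊ A) Bs → All (λ A → Meas A × A ⊑ C × _ ≋ ms A) Bs →
      All (λ A → Meas A × A ⊑ (C ∖ B) × _ ≋ ms A) Bs
    rest All.[] All.[] = All.[]
    rest (q All.∷ qs) ((m , s , e) All.∷ hs) = (m , (λ z → ∖-∊ (s z) λ b → q _ b z) , e) All.∷ rest qs hs

  -- Otherwise `c`, which is 1 minus the multiple of `p`, is negative, and `copies` puts 1 itself
  -- into the open cut of μ(Ω) = 1.
  copies-bound : ∀ {A} (Bs : List (𝕍 ℓ)) → All (λ B → Meas B × ms A ≋ ms B) Bs →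
    AllPairs (λ A B → ∀ z → z ∊ A → ¬ z ∊ B) Bs → ∀ p → p ∊ᴿ ms A → mult (List.length Bs) p ℚ.≤ ℚ.1ℚ
  copies-bound {A} Bs hs ds p m = ℚₚ.≮⇒≥ λ lt →
    let c = ℚ.1ℚ ℚ.- mult (List.length Bs) p
        q = copies {r = ms A} {p} m Bs Meas-Ω (within hs) ds {c}
              (subst (c ℚ.<_) (ℚₚ.+-inverseʳ (mult (List.length Bs) p)) (ℚₚ.+-monoˡ-< (ℚ.- mult (List.length Bs) p) lt))
        e = ≡-trans (cong (mult (List.length Bs) p ℚ.+_) (ℚₚ.+-comm ℚ.1ℚ (ℚ.- mult (List.length Bs) p)))
              (≡-trans (≡-sym (ℚₚ.+-assoc (mult (List.length Bs) p) _ ℚ.1ℚ))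
                (≡-trans (cong (ℚ._+ ℚ.1ℚ) (ℚₚ.+-inverseʳ (mult (List.length Bs) p))) (ℚₚ.+-identityˡ ℚ.1ℚ)))
    in ℚₚ.<-irrefl e (∊-cut {ℓ} (∊-respʳ (≡⇒≋ (ms-≡ Ω) ◂ eq total) q))
    where
    within : ∀ {Bs} → All (λ B → Meas B × ms A ≋ ms B) Bs → All (λ B → Meas B × B ⊑ Ω × ms A ≋ ms B) Bs
    within All.[] = All.[]
    within ((m , e) All.∷ hs) = (m , Meas-⊑ m , e) All.∷ within hs

  -- Transpositions.

  module _ (a b : ℕ) where
    private
      xa = xs a
      xb = xs b

    abstract
      transposeᵗ : Tm 1
      transposeᵗ = iteᵗ (#0 ≈ᵗ cst xa (V-xs a)) (cst xb (V-xs b)) (iteᵗ (#0 ≈ᵗ cst xb (V-xs b)) (cst xa (V-xs a)) #0)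

      transpose-a : ∀ {x} → x ≋ xa → fam transposeᵗ x ≋ xb
      transpose-a e = ≡⇒≋ (ite-yes (em₀ _) (un≋ e))

      transpose-b : ∀ {x} → x ≋ xb → fam transposeᵗ x ≋ xa
      transpose-b {x} e with em₀ (x ≋ xa)
      ... | yes e′ = ≡⇒≋ (ite-yes (em₀ _) (un≋ e′)) ◂ ≋-sym e ◂ e′
      ... | no n = ≡⇒≋ (ite-no (em₀ _) (n ∘ eq)) ◂ ≡⇒≋ (ite-yes (em₀ _) (un≋ e))

      transpose-else : ∀ {x} → ¬ x ≋ xa → ¬ x ≋ xb → fam transposeᵗ x ≋ x
      transpose-else n n′ = ≡⇒≋ (ite-no (em₀ _) (n ∘ eq)) ◂ ≡⇒≋ (ite-no (em₀ _) (n′ ∘ eq))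

    transpose² : ∀ x → V x → fam transposeᵗ (fam transposeᵗ x) ≋ x
    transpose² x vx = case em₀ (x ≋ xa) of λ
      { (yes e) → transpose-b (transpose-a e) ◂ ≋-sym e
      ; (no n) → case em₀ (x ≋ xb) of λ
        { (yes e) → transpose-a (transpose-b e) ◂ ≋-sym e
        ; (no n′) → let e = transpose-else n n′ in
            transpose-else (λ p → n (≋-sym e ◂ p)) (λ p → n′ (≋-sym e ◂ p)) ◂ e } }

    transpose-∊ : ∀ x → x ∊ X → fam transposeᵗ x ∊ X
    transpose-∊ x m = case em₀ (x ≋ xa) of λ
      { (yes e) → ∊-respˡ (≋-sym (transpose-a e)) (xs-∊ b)
      ; (no n) → case em₀ (x ≋ xb) of λ
        { (yes e) → ∊-respˡ (≋-sym (transpose-b e)) (xs-∊ a)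
        ; (no n′) → ∊-respˡ (≋-sym (transpose-else n n′)) m } }

    transposition : 𝕍 ℓ
    transposition = ev (graphᵗ (cst X VX) transposeᵗ) []

    V-transposition : V transposition
    V-transposition = closed (graphᵗ (cst X VX) transposeᵗ) [] []ᵛ

    private
      coh : Coherent X (λ i → fam transposeᵗ (X ▹ i))
      coh i j e = fam-cong transposeᵗ (V-▹ VX i) e

    transposition-· : ∀ i → transposition · (X ▹ i) ≋ fam transposeᵗ (X ▹ i)
    transposition-· i = graphOf-· {a = X} coh i ≋-refl

    transposition-bijection : IsBijection transposition X X
    transposition-bijection = record
      { isInjection = record
        { isFun = graphOf-isFun {a = X} coh ≋-refl
        ; into = ⊑⇒⊆ {x = image transposition X} λ m → let (i , e) = ∊-sup m in
            ∊-respˡ (≋-sym (e ◂ transposition-· i)) (transpose-∊ (X ▹ i) (▹-∊ X i))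
        ; injective = λ i j e → un≋ (≋-sym (transpose² (X ▹ i) (V-▹ VX i)) ◂
            fam-cong transposeᵗ (V-∊ VX (transpose-∊ (X ▹ i) (▹-∊ X i))) (≋-sym (transposition-· i) ◂ eq e ◂ transposition-· j) ◂
            transpose² (X ▹ j) (V-▹ VX j)) }
      ; onto = λ i → let (j , e) = ∊-idx (transpose-∊ (X ▹ i) (▹-∊ X i)) in
          un∊ (sup-∊ {f = λ j → transposition · (X ▹ j)} j (≋-sym (transposition-· j ◂
            fam-cong transposeᵗ (V-▹ VX j) (≋-sym e) ◂ transpose² (X ▹ i) (V-▹ VX i)))) }

  act-fact : ∀ g M s (a : Vec (idx X) (ar L s)) → fact L s (X at a) ∊ M → fact L s (map (g ·_) (X at a)) ∊ act L X g M
  act-fact g M s a m = mem (inj₂ (s , a , un∊ m) , ≈-refl (fact L s (map (g ·_) (X at a))))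

  act-fact⁻¹ : ∀ g M x t → ⟨ num 1 , ⟨ x , t ⟩ ⟩ ∊ act L X g M →
    Σ[ s ∈ Sym L ] Σ[ a ∈ Vec (idx X) (ar L s) ] fact L s (X at a) ∊ M × x ≋ S s × t ≋ tup (map (g ·_) (X at a))
  act-fact⁻¹ g M x t (mem (inj₁ i , e)) =
    ⊥-elim (suc-≢∅ (⟨⟩-injˡ (eq {x = ⟨ num 1 , ⟨ x , t ⟩ ⟩} {⟨ num 0 , g · (X ▹ i) ⟩} e)))
  act-fact⁻¹ g M x t (mem (inj₂ (s , a , m) , e)) =
    let e′ = ⟨⟩-injʳ (eq {x = ⟨ num 1 , ⟨ x , t ⟩ ⟩} {fact L s (map (g ·_) (X at a))} e) in
    s , a , mem m , ⟨⟩-injˡ e′ , ⟨⟩-injʳ e′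

  at-lookup : ∀ {m n} (a : Vec (idx X) m) (v : Vec (Fin m) n) → X at map (lookup a) v ≡ map (lookup (X at a)) v
  at-lookup a [] = refl
  at-lookup a (l ∷ v) = cong₂ _∷_ (≡-sym (Vecₚ.lookup-map l (X ▹_) a)) (at-lookup a v)

  map-·-lookup : ∀ {m n} g (a : Vec (𝕍 ℓ) m) (v : Vec (Fin m) n) (b : Vec (𝕍 ℓ) m) → (∀ l → g · lookup a l ≋ lookup b l) →
    tup (map (g ·_) (map (lookup a) v)) ≋ tup (map (lookup b) v)
  map-·-lookup g a [] b h = ≋-refl
  map-·-lookup g a (l ∷ v) b h = ⟨⟩-cong (h l) (map-·-lookup g a v b h)

  prevs-below : ∀ i (l : Fin i) → Σ[ k ∈ ℕ ] k ℕ.< i × lookup (prevs i) l ≡ xs k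
  prevs-below (suc i) fzero = i , ℕₚ.n<1+n i , refl
  prevs-below (suc i) (fsuc l) = let (k , lt , e) = prevs-below i l in k , ℕₚ.m<n⇒m<1+n lt , e

  module _ (a b : ℕ) where

    -- The parameters have indices below `i`, hence below both exchanged ones, so only the first
    -- argument moves.
    moved : ∀ i → i ℕ.≤ a → i ℕ.≤ b → ∀ l → transposition a b · lookup (X at args i a) l ≋ lookup (xs b ∷ prevs i) l
    moved i ia ib l = let t = lookup (args i a) l in
      ≡⇒≋ (cong (transposition a b ·_) (Vecₚ.lookup-map l (X ▹_) (args i a))) ◂ transposition-· a b t ◂
      go l (≡⇒≋ (≡-sym (Vecₚ.lookup-map l (X ▹_) (args i a))) ◂ args-≋ i a l)
      where
      go : ∀ l {x} → x ≋ lookup (xs a ∷ prevs i) l → fam (transposeᵗ a b) x ≋ lookup (xs b ∷ prevs i) l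
      go fzero e = transpose-a a b e
      go (fsuc l) e = let (k , lt , p) = prevs-below i l ; e′ = e ◂ ≡⇒≋ p in
        transpose-else a b
          (λ q → ℕₚ.<⇒≢ (ℕₚ.<-≤-trans lt ia) (xs-inj k a (≋-sym e′ ◂ q)))
          (λ q → ℕₚ.<⇒≢ (ℕₚ.<-≤-trans lt ib) (xs-inj k b (≋-sym e′ ◂ q))) ◂ e

    act-moves : ∀ M s i → i ℕ.≤ a → i ℕ.≤ b → factAt s i a ∊ M → factAt s i b ∊ act L X (transposition a b) M
    act-moves M s i ia ib m = ∊-respˡ
      (⟨⟩-cong ≋-refl (⟨⟩-cong ≋-refl (≡⇒≋ (cong (λ v → tup (map (transposition a b ·_) v)) (at-lookup (args i a) (pat i (ar L s)))) ◂
        map-·-lookup (transposition a b) (X at args i a) (pat i (ar L s)) (xs b ∷ prevs i) (moved i ia ib))))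
      (act-fact (transposition a b) M s (map (lookup (args i a)) (pat i (ar L s)))
        (∊-respˡ (≋-sym (⟨⟩-cong ≋-refl (⟨⟩-cong ≋-refl (≡⇒≋ (cong tup (at-lookup (args i a) (pat i (ar L s)))))) ◂ fact-args s i a)) m))

    Fixed : 𝕍 ℓ → Set ℓ
    Fixed x = x ∊ X × ¬ x ≋ xs a × ¬ x ≋ xs b

    tup-fixed : ∀ {m n} (v : Vec (idx X) m) (w : Vec (𝕍 ℓ) n) → (∀ l → Fixed (lookup w l)) →
      tup w ≋ tup (map (transposition a b ·_) (X at v)) → tup w ≋ tup (X at v)
    tup-fixed [] [] h e = ≋-refl
    tup-fixed [] (x ∷ w) h e = e
    tup-fixed (i ∷ v) [] h e = ⊥-elim (⟨⟩-≢∅ (≋-sym e))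
    tup-fixed (i ∷ v) (x ∷ w) h e = ⟨⟩-cong
      (let (m , n , n′) = h fzero in
        ≋-sym (transpose-else a b n n′) ◂
        fam-cong (transposeᵗ a b) (V-∊ VX m) (⟨⟩-injˡ e ◂ transposition-· a b i) ◂ transpose² a b (X ▹ i) (V-▹ VX i))
      (tup-fixed v w (h ∘ fsuc) (⟨⟩-injʳ e))

    -- All arguments of this fact are fixed points. A fact of the moved structure comes from one of
    -- `M` by the transposition, and undoing this involution returns the same arguments.
    act-fixes : ∀ M s i c → i ℕ.≤ a → i ℕ.≤ b → c ≢ a → c ≢ b → factAt s i c ∊ act L X (transposition a b) M → factAt s i c ∊ M
    act-fixes M s i c ia ib ca cb m =
      let (s′ , v , p , e , e′) = act-fact⁻¹ (transposition a b) M (S s) (tup w) m in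
      ∊-respˡ (⟨⟩-cong ≋-refl (⟨⟩-cong (≋-sym e) (≋-sym (tup-fixed v w (λ l → fixed l) e′)))) p
      where
      w = map (lookup (xs c ∷ prevs i)) (pat i (ar L s))
      fixed′ : ∀ l → Fixed (lookup (xs c ∷ prevs i) l)
      fixed′ fzero = xs-∊ c , (λ e → ca (xs-inj c a e)) , (λ e → cb (xs-inj c b e))
      fixed′ (fsuc l) = let (k , lt , p) = prevs-below i l in
        subst Fixed (≡-sym p) (xs-∊ k , (λ e → ℕₚ.<⇒≢ (ℕₚ.<-≤-trans lt ia) (xs-inj k a e)) ,
                                        (λ e → ℕₚ.<⇒≢ (ℕₚ.<-≤-trans lt ib) (xs-inj k b e)))
      fixed : ∀ l → Fixed (lookup w l)
      fixed l = subst Fixed (≡-sym (Vecₚ.lookup-map l (lookup (xs c ∷ prevs i)) (pat i (ar L s)))) (fixed′ (lookup (pat i (ar L s)) l))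

  moveSet : ℕ → ℕ → 𝕍 ℓ → 𝕍 ℓ
  moveSet a b A = sup (idx A) λ i → act L X (transposition a b) (A ▹ i)

  moveSet-measure : ∀ a b {A} → Meas A → ms A ≋ ms (moveSet a b A)
  moveSet-measure a b {A} m = ≋-sym (≡⇒≋ (ms-≡ (moveSet a b A)) ◂
    eq (invariant (transposition a b) (V-transposition a b) (transposition-bijection a b) A (un∊ m)) ◂ ≡⇒≋ (≡-sym (ms-≡ A)))

  -- A value μ · A outside the domain of μ is the empty set.
  Meas-inhabited : ∀ {A p} → p ∊ᴿ ms A → Meas A
  Meas-inhabited {A} {p} h =
    let (w , q , r) = ∊-⋃ (sep (⋃ (⋃ μ)) (λ y → ⟨ A , y ⟩ ∈ μ)) (∊-respʳ (≡⇒≋ (ms-≡ A)) h)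
        (_ , s) = ∊-sep (⋃ (⋃ μ)) (λ y → ⟨ A , y ⟩ ∈ μ) (graph-resp A μ) q
    in proj₁ (∊-fun {f = μ} {𝓑} isFun (mem s))

  -- Invariance only equates values of `μ`. The value at `A` contains -1, so the value at the moved
  -- set is inhabited and therefore defined.
  Meas-moveSet : ∀ a b {A} → Meas A → Meas (moveSet a b A)
  Meas-moveSet a b {A} m = Meas-inhabited {p = ℚ.- ℚ.1ℚ} (∊-respʳ (moveSet-measure a b m) (negative-∊ {p = ℚ.- ℚ.1ℚ} m (ℚ.*<* ℤ.-<+)))

  -- Events saying that a block is missed.

  module _ (s : Sym L) (i : ℕ) where

    holdsAt : ℕ → 𝕍 ℓ → Set ℓ
    holdsAt c M = factAt s i c ∊ M

    abstract
      atomSet : Tm 1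
      atomSet = sepᵗ (cst Ω Ω∈V) (atomᵗ s i #1 ∈ᵗ #0)

      atomSet-∊ : ∀ {x c M} → V x → natOf x ≡ c → M ∊ fam atomSet x → M ∊ Ω × holdsAt c M
      atomSet-∊ {x} {c} {M} vx e m = let (p , q) = ∊-sepᵗ (cst Ω Ω∈V) (atomᵗ s i #1 ∈ᵗ #0) {x ∷ []} (vx ∷ᵛ []ᵛ) m in
        p , ∊-respˡ (ev-atomᵗ s i (#1 {0}) (M ∷ x ∷ []) e) (mem q)

      ∊-atomSet : ∀ {x c M} → V x → natOf x ≡ c → M ∊ Ω → holdsAt c M → M ∊ fam atomSet x
      ∊-atomSet {x} {c} {M} vx e m h = sepᵗ-∊ (cst Ω Ω∈V) (atomᵗ s i #1 ∈ᵗ #0) {x ∷ []} (vx ∷ᵛ []ᵛ) m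
        (un∊ (∊-respˡ (≋-sym (ev-atomᵗ s i (#1 {0}) (M ∷ x ∷ []) e)) h))

    Meas-atomSet : ∀ {x c} → V x → natOf x ≡ c → Meas (fam atomSet x)
    Meas-atomSet {x} {c} vx e = ∊-respˡ (ext
      (λ {M} m → let (p , q) = ∊-sep Ω P r m in ∊-atomSet vx e p (proj₁ (sat-literal 1 s i c M) q))
      (λ {M} m → let (p , q) = atomSet-∊ vx e m in sep-∊ P r p (proj₂ (sat-literal 1 s i c M) q)))
      (mem {x = sep Ω P} (literals (literal 1 s i) (args i c)))
      where
      P : 𝕍 ℓ → Set ℓ
      P M = SatLiteral L M (literal 1 s i) (X at args i c)
      r : Resp P
      r {M} {N} e p = proj₂ (sat-literal 1 s i c N) (∊-respʳ e (proj₁ (sat-literal 1 s i c M) p))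

    Quiet : ℕ → ℕ → 𝕍 ℓ → Set ℓ
    Quiet c q M = holdsAt c M × (∀ j → j ℕ.< pow2 q → ¬ holdsAt (q ℕ.+ j) M)

    abstract
      quietSet : ℕ → Tm 1
      quietSet c = sepᵗ (cst Ω Ω∈V) ((atomᵗ s i (cst (num c) (V-num c)) ∈ᵗ #0) ∧ᵗ ∀ᵗ (powᵗ #1) (¬ᵗ (atomᵗ s i (addᵗ #2 #0) ∈ᵗ #1)))

      quietSet-∊ : ∀ c {x q M} → V x → natOf x ≡ q → M ∊ fam (quietSet c) x → M ∊ Ω × Quiet c q M
      quietSet-∊ c {x} {q} {M} vx refl m =
        let (p , h , k) = ∊-sepᵗ (cst Ω Ω∈V) ((atomᵗ s i (cst (num c) (V-num c)) ∈ᵗ #0) ∧ᵗ ∀ᵗ (powᵗ #1) (¬ᵗ (atomᵗ s i (addᵗ #2 #0) ∈ᵗ #1))) {x ∷ []} (vx ∷ᵛ []ᵛ) m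
        in p , ∊-respˡ (ev-atomᵗ s i (cst {2} (num c) (V-num c)) (M ∷ x ∷ []) (natOf-num ≋-refl)) (mem h) ,
           λ j lt a → let (l , e) = ∊-idx (num-< {ℓ} lt) in
             k l (un∊ (∊-respˡ (≋-sym (ev-atomᵗ s i (addᵗ (#2 {0}) #0) (num (pow2 q) ▹ l ∷ M ∷ x ∷ [])
               (≡-trans (natOf-num ≋-refl) (cong (q ℕ.+_) (natOf-num (≋-sym e)))))) a))

      ∊-quietSet : ∀ c {x q M} → V x → natOf x ≡ q → M ∊ Ω → Quiet c q M → M ∊ fam (quietSet c) x
      ∊-quietSet c {x} {q} {M} vx refl m (h , k) = sepᵗ-∊ (cst Ω Ω∈V) ((atomᵗ s i (cst (num c) (V-num c)) ∈ᵗ #0) ∧ᵗ ∀ᵗ (powᵗ #1) (¬ᵗ (atomᵗ s i (addᵗ #2 #0) ∈ᵗ #1))) {x ∷ []} (vx ∷ᵛ []ᵛ) m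
        (un∊ (∊-respˡ (≋-sym (ev-atomᵗ s i (cst {2} (num c) (V-num c)) (M ∷ x ∷ []) (natOf-num ≋-refl))) h) ,
         λ l a → let (j , lt , e) = ∊-num {n = pow2 q} (▹-∊ (num (pow2 q)) l) in
           k j lt (∊-respˡ (ev-atomᵗ s i (addᵗ (#2 {0}) #0) (num (pow2 q) ▹ l ∷ M ∷ x ∷ [])
             (≡-trans (natOf-num ≋-refl) (cong (q ℕ.+_) (natOf-num e)))) (mem a)))

      shifted : ℕ → Tm 1
      shifted q = letᵗ (addᵗ (cst (num q) (V-num q)) #0) (wk₁T atomSet)

      fam-shifted : ∀ q x → fam (shifted q) x ≡ fam atomSet (num (natOf (num q) ℕ.+ natOf x))
      fam-shifted q x = refl

    Meas-quietSet : ∀ c {x q} → V x → natOf x ≡ q → Meas (fam (quietSet c) x)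
    Meas-quietSet c {x} {q} vx e = ∊-respˡ (ext
      (λ m → let (p , n) = ∊-∖ A B m ; (mΩ , h) = atomSet-∊ (V-num c) (natOf-num ≋-refl) p in
        ∊-quietSet c vx e mΩ (h , λ j lt a → n (Over-∊ (shifted q) (V-num (pow2 q)) (num-< {ℓ} lt)
          (∊-respʳ (≡⇒≋ (≡-sym (fam-shifted q (num j)))) (∊-atomSet (V-num _) (index-≡ j) mΩ a)))))
      (λ m → let (mΩ , h , k) = quietSet-∊ c vx e m in ∖-∊ {a = A} {B} (∊-atomSet (V-num c) (natOf-num ≋-refl) mΩ h)
        λ b → let (y , p , r) = ∊-Over (shifted q) (num (pow2 q)) b ; (j , lt , e′) = ∊-num {n = pow2 q} p in
          k j lt (proj₂ (atomSet-∊ (V-num _) (index-≡ j) (∊-respʳ (≡⇒≋ (≡-trans (fam-shifted q y)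
            (cong (λ z → fam atomSet (num (natOf (num q) ℕ.+ z))) (natOf-cong e′)))) r)))))
      (Meas-∖ mA mB)
      where
      A B : 𝕍 ℓ
      A = fam atomSet (num c)
      B = Over (shifted q) (num (pow2 q))
      index-≡ : ∀ j → natOf (num (natOf (num q) ℕ.+ natOf (num j))) ≡ q ℕ.+ j
      index-≡ j = ≡-trans (natOf-num ≋-refl) (cong₂ ℕ._+_ (natOf-num ≋-refl) (natOf-num ≋-refl))
      mA : Meas A
      mA = Meas-atomSet (V-num c) (natOf-num ≋-refl)
      mB : Meas B
      mB = Meas-Over (shifted q) (num (pow2 q)) (V-num (pow2 q))
        (λ m → let (k , _ , e) = ∊-num {n = pow2 q} m in ∊-respˡ (≋-sym e) (num∊κ k))
        λ y _ → ∊-respˡ (≡⇒≋ (≡-sym (fam-shifted q y))) (Meas-atomSet (V-num _) refl)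

    -- Exchanging xs c with one of the 2 ^ q elements of the block gives
    -- disjoint sets of the same measure.
    quiet-bound : ∀ c {x q} → V x → natOf x ≡ q → i ℕ.≤ c → c ℕ.< q → Bound (fam (quietSet c) x) (halfPow q)
    quiet-bound c {x} {q} vx e ic cq p m = mult-bound q (subst (λ n → mult n p ℚ.≤ ℚ.1ℚ) (Listₚ.length-tabulate {n = pow2 q} copy)
      (copies-bound (List.tabulate copy) (Allₚ.tabulate⁺ λ l → Meas-moveSet c (q ℕ.+ toℕ l) mE , moveSet-measure c (q ℕ.+ toℕ l) mE)
        (AllPairsₚ.tabulate⁺ λ {k} {l} → disjoint k l) p m))
      where
      E : 𝕍 ℓ
      E = fam (quietSet c) x
      mE : Meas E
      mE = Meas-quietSet c vx e
      copy : Fin (pow2 q) → 𝕍 ℓ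
      copy l = moveSet c (q ℕ.+ toℕ l) E
      i≤ : ∀ m → i ℕ.≤ q ℕ.+ m
      i≤ m = ℕₚ.≤-trans (ℕₚ.≤-trans ic (ℕₚ.<⇒≤ cq)) (ℕₚ.m≤m+n q m)
      quiet : ∀ {M} → M ∊ E → Quiet c q M
      -- In copy `k` the fact at `q + k` holds, being the image of the one at `c`. In copy `l` with
      -- `l ≠ k` it was not touched by the exchange and still fails as in `E`.
      quiet m = proj₂ (quietSet-∊ c vx e m)
      disjoint : ∀ k l → k ≢ l → ∀ z → z ∊ copy k → ¬ z ∊ copy l
      disjoint k l ne z zk zl =
        let (u , eu) = ∊-sup zk
            (v , ev′) = ∊-sup zl
            (h , _) = quiet (▹-∊ E u)
            (_ , n) = quiet (▹-∊ E v)
            a = act-moves c (q ℕ.+ toℕ k) (E ▹ u) s i ic (i≤ (toℕ k)) h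
        in n (toℕ k) (Finₚ.toℕ<n k) (act-fixes c (q ℕ.+ toℕ l) (E ▹ v) s i (q ℕ.+ toℕ k) ic (i≤ (toℕ l))
             (λ e → ℕₚ.<⇒≢ (ℕₚ.<-≤-trans cq (ℕₚ.m≤m+n q (toℕ k))) (≡-sym e))
             (λ e → ne (Finₚ.toℕ-injective (ℕₚ.+-cancelˡ-≡ q (toℕ k) (toℕ l) e)))
             (∊-respʳ (≋-sym eu ◂ ev′) a))

  -- Quantifying over all `s` named by `u` makes this true when `u` names no symbol, in agreement
  -- with the empty conjunction in `leaf′`.
  LeafP : (u i N k j M : 𝕍 ℓ) → Set ℓ
  LeafP u i N k j M = ∀ s → f · S s ≋ u →
    Signed (natOf N) (factAt s (natOf i) (index (natOf i) (natOf N) (natOf k) (natOf j))) M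

  abstract
    leaf-def : ∀ {n} (u i N k j M : Tm n) → Def (λ ρ → ↑ (LeafP (ev u ρ) (ev i ρ) (ev N ρ) (ev k ρ) (ev j ρ) (ev M ρ)))
    leaf-def {n} u i N k j M = isDef (sealᶠ
      (validᵗ u ⇒ᵗ (((normᵗ N ≈ᵗ ∅ᵗ) ∧ᵗ (¬ᵗ (F ∈ᵗ M))) ∨ᵗ ((¬ᵗ (normᵗ N ≈ᵗ ∅ᵗ)) ∧ᵗ (F ∈ᵗ M))))
      (λ ρ → LeafP (ev u ρ) (ev i ρ) (ev N ρ) (ev k ρ) (ev j ρ) (ev M ρ))
      λ ρ v → (λ h s e → to (natOf (ev N ρ)) (sem ρ s e) (h (s , un≋ e))) , (λ h (s , e) → from (natOf (ev N ρ)) (sem ρ s (eq e)) (h s (eq e))))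
      where
      F : Tm n
      F = factᵗ (symOfᵗ u) i (indexᵗ i N k j)
      ind : Vec (𝕍 ℓ) n → ℕ
      ind ρ = index (natOf (ev i ρ)) (natOf (ev N ρ)) (natOf (ev k ρ)) (natOf (ev j ρ))
      sem : ∀ ρ s → f · S s ≋ ev u ρ → ev F ρ ≋ factAt s (natOf (ev i ρ)) (ind ρ)
      sem ρ s e = ≡⇒≋ (cong (codeFact (symOf (ev u ρ)) (natOf (ev i ρ))) (natOf-num ≋-refl)) ◂
        codeFact-≋ s (natOf (ev i ρ)) (ind ρ) (symOf-≋ s e)
      to : ∀ n {x y M} → x ≋ y → ((num {ℓ} n ≈ ∅) × (¬ x ∈ M)) ⊎ ((¬ num {ℓ} n ≈ ∅) × x ∈ M) → Signed n y M
      to zero {x} {y} {M} e (inj₁ (_ , n)) m = n (un∊ (∊-respˡ (≋-sym e) m))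
      to zero e (inj₂ (n , _)) = ⊥-elim (n (≈-refl ∅))
      to (suc n) e (inj₁ (p , _)) = ⊥-elim (suc-≢∅ (eq {x = num (suc n)} p))
      to (suc n) {x} {y} {M} e (inj₂ (_ , m)) = ∊-respˡ e (mem {y = M} m)
      from : ∀ n {x y M} → x ≋ y → Signed n y M → ((num {ℓ} n ≈ ∅) × (¬ x ∈ M)) ⊎ ((¬ num {ℓ} n ≈ ∅) × x ∈ M)
      from zero {x} {y} {M} e h = inj₁ (≈-refl ∅ , λ m → h (∊-respˡ e (mem {y = M} m)))
      from (suc n) e h = inj₂ ((λ p → suc-≢∅ (eq {x = num (suc n)} p)) , un∊ (∊-respˡ (≋-sym e) h))

  -- Measurability of `U`, level by level.

  leafF : ∀ {n} (u i N k j M : Tm n) → Fm n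
  leafF u i N k j M = mkFm (λ ρ → LeafP (ev u ρ) (ev i ρ) (ev N ρ) (ev k ρ) (ev j ρ) (ev M ρ)) (leaf-def u i N k j M)

  κᵗ : ∀ {n} → Tm n
  κᵗ = cst κ Vκ

  F4 : ∀ {n} (u i N k M : Tm n) → Fm n
  F4 u i N k M = ∃ᵗ κᵗ (leafF (wkT u) (wkT i) (wkT N) (wkT k) #0 (wkT M))

  F3 : ∀ {n} (u i N M : Tm n) → Fm n
  F3 u i N M = ∀ᵗ κᵗ (F4 (wkT u) (wkT i) (wkT N) #0 (wkT M))

  F2 : ∀ {n} (u i M : Tm n) → Fm n
  F2 u i M = ∃ᵗ κᵗ (F3 (wkT u) (wkT i) #0 (wkT M))

  F1 : ∀ {n} (u M : Tm n) → Fm n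
  F1 u M = ∀ᵗ κᵗ (F2 (wkT u) #0 (wkT M))

  F0 : ∀ {n} (M : Tm n) → Fm n
  F0 M = ∀ᵗ κᵗ (F1 #0 (wkT M))

  atᵗ : ∀ {n} → idx κ → Tm n
  atᵗ i = cst (κ ▹ i) (V-▹ Vκ i)

  -- In Φ, variable 0 is the structure and variable 1 the parameter of the family.
  setᵗ : Fm 2 → Tm 1
  setᵗ Φ = sepᵗ (cst Ω Ω∈V) Φ

  ∊-set : ∀ Φ {x M} → V x → M ∊ fam (setᵗ Φ) x → M ∊ Ω × holds Φ (M ∷ x ∷ [])
  ∊-set Φ {x} vx m = ∊-sepᵗ (cst Ω Ω∈V) Φ {x ∷ []} (vx ∷ᵛ []ᵛ) m

  set-∊ : ∀ Φ {x M} → V x → M ∊ Ω → holds Φ (M ∷ x ∷ []) → M ∊ fam (setᵗ Φ) x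
  set-∊ Φ {x} vx m h = sepᵗ-∊ (cst Ω Ω∈V) Φ {x ∷ []} (vx ∷ᵛ []ᵛ) m h

  MeasSet : Fm 2 → Set ℓ
  MeasSet Φ = ∀ i → Meas (fam (setᵗ Φ) (κ ▹ i))

  Meas-¬ : ∀ Φ → MeasSet Φ → MeasSet (¬ᵗ Φ)
  Meas-¬ Φ h i = ∊-respˡ (ext
    (λ m → let (p , q) = ∊-∖ Ω A m in set-∊ (¬ᵗ Φ) v p λ r → q (set-∊ Φ v p r))
    (λ m → let (p , q) = ∊-set (¬ᵗ Φ) v m in ∖-∊ {a = Ω} {A} p λ r → q (proj₂ (∊-set Φ v r)))) (Meas-Ω∖ (h i))
    where
    v = V-▹ Vκ i
    A = fam (setᵗ Φ) (κ ▹ i)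

  overSet : ∀ Φ {M} → M ∊ Over (setᵗ Φ) κ → M ∊ Ω × Σ[ i ∈ idx κ ] holds Φ (M ∷ κ ▹ i ∷ [])
  overSet Φ {M} m =
    let (y , p , q) = ∊-Over (setᵗ Φ) κ m ; vy = V-∊ Vκ p ; (r , h) = ∊-set Φ vy q ; (i , e) = ∊-idx p in
    r , i , holds-resp Φ {M ∷ y ∷ []} {M ∷ κ ▹ i ∷ []} (V-M r ∷ᵛ vy ∷ᵛ []ᵛ) (V-M r ∷ᵛ V-▹ Vκ i ∷ᵛ []ᵛ)
      (λ { fzero → ≋-refl ; (fsuc fzero) → e }) h
    where
    V-M : ∀ {M} → M ∊ Ω → V M
    V-M r = V-∊ Ω∈V r

  setOver : ∀ Φ {M} i → M ∊ Ω → holds Φ (M ∷ κ ▹ i ∷ []) → M ∊ Over (setᵗ Φ) κ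
  setOver Φ i m h = Over-∊ (setᵗ Φ) Vκ (▹-∊ κ i) (set-∊ Φ (V-▹ Vκ i) m h)

  Meas-OverSet : ∀ Φ → MeasSet Φ → Meas (Over (setᵗ Φ) κ)
  Meas-OverSet Φ h = Meas-Over (setᵗ Φ) κ Vκ id λ y p → let (i , e) = ∊-idx p in
    ∊-respˡ (fam-cong (setᵗ Φ) (V-▹ Vκ i) (≋-sym e)) (h i)

  Meas-∃ : ∀ Φ {T} → MeasSet Φ → (∀ {M} → M ∊ T → M ∊ Ω × Σ[ i ∈ idx κ ] holds Φ (M ∷ κ ▹ i ∷ [])) →
    (∀ {M} → M ∊ Ω → Σ[ i ∈ idx κ ] holds Φ (M ∷ κ ▹ i ∷ []) → M ∊ T) → Meas T
  Meas-∃ Φ h to from = ∊-respˡ (ext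
    (λ m → let (p , q) = overSet Φ m in from p q)
    (λ m → let (p , i , q) = to m in setOver Φ i p q)) (Meas-OverSet Φ h)

  Meas-∀ : ∀ Φ {T} → MeasSet Φ → (∀ {M} → M ∊ T → M ∊ Ω × (∀ i → holds Φ (M ∷ κ ▹ i ∷ []))) →
    (∀ {M} → M ∊ Ω → (∀ i → holds Φ (M ∷ κ ▹ i ∷ [])) → M ∊ T) → Meas T
  Meas-∀ Φ h to from = ∊-respˡ (ext
    (λ m → let (p , q) = ∊-∖ Ω A m in from p λ i → stable₀ λ n → q (setOver (¬ᵗ Φ) i p n))
    (λ m → let (p , q) = to m in ∖-∊ {a = Ω} {A} p λ r → let (_ , i , n) = overSet (¬ᵗ Φ) r in n (q i)))
    (Meas-Ω∖ (Meas-OverSet (¬ᵗ Φ) (Meas-¬ Φ h)))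
    where
    A = Over (setᵗ (¬ᵗ Φ)) κ

  -- Each level is a family in the last variable bound outside it, with the other variables frozen.
  -- In this form `Meas-∃` and `Meas-∀` lead from each level to the next.
  Φ5 : (u i N k : idx κ) → Fm 2
  Φ5 u i N k = leafF (atᵗ u) (atᵗ i) (atᵗ N) (atᵗ k) #1 #0
  Φ4 : (u i N : idx κ) → Fm 2
  Φ4 u i N = F4 (atᵗ u) (atᵗ i) (atᵗ N) #1 #0
  Φ3 : (u i : idx κ) → Fm 2
  Φ3 u i = F3 (atᵗ u) (atᵗ i) #1 #0
  Φ2 : (u : idx κ) → Fm 2
  Φ2 u = F2 (atᵗ u) #1 #0
  Φ1 : Fm 2
  Φ1 = F1 #1 #0

  Meas-5 : ∀ u i N k → MeasSet (Φ5 u i N k)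
  Meas-5 u i N k j = go (em₀ (Valid (κ ▹ u)))
    where
    v = V-▹ Vκ j
    c = indexOf i N k j
    to : ∀ {M} → LeafP (κ ▹ u) (κ ▹ i) (κ ▹ N) (κ ▹ k) (κ ▹ j) M → holds (Φ5 u i N k) (M ∷ κ ▹ j ∷ [])
    to h = h
    from : ∀ {M} → holds (Φ5 u i N k) (M ∷ κ ▹ j ∷ []) → LeafP (κ ▹ u) (κ ▹ i) (κ ▹ N) (κ ▹ k) (κ ▹ j) M
    from h = h
    go : Dec (Valid (κ ▹ u)) → Meas (fam (setᵗ (Φ5 u i N k)) (κ ▹ j))
    go (no n) = ∊-respˡ (ext (λ m → set-∊ (Φ5 u i N k) v m (to λ s e → ⊥-elim (n (s , un≋ e)))) (λ m → proj₁ (∊-set (Φ5 u i N k) v m))) Meas-Ω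
    go (yes (s , e)) = ∊-respˡ (ext
      (λ {M} m → let (p , q) = ∊-sep Ω P r m in set-∊ (Φ5 u i N k) v p (to λ s′ e′ →
        Signed-resp (κ→nat N) (factAt-cong s s′ (κ→nat i) c (f-injective s s′ (eq e) e′)) (proj₁ (sat-literal (κ→nat N) s (κ→nat i) c M) q)))
      (λ {M} m → let (p , q) = ∊-set (Φ5 u i N k) v m in sep-∊ P r p (proj₂ (sat-literal (κ→nat N) s (κ→nat i) c M) (from q s (eq e)))))
      (mem {x = sep Ω P} (literals (literal (κ→nat N) s (κ→nat i)) (args (κ→nat i) c)))
      where
      P : 𝕍 ℓ → Set ℓ
      P M = SatLiteral L M (literal (κ→nat N) s (κ→nat i)) (X at args (κ→nat i) c)
      rS : ∀ n {x M M′} → M ≋ M′ → Signed n x M → Signed n x M′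
      rS zero e n m = n (∊-respʳ (≋-sym e) m)
      rS (suc _) e m = ∊-respʳ e m
      r : Resp P
      r {M} {M′} e p = proj₂ (sat-literal (κ→nat N) s (κ→nat i) c M′) (rS (κ→nat N) e (proj₁ (sat-literal (κ→nat N) s (κ→nat i) c M) p))

  Meas-4 : ∀ u i N → MeasSet (Φ4 u i N)
  Meas-4 u i N k = Meas-∃ (Φ5 u i N k) (Meas-5 u i N k) (∊-set (Φ4 u i N) (V-▹ Vκ k)) (set-∊ (Φ4 u i N) (V-▹ Vκ k))

  Meas-3 : ∀ u i → MeasSet (Φ3 u i)
  Meas-3 u i N = Meas-∀ (Φ4 u i N) (Meas-4 u i N) (∊-set (Φ3 u i) (V-▹ Vκ N)) (set-∊ (Φ3 u i) (V-▹ Vκ N))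

  Meas-2 : ∀ u → MeasSet (Φ2 u)
  Meas-2 u i = Meas-∃ (Φ3 u i) (Meas-3 u i) (∊-set (Φ2 u) (V-▹ Vκ i)) (set-∊ (Φ2 u) (V-▹ Vκ i))

  Meas-1 : MeasSet Φ1
  Meas-1 u = Meas-∀ (Φ2 u) (Meas-2 u) (∊-set Φ1 (V-▹ Vκ u)) (set-∊ Φ1 (V-▹ Vκ u))

  sat⇒ : ∀ M → Sat κ L X M U → holds (F0 (#0 {0})) (M ∷ [])
  sat⇒ M h u i = let (N , h′) = h u i in N , λ k → let (j , h″) = h′ k in j , λ s e → sat-leaf⇒ u i N k j s M e h″

  sat⇐ : ∀ M → holds (F0 (#0 {0})) (M ∷ []) → Sat κ L X M U
  sat⇐ M h u i = let (N , h′) = h u i in N , λ k → let (j , h″) = h′ k in j , sat-leaf⇐ u i N k j M h″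

  -- Null sets and the Borel-Cantelli argument.

  Null : Fm 2 → Set ℓ
  Null Φ = ∀ i → Bound (fam (setᵗ Φ) (κ ▹ i)) ℚ.0ℚ

  null-over : ∀ Φ {T} → MeasSet Φ → Null Φ → Meas T → (∀ {M} → M ∊ T → M ∊ Ω × Σ[ i ∈ idx κ ] holds Φ (M ∷ κ ▹ i ∷ [])) →
    Bound T ℚ.0ℚ
  null-over Φ m n mT h = Bound-⊑ mT (Meas-OverSet Φ m) (λ q → let (p , i , r) = h q in setOver Φ i p r)
    (null-union (setᵗ Φ) m n)

  module _ (c : ℕ) (s : Sym L) (i : ℕ) where

    number : idx κ → Maybe ℕ
    number j = ite (em₀ (κ ▹ j ∊ ω)) (just (κ→nat j)) nothing

    number-just : ∀ {j n} → number j ≡ just n → κ ▹ j ≋ num n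
    number-just {j} e with em₀ (κ ▹ j ∊ ω)
    number-just {j} refl | yes m = let (k , p) = ∊-ω m in p ◂ num-≋ (≡-sym (natOf-num p))
    number-just {j} () | no _

    abstract
      -- A numeral `k` gives the event for the block `q = k + (N + i)`. Other elements of `κ` give
      -- `∅`, in accordance with their weight 0.
      quietFam : ℕ → Tm 1
      quietFam N = iteᵗ (#0 ∈ᵗ ωᵗ) (letᵗ (addᵗ #0 (cst (num (N ℕ.+ i)) (V-num (N ℕ.+ i)))) (wk₁T (quietSet s i c))) ∅ᵗ

      quietFam-yes : ∀ N {x} → x ∊ ω → fam (quietFam N) x ≡ fam (quietSet s i c) (num (natOf x ℕ.+ (N ℕ.+ i)))
      quietFam-yes N {x} m = ≡-trans (ite-yes (em₀ _) (un∊ m))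
        (cong (λ z → fam (quietSet s i c) (num (natOf x ℕ.+ z))) (natOf-num ≋-refl))

      quietFam-no : ∀ N {x} → ¬ x ∊ ω → fam (quietFam N) x ≡ ∅
      quietFam-no N n = ite-no (em₀ _) (n ∘ mem)

    Meas-quietFam : ∀ N x → Meas (fam (quietFam N) x)
    Meas-quietFam N x = case em₀ (x ∊ ω) of λ
      { (yes m) → ∊-respˡ (≡⇒≋ (≡-sym (quietFam-yes N m))) (Meas-quietSet s i c (V-num _) (natOf-num ≋-refl))
      ; (no n) → ∊-respˡ (≡⇒≋ (≡-sym (quietFam-no N n))) Meas-∅ }

  -- The empty set is disjoint from itself, so arbitrarily many copies of it fit into `Ω`.
  null-∅ : Bound ∅ ℚ.0ℚ
  null-∅ p m = archimedean λ q → mult-bound q (subst (λ n → mult n p ℚ.≤ ℚ.1ℚ) (Listₚ.length-replicate (pow2 q))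
    (copies-bound (List.replicate (pow2 q) ∅) (Allₚ.replicate⁺ (pow2 q) (Meas-∅ , ≋-refl)) (disjoint (pow2 q)) p m))
    where
    disjoint : ∀ n → AllPairs (λ A B → ∀ z → z ∊ A → ¬ z ∊ B) (List.replicate n ∅)
    disjoint zero = AllPairs.[]
    disjoint (suc n) = Allₚ.replicate⁺ n (λ z m → ⊥-elim (∉∅ m)) AllPairs.∷ disjoint n

  -- Borel–Cantelli for the events quietSet s i c.
  module _ (c : ℕ) (s : Sym L) (i : ℕ) (i≤c : i ℕ.≤ c) where

    -- The `k`-th event has measure at most 2 ^ - (k + n + 1 + i), hence at most 2 ^ - (n + 1) times
    -- 2 ^ - k, and distinct `k` sum to at most 2. The condition `c ≤ n` places all these blocks
    -- beyond `c`.
    tail-bound : ∀ n → c ℕ.≤ n → Bound (Over (quietFam c s i (suc n)) κ) (halfPow n)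
    tail-bound n c≤n = subadditive (quietFam c s i (suc n)) (λ j → Meas-quietFam c s i (suc n) (κ ▹ j))
      (λ j → halfPow (suc n) ℚ.* weight (number c s i) j) bound
      (λ is d → ℚₚ.≤-trans (ℚₚ.≤-reflexive (sumOver-* (halfPow (suc n)) (weight (number c s i)) is))
        (ℚₚ.≤-trans (*-monoˡ (suc n) (sum-weight (number c s i) is (separated is d))) (ℚₚ.≤-reflexive (double-half n))))
      where
      *-monoˡ : ∀ m {p q} → p ℚ.≤ q → halfPow m ℚ.* p ℚ.≤ halfPow m ℚ.* q
      *-monoˡ m le = ℚₚ.*-monoˡ-≤-nonNeg (halfPow m) {{ℚ.nonNegative (halfPow-≥0 m)}} le
      separated : ∀ is → AllPairs (λ i j → ¬ κ ▹ i ≈ κ ▹ j) is →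
        AllPairs (λ k l → ∀ m n → number c s i k ≡ just m → number c s i l ≡ just n → m ≢ n) is
      separated is d = AllPairs.map (λ {k} {l} ne m n p q e → ne (un≋ (number-just c s i {k} p ◂ num-≋ e ◂ ≋-sym (number-just c s i {l} q)))) d
      bound : ∀ j → Bound (fam (quietFam c s i (suc n)) (κ ▹ j)) (halfPow (suc n) ℚ.* weight (number c s i) j)
      bound j with em₀ (κ ▹ j ∊ ω)
      ... | no h = λ p m → ℚₚ.≤-trans (null-∅ p (∊-respʳ (ms-cong (≡⇒≋ (quietFam-no c s i (suc n) h))) m)) (ℚₚ.≤-reflexive (≡-sym (ℚₚ.*-zeroʳ (halfPow (suc n)))))
      ... | yes h = λ p m → ℚₚ.≤-trans
        (quiet-bound s i c (V-num q) (natOf-num ≋-refl) i≤c c<q p (∊-respʳ (ms-cong (≡⇒≋ (quietFam-yes c s i (suc n) h))) m))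
        (ℚₚ.≤-trans (subst (λ m → halfPow m ℚ.≤ halfPow (suc n ℕ.+ κ→nat j)) q-≡ (halfPow-mono (suc n ℕ.+ κ→nat j) i))
          (ℚₚ.≤-reflexive (halfPow-+ (suc n) (κ→nat j))))
        where
        q = κ→nat j ℕ.+ (suc n ℕ.+ i)
        q-≡ : i ℕ.+ (suc n ℕ.+ κ→nat j) ≡ q
        q-≡ = ≡-trans (ℕₚ.+-comm i (suc n ℕ.+ κ→nat j)) (≡-trans (cong (ℕ._+ i) (ℕₚ.+-comm (suc n) (κ→nat j))) (ℕₚ.+-assoc (κ→nat j) (suc n) i))
        c<q : c ℕ.< q
        c<q = ℕₚ.≤-trans (s≤s c≤n) (ℕₚ.≤-trans (ℕₚ.m≤m+n (suc n) i) (ℕₚ.m≤n+m (suc n ℕ.+ i) (κ→nat j)))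

    borel-cantelli : ∀ {T} → Meas T → (∀ n → T ⊑ Over (quietFam c s i (suc n)) κ) → Bound T ℚ.0ℚ
    borel-cantelli mT h p m = archimedean λ q → ℚₚ.≤-trans
      (Bound-⊑ mT (Meas-Over (quietFam c s i (suc (q ℕ.+ c))) κ Vκ id λ y _ → Meas-quietFam c s i (suc (q ℕ.+ c)) y)
        (h (q ℕ.+ c)) (tail-bound (q ℕ.+ c) (ℕₚ.m≤n+m c q)) p m)
      (subst (λ k → halfPow k ℚ.≤ halfPow q) (ℕₚ.+-comm c q) (halfPow-mono q c))

  -- Write `n` for the pattern. In a bad structure the failure of the disjunct `N = 0` yields some
  -- `k` with the fact at `k + n`; the failure of each `N = m + 1` yields a missed block from number
  -- `m + 1 + n` on. So `Bad` is covered by the sets `B` at `k`, to each of which `borel-cantelli`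
  -- applies with `c = k + n`.
  null-2 : ∀ u → Null (¬ᵗ Φ2 u)
  null-2 u i = go (em₀ (Valid (κ ▹ u)))
    where
    n = κ→nat i
    Bad : 𝕍 ℓ
    Bad = fam (setᵗ (¬ᵗ Φ2 u)) (κ ▹ i)
    mBad : Meas Bad
    mBad = Meas-¬ (Φ2 u) (Meas-2 u) i
    bad : ∀ {M} → M ∊ Bad → M ∊ Ω × ∀ N → Σ[ k ∈ idx κ ] ∀ j → ¬ LeafP (κ ▹ u) (κ ▹ i) (κ ▹ N) (κ ▹ k) (κ ▹ j) M
    bad m = let (p , h) = ∊-set (¬ᵗ Φ2 u) (V-▹ Vκ i) m in p , λ N →
      let (k , h′) = ¬∀⇒∃ λ a → h (N , a) in k , λ j q → h′ (j , q)
    go : Dec (Valid (κ ▹ u)) → Bound Bad ℚ.0ℚ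
    go (no h) = Bound-⊑ mBad Meas-∅ (λ m → ⊥-elim (let (_ , b) = bad m ; (k , b′) = b (nat→κ 0) in
      b′ (nat→κ 0) λ s e → ⊥-elim (h (s , un≋ e)))) null-∅
    go (yes (s , e)) = Bound-⊑ mBad (Meas-Over B κ Vκ id λ y m → Meas-B (V-∊ Vκ m))
      covered (null-union B (λ k → Meas-B (V-▹ Vκ k)) λ k → borel-cantelli (κ→nat k ℕ.+ n) s n (ℕₚ.m≤n+m n (κ→nat k)) (Meas-B (V-▹ Vκ k)) (quiet k))
      where
      φ : Fm 2
      φ = atomᵗ s n (addᵗ #1 (cst (num n) (V-num n))) ∈ᵗ #0
      φ-≋ : ∀ x M → ev (atomᵗ s n (addᵗ #1 (cst (num n) (V-num n)))) (M ∷ x ∷ []) ≋ factAt s n (natOf x ℕ.+ n)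
      φ-≋ x M = ev-atomᵗ s n (addᵗ #1 (cst (num n) (V-num n))) (M ∷ x ∷ []) (≡-trans (natOf-num ≋-refl) (cong (natOf x ℕ.+_) (natOf-num ≋-refl)))
      B : Tm 1
      B = sepᵗ (cst Bad (V-Meas mBad)) φ
      ∊-B : ∀ {x M} → V x → M ∊ fam B x → M ∊ Bad × holdsAt s n (natOf x ℕ.+ n) M
      ∊-B {x} {M} vx m = let (p , q) = ∊-sepᵗ (cst Bad (V-Meas mBad)) φ {x ∷ []} (vx ∷ᵛ []ᵛ) m in p , ∊-respˡ (φ-≋ x M) (mem q)
      B-∊ : ∀ {x M} → V x → M ∊ Bad → holdsAt s n (natOf x ℕ.+ n) M → M ∊ fam B x
      B-∊ {x} {M} vx m h = sepᵗ-∊ (cst Bad (V-Meas mBad)) φ {x ∷ []} (vx ∷ᵛ []ᵛ) m (un∊ (∊-respˡ (≋-sym (φ-≋ x M)) h))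
      Meas-B : ∀ {x} → V x → Meas (fam B x)
      Meas-B {x} vx = ∊-respˡ (ext
        (λ {M} m → let (p , q) = ∊-∖ Bad (Ω ∖ A) m in B-∊ vx p (proj₂ (atomSet-∊ s n (V-num _) (natOf-num ≋-refl)
          (stable₀ λ r → q (∖-∊ {a = Ω} {A} (proj₁ (bad p)) r)))))
        (λ {M} m → let (p , q) = ∊-B vx m in ∖-∊ {a = Bad} {Ω ∖ A} p λ r → proj₂ (∊-∖ Ω A r)
          (∊-atomSet s n (V-num _) (natOf-num ≋-refl) (proj₁ (bad p)) q)))
        (Meas-∖ mBad (Meas-Ω∖ (Meas-atomSet s n (V-num _) (natOf-num ≋-refl))))
        where
        A : 𝕍 ℓ
        A = fam (atomSet s n) (num (natOf x ℕ.+ n))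
      holds-cong : ∀ s′ c {M} → f · S s′ ≋ κ ▹ u → holdsAt s n c M → holdsAt s′ n c M
      holds-cong s′ c e′ = ∊-respˡ (factAt-cong s s′ n c (f-injective s s′ (eq e) e′))
      covered : Bad ⊑ Over B κ
      covered {M} m =
        let (p , b) = bad m ; (k , h) = b (nat→κ 0) in
        Over-∊ B Vκ (▹-∊ κ k) (B-∊ (V-▹ Vκ k) m (stable₀ λ r → h (nat→κ 0) λ s′ e′ →
          subst (λ N → Signed N (factAt s′ n (index n N (κ→nat k) (κ→nat (nat→κ 0)))) M) (≡-sym (κ→nat→κ 0))
            λ r′ → r (∊-respˡ (factAt-cong s′ s n (κ→nat k ℕ.+ n) (f-injective s′ s e′ (eq e))) r′)))
      quiet : ∀ k m → fam B (κ ▹ k) ⊑ Over (quietFam (κ→nat k ℕ.+ n) s n (suc m)) κ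
      quiet k m {M} q =
        let (p , h) = ∊-B (V-▹ Vκ k) q
            (pΩ , b) = bad p
            (k′ , h′) = b (nat→κ (suc m))
            l = κ→nat k′
            q = l ℕ.+ (suc m ℕ.+ n)
        in Over-∊ (quietFam (κ→nat k ℕ.+ n) s n (suc m)) Vκ (num∊κ l)
          (∊-respʳ (≡⇒≋ (≡-sym (quietFam-yes (κ→nat k ℕ.+ n) s n (suc m) num∊ω)))
            (∊-quietSet s n (κ→nat k ℕ.+ n) (V-num _) (≡-trans (natOf-num ≋-refl) (cong (ℕ._+ (suc m ℕ.+ n)) (natOf-num ≋-refl))) pΩ
              (h , λ j lt a → h′ (nat→κ j) λ s′ e′ →
                subst₂ (λ N j′ → Signed N (factAt s′ n (index n N l j′)) M) (≡-sym (κ→nat→κ (suc m))) (≡-sym (κ→nat→κ j))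
                  (holds-cong s′ _ e′ (subst (λ b → holdsAt s n (q ℕ.+ b) M) (≡-sym (ite-yes (j ℕ.<? pow2 q) lt)) a)))))

  null-1 : Null (¬ᵗ Φ1)
  null-1 u = null-over (¬ᵗ Φ2 u) (Meas-¬ (Φ2 u) (Meas-2 u)) (null-2 u) (Meas-¬ Φ1 Meas-1 u)
    λ m → let (p , h) = ∊-set (¬ᵗ Φ1) (V-▹ Vκ u) m in p , ¬∀⇒∃ h

  -- From measure one to random generics.

  lit-resp : ∀ {m} (φ : Literal L m) a {M N} → M ≋ N → SatLiteral L M φ a ↔ SatLiteral L N φ a
  lit-resp (rel s v) a e = (λ m → un∊ (∊-respʳ e (mem m))) , (λ m → un∊ (∊-respʳ (≋-sym e) (mem m)))
  lit-resp (Literal.eq i j) a e = id , id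
  lit-resp (neg φ) a e = let (p , q) = lit-resp φ a e in (λ n m → n (q m)) , (λ n m → n (p m))

  sat-resp : ∀ (γ : Code κ L X) {M N} → M ≋ N → Sat κ L X M γ ↔ Sat κ L X N γ
  sat-resp (basic φ a) e = All.map (λ {ψ} → proj₁ (lit-resp ψ (X at a) e)) , All.map (λ {ψ} → proj₂ (lit-resp ψ (X at a) e))
  sat-resp (¬' γ) e = let (p , q) = sat-resp γ e in (λ n m → n (q m)) , (λ n m → n (p m))
  sat-resp (⋁ Γ _) e = (λ (i , h) → i , proj₁ (sat-resp (Γ i) e) h) , (λ (i , h) → i , proj₂ (sat-resp (Γ i) e) h)
  sat-resp (⋀ Γ _) e = (λ h i → proj₁ (sat-resp (Γ i) e) (h i)) , (λ h i → proj₂ (sat-resp (Γ i) e) (h i))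

  SatU : 𝕍 ℓ → Set ℓ
  SatU M = Sat κ L X M U

  setU : 𝕍 ℓ
  setU = sep Ω SatU

  Meas-U : Meas setU
  Meas-U = Meas-∀ Φ1 Meas-1
    (λ {M} m → let (p , q) = ∊-sep Ω SatU (λ e → proj₁ (sat-resp U e)) m in p , sat⇒ M q)
    (λ {M} p h → sep-∊ SatU (λ e → proj₁ (sat-resp U e)) p (sat⇐ M h))

  null-U : Bound (Ω ∖ setU) ℚ.0ℚ
  null-U = null-over (¬ᵗ Φ1) (Meas-¬ Φ1 Meas-1) null-1 (Meas-Ω∖ Meas-U)
    λ {M} m → let (p , q) = ∊-∖ Ω setU m in p , ¬∀⇒∃ λ h → q (sep-∊ SatU (λ e → proj₁ (sat-resp U e)) p (sat⇐ M h))

  -- The bound gives only `p ≤ 0` for the members of the cut; openness makes it strict, as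
  -- membership in `0ᴿ` demands.
  null⇒0ᴿ : ∀ {A} → Meas A → Bound A ℚ.0ℚ → ms A ≋ 0ᴿ
  null⇒0ᴿ {A} mA h = ext
    (λ {z} m → let (j , e) = ∊-idx m ; (p , e′) = IsReal.rational isR j
                   (q , lt , r) = open-∊ mA (∊-respˡ (e ◂ eq {x = ms A ▹ j} {⌜ p ⌝ᵠ} e′) m)
               in ∊-respˡ (≋-sym (e ◂ eq {x = ms A ▹ j} {⌜ p ⌝ᵠ} e′)) (cut-∊ (ℚₚ.<-≤-trans lt (h q r))))
    (λ m → ∊-respʳ (≡⇒≋ (≡-sym (ms-≡ A))) (⊆⇒⊑ {x = 0ᴿ} {μ · A} (nonnegative A (un∊ mA)) m))
    where
    isR : IsReal (ms A)
    isR = subst IsReal (≡-sym (ms-≡ A)) (real A (un∊ mA))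

  null-cover : ∀ {A} → Meas A → Bound A ℚ.0ℚ → Bound (Ω ∖ A) ℚ.0ℚ → Bound Ω ℚ.0ℚ
  null-cover {A} mA b b′ = Bound-⊑ Meas-Ω (Meas-Over D κ Vκ id λ y _ → Meas-cases mA mC (split y))
      (λ {z} m → case em₀ (z ∊ A) of λ
        { (yes p) → Over-∊ D Vκ (num∊κ 0) (∊-respʳ (≋-sym (cases-0 (V-Meas mA) (V-Meas mC) ≋-refl)) p)
        ; (no p) → Over-∊ D Vκ (num∊κ 1) (∊-respʳ (≋-sym (cases-1 (V-Meas mA) (V-Meas mC) ≋-refl)) (∖-∊ {a = Ω} {A} m p)) })
      (null-union D (λ i → Meas-cases mA mC (split (κ ▹ i))) λ i → piece (split (κ ▹ i)))
    where
    mC : Meas (Ω ∖ A)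
    mC = Meas-Ω∖ mA
    D : Tm 1
    D = cases (V-Meas mA) (V-Meas mC)
    split : ∀ x → Split A (Ω ∖ A) x (fam D x)
    split = cases-split (V-Meas mA) (V-Meas mC)
    piece : ∀ {x E} → Split A (Ω ∖ A) x E → Bound E ℚ.0ℚ
    piece (inj₁ (_ , e)) p m = b p (∊-respʳ (ms-cong e) m)
    piece (inj₂ (inj₁ (_ , e))) p m = b′ p (∊-respʳ (ms-cong e) m)
    piece (inj₂ (inj₂ e)) p m = null-∅ p (∊-respʳ (ms-cong e) m)

  -- If `U` were null as well as its complement, so would be `Ω`, whose cut contains 1/2.
  U-positive : 0ᴿ <ᴿ measure SatU
  U-positive le = ½≰0 (Bound-Ω ℚ.½ ½∊Ω)
    where
    ½≰0 : ¬ ℚ.½ ℚ.≤ ℚ.0ℚ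
    ½≰0 (ℚ.*≤* (ℤ.+≤+ ()))
    ½∊Ω : ℚ.½ ∊ᴿ ms Ω
    ½∊Ω = ∊-respʳ {z = ⌜ ℚ.½ ⌝ᵠ} {1ᴿ} {ms Ω} (≋-sym (≡⇒≋ (ms-≡ Ω) ◂ eq {y = 1ᴿ} total))
      (cut-∊ {ℓ} {ℚ.½} {ℚ.1ℚ} (ℚ.*<* (ℤ.+<+ (s≤s (s≤s z≤n)))))
    Bound-Ω : Bound Ω ℚ.0ℚ
    Bound-Ω = null-cover Meas-U (λ p m → ℚₚ.<⇒≤ (∊-cut {ℓ} {p} {ℚ.0ℚ}
      (⊆⇒⊑ {x = μ · setU} {0ᴿ} le (∊-respʳ {z = ⌜ p ⌝ᵠ} {ms setU} {μ · setU} (≡⇒≋ (ms-≡ setU)) m)))) null-U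

  random-generic : ∀ G M → IsRandomGeneric V κ L X ν G M → Int κ L X (V [ G ]) U M
  random-generic G M r = member U (upward p (⌜_⌝ κ L X U) p∈G
    (U , (V-U , ≈-refl _) , U-positive)
    (γ , U , γ-codes , (V-U , ≈-refl _) , null))
    where
    open IsRandomGeneric r
    open IsGenericFilter isGenericFilter
    p = proj₁ nonempty
    p∈G = proj₂ nonempty
    γ = proj₁ (conditions p p∈G)
    γ-codes = proj₁ (proj₂ (conditions p p∈G))
    P Q : 𝕍 ℓ → Set ℓ
    P N = Sat κ L X N γ
    Q N = P N × ¬ SatU N
    rP : Resp P
    rP e = proj₁ (sat-resp γ e)
    rQ : Resp Q
    rQ e (h , n) = rP e h , λ u → n (proj₂ (sat-resp U e) u)
    -- An undefined value of `μ` is empty and so below `0ᴿ`; positivity of the condition `p` thus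
    -- puts its interpretation into the domain of `μ`.
    mP : Meas (sep Ω P)
    mP = stable₀ λ n → proj₂ (proj₂ (conditions p p∈G)) (⊑⇒⊆ {x = μ · sep Ω P} {0ᴿ} λ {z} m →
      ⊥-elim (n (Meas-element (sep Ω P) m)))
      where
      Meas-element : ∀ A {z} → z ∊ μ · A → Meas A
      Meas-element A h =
        let (w , q , r) = ∊-⋃ (sep (⋃ (⋃ μ)) (λ y → ⟨ A , y ⟩ ∈ μ)) h
            (_ , s) = ∊-sep (⋃ (⋃ μ)) (λ y → ⟨ A , y ⟩ ∈ μ) (graph-resp A μ) q
        in proj₁ (∊-fun {f = μ} {𝓑} isFun (mem s))
    sepQ : sep Ω P ∖ setU ≋ sep Ω Q
    sepQ = ext
      (λ m → let (a , b) = ∊-∖ (sep Ω P) setU m ; (c , d) = ∊-sep Ω P rP a in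
        sep-∊ Q rQ c (d , λ u → b (sep-∊ SatU (λ e → proj₁ (sat-resp U e)) c u)))
      (λ m → let (c , d , n) = ∊-sep Ω Q rQ m in ∖-∊ {a = sep Ω P} {setU} (sep-∊ P rP c d)
        λ b → n (proj₂ (∊-sep Ω SatU (λ e → proj₁ (sat-resp U e)) b)))
    mQ : Meas (sep Ω Q)
    mQ = ∊-respˡ sepQ (Meas-∖ mP Meas-U)
    null : μ · sep Ω Q ≈ 0ᴿ
    null = un≋ (≡⇒≋ (≡-sym (ms-≡ (sep Ω Q))) ◂ null⇒0ᴿ mQ (Bound-⊑ mQ (Meas-Ω∖ Meas-U)
      (λ m → let (c , d , n) = ∊-sep Ω Q rQ m in ∖-∊ {a = Ω} {setU} c
        λ b → n (proj₂ (∊-sep Ω SatU (λ e → proj₁ (sat-resp U e)) b))) null-U))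

-- Finite tuples and copies of members of `K`.

module Amalgamation {ℓ : Level} (em : ExcludedMiddle (lsuc ℓ)) (V : Class ℓ) (zfc : TransitiveModelOfZFC V)
    (X : 𝕍 ℓ) (VX : V X) (infinite : Infinite X) (L : Language ℓ) (VL : V ⌜ L ⌝ᴸ)
    (K : Class ℓ) (fraisse : IsStrongFraisse V L K) where

  open Facts em V zfc X VX infinite L VL public
  open IsStrongFraisse fraisse public

  V-K : ∀ {M} → K M → V M
  V-K {M} k = let (_ , _ , _ , _ , h) = isClass in proj₁ (proj₁ (h M) k)

  Idx : ℕ → Set ℓ
  Idx n = Lift ℓ (Fin n)

  cons : ∀ {a} {A : Set a} {n} → A → (Idx n → A) → Idx (suc n) → A
  cons y a (lift fzero) = y
  cons y a (lift (fsuc i)) = a (lift i)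

  shift : ∀ {n} → Idx n → Idx (suc n)
  shift (lift i) = lift (fsuc i)

  V-finite : ∀ n (x : Idx n → 𝕍 ℓ) → (∀ i → V (x i)) → V (sup (Idx n) x)
  V-finite zero x h = V-≋ (ext (λ m → ⊥-elim (∉∅ m)) (λ m → case ∊-sup m of λ { (lift () , _) })) V-∅
  V-finite (suc n) x h = V-≋ (ext
    (λ m → case ∊-ins (x (lift fzero)) (sup (Idx n) (x ∘ shift)) m of λ
      { (inj₁ e) → sup-∊ (lift fzero) e ; (inj₂ p) → let (lift i , e) = ∊-sup p in sup-∊ (lift (fsuc i)) e })
    (λ m → case ∊-sup m of λ { (lift fzero , e) → ins-∊ˡ e ; (lift (fsuc i) , e) → ins-∊ʳ (sup-∊ {f = x ∘ shift} (lift i) e) }))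
    (V-⋃ (V-⟦⟧ (V-finite n (x ∘ shift) (h ∘ shift)) (V-⟦⟧ (h (lift fzero)) (h (lift fzero)))))

  V-pairs : ∀ {n} (a b : Idx n → 𝕍 ℓ) → (∀ i → V (a i)) → (∀ i → V (b i)) → V (pairs (Idx n) a b)
  V-pairs a b va vb = V-finite _ _ λ i → V-⟨⟩ (va i) (vb i)

  V-carrier : ∀ {M x} → V M → x ∊ ∣ M ∣ → V x
  V-carrier {M} vM m = V-⟨⟩ʳ (V-∊ vM (∊-∣∣ M m))

  record Tuple (n : ℕ) (A : 𝕍 ℓ) : Set (lsuc ℓ) where
    field
      el  : Idx n → 𝕍 ℓ
      inA : ∀ i → el i ∊ A
      inj : ∀ i j → el i ≋ el j → i ≡ j
  open Tuple public

  Inj : ∀ {n} → (Idx n → 𝕍 ℓ) → Set ℓ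
  Inj b = ∀ i j → b i ≋ b j → i ≡ j

  -- For injective `a` and `b` this makes `a i ↦ b i` a partial isomorphism from `M` to `N`.
  Facts↔ : ∀ {n} → 𝕍 ℓ → (Idx n → 𝕍 ℓ) → 𝕍 ℓ → (Idx n → 𝕍 ℓ) → Set ℓ
  Facts↔ {n} M a N b = ∀ s (w : Vec (Idx n) (ar L s)) → fact L s (map a w) ∊ M ↔ fact L s (map b w) ∊ N

  Facts↔-trans : ∀ {n M N P} {a b c : Idx n → 𝕍 ℓ} → Facts↔ M a N b → Facts↔ N b P c → Facts↔ M a P c
  Facts↔-trans f g s w = (λ m → proj₁ (g s w) (proj₁ (f s w) m)) , (λ m → proj₂ (f s w) (proj₂ (g s w) m))

  Facts↔-sym : ∀ {n M N} {a b : Idx n → 𝕍 ℓ} → Facts↔ M a N b → Facts↔ N b M a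
  Facts↔-sym f s w = proj₂ (f s w) , proj₁ (f s w)

  Facts↔-≋ : ∀ {n M} (a b : Idx n → 𝕍 ℓ) → (∀ i → a i ≋ b i) → Facts↔ M a M b
  Facts↔-≋ a b h s w = ∊-respˡ (fact-≋ s (map-≋ a b w h)) , ∊-respˡ (fact-≋ s (map-≋ b a w (≋-sym ∘ h)))

  Facts↔-∘ : ∀ {m n M N} {a b : Idx n → 𝕍 ℓ} (φ : Idx m → Idx n) → Facts↔ M a N b → Facts↔ M (a ∘ φ) N (b ∘ φ)
  Facts↔-∘ {M = M} {N} {a} {b} φ f s w =
    (λ m → subst (λ v → fact L s v ∊ N) (≡-sym (Vecₚ.map-∘ b φ w)) (proj₁ (f s (map φ w)) (subst (λ v → fact L s v ∊ M) (Vecₚ.map-∘ a φ w) m))) ,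
    (λ m → subst (λ v → fact L s v ∊ M) (≡-sym (Vecₚ.map-∘ a φ w)) (proj₂ (f s (map φ w)) (subst (λ v → fact L s v ∊ N) (Vecₚ.map-∘ b φ w) m)))

  Enumerates : ∀ {n} → (Idx n → 𝕍 ℓ) → 𝕍 ℓ → Set (lsuc ℓ)
  Enumerates {n} a A = ∀ {x} → x ∊ A → Σ[ i ∈ Idx n ] x ≋ a i

  enumerate : ∀ {A n} → HasSize A n → Σ[ t ∈ Tuple n A ] Enumerates (el t) A
  enumerate {A} (e , i , o) = record
    { el = λ (lift k) → A ▹ e k ; inA = λ (lift k) → ▹-∊ A (e k) ; inj = λ (lift k) (lift l) p → cong lift (i k l (un≋ p)) } ,
    λ m → let (k , p) = ∊-idx m ; (l , q) = o k in lift l , (p ◂ eq q)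

  module _ {n : ℕ} (a b : Idx n → 𝕍 ℓ) (injective : Inj a) where

    pairs-· : ∀ {x} i → x ≋ a i → pairs (Idx n) a b · x ≋ b i
    pairs-· {x} i e = ·-≋ (sup-∊ {f = λ i → ⟨ a i , b i ⟩} i (⟨⟩-cong e ≋-refl)) λ m →
      let (j , e′) = ∊-sup m in ⟨⟩-injʳ e′ ◂ ≡⇒≋ (cong b (injective j i (≋-sym (⟨⟩-injˡ e′) ◂ e)))

    private
      f : 𝕍 ℓ
      f = pairs (Idx n) a b

    pairs-injection : ∀ {A B} → Enumerates a A → (∀ i → a i ∊ A) → (∀ i → b i ∊ B) → Inj b → IsInjection f A B
    pairs-injection {A} {B} enum aA bB bInj = record
      { isFun = un≋ (ext
          (λ m → let (i , e) = ∊-sup m ; (k , e′) = ∊-idx (aA i) in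
            sup-∊ {f = λ k → ⟨ A ▹ k , f · (A ▹ k) ⟩} k (e ◂ ⟨⟩-cong e′ (≋-sym (pairs-· i (≋-sym e′)))))
          (λ m → let (k , e) = ∊-sup m ; (i , e′) = enum (▹-∊ A k) in
            sup-∊ {f = λ i → ⟨ a i , b i ⟩} i (e ◂ ⟨⟩-cong e′ (pairs-· i e′))))
      ; into = ⊑⇒⊆ {x = image f A} λ m → let (k , e) = ∊-sup m ; (i , e′) = enum (▹-∊ A k) in
          ∊-respˡ (≋-sym (e ◂ pairs-· i e′)) (bB i)
      ; injective = λ k l e → let (i , p) = enum (▹-∊ A k) ; (j , q) = enum (▹-∊ A l) in
          un≋ (p ◂ ≡⇒≋ (cong a (bInj i j (≋-sym (pairs-· i p) ◂ eq e ◂ pairs-· j q))) ◂ ≋-sym q) }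

  select : ∀ {n m} {A : 𝕍 ℓ} (a : Idx n → 𝕍 ℓ) → Enumerates a A → (u : Vec (idx A) m) → Σ[ w ∈ Vec (Idx n) m ] tup (A at u) ≋ tup (map a w)
  select a enum [] = [] , ≋-refl
  select {A = A} a enum (k ∷ u) = let (i , e) = enum (▹-∊ A k) ; (w , e′) = select a enum u in i ∷ w , ⟨⟩-cong e e′

  map-·-cong : ∀ {n} f (v w : Vec (𝕍 ℓ) n) → tup v ≋ tup w → tup (map (f ·_) v) ≋ tup (map (f ·_) w)
  map-·-cong f [] [] e = ≋-refl
  map-·-cong f (x ∷ v) (y ∷ w) e = ⟨⟩-cong (·-cong {f = f} ≋-refl (⟨⟩-injˡ e)) (map-·-cong f v w (⟨⟩-injʳ e))

  pairs-embedding : ∀ {n M N} (a b : Idx n → 𝕍 ℓ) → Inj a → Enumerates a ∣ M ∣ → (∀ i → a i ∊ ∣ M ∣) → (∀ i → b i ∊ ∣ N ∣) → Inj b →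
    Facts↔ M a N b → IsEmbedding L (pairs (Idx n) a b) M N
  pairs-embedding {n} {M} {N} a b aInj enum aM bN bInj facts = record
    { isInjection = pairs-injection a b aInj enum aM bN bInj
    ; relations = λ s u →
        let (w , e) = select a enum u
            e′ = map-·-cong f (∣ M ∣ at u) (map a w) e ◂ ≡⇒≋ (cong tup (≡-sym (Vecₚ.map-∘ (f ·_) a w))) ◂
                   map-≋ (λ i → f · a i) b w (λ i → pairs-· a b aInj i ≋-refl)
        in (λ m → un∊ (∊-respˡ (fact-≋ s (≋-sym e′)) (proj₁ (facts s w) (∊-respˡ (fact-≋ s e) (mem m))))) ,
           (λ m → un∊ (∊-respˡ (fact-≋ s (≋-sym e)) (proj₂ (facts s w) (∊-respˡ (fact-≋ s e′) (mem m))))) }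
    where
    f : 𝕍 ℓ
    f = pairs (Idx n) a b

  module Embedding {f M N : 𝕍 ℓ} (emb : IsEmbedding L f M N) where

    open IsEmbedding emb

    emb-∊ : ∀ {x} → x ∊ ∣ M ∣ → f · x ∊ ∣ N ∣
    emb-∊ m = ⊆⇒⊑ {x = image f ∣ M ∣} (IsInjection.into isInjection) (image-∊ f m ≋-refl)

    emb-inj : ∀ {x y} → x ∊ ∣ M ∣ → y ∊ ∣ M ∣ → f · x ≋ f · y → x ≋ y
    emb-inj p q e = let (i , e₁) = ∊-idx p ; (j , e₂) = ∊-idx q in
      e₁ ◂ eq (IsInjection.injective isInjection i j (un≋ (·-cong {f = f} ≋-refl (≋-sym e₁) ◂ e ◂ ·-cong {f = f} ≋-refl e₂))) ◂ ≋-sym e₂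

    emb-facts : ∀ {n} (a : Idx n → 𝕍 ℓ) → (∀ i → a i ∊ ∣ M ∣) → Facts↔ M a N (λ i → f · a i)
    emb-facts a aM s w =
      let (u , e) = indices ∣ M ∣ (map a w) (λ l → ∊-respˡ (≡⇒≋ (≡-sym (Vecₚ.lookup-map l a w))) (aM (lookup w l)))
          e′ = ≡⇒≋ (cong tup (Vecₚ.map-∘ (f ·_) a w)) ◂ map-·-cong f (map a w) (∣ M ∣ at u) e
      in (λ m → ∊-respˡ (fact-≋ s (≋-sym e′)) (mem (proj₁ (relations s u) (un∊ (∊-respˡ (fact-≋ s e) m))))) ,
         (λ m → ∊-respˡ (fact-≋ s (≋-sym e)) (mem (proj₂ (relations s u) (un∊ (∊-respˡ (fact-≋ s e′) m)))))

  enumerated-substructure : ∀ {n M N} (a : Idx n → 𝕍 ℓ) → IsStructure L N → IsStructure L M → Enumerates a ∣ N ∣ → (∀ i → a i ∊ ∣ M ∣) →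
    Facts↔ N a M a → _isSubstructureOf_ L N M
  enumerated-substructure {N = N} a stN stM enum aM facts = stN , stM ,
    ⊑⇒⊆ {x = ∣ N ∣} (λ m → let (i , e) = enum m in ∊-respˡ (≋-sym e) (aM i)) ,
    λ s u → let (w , e) = select a enum u in
      (λ m → un∊ (∊-respˡ (fact-≋ s (≋-sym e)) (proj₁ (facts s w) (∊-respˡ (fact-≋ s e) (mem m))))) ,
      (λ m → un∊ (∊-respˡ (fact-≋ s (≋-sym e)) (proj₂ (facts s w) (∊-respˡ (fact-≋ s e) (mem m)))))

  substructure-fact : ∀ {N M} → _isSubstructureOf_ L N M → ∀ s (v : Vec (𝕍 ℓ) (ar L s)) → (∀ l → lookup v l ∊ ∣ N ∣) →
    fact L s v ∊ N ↔ fact L s v ∊ M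
  substructure-fact {N} {M} (_ , _ , _ , h) s v vN = let (u , e) = indices ∣ N ∣ v vN in
    (λ m → ∊-respˡ (fact-≋ s (≋-sym e)) (mem (proj₁ (h s u) (un∊ (∊-respˡ (fact-≋ s e) m))))) ,
    (λ m → ∊-respˡ (fact-≋ s (≋-sym e)) (mem (proj₂ (h s u) (un∊ (∊-respˡ (fact-≋ s e) m)))))

  module Copy {n : ℕ} {M : 𝕍 ℓ} (kM : K M) (a : Tuple n ∣ M ∣) (b : Idx n → 𝕍 ℓ) (vb : ∀ i → V (b i)) (bInj : Inj b) where

    private
      va : ∀ i → V (el a i)
      va i = V-carrier (V-K kM) (inA a i)
      module R = Push M (V-K kM) (proj₁ (structures M kM)) (Idx n) (el a) (el a) (V-pairs (el a) (el a) va va)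
      module P = Push M (V-K kM) (proj₁ (structures M kM)) (Idx n) (el a) b (V-pairs (el a) b va vb)

    copy : 𝕍 ℓ
    copy = P.push

    copy-enum : Enumerates b ∣ copy ∣
    copy-enum = P.carrier-∊

    copy-∊ : ∀ i → b i ∊ ∣ copy ∣
    copy-∊ i = P.∊-carrier i ≋-refl

    copy-facts : Facts↔ M (el a) copy b
    copy-facts s w = P.fact-push s w , P.push-fact (λ i j e → ≡⇒≋ (cong (el a) (bInj i j e))) s w

    private
      R-facts : Facts↔ M (el a) R.push (el a)
      R-facts s w = R.fact-push s w , R.push-fact (λ i j e → e) s w

      kR : K R.push
      kR = hereditary M R.push kM R.V-push (enumerated-substructure (el a) R.push-structure (proj₁ (structures M kM))
        R.carrier-∊ (inA a) (Facts↔-sym {M = M} {R.push} {el a} {el a} R-facts))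

    copy-structure : IsStructure L copy
    copy-structure = P.push-structure

    -- In two stages: `R.push` is the substructure of `M` on the tuple, and `copy` is isomorphic to
    -- it by `a i ↦ b i`.
    K-copy : K copy
    K-copy = isomorphism R.push copy kR P.V-push P.push-structure
      (∃ᶜ-intro (pairs (Idx n) (el a) b) (V-pairs (el a) b va vb) (lift record
        { isEmbedding = pairs-embedding (el a) b (inj a) R.carrier-∊ (λ i → R.∊-carrier i ≋-refl) copy-∊ bInj
            (Facts↔-trans {M = R.push} {M} {copy} {el a} {el a} {b} (Facts↔-sym {M = M} {R.push} {el a} {el a} R-facts) copy-facts)
        ; onto = ⊑⇒⊆ {x = ∣ copy ∣} λ m → let (i , e) = copy-enum m in
            image-∊ (pairs (Idx n) (el a) b) (R.∊-carrier i ≋-refl) (e ◂ ≋-sym (pairs-· (el a) b (inj a) i ≋-refl)) }))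

  -- One-point extensions by strong amalgamation.

  Extension : ∀ {m} → 𝕍 ℓ → (Idx m → 𝕍 ℓ) → 𝕍 ℓ → 𝕍 ℓ → (Idx (suc m) → 𝕍 ℓ) → Set (lsuc ℓ)
  Extension p a y A e = Σ[ q ∈ 𝕍 ℓ ] K q × _isSubstructureOf_ L p q × (∀ {z} → z ∊ ∣ q ∣ → z ∊ ∣ p ∣ ⊎ z ≋ y) × y ∊ ∣ q ∣ ×
    Facts↔ q (cons y a) A e

  -- Strong amalgamation of p and A over the structure induced on a.
  module Extend {m p A} (kp : K p) (kA : K A) (a : Tuple m ∣ p ∣) (e : Tuple (suc m) ∣ A ∣)
      (agree : Facts↔ p (el a) A (el e ∘ shift)) (y : 𝕍 ℓ) (vy : V y) (y∉p : ¬ y ∊ ∣ p ∣) where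

    private
      size = proj₂ (structures p kp)
      n = proj₁ size
      F : Tuple n ∣ p ∣
      F = proj₁ (enumerate (proj₂ size))
      F-onto : Enumerates (el F) ∣ p ∣
      F-onto = proj₂ (enumerate (proj₂ size))
      va : ∀ i → V (el a i)
      va i = V-carrier (V-K kp) (inA a i)
      ve : ∀ i → V (el e i)
      ve i = V-carrier (V-K kA) (inA e i)
      e′ : Idx m → 𝕍 ℓ
      e′ = el e ∘ shift
      e′-inj : Inj e′
      e′-inj (lift i) (lift j) h = cong lift (Finₚ.suc-injective (cong lower (inj e (lift (fsuc i)) (lift (fsuc j)) h)))
      module M₀ = Copy kp a (el a) va (inj a)
      i₁ i₂ : 𝕍 ℓ
      i₁ = pairs (Idx m) (el a) (el a)
      i₂ = pairs (Idx m) (el a) e′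
      back : Facts↔ M₀.copy (el a) p (el a)
      back = Facts↔-sym {M = p} {M₀.copy} {el a} {el a} M₀.copy-facts
      i₁-emb : IsEmbedding L i₁ M₀.copy p
      i₁-emb = pairs-embedding (el a) (el a) (inj a) M₀.copy-enum M₀.copy-∊ (inA a) (inj a) back
      i₂-emb : IsEmbedding L i₂ M₀.copy A
      i₂-emb = pairs-embedding (el a) e′ (inj a) M₀.copy-enum M₀.copy-∊ (λ i → inA e (shift i)) e′-inj
        (Facts↔-trans {M = M₀.copy} {p} {A} {el a} {el a} {e′} back agree)
      Amalgam : 𝕍 ℓ → 𝕍 ℓ → 𝕍 ℓ → Set ℓ
      Amalgam M₃ j₁ j₂ = IsEmbedding L j₁ p M₃ × IsEmbedding L j₂ A M₃ ×
        (∀ x → j₁ · (i₁ · (∣ M₀.copy ∣ ▹ x)) ≈ j₂ · (i₂ · (∣ M₀.copy ∣ ▹ x))) ×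
        image j₁ ∣ p ∣ ∩ image j₂ ∣ A ∣ ≈ image j₁ (image i₁ ∣ M₀.copy ∣)

    module Glue {M₃ j₁ j₂ : 𝕍 ℓ} (k₃ : K M₃) (am : Amalgam M₃ j₁ j₂) where

      private
        module J₁ = Embedding (proj₁ am)
        module J₂ = Embedding (proj₁ (proj₂ am))

      commute : ∀ l → j₁ · el a l ≋ j₂ · e′ l
      commute l = let (x , h) = ∊-idx (M₀.copy-∊ l) in
        ·-cong {f = j₁} ≋-refl (≋-sym (pairs-· (el a) (el a) (inj a) l (≋-sym h))) ◂ eq (proj₁ (proj₂ (proj₂ am)) x) ◂
        ·-cong {f = j₂} ≋-refl (pairs-· (el a) e′ (inj a) l (≋-sym h))

      -- Of the amalgam only the image of `p` and that of the first entry of `e` are kept; `d` gives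
      -- them their names back, so that `p` becomes a genuine substructure and the new point becomes
      -- `y`.
      c d : Idx (suc n) → 𝕍 ℓ
      c = cons (j₂ · el e (lift fzero)) (λ k → j₁ · el F k)
      d = cons y (el F)

      -- Here the amalgamation has to be strong: a common point of both images comes from `M₀`,
      -- hence is also `j₂` of a later entry of `e`, against injectivity.
      separate : ∀ k → ¬ j₂ · el e (lift fzero) ≋ j₁ · el F k
      separate k h =
        let z = j₁ · el F k
            r : ∀ b → Resp (_∈ b)
            r b = λ p m → un∊ (∊-respˡ p (mem {y = b} m))
            both = sep-∊ {a = image j₁ ∣ p ∣} (_∈ image j₂ ∣ A ∣) (r (image j₂ ∣ A ∣)) {z} (image-∊ j₁ (inA F k) ≋-refl)
                     (un∊ (image-∊ j₂ (inA e (lift fzero)) (≋-sym h)))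
            (x , p₁ , q₁) = ∊-image j₁ (image i₁ ∣ M₀.copy ∣) (∊-respʳ (eq (proj₂ (proj₂ (proj₂ am)))) both)
            (x′ , p₂ , q₂) = ∊-image i₁ ∣ M₀.copy ∣ p₁
            (l , q₃) = M₀.copy-enum p₂
            z≋ = h ◂ q₁ ◂ ·-cong {f = j₁} ≋-refl (q₂ ◂ pairs-· (el a) (el a) (inj a) l q₃) ◂ commute l
        in case inj e (lift fzero) (shift l) (J₂.emb-inj (inA e (lift fzero)) (inA e (shift l)) z≋) of λ ()

      c-in : ∀ i → c i ∊ ∣ M₃ ∣
      c-in (lift fzero) = J₂.emb-∊ (inA e (lift fzero))
      c-in (lift (fsuc i)) = J₁.emb-∊ (inA F (lift i))

      c-inj : Inj c
      c-inj (lift fzero) (lift fzero) h = refl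
      c-inj (lift fzero) (lift (fsuc j)) h = ⊥-elim (separate (lift j) h)
      c-inj (lift (fsuc i)) (lift fzero) h = ⊥-elim (separate (lift i) (≋-sym h))
      c-inj (lift (fsuc i)) (lift (fsuc j)) h = cong shift (inj F (lift i) (lift j) (J₁.emb-inj (inA F (lift i)) (inA F (lift j)) h))

      d-inj : Inj d
      d-inj (lift fzero) (lift fzero) h = refl
      d-inj (lift fzero) (lift (fsuc j)) h = ⊥-elim (y∉p (∊-respˡ (≋-sym h) (inA F (lift j))))
      d-inj (lift (fsuc i)) (lift fzero) h = ⊥-elim (y∉p (∊-respˡ h (inA F (lift i))))
      d-inj (lift (fsuc i)) (lift (fsuc j)) h = cong shift (inj F (lift i) (lift j) h)

      vd : ∀ i → V (d i)
      vd (lift fzero) = vy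
      vd (lift (fsuc i)) = V-carrier (V-K kp) (inA F (lift i))

      c-tuple : Tuple (suc n) ∣ M₃ ∣
      c-tuple = record { el = c ; inA = c-in ; inj = c-inj }

      module Q = Copy k₃ c-tuple d vd d-inj

      p-facts : Facts↔ p (el F) Q.copy (el F)
      p-facts = Facts↔-trans {M = p} {M₃} {Q.copy} {el F} {λ k → j₁ · el F k} {el F} (J₁.emb-facts (el F) (inA F))
        (Facts↔-∘ {M = M₃} {Q.copy} {c} {d} shift Q.copy-facts)

      position : Idx (suc m) → Idx (suc n)
      position (lift fzero) = lift fzero
      position (lift (fsuc l)) = shift (proj₁ (F-onto (inA a (lift l))))

      d-position : ∀ i → cons y (el a) i ≋ d (position i)
      d-position (lift fzero) = ≋-refl
      d-position (lift (fsuc l)) = proj₂ (F-onto (inA a (lift l)))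

      c-position : ∀ i → c (position i) ≋ j₂ · el e i
      c-position (lift fzero) = ≋-refl
      c-position (lift (fsuc l)) = ·-cong {f = j₁} ≋-refl (≋-sym (proj₂ (F-onto (inA a (lift l))))) ◂ commute (lift l)

      new-facts : Facts↔ Q.copy (cons y (el a)) A (el e)
      new-facts = Facts↔-trans {M = Q.copy} {Q.copy} {A} {cons y (el a)} {d ∘ position} {el e}
        (Facts↔-≋ {M = Q.copy} (cons y (el a)) (d ∘ position) d-position)
        (Facts↔-trans {M = Q.copy} {M₃} {A} {d ∘ position} {c ∘ position} {el e}
          (Facts↔-sym {M = M₃} {Q.copy} {c ∘ position} {d ∘ position} (Facts↔-∘ {M = M₃} {Q.copy} {c} {d} position Q.copy-facts))
          (Facts↔-trans {M = M₃} {M₃} {A} {c ∘ position} {λ i → j₂ · el e i} {el e}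
            (Facts↔-≋ {M = M₃} (c ∘ position) (λ i → j₂ · el e i) c-position)
            (Facts↔-sym {M = A} {M₃} {el e} {λ i → j₂ · el e i} (J₂.emb-facts (el e) (inA e)))))

      result : Extension p (el a) y A (el e)
      result = Q.copy , Q.K-copy ,
        enumerated-substructure (el F) (proj₁ (structures p kp)) Q.copy-structure F-onto (λ i → Q.copy-∊ (shift i)) p-facts ,
        (λ m → case Q.copy-enum m of λ { (lift fzero , h) → inj₂ h ; (lift (fsuc k) , h) → inj₁ (∊-respˡ (≋-sym h) (inA F (lift k))) }) ,
        Q.copy-∊ (lift fzero) , new-facts

    extension : Extension p (el a) y A (el e)
    extension =
      let (M₃ , _ , k₃ , h) = ∃V (strong-amalgamation M₀.copy p A M₀.K-copy kp kA i₁ i₂ (V-pairs (el a) (el a) va va)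
            (V-pairs (el a) e′ va (λ i → ve (shift i))) i₁-emb i₂-emb)
          (j₁ , _ , h′) = ∃V h
          (j₂ , _ , lift am) = ∃V h′
      in Glue.result k₃ am

  -- The first failure of homogeneity.

  Homogeneous : ℕ → Set (lsuc ℓ)
  Homogeneous n = ∀ A B → K A → K B → (a : Tuple n ∣ A ∣) (b : Tuple n ∣ B ∣) →
    ∀ s (w : Vec (Idx n) (ar L s)) → fact L s (map (el a) w) ∊ A → fact L s (map (el b) w) ∊ B

  homogeneous-facts : ∀ {n A B} → Homogeneous n → K A → K B → (a : Tuple n ∣ A ∣) (b : Tuple n ∣ B ∣) → Facts↔ A (el a) B (el b)
  homogeneous-facts {A = A} {B} h kA kB a b s w = h A B kA kB a b s w , h B A kB kA b a s w

  homogeneous⇒HH : (∀ n → Homogeneous n) → HighlyHomogeneous V L K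
  homogeneous⇒HH h M N n kM kN sM sN =
    let (a , a-onto) = enumerate sM
        (b , b-onto) = enumerate sN
    in ∃ᶜ-intro (pairs (Idx n) (el a) (el b))
      (V-pairs (el a) (el b) (λ i → V-carrier (V-K kM) (inA a i)) (λ i → V-carrier (V-K kN) (inA b i)))
      (lift record
        { isEmbedding = pairs-embedding (el a) (el b) (inj a) a-onto (inA a) (inA b) (inj b) (homogeneous-facts (h n) kM kN a b)
        ; onto = ⊑⇒⊆ {x = ∣ N ∣} λ m → let (i , e) = b-onto m in
            image-∊ (pairs (Idx n) (el a) (el b)) (inA a i) (e ◂ ≋-sym (pairs-· (el a) (el b) (inj a) i ≋-refl)) })

  -- Facts about the empty tuple come from nullary symbols; both structures agree on them with a
  -- common extension given by joint embedding.
  homogeneous-0 : Homogeneous 0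
  homogeneous-0 A B kA kB a b s w m =
    let (C , _ , _ , hA , hB) = ∃V (joint A B kA kB)
        (f , _ , lift fE) = ∃V hA
        (g , _ , lift gE) = ∃V hB
    in proj₂ (Embedding.emb-facts gE (el b) (inA b) s w) (proj₁ (Facts↔-≋ {M = C} (λ i → f · el a i) (λ i → g · el b i) (λ { (lift ()) }) s w)
         (proj₁ (Embedding.emb-facts fE (el a) (inA a) s w) m))

  first-failure : ¬ HighlyHomogeneous V L K → Σ[ n ∈ ℕ ] Homogeneous n × ¬ Homogeneous (suc n)
  first-failure h = stable λ k → h (homogeneous⇒HH (all k))
    where
    all : ¬ (Σ[ n ∈ ℕ ] Homogeneous n × ¬ Homogeneous (suc n)) → ∀ n → Homogeneous n
    all k zero = homogeneous-0
    all k (suc n) = stable λ g → k (n , all k n , g)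

  record Splitting (n : ℕ) : Set (lsuc ℓ) where
    field
      homogeneous : Homogeneous n
      A₀ A₁ : 𝕍 ℓ
      k₀ : K A₀
      k₁ : K A₁
      e₀ : Tuple (suc n) ∣ A₀ ∣
      e₁ : Tuple (suc n) ∣ A₁ ∣
      s : Sym L
      w : Vec (Idx (suc n)) (ar L s)
      fails : ¬ fact L s (map (el e₀) w) ∊ A₀
      holds₁ : fact L s (map (el e₁) w) ∊ A₁

  splitting : ¬ HighlyHomogeneous V L K → Σ[ n ∈ ℕ ] Splitting n
  splitting h = let (n , hom , fail) = first-failure h in n , stable λ k → fail λ A B kA kB a b s w m → stable₀ λ g → k record
    { homogeneous = hom ; A₀ = B ; A₁ = A ; k₀ = kB ; k₁ = kA ; e₀ = b ; e₁ = a ; s = s ; w = w ; fails = g ; holds₁ = m }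

  -- Deciding facts by stronger conditions.

  sub-fact : ∀ {N M x t} → _isSubstructureOf_ L N M → ⟨ num 1 , ⟨ x , t ⟩ ⟩ ∊ N → ⟨ num 1 , ⟨ x , t ⟩ ⟩ ∊ M
  sub-fact {N} {M} {x} {t} (stN , _ , _ , h) m =
    let (s , u , e , e′) = fact-element stN m
        q = ⟨⟩-cong (≋-refl {x = num 1}) (⟨⟩-cong e e′)
    in ∊-respˡ (≋-sym q) (mem {y = M} (proj₁ (h s u) (un∊ (∊-respˡ q m))))

  sub-carrier : ∀ {N M} → _isSubstructureOf_ L N M → ∣ N ∣ ⊑ ∣ M ∣
  sub-carrier {N} (_ , _ , h , _) = ⊆⇒⊑ {x = ∣ N ∣} h

  sub-trans : ∀ {N M P} → _isSubstructureOf_ L N M → _isSubstructureOf_ L M P → _isSubstructureOf_ L N P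
  sub-trans {N} {M} {P} a@(stN , _ , h , f) b@(_ , stP , g , _) = stN , stP ,
    ⊑⇒⊆ {x = ∣ N ∣} (λ m → sub-carrier {M} {P} b (sub-carrier {N} {M} a m)) , λ s u →
      let c = substructure-fact {M} {P} b s (∣ N ∣ at u) (λ l → sub-carrier {N} {M} a (at-∊ ∣ N ∣ u l)) in
      (λ m → un∊ (proj₁ c (mem (proj₁ (f s u) m)))) , (λ m → proj₂ (f s u) (un∊ (proj₂ c (mem m))))

  sub-refl : ∀ {N} → IsStructure L N → _isSubstructureOf_ L N N
  sub-refl {N} st = st , st , ⊑⇒⊆ {x = ∣ N ∣} id , λ s u → id , id

  Cond : 𝕍 ℓ → Set (lsuc ℓ)
  Cond p = K p × ∣ p ∣ ⊑ X

  _≼_ : 𝕍 ℓ → 𝕍 ℓ → Set ℓ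
  q ≼ p = _isSubstructureOf_ L p q

  Covers : ℕ → 𝕍 ℓ → Set ℓ
  Covers i p = ∀ k → k ℕ.< i → xs k ∊ ∣ p ∣

  fresh-index : ∀ {p} → K p → Σ[ B ∈ ℕ ] ∀ c → B ℕ.≤ c → ¬ xs c ∊ ∣ p ∣
  fresh-index {p} kp =
    let (n , sz) = proj₂ (structures p kp)
        (F , onto) = enumerate sz
        (B , h) = go n (el F)
    in B , λ c le m → let (i , e) = onto m in h i c le e
    where
    go : ∀ n (F : Idx n → 𝕍 ℓ) → Σ[ B ∈ ℕ ] ∀ i c → B ℕ.≤ c → ¬ xs c ≋ F i
    go zero F = 0 , λ { (lift ()) }
    go (suc n) F =
      let (B , h) = go n (F ∘ shift) in
      case em₀ (Σ[ b ∈ ℕ ] xs b ≋ F (lift fzero)) of λ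
        { (yes (b , e)) → B ℕ.⊔ suc b , λ
            { (lift fzero) c le e′ → ℕₚ.<⇒≢ (ℕₚ.≤-trans (ℕₚ.m≤n⊔m B (suc b)) le) (xs-inj b c (e ◂ ≋-sym e′))
            ; (lift (fsuc i)) c le e′ → h (lift i) c (ℕₚ.≤-trans (ℕₚ.m≤m⊔n B (suc b)) le) e′ }
        ; (no n) → B , λ
            { (lift fzero) c le e′ → n (c , e′)
            ; (lift (fsuc i)) c le e′ → h (lift i) c le e′ } }

  module Generic {n : ℕ} (split : Splitting n) where

    open Splitting split public

    -- A pattern that spells out the tuple `w`, in which 0 stands for the new point. The bound
    -- `n ≤ i₀` provides enough earlier terms to serve as parameters.
    i-spec = pat-onto n (map (toℕ ∘ lower) w)

    i₀ : ℕ
    i₀ = proj₁ i-spec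

    params : Idx n → 𝕍 ℓ
    params (lift l) = lookup (prevs i₀) (Fin.inject≤ l (proj₁ (proj₂ i-spec)))

    Atom : ℕ → 𝕍 ℓ
    Atom c = factAt s i₀ c

    atom-≋ : ∀ c → Atom c ≋ fact L s (map (cons (xs c) params) w)
    atom-≋ c = fact-≋ s (go (pat i₀ (ar L s)) w (proj₂ (proj₂ i-spec)))
      where
      entry-≋ : ∀ (l : Fin (suc i₀)) (j : Idx (suc n)) → toℕ l ≡ toℕ (lower j) → lookup (xs c ∷ prevs i₀) l ≋ cons (xs c) params j
      entry-≋ fzero (lift fzero) e = ≋-refl
      entry-≋ (fsuc l) (lift (fsuc j)) e = ≡⇒≋ (cong (lookup (prevs i₀)) (Finₚ.toℕ-injective
        (≡-trans (ℕₚ.suc-injective e) (≡-sym (Finₚ.toℕ-inject≤ j (proj₁ (proj₂ i-spec)))))))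
      go : ∀ {r} (P : Vec (Fin (suc i₀)) r) (u : Vec (Idx (suc n)) r) → map toℕ P ≡ map (toℕ ∘ lower) u →
        tup (map (lookup (xs c ∷ prevs i₀)) P) ≋ tup (map (cons (xs c) params) u)
      go [] [] e = ≋-refl
      go (l ∷ P) (j ∷ u) e = ⟨⟩-cong (entry-≋ l j (Vecₚ.∷-injectiveˡ e)) (go P u (Vecₚ.∷-injectiveʳ e))

    params-tuple : ∀ {p} → Covers i₀ p → Tuple n ∣ p ∣
    params-tuple cov = record
      { el = params
      ; inA = λ (lift l) → let (k , lt , e) = prevs-k (Fin.inject≤ l le) in ∊-respˡ (≡⇒≋ (≡-sym e)) (cov k lt)
      ; inj = λ (lift l) (lift m) e → cong lift (Finₚ.inject≤-injective le le l m (prevs-inj _ _ e)) }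
      where
      le : n ℕ.≤ i₀
      le = proj₁ (proj₂ i-spec)
      prevs-k : ∀ {m} (l : Fin m) → Σ[ k ∈ ℕ ] k ℕ.< m × lookup (prevs m) l ≡ xs k
      prevs-k {m} l = m ℕ.∸ suc (toℕ l) , ℕₚ.∸-monoʳ-< {m} {suc (toℕ l)} {0} (s≤s z≤n) (Finₚ.toℕ<n l) , prevs-lookup m l
      prevs-inj : ∀ {m} (l l′ : Fin m) → lookup (prevs m) l ≋ lookup (prevs m) l′ → l ≡ l′
      prevs-inj {m} l l′ e = Finₚ.toℕ-injective (ℕₚ.suc-injective (ℕₚ.∸-cancelˡ-≡ (Finₚ.toℕ<n l) (Finₚ.toℕ<n l′)
        (xs-inj _ _ (≡⇒≋ (≡-sym (prevs-lookup m l)) ◂ e ◂ ≡⇒≋ (prevs-lookup m l′)))))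

    atom-entries : ∀ {p} c → Covers i₀ p → xs c ∊ ∣ p ∣ → ∀ l → lookup (map (cons (xs c) params) w) l ∊ ∣ p ∣
    atom-entries {p} c cov m l = ∊-respˡ (≡⇒≋ (≡-sym (Vecₚ.lookup-map l (cons (xs c) params) w))) (go (lookup w l))
      where
      go : ∀ j → cons (xs c) params j ∊ ∣ p ∣
      go (lift fzero) = m
      go (lift (fsuc j)) = inA (params-tuple {p} cov) (lift j)

    atom-sub : ∀ {p q} c → q ≼ p → Covers i₀ p → xs c ∊ ∣ p ∣ → Atom c ∊ p ↔ Atom c ∊ q
    atom-sub {p} {q} c sub cov m =
      let h = substructure-fact {p} {q} sub s (map (cons (xs c) params) w) (atom-entries {p} c cov m) in
      (λ a → ∊-respˡ (≋-sym (atom-≋ c)) (proj₁ h (∊-respˡ (atom-≋ c) a))) ,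
      (λ a → ∊-respˡ (≋-sym (atom-≋ c)) (proj₂ h (∊-respˡ (atom-≋ c) a)))

    record Adjoined (p : 𝕍 ℓ) (c : ℕ) : Set (lsuc ℓ) where
      field
        q    : 𝕍 ℓ
        cond : Cond q
        sub  : q ≼ p
        new  : xs c ∊ ∣ q ∣
        only : ∀ {z} → z ∊ ∣ q ∣ → z ∊ ∣ p ∣ ⊎ z ≋ xs c

    adjoined : ∀ {p c m A} {a : Idx m → 𝕍 ℓ} {e : Idx (suc m) → 𝕍 ℓ} → Cond p → Extension p a (xs c) A e → Adjoined p c
    adjoined {c = c} (_ , pX) (q , kq , sub , only , new , _) = record
      { q = q ; cond = kq , (λ m → case only m of λ { (inj₁ a) → pX a ; (inj₂ e) → ∊-respˡ (≋-sym e) (xs-∊ c) })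
      ; sub = sub ; new = new ; only = only }

    -- The extension over the empty tuple by a point of `A₀`; nothing is prescribed about its
    -- relations to `p`.
    adjoin : ∀ {p} → Cond p → ∀ c → ¬ xs c ∊ ∣ p ∣ → Adjoined p c
    adjoin {p} cp@(kp , pX) c c∉p = adjoined {m = 0} cp
      (Extend.extension kp k₀ none one (homogeneous-facts homogeneous-0 kp k₀ none none′) (xs c) (V-∊ VX (xs-∊ c)) c∉p)
      where
      none : Tuple 0 ∣ p ∣
      none = record { el = λ { (lift ()) } ; inA = λ { (lift ()) } ; inj = λ { (lift ()) } }
      one : Tuple 1 ∣ A₀ ∣
      one = record { el = λ _ → el e₀ (lift fzero) ; inA = λ _ → inA e₀ (lift fzero) ; inj = λ { (lift fzero) (lift fzero) _ → refl } }
      none′ : Tuple 0 ∣ A₀ ∣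
      none′ = record { el = el one ∘ shift ; inA = λ { (lift ()) } ; inj = λ { (lift ()) } }

    -- The first entry of `e` is the model for `xs c`. Homogeneity for `n` matches its other entries
    -- with `params`, whatever `p` says about these, so the one-point extension applies.
    decide : ∀ {p A} → K A → (e : Tuple (suc n) ∣ A ∣) → Cond p → Covers i₀ p → ∀ c → ¬ xs c ∊ ∣ p ∣ →
      Σ[ a ∈ Adjoined p c ] Atom c ∊ Adjoined.q a ↔ fact L s (map (el e) w) ∊ A
    decide {p} {A} kA e cp@(kp , pX) cov c c∉p =
      let t = params-tuple {p} cov
          e′ = record { el = el e ∘ shift ; inA = λ i → inA e (shift i)
                      ; inj = λ { (lift i) (lift j) h → cong lift (Finₚ.suc-injective (cong lower (inj e (lift (fsuc i)) (lift (fsuc j)) h))) } }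
          x = Extend.extension kp kA t e (homogeneous-facts homogeneous kp kA t e′) (xs c) (V-∊ VX (xs-∊ c)) c∉p
          (_ , _ , _ , _ , _ , facts) = x
      in adjoined cp x , (λ m → proj₁ (facts s w) (∊-respˡ (atom-≋ c) m)) , (λ m → ∊-respˡ (≋-sym (atom-≋ c)) (proj₂ (facts s w) m))

    Covering : ℕ → 𝕍 ℓ → Set (lsuc ℓ)
    Covering m p = Σ[ q ∈ 𝕍 ℓ ] Cond q × q ≼ p × Covers m q

    covers-suc : ∀ {m q} → Covers m q → xs m ∊ ∣ q ∣ → Covers (suc m) q
    covers-suc {m} cov h k lt = case ℕₚ.m≤n⇒m<n∨m≡n (ℕₚ.≤-pred lt) of λ { (inj₁ l) → cov k l ; (inj₂ refl) → h }

    cover : ∀ m {p} → Cond p → Covering m p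
    cover zero {p} cp = p , cp , sub-refl {p} (proj₁ (structures p (proj₁ cp))) , λ _ ()
    cover (suc m) {p} cp = next-step (cover m cp)
      where
      with-new : ∀ {q} → q ≼ p → Covers m q → Adjoined q m → Covering (suc m) p
      with-new {q} sub cov a = Adjoined.q a , Adjoined.cond a , sub-trans {p} {q} {Adjoined.q a} sub (Adjoined.sub a) ,
        covers-suc {m} {Adjoined.q a} (λ k lt → sub-carrier {q} {Adjoined.q a} (Adjoined.sub a) (cov k lt)) (Adjoined.new a)
      next-step : Covering m p → Covering (suc m) p
      next-step (q , cq , sub , cov) = case em₀ (xs m ∊ ∣ q ∣) of λ
        { (yes h) → q , cq , sub , covers-suc {m} {q} cov h
        ; (no h) → with-new sub cov (adjoin cq m h) }

    force-true : ∀ {p} → Cond p → Σ[ q ∈ 𝕍 ℓ ] Cond q × q ≼ p × Σ[ k ∈ ℕ ] Atom (k ℕ.+ i₀) ∊ q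
    force-true {p} cp = go (cover i₀ cp)
      where
      Goal : Set (lsuc ℓ)
      Goal = Σ[ q ∈ 𝕍 ℓ ] Cond q × q ≼ p × Σ[ k ∈ ℕ ] Atom (k ℕ.+ i₀) ∊ q
      done : ∀ {q} → q ≼ p → ∀ B → (Σ[ a ∈ Adjoined q (B ℕ.+ i₀) ] Atom (B ℕ.+ i₀) ∊ Adjoined.q a ↔ fact L s (map (el e₁) w) ∊ A₁) → Goal
      done {q} sub B (a , _ , h) = Adjoined.q a , Adjoined.cond a , sub-trans {p} {q} {Adjoined.q a} sub (Adjoined.sub a) , B , h holds₁
      go : Covering i₀ p → Goal
      go (q , cq , sub , cov) = let (B , fresh) = fresh-index (proj₁ cq) in
        done sub B (decide k₁ e₁ cq cov (B ℕ.+ i₀) (fresh (B ℕ.+ i₀) (ℕₚ.m≤m+n B i₀)))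

    -- The field `only` keeps track of the points added, so that the next one, `xs (q + m)`, is
    -- still new.
    record Falsified (p : 𝕍 ℓ) (q m : ℕ) : Set (lsuc ℓ) where
      field
        r    : 𝕍 ℓ
        cond : Cond r
        sub  : r ≼ p
        new  : ∀ j → j ℕ.< m → xs (q ℕ.+ j) ∊ ∣ r ∣ × ¬ Atom (q ℕ.+ j) ∊ r
        only : ∀ {z} → z ∊ ∣ r ∣ → z ∊ ∣ p ∣ ⊎ (Σ[ j ∈ ℕ ] j ℕ.< m × z ≋ xs (q ℕ.+ j))

    falsify : ∀ {p} → Cond p → Covers i₀ p → ∀ q → (∀ c → q ℕ.≤ c → ¬ xs c ∊ ∣ p ∣) → ∀ m → Falsified p q m
    falsify {p} cp cov q fresh zero = record
      { r = p ; cond = cp ; sub = sub-refl {p} (proj₁ (structures p (proj₁ cp))) ; new = λ _ () ; only = inj₁ }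
    falsify {p} cp cov q fresh (suc m) = one-more (falsify cp cov q fresh m)
      where
      module _ (F : Falsified p q m) where
        open Falsified F
        cov′ : Covers i₀ r
        cov′ k lt = sub-carrier {p} {r} sub (cov k lt)
        c∉r : ¬ xs (q ℕ.+ m) ∊ ∣ r ∣
        c∉r h = case only h of λ
          { (inj₁ a) → fresh (q ℕ.+ m) (ℕₚ.m≤m+n q m) a
          ; (inj₂ (j , lt , e)) → ℕₚ.<⇒≢ lt (≡-sym (ℕₚ.+-cancelˡ-≡ q m j (xs-inj _ _ e))) }
        append : (Σ[ a ∈ Adjoined r (q ℕ.+ m) ] Atom (q ℕ.+ m) ∊ Adjoined.q a ↔ fact L s (map (el e₀) w) ∊ A₀) → Falsified p q (suc m)
        append (a , h , _) = record
          { r = r′ ; cond = Adjoined.cond a ; sub = sub-trans {p} {r} {r′} sub sub′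
          ; new = new′ ; only = only′ }
          where
          r′ : 𝕍 ℓ
          r′ = Adjoined.q a
          sub′ : r′ ≼ r
          sub′ = Adjoined.sub a
          new′ : ∀ j → j ℕ.< suc m → xs (q ℕ.+ j) ∊ ∣ r′ ∣ × ¬ Atom (q ℕ.+ j) ∊ r′
          new′ j lt = case ℕₚ.m≤n⇒m<n∨m≡n (ℕₚ.≤-pred lt) of λ
            { (inj₁ l) → sub-carrier {r} {r′} sub′ (proj₁ (new j l)) ,
                (λ b → proj₂ (new j l) (proj₂ (atom-sub {r} {r′} (q ℕ.+ j) sub′ cov′ (proj₁ (new j l))) b))
            ; (inj₂ refl) → Adjoined.new a , (λ b → fails (h b)) }
          only′ : ∀ {z} → z ∊ ∣ r′ ∣ → z ∊ ∣ p ∣ ⊎ (Σ[ j ∈ ℕ ] j ℕ.< suc m × z ≋ xs (q ℕ.+ j))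
          only′ z = case Adjoined.only a z of λ
            { (inj₁ b) → case only b of λ { (inj₁ c) → inj₁ c ; (inj₂ (j , lt , e)) → inj₂ (j , ℕₚ.m<n⇒m<1+n lt , e) }
            ; (inj₂ e) → inj₂ (m , ℕₚ.n<1+n m , e) }
      one-more : Falsified p q m → Falsified p q (suc m)
      one-more F = append F (decide k₀ e₀ (Falsified.cond F) (cov′ F) (q ℕ.+ m) (c∉r F))

    -- The absence of a fact passes to stronger conditions only when all its arguments already
    -- belong to the condition; hence the clauses on the parameters and on the points of the block.
    Silent : ℕ → ℕ → 𝕍 ℓ → Set ℓ
    Silent q m r = Covers i₀ r × (∀ j → j ℕ.< m → xs (q ℕ.+ j) ∊ ∣ r ∣ × ¬ Atom (q ℕ.+ j) ∊ r)

    force-quiet : ∀ (N : ℕ) (size : ℕ → ℕ) {p} → Cond p →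
      Σ[ r ∈ 𝕍 ℓ ] Cond r × r ≼ p × Σ[ k ∈ ℕ ] Silent (k ℕ.+ (N ℕ.+ i₀)) (size (k ℕ.+ (N ℕ.+ i₀))) r
    force-quiet N size {p} cp = go (cover i₀ cp)
      where
      Goal : Set (lsuc ℓ)
      Goal = Σ[ r ∈ 𝕍 ℓ ] Cond r × r ≼ p × Σ[ k ∈ ℕ ] Silent (k ℕ.+ (N ℕ.+ i₀)) (size (k ℕ.+ (N ℕ.+ i₀))) r
      done : ∀ {q} → q ≼ p → Covers i₀ q → ∀ B → Falsified q (B ℕ.+ (N ℕ.+ i₀)) (size (B ℕ.+ (N ℕ.+ i₀))) → Goal
      done {q} sub cov B F = Falsified.r F , Falsified.cond F , sub-trans {p} {q} {Falsified.r F} sub (Falsified.sub F) , B ,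
        (λ k lt → sub-carrier {q} {Falsified.r F} (Falsified.sub F) (cov k lt)) , Falsified.new F
      go : Covering i₀ p → Goal
      go (q , cq , sub , cov) = let (B , fresh) = fresh-index (proj₁ cq) in
        done sub cov B (falsify cq cov (B ℕ.+ (N ℕ.+ i₀)) (λ c le → fresh c (ℕₚ.≤-trans (ℕₚ.m≤m+n B (N ℕ.+ i₀)) le)) (size (B ℕ.+ (N ℕ.+ i₀))))

-- Dense sets in `V` and Cohen generics.

module CohenSide {ℓ : Level} (em : ExcludedMiddle (lsuc ℓ)) (V : Class ℓ) (zfc : TransitiveModelOfZFC V)
    (κ : 𝕍 ℓ) (Vκ : V κ) (ordinal : IsOrdinal κ) (infinite-κ : Infinite κ)
    (X : 𝕍 ℓ) (VX : V X) (infinite : Infinite X) (L : Language ℓ) (VL : V ⌜ L ⌝ᴸ)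
    (f : 𝕍 ℓ) (Vf : V f) (f-inj : IsInjection f (sym L) κ)
    (K : Class ℓ) (fraisse : IsStrongFraisse V L K) where

  open Amalgamation em V zfc X VX infinite L VL K fraisse
  open Construction em V zfc κ Vκ ordinal infinite-κ X VX infinite L VL f Vf f-inj
    using (U; sat-leaf⇒; nat→κ; κ→nat; κ→nat→κ; addᵗ; powᵗ; Signed)

  -- Every condition is a subset of allFacts, so the conditions form a set of V.
  private
    V-diag : V (pairs (idx X) (X ▹_) (X ▹_))
    V-diag = closed (imgᵗ (cst X VX) ⟨ #0 , #0 ⟩ᵗ) [] []ᵛ

    module XT = Tuples (idx X) (X ▹_) (X ▹_) V-diag

    pointsᵗ factsᵗ : Tm 0
    pointsᵗ = imgᵗ (cst X VX) ⟨ ∅ᵗ , #0 ⟩ᵗ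
    factsᵗ = ⋃ᵗ (imgᵗ (cst (sym L) V-sym) (imgᵗ XT.tuplesᵗ ⟨ numᵗ 1 , ⟨ #1 , fstᵗ #0 ⟩ᵗ ⟩ᵗ))

    allFacts : 𝕍 ℓ
    allFacts = ev (⋃ᵗ ⟦ pointsᵗ , factsᵗ ⟧ᵗ) []

    V-allFacts : V allFacts
    V-allFacts = closed (⋃ᵗ ⟦ pointsᵗ , factsᵗ ⟧ᵗ) [] []ᵛ

    fact-∊ : ∀ s {r} (w : Vec (idx X) r) → ⟨ num 1 , ⟨ S s , tup (map (X ▹_) w) ⟩ ⟩ ∊ allFacts
    fact-∊ s w = ⋃-∊ (pair-∊ʳ ≋-refl) (⋃-∊
      (imgᵗ-∊ (cst (sym L) V-sym) (imgᵗ XT.tuplesᵗ ⟨ numᵗ 1 , ⟨ #1 , fstᵗ #0 ⟩ᵗ ⟩ᵗ) {[]} {S s}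
        {ev (imgᵗ XT.tuplesᵗ ⟨ numᵗ 1 , ⟨ #1 , fstᵗ #0 ⟩ᵗ ⟩ᵗ) (S s ∷ [])} []ᵛ (▹-∊ (sym L) s) ≋-refl)
      (imgᵗ-∊ XT.tuplesᵗ ⟨ numᵗ 1 , ⟨ #1 , fstᵗ #0 ⟩ᵗ ⟩ᵗ {S s ∷ []} {⟨ tup (map (X ▹_) w) , tup (map (X ▹_) w) ⟩}
        (V-▹ V-sym s ∷ᵛ []ᵛ) (XT.∊-tuples (S s ∷ []) w)
        (⟨⟩-cong ≋-refl (⟨⟩-cong (≋-refl {x = S s}) (≋-sym (fst-⟨⟩ {x = tup (map (X ▹_) w)} {tup (map (X ▹_) w)}))))))

    point-∊ : ∀ {y} → y ∊ X → ⟨ num 0 , y ⟩ ∊ allFacts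
    point-∊ m = let (i , e) = ∊-idx m in ⋃-∊ (pair-∊ˡ ≋-refl) (sup-∊ {f = λ i → ⟨ ∅ , X ▹ i ⟩} i (⟨⟩-cong ≋-refl e))

    bounded-by : ∀ {p} → Cond p → p ⊑ allFacts
    bounded-by {p} (kp , pX) {z} m = side (element (proj₁ (structures p kp)) m)
      where
      side : Element p z → z ∊ allFacts
      side (inj₁ (i , e)) = ∊-respˡ (≋-sym e) (point-∊ (pX (▹-∊ ∣ p ∣ i)))
      side (inj₂ (s , u , e)) =
        let (w , e′) = indices X (∣ p ∣ at u) (λ l → pX (at-∊ ∣ p ∣ u l)) in
        ∊-respˡ (≋-sym (e ◂ fact-≋ s e′)) (fact-∊ s w)

    Pw : 𝕍 ℓ
    Pw = proj₁ (V-power allFacts V-allFacts)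

    V-Pw : V Pw
    V-Pw = proj₁ (proj₂ (V-power allFacts V-allFacts))

    cond-∊ : ∀ {p} → Cond p → p ∊ Pw
    cond-∊ {p} cp = proj₂ (proj₂ (proj₂ (V-power allFacts V-allFacts))) p (V-K (proj₁ cp)) (bounded-by cp)

  module _ {G : 𝕍 ℓ} (filter : IsGenericFilter V (ℭ V L X K) (λ A B → ↑ (_isSubstructureOf_ L B A)) G) where

    open IsGenericFilter filter

    to-Cond : ∀ {p} → ℭ V L X K p → Cond p
    to-Cond {p} (kp , s) = kp , ⊆⇒⊑ {x = ∣ p ∣} s

    -- Genericity concerns dense sets that belong to `V`. Definability of `Φ` and of `K` allows one
    -- to be separated from `Pw`.
    meets : (Φ : Fm 1) → (∀ {p} → Cond p → Σ[ q ∈ 𝕍 ℓ ] Cond q × q ≼ p × holds Φ (q ∷ [])) →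
      Σ[ d ∈ 𝕍 ℓ ] d ∊ G × Cond d × holds Φ (d ∷ [])
    meets Φ dense = found (generic D V-D (λ d m → let (c , _) = D-elim {d} (mem m) in proj₁ c , ⊑⇒⊆ {x = ∣ d ∣} (proj₂ c)) D-dense)
      where
      δ : Fm 1
      δ = classFm isClass #0 ∧ᵗ (∀ᵗ ∣ #0 ∣ᵗ (#0 ∈ᵗ cst X VX)) ∧ᵗ Φ
      D : 𝕍 ℓ
      D = ev (sepᵗ (cst Pw V-Pw) δ) []
      V-D : V D
      V-D = closed (sepᵗ (cst Pw V-Pw) δ) [] []ᵛ
      D-elim : ∀ {d} → d ∊ D → Cond d × holds Φ (d ∷ [])
      D-elim {d} m = let (_ , k , x , h) = ∊-sepᵗ (cst Pw V-Pw) δ {[]} {d} []ᵛ m in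
        (unsquash k , ⊆⇒⊑ {x = ∣ d ∣} {X} x) , h
      D-intro : ∀ {d} → Cond d → holds Φ (d ∷ []) → d ∊ D
      D-intro {d} c h = sepᵗ-∊ (cst Pw V-Pw) δ {[]} {d} []ᵛ (cond-∊ c) (squash (proj₁ c) , ⊑⇒⊆ {x = ∣ d ∣} (proj₂ c) , h)
      D-dense : ∀ p → ℭ V L X K p → Σ[ d ∈ 𝕍 ℓ ] d ∈ D × ↑ (_isSubstructureOf_ L p d)
      D-dense p cp = let (q , cq , sub , h) = dense (to-Cond cp) in q , un∊ (D-intro cq h) , lift sub
      found : (Σ[ d ∈ 𝕍 ℓ ] d ∈ D × d ∈ G) → Σ[ d ∈ 𝕍 ℓ ] d ∊ G × Cond d × holds Φ (d ∷ [])
      found (d , dD , dG) = let (c , h) = D-elim {d} (mem dD) in d , mem dG , c , h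

    module _ {n : ℕ} (split : Splitting n) where

      open Generic split

      private
        i₀ᵗ : ∀ {m} → Tm m
        i₀ᵗ = cst (num i₀) (V-num i₀)

      True : 𝕍 ℓ → Set ℓ
      True d = Σ[ k ∈ ℕ ] Atom (k ℕ.+ i₀) ∊ d

      private
        t : Tm 2
        t = addᵗ #0 i₀ᵗ

        sem-t : ∀ k q → ev (atomᵗ s i₀ t) (num k ∷ q ∷ []) ≋ Atom (k ℕ.+ i₀)
        sem-t k q = ev-atomᵗ s i₀ t (num k ∷ q ∷ []) (≡-trans (natOf-num ≋-refl) (cong₂ ℕ._+_ (natOf-num ≋-refl) (natOf-num ≋-refl)))

        true-⇒ : ∀ d → (Σ[ k ∈ Lift ℓ ℕ ] ev (atomᵗ s i₀ t) (num (lower k) ∷ d ∷ []) ∈ d) → True d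
        true-⇒ d (lift k , h) = k , ∊-respˡ (sem-t k d) (mem {y = d} h)

        true-⇐ : ∀ d → True d → Σ[ k ∈ Lift ℓ ℕ ] ev (atomᵗ s i₀ t) (num (lower k) ∷ d ∷ []) ∈ d
        true-⇐ d (k , h) = lift k , un∊ (∊-respˡ (≋-sym (sem-t k d)) h)

      trueᶠ : Fm 1
      trueᶠ = sealᶠ (∃ᵗ ωᵗ (atomᵗ s i₀ t ∈ᵗ #1)) (λ ρ → True (Vec.head ρ)) λ { (d ∷ []) _ → true-⇒ d , true-⇐ d }

      some-true : Σ[ d ∈ 𝕍 ℓ ] d ∊ G × Cond d × True d
      some-true = meets trueᶠ force-true

      module _ (N : ℕ) where

        private
          m : ℕ
          m = N ℕ.+ i₀
          Q : Tm 2
          Q = addᵗ #0 (cst (num m) (V-num m))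
          R : Tm 3
          R = addᵗ (addᵗ #1 (cst (num m) (V-num m))) #0

        SilentAt : ℕ → 𝕍 ℓ → Set ℓ
        SilentAt k d = Silent (k ℕ.+ m) (pow2 (k ℕ.+ m)) d

        SilentSomewhere : 𝕍 ℓ → Set ℓ
        SilentSomewhere d = Σ[ k ∈ ℕ ] SilentAt k d

        private
          coverFm : Fm 2
          coverFm = ∀ᵗ i₀ᵗ (xsᵗ #0 ∈ᵗ ∣ #2 ∣ᵗ)

          Atoms : 𝕍 ℓ → 𝕍 ℓ → 𝕍 ℓ → Set ℓ
          Atoms d k x = xs (natOf (ev R (x ∷ k ∷ d ∷ []))) ∈ ∣ d ∣ × (¬ ev (atomᵗ s i₀ R) (x ∷ k ∷ d ∷ []) ∈ d)

          quietFm : Fm 2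
          quietFm = ∀ᵗ (powᵗ Q) ((xsᵗ R ∈ᵗ ∣ #2 ∣ᵗ) ∧ᵗ (¬ᵗ (atomᵗ s i₀ R ∈ᵗ #2)))

          semQ : ∀ k d → natOf (ev Q (num k ∷ d ∷ [])) ≡ k ℕ.+ m
          semQ k d = ≡-trans (natOf-num ≋-refl) (cong₂ ℕ._+_ (natOf-num ≋-refl) (natOf-num ≋-refl))

          semR : ∀ x j k d → x ≋ num j → natOf (ev R (x ∷ num k ∷ d ∷ [])) ≡ (k ℕ.+ m) ℕ.+ j
          semR x j k d e = ≡-trans (natOf-num ≋-refl) (cong₂ ℕ._+_ (semQ k d) (natOf-num e))

          atoms-⇒ : ∀ x j k d → x ≋ num j → Atoms d (num k) x → xs ((k ℕ.+ m) ℕ.+ j) ∊ ∣ d ∣ × ¬ Atom ((k ℕ.+ m) ℕ.+ j) ∊ d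
          atoms-⇒ x j k d e (a , b) = ∊-respˡ (≡⇒≋ (cong xs (semR x j k d e))) (mem {x = xs (natOf (ev R (x ∷ num k ∷ d ∷ [])))} {∣ d ∣} a) ,
            λ c → b (un∊ (∊-respˡ {x = Atom ((k ℕ.+ m) ℕ.+ j)} {ev (atomᵗ s i₀ R) (x ∷ num k ∷ d ∷ [])} {d}
              (≋-sym (ev-atomᵗ s i₀ R (x ∷ num k ∷ d ∷ []) (semR x j k d e))) c))

          atoms-⇐ : ∀ x j k d → x ≋ num j → xs ((k ℕ.+ m) ℕ.+ j) ∊ ∣ d ∣ → ¬ Atom ((k ℕ.+ m) ℕ.+ j) ∊ d → Atoms d (num k) x
          atoms-⇐ x j k d e a b = un∊ (∊-respˡ {y = xs (natOf (ev R (x ∷ num k ∷ d ∷ [])))} {∣ d ∣} (≡⇒≋ (cong xs (≡-sym (semR x j k d e)))) a) ,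
            λ c → b (∊-respˡ {x = ev (atomᵗ s i₀ R) (x ∷ num k ∷ d ∷ [])} {Atom ((k ℕ.+ m) ℕ.+ j)} {d}
              (ev-atomᵗ s i₀ R (x ∷ num k ∷ d ∷ []) (semR x j k d e)) (mem {y = d} c))

          cover-⇒ : ∀ k d → holds coverFm (k ∷ d ∷ []) → Covers i₀ d
          cover-⇒ k d cov a lt = let (l , e) = ∊-idx (num-< {ℓ} lt) in
            ∊-respˡ (≡⇒≋ (cong xs (natOf-num (≋-sym e)))) (mem {x = xs (natOf (num i₀ ▹ l))} {∣ d ∣} (cov l))

          cover-⇐ : ∀ k d → Covers i₀ d → holds coverFm (k ∷ d ∷ [])
          cover-⇐ k d cov l = let (a , lt , e) = ∊-num {n = i₀} (▹-∊ (num i₀) l) in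
            un∊ (∊-respˡ {y = xs (natOf (num i₀ ▹ l))} {∣ d ∣} (≡⇒≋ (cong xs (≡-sym (natOf-num e)))) (cov a lt))

          quiet-⇒ : ∀ k d c → c ≡ k ℕ.+ m → (∀ l → Atoms d (num k) (num (pow2 c) ▹ l)) →
            ∀ j → j ℕ.< pow2 (k ℕ.+ m) → xs ((k ℕ.+ m) ℕ.+ j) ∊ ∣ d ∣ × ¬ Atom ((k ℕ.+ m) ℕ.+ j) ∊ d
          quiet-⇒ k d c refl h j lt = let (l , e) = ∊-idx (num-< {ℓ} lt) in atoms-⇒ _ j k d (≋-sym e) (h l)

          quiet-⇐ : ∀ k d c → c ≡ k ℕ.+ m → (∀ j → j ℕ.< pow2 (k ℕ.+ m) → xs ((k ℕ.+ m) ℕ.+ j) ∊ ∣ d ∣ × ¬ Atom ((k ℕ.+ m) ℕ.+ j) ∊ d) →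
            ∀ l → Atoms d (num k) (num (pow2 c) ▹ l)
          quiet-⇐ k d c refl h l = let (j , lt , e) = ∊-num {n = pow2 c} (▹-∊ (num (pow2 c)) l) ; (a , b) = h j lt in atoms-⇐ _ j k d e a b

          some-⇒ : ∀ d → (Σ[ k ∈ Lift ℓ ℕ ] holds (coverFm ∧ᵗ quietFm) (num (lower k) ∷ d ∷ [])) → SilentSomewhere d
          some-⇒ d (lift k , cov , h) = k , cover-⇒ (num k) d cov , quiet-⇒ k d (natOf (ev Q (num k ∷ d ∷ []))) (semQ k d) h

          some-⇐ : ∀ d → SilentSomewhere d → Σ[ k ∈ Lift ℓ ℕ ] holds (coverFm ∧ᵗ quietFm) (num (lower k) ∷ d ∷ [])
          some-⇐ d (k , cov , h) = lift k , cover-⇐ (num k) d cov , quiet-⇐ k d (natOf (ev Q (num k ∷ d ∷ []))) (semQ k d) h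

        quietᶠ : Fm 1
        quietᶠ = sealᶠ (∃ᵗ ωᵗ (coverFm ∧ᵗ quietFm)) (λ ρ → SilentSomewhere (Vec.head ρ)) λ { (d ∷ []) _ → some-⇒ d , some-⇐ d }

        some-quiet : Σ[ d ∈ 𝕍 ℓ ] d ∊ G × Cond d × SilentSomewhere d
        some-quiet = meets quietᶠ (force-quiet N pow2)

      -- If the fact were in the union it would hold in some `g` of the filter, hence in a common
      -- extension of `g` and `d`; but `d` has already decided against it.
      absent : ∀ {d c} → d ∊ G → Covers i₀ d → xs c ∊ ∣ d ∣ → ¬ Atom c ∊ d → ¬ Atom c ∊ ⋃ G
      absent {d} {c} dG cov x out m =
        let (g , gG , h) = ∊-⋃ G m
            (r , rG , lift rd , lift rg) = directed d g (un∊ dG) (un∊ gG)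
        in out (proj₂ (atom-sub {d} {r} c rd cov x) (sub-fact {g} {r} rg h))

      -- Satisfaction fails at the conjunct for the symbol `s`, reached through its value under `f`,
      -- and the pattern `i₀`: every disjunct `N` is contradicted.
      refuted : ∀ {M} → M ≋ ⋃ G → ¬ Sat κ L X M U
      refuted {M} M≋ h = side (κ→nat N) refl
        where
        u : idx κ
        u = proj₁ (∊-idx {x = κ} (⊆⇒⊑ {x = image f (sym L)} (IsInjection.into f-inj) (image-∊ f (▹-∊ (sym L) s) ≋-refl)))
        u≋ : f · S s ≋ κ ▹ u
        u≋ = proj₂ (∊-idx {x = κ} (⊆⇒⊑ {x = image f (sym L)} (IsInjection.into f-inj) (image-∊ f (▹-∊ (sym L) s) ≋-refl)))
        N : idx κ
        N = proj₁ (h u (nat→κ i₀))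
        leaves : ∀ k → Σ[ j ∈ ℕ ] Signed (κ→nat N) (factAt s i₀ (index i₀ (κ→nat N) k j)) M
        leaves k = let (j , l) = proj₂ (h u (nat→κ i₀)) (nat→κ k) in κ→nat j ,
          subst₂ (λ a b → Signed (κ→nat N) (factAt s a (index a (κ→nat N) b (κ→nat j))) M) (κ→nat→κ i₀) (κ→nat→κ k)
            (sat-leaf⇒ u (nat→κ i₀) N (nat→κ k) j s M u≋ l)
        pow2-pos : ∀ q → 0 ℕ.< pow2 q
        pow2-pos zero = s≤s z≤n
        pow2-pos (suc q) = ℕₚ.≤-trans (pow2-pos q) (ℕₚ.m≤m+n (pow2 q) (pow2 q))
        blk-< : ∀ q j → blk q j ℕ.< pow2 q
        blk-< q j with j ℕ.<? pow2 q
        ... | yes p = p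
        ... | no _ = pow2-pos q
        side : ∀ m → κ→nat N ≡ m → ⊥
        side zero e =
          -- This disjunct denies the fact at every `k + i₀`, in particular at the one that the
          -- filter makes true.
          let (d , dG , _ , k , a) = some-true
              (j , l) = leaves k
          in subst (λ m → Signed m (factAt s i₀ (index i₀ m k j)) M) e l (∊-respʳ (≋-sym M≋) (⋃-∊ dG a))
        side (suc m) e =
          -- This disjunct claims a hit in every block from number `m + 1 + i₀` on; `blk q j` is the
          -- claimed position in a block that the filter keeps silent.
          let (d , dG , _ , k , cov , quiet) = some-quiet (suc m)
              (j , l) = leaves k
              q = k ℕ.+ (suc m ℕ.+ i₀)
              (a , b) = quiet (blk q j) (blk-< q j)
          in absent {d} {q ℕ.+ blk q j} dG cov a b (∊-respʳ M≋ (subst (λ m → Signed m (factAt s i₀ (index i₀ m k j)) M) e l))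

  cohen-generic : ¬ HighlyHomogeneous V L K → ∀ G M → IsCohenGeneric V L K X G M → ¬ Int κ L X (V [ G ]) U M
  cohen-generic h G M c (_ , _ , sat) = let (n , split) = splitting h in
    refuted (IsCohenGeneric.isGenericFilter c) split (eq (IsCohenGeneric.isUnion c)) sat

theorem7p14 : ∀ {ℓ : Level} → ExcludedMiddle (lsuc ℓ) →
    (V : Class ℓ) → TransitiveModelOfZFC V →
    (κ : 𝕍 ℓ) → V κ → IsOrdinal κ → Infinite κ →
    (X : 𝕍 ℓ) → V X → Infinite X →
    (L : Language ℓ) → V ⌜ L ⌝ᴸ → Card≤ V (sym L) κ →
    Σ[ U ∈ Code κ L X ]
    V (⌜_⌝ κ L X U) ×
    rank κ L X U ≈ num 5 ×
    (∀ (K : Class ℓ) → IsStrongFraisse V L K → ¬ HighlyHomogeneous V L K →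
    ∀ G M → IsCohenGeneric V L K X G M → ¬ Int κ L X (V [ G ]) U M) ×
    (∀ (ν : InvariantMeasure V κ L X) →
    ∀ G M → IsRandomGeneric V κ L X ν G M → Int κ L X (V [ G ]) U M)
theorem7p14 em V zfc κ Vκ ordinal infinite-κ X VX infinite L VL card =
  -- The injection exists in the sense of a double negation; excluded middle extracts one, and `U`
  -- depends on it.
  let (f , Vf , lift f-inj) = Definability.∃V em V zfc card in
     Construction.U em V zfc κ Vκ ordinal infinite-κ X VX infinite L VL f Vf f-inj ,
     Construction.V-U em V zfc κ Vκ ordinal infinite-κ X VX infinite L VL f Vf f-inj ,
     Construction.rank-U em V zfc κ Vκ ordinal infinite-κ X VX infinite L VL f Vf f-inj ,
     CohenSide.cohen-generic em V zfc κ Vκ ordinal infinite-κ X VX infinite L VL f Vf f-inj ,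
     RandomSide.random-generic em V zfc κ Vκ ordinal infinite-κ X VX infinite L VL f Vf f-inj
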